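{- Let $X$ be a finite connected graph such that $\chi(X)\ne0$, and fix a voltage assignment $\alpha\colon\mathbf{E}_X\to\mathbb{Z}$ such that the graph $X_\infty := X(\mathbb{Z},\alpha)$ is connected. For every $n\in\mathbb{N}$ let $X_n := X(\mathbb{Z}/n\mathbb{Z},\pi_n\circ\alpha)$, where $\pi_n\colon\mathbb{Z}\to\mathbb{Z}/n\mathbb{Z}$ is the natural quotient map. Let $\mathcal{I}_\alpha\in\mathbb{Z}[t^{\pm1}]$ be the Ihara polynomial of $\alpha$, let $b := -\mathrm{ord}_{t=0}(\mathcal{I}_\alpha)\ge0$ and $e := \mathrm{ord}_{t=1}(\mathcal{I}_\alpha)\ge1$, and let $J_\alpha(t) := t^b(t-1)^{ -e}\mathcal{I}_\alpha(t)\in\mathbb{Z}[t]$. Then the number of spanning trees of $X_n$ is $$\kappa(X_n)=(-1)^{b(n-1)}\cdot\kappa(X)\cdot n^{e-1}\cdot\frac{\Delta_n(J_\alpha)}{\Delta_1(J_\alpha)}$$ for every $n\in\mathbb{N}$, where $\{\Delta_n(J_\alpha)\}_{n\in\mathbb{N}}$ is the Pierce-Lehmer sequence associated to $J_\alpha$.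
   Context: $\mathbb{N}=\{1,2,\dots\}$. Graphs are in the sense of Serre: a graph $X$ consists of a set $V_X$ of vertices, a set $\mathbf{E}_X$ of directed edges, origin and terminus maps $o,t\colon\mathbf{E}_X\to V_X$, and an inversion $e\mapsto\bar e$ on $\mathbf{E}_X$ with $o(\bar e)=t(e)$, $t(\bar e)=o(e)$ and $\bar{\bar e}=e\ne\bar e$. Loops and multiple edges are allowed. $X$ is finite if $V_X$ and $\mathbf{E}_X$ are finite, and connected if any two vertices are joined by a path of directed edges. $\chi(X)=|V_X|-|\mathbf{E}_X|/2$, and $\kappa(X)$ is the number of spanning trees of a finite graph $X$. A voltage assignment with values in a group $G$ is a function $\alpha\colon\mathbf{E}_X\to G$ with $\alpha(\bar e)=\alpha(e)^{ -1}$ for all $e$. The graph $X(G,\alpha)$ has vertex set $V_X\times G$, edge set $\mathbf{E}_X\times G$, and $o(e,\sigma)=(o(e),\sigma)$, $t(e,\sigma)=(t(e),\sigma\cdot\alpha(e))$, $\overline{(e,\sigma)}=(\bar e,\sigma\cdot\alpha(e))$. Ihara polynomial of $\alpha\colon\mathbf{E}_X\to\mathbb{Z}$: order $V_X=\{v_1,\dots,v_g\}$, let $D_X$ be the diagonal matrix with entries $\#\{e\in\mathbf{E}_X: o(e)=v_i\}$, and let $A_\alpha(t)$ be the $g\times g$ matrix with $(i,j)$ entry $\sum_{e:\,o(e)=v_i,\,t(e)=v_j}t^{\alpha(e)}$; then $\mathcal{I}_\alpha(t)=\det(D_X-A_\alpha(t))\in\mathbb{Z}[t^{\pm1}]$.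 $\mathrm{ord}_{t=a}$ denotes the order of vanishing at $t=a$. For $f(t)=a_d\prod_{i=1}^d(t-\alpha_i)\in\mathbb{Z}[t]$ with $a_d\neq0$ and $\alpha_i\in\overline{\mathbb{Q}}$, the Pierce-Lehmer sequence is $\Delta_n(f)=a_d^n\prod_{i=1}^d(\alpha_i^n-1)=\mathrm{Res}(f(t),t^n-1)\in\mathbb{Z}$. -}

module Defs where

open import Algebra.Bundles using (RawRing)
open import Algebra.Structures using (IsGroup)
open import Data.Empty using (⊥-elim)
open import Data.Fin as Fin using (Fin; zero; suc; toℕ; fromℕ<; splitAt; punchIn)
open import Data.Fin.Properties as Fin
  using (any?; all?; toℕ<n; toℕ-fromℕ<; injective⇒≤; *↔×)
open import Data.Fin.Subset using (Subset; _∈_; inside; outside)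
open import Data.Fin.Subset.Properties using (_∈?_)
open import Data.Integer as ℤ using (ℤ; +_; 0ℤ; 1ℤ; -1ℤ; _%ℕ_; _/ℕ_)
open import Data.Integer.DivMod using (n%ℕd<d; a≡a%ℕn+[a/ℕn]*n)
import Data.Integer.Properties as ℤ
open import Data.Integer.Tactic.RingSolver using (solve-∀)
open import Data.List as List using (List; []; _∷_; _++_; filter; length; allFin)
open import Data.List.Membership.Propositional using () renaming (_∈_ to _∈ₗ_)
open import Data.List.Membership.Propositional.Properties using (∈-map⁺; ∈-allFin)
open import Data.List.Relation.Unary.Any using (here; there)
open import Data.Nat as ℕ using (ℕ; zero; suc; NonZero)
open import Data.Nat.DivMod using (_mod_)
import Data.Nat.Properties as ℕ
open import Data.Product using (Σ; Σ-syntax; ∃; _×_; _,_; proj₁; proj₂)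
open import Data.Product.Function.NonDependent.Propositional using (_×-↔_)
import Data.Product.Properties as Product
open import Data.Rational as ℚ using (ℚ)
open import Data.Sum using (_⊎_; inj₁; inj₂; [_,_]′)
open import Data.Vec as Vec using (Vec; []; _∷_; lookup)
open import Data.Vec.Properties.WithK using ([]=-irrelevant)
open import Function using (_∘_; _↔_; Inverse; Injection)
import Function.Construct.Composition as Comp
import Function.Construct.Symmetry as Sym
open import Function.Properties.Inverse using (↔⇒↣)
open import Level using (0ℓ)
open import Relation.Binary.Definitions using (DecidableEquality)
open import Relation.Binary.PropositionalEquality
open import Relation.Nullary using (¬_; Dec; yes; no; ¬?; _×-dec_; _⊎-dec_; _→-dec_)
open import Relation.Nullary.Decidable using (map′; via-injection; decidable-stable)
open import Relation.Unary using (Decidable)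

record Graph : Set₁ where
  field
    V E     : Set
    o t     : E → V
    inv     : E → E
    o-inv   : ∀ e → o (inv e) ≡ t e
    t-inv   : ∀ e → t (inv e) ≡ o e
    inv-inv : ∀ e → inv (inv e) ≡ e
    inv-≢   : ∀ e → inv e ≢ e

record Finite (X : Graph) : Set where
  open Graph X
  field
    #V #E : ℕ
    V↔Fin : V ↔ Fin #V
    E↔Fin : E ↔ Fin #E

  vertex : Fin #V → V
  vertex = Inverse.from V↔Fin

  vertices : List V
  vertices = List.map vertex (allFin #V)

  edges : List E
  edges = List.map (Inverse.from E↔Fin) (allFin #E)

  _≟ᵥ_ : DecidableEquality V
  _≟ᵥ_ = via-injection (↔⇒↣ V↔Fin) Fin._≟_

  _≟ₑ_ : DecidableEquality E
  _≟ₑ_ = via-injection (↔⇒↣ E↔Fin) Fin._≟_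

module _ (X : Graph) where
  open Graph X

  data Path : V → V → Set where
    []  : ∀ {v} → Path v v
    _∷_ : ∀ e {v} → Path (t e) v → Path (o e) v

  Connected : Set
  Connected = ∀ u v → Path u v

  cyclicSuc : ∀ {n} → Fin (suc n) → Fin (suc n)
  cyclicSuc {n} i = suc (toℕ i) mod suc n

  -- A closed path e₀ … eₙ without backtracking (also at the closing point)
  -- that visits every vertex at most once.  The no-backtracking condition
  -- only matters for length two, where it rules out the path e, inv e.
  IsCircuit : ∀ {n} → Vec E (suc n) → Set
  IsCircuit c =
    (∀ i → t (lookup c i) ≡ o (lookup c (cyclicSuc i))) ×
    (∀ i → lookup c (cyclicSuc i) ≢ inv (lookup c i)) ×
    (∀ i j → t (lookup c i) ≡ t (lookup c j) → i ≡ j)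

  Circuit : Set
  Circuit = Σ[ n ∈ ℕ ] Σ[ c ∈ Vec E (suc n) ] IsCircuit c

  -- The first factor says that a tree is nonempty.
  IsTree : Set
  IsTree = V × Connected × ¬ Circuit

χ : (X : Graph) → Finite X → ℚ
χ X fin = (+ #V ℚ./ 1) ℚ.- (+ #E ℚ./ 2)
  where open Finite fin

module _ {X : Graph} (fin : Finite X) where
  open Graph X
  open Finite fin

  _∈ₑ_ : E → Subset #E → Set
  e ∈ₑ S = Inverse.to E↔Fin e ∈ S

  InvClosed : Subset #E → Set
  InvClosed S = ∀ e → e ∈ₑ S → inv e ∈ₑ S

  spanningSubgraph : (S : Subset #E) → InvClosed S → Graph
  spanningSubgraph S closed = record
    { V       = V
    ; E       = Σ[ e ∈ E ] e ∈ₑ S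
    ; o       = o ∘ proj₁
    ; t       = t ∘ proj₁
    ; inv     = λ (e , e∈S) → inv e , closed e e∈S
    ; o-inv   = o-inv ∘ proj₁
    ; t-inv   = t-inv ∘ proj₁
    ; inv-inv = λ (e , e∈S) → Σ-≡ (inv-inv e)
    ; inv-≢   = λ (e , e∈S) eq → inv-≢ e (cong proj₁ eq)
    }
    where
    Σ-≡ : ∀ {e e′ p p′} → e ≡ e′ → _≡_ {A = Σ[ e ∈ E ] e ∈ₑ S} (e , p) (e′ , p′)
    Σ-≡ {e} refl = cong (e ,_) ([]=-irrelevant _ _)

  IsSpanningTree : Subset #E → Set
  IsSpanningTree S = Σ[ closed ∈ InvClosed S ] IsTree (spanningSubgraph S closed)

-- Being a tree is decidable for a graph with finitely many vertices whose
-- edges can be searched exhaustively.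

Searchable : Set → Set₁
Searchable A = ∀ {P : A → Set} → Decidable P → Dec (∃ P)

search-∀ : ∀ {A} → Searchable A → {P : A → Set} → Decidable P → Dec (∀ x → P x)
search-∀ srch P? = map′
  (λ ¬∃ x → decidable-stable (P? x) (λ ¬p → ¬∃ (x , ¬p)))
  (λ ∀P (x , ¬p) → ¬p (∀P x))
  (¬? (srch (¬? ∘ P?)))

search-↔ : ∀ {A n} → A ↔ Fin n → Searchable A
search-↔ A↔ {P} P? = map′
  (λ (i , p) → Inverse.from A↔ i , p)
  (λ (x , p) → Inverse.to A↔ x , subst P (sym (Inverse.strictlyInverseʳ A↔ x)) p)
  (any? (P? ∘ Inverse.from A↔))

search-Σ : ∀ {A} {Q : A → Set} → Searchable A → Decidable Q →
           (∀ {x} (p q : Q x) → p ≡ q) → Searchable (Σ A Q)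
search-Σ {A} {Q} srch Q? irr {P} P? = map′
  (λ (x , q , p) → (x , q) , p)
  (λ ((x , q) , p) → x , q , p)
  (srch dec)
  where
  dec : Decidable (λ x → Σ[ q ∈ Q x ] P (x , q))
  dec x with Q? x
  ... | no ¬q = no (λ (q , _) → ¬q q)
  ... | yes q = map′ (q ,_) (λ (q′ , p) → subst (λ r → P (x , r)) (irr q′ q) p) (P? (x , q))

search-Vec : ∀ {A} → Searchable A → ∀ n → Searchable (Vec A n)
search-Vec srch zero    P? = map′ ([] ,_) (λ { ([] , p) → p }) (P? [])
search-Vec srch (suc n) P? = map′
  (λ (x , xs , p) → x ∷ xs , p)
  (λ { (x ∷ xs , p) → x , xs , p })
  (srch (λ x → search-Vec srch n (λ xs → P? (x ∷ xs))))

module _ (X : Graph) {n : ℕ} (V↔ : Graph.V X ↔ Fin n)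
         (_≟_ : DecidableEquality (Graph.E X)) (searchE : Searchable (Graph.E X)) where
  open Graph X

  _≟′_ : DecidableEquality V
  _≟′_ = via-injection (↔⇒↣ V↔) Fin._≟_

  -- Reach ws u v: a nonempty path from u to v whose interior vertices
  -- all lie in ws.
  Reach : List V → V → V → Set
  Reach []       u v = Σ[ e ∈ E ] o e ≡ u × t e ≡ v
  Reach (w ∷ ws) u v = Reach ws u v ⊎ (Reach ws u w × Reach ws w v)

  reach? : ∀ ws u v → Dec (Reach ws u v)
  reach? []       u v = searchE (λ e → (o e ≟′ u) ×-dec (t e ≟′ v))
  reach? (w ∷ ws) u v = reach? ws u v ⊎-dec (reach? ws u w ×-dec reach? ws w v)

  _▷_ : ∀ {u v w} → Path X u v → Path X v w → Path X u w
  []      ▷ q = q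
  (e ∷ p) ▷ q = e ∷ (p ▷ q)

  reach⇒path : ∀ ws {u v} → Reach ws u v → Path X u v
  reach⇒path []       (e , refl , refl) = e ∷ []
  reach⇒path (w ∷ ws) (inj₁ r)          = reach⇒path ws r
  reach⇒path (w ∷ ws) (inj₂ (r , s))    = reach⇒path ws r ▷ reach⇒path ws s

  weaken : ∀ ws {u v} → (Σ[ e ∈ E ] o e ≡ u × t e ≡ v) → Reach ws u v
  weaken []       r = r
  weaken (w ∷ ws) r = inj₁ (weaken ws r)

  join : ∀ ws {u x v} → x ∈ₗ ws → Reach ws u x → Reach ws x v → Reach ws u v
  join (w ∷ ws) (here refl) r s = inj₂ ([ (λ z → z) , proj₁ ]′ r , [ (λ z → z) , proj₂ ]′ s)
  join (w ∷ ws) (there x∈)  (inj₁ p)        (inj₁ q)        = inj₁ (join ws x∈ p q)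
  join (w ∷ ws) (there x∈)  (inj₁ p)        (inj₂ (q , q′)) = inj₂ (join ws x∈ p q , q′)
  join (w ∷ ws) (there x∈)  (inj₂ (p , p′)) (inj₁ q)        = inj₂ (p , join ws x∈ p′ q)
  join (w ∷ ws) (there x∈)  (inj₂ (p , _))  (inj₂ (_ , q′)) = inj₂ (p , q′)

  allV : List V
  allV = List.map (Inverse.from V↔) (allFin n)

  ∈allV : ∀ v → v ∈ₗ allV
  ∈allV v = subst (_∈ₗ allV) (Inverse.strictlyInverseʳ V↔ v)
                  (∈-map⁺ (Inverse.from V↔) (∈-allFin (Inverse.to V↔ v)))

  path⇒reach : ∀ {u v} → Path X u v → u ≡ v ⊎ Reach allV u v
  path⇒reach []      = inj₁ refl
  path⇒reach (e ∷ p) with path⇒reach p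
  ... | inj₁ refl = inj₂ (weaken allV (e , refl , refl))
  ... | inj₂ r    = inj₂ (join allV (∈allV _) (weaken allV (e , refl , refl)) r)

  path? : ∀ u v → Dec (Path X u v)
  path? u v = map′ [ (λ { refl → [] }) , reach⇒path allV ]′ path⇒reach
                   ((u ≟′ v) ⊎-dec reach? allV u v)

  connected? : Dec (Connected X)
  connected? = search-∀ (search-↔ V↔) (λ u → search-∀ (search-↔ V↔) (path? u))

  isCircuit? : ∀ {k} → Decidable (IsCircuit X {k})
  isCircuit? c =
    all? (λ i → t (lookup c i) ≟′ o (lookup c (cyclicSuc X i))) ×-dec
    all? (λ i → ¬? (lookup c (cyclicSuc X i) ≟ inv (lookup c i))) ×-dec
    all? (λ i → all? (λ j → (t (lookup c i) ≟′ t (lookup c j)) →-dec (i Fin.≟ j)))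

  circuit-bound : ∀ {k} {c : Vec E (suc k)} → IsCircuit X c → k ℕ.< n
  circuit-bound {c = c} (_ , _ , inj) =
    injective⇒≤ {f = λ i → Inverse.to V↔ (t (lookup c i))}
                (λ {i} {j} eq → inj i j (Injection.injective (↔⇒↣ V↔) eq))

  circuit? : Dec (Circuit X)
  circuit? = map′
    (λ (i , c) → toℕ i , c)
    (λ (k , c , isC) → let k<n = circuit-bound {c = c} isC in
       fromℕ< k<n , subst (λ k → Σ (Vec E (suc k)) (IsCircuit X))
                          (sym (toℕ-fromℕ< k<n)) (c , isC))
    (any? (λ i → search-Vec searchE (suc (toℕ i)) isCircuit?))

  isTree? : Dec (IsTree X)
  isTree? = map′ proj₁ (_, refl) (search-↔ V↔ {P = λ v → v ≡ v} (λ v → yes refl))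
            ×-dec connected? ×-dec ¬? circuit?

module _ {X : Graph} (fin : Finite X) where
  open Graph X
  open Finite fin

  isSpanningTree? : Decidable (IsSpanningTree fin)
  isSpanningTree? S with search-∀ (search-↔ E↔Fin)
    (λ e → (Inverse.to E↔Fin e ∈? S) →-dec (Inverse.to E↔Fin (inv e) ∈? S))
  ... | no ¬closed = no (¬closed ∘ proj₁)
  ... | yes closed = map′ (closed ,_) (λ (_ , conn) → transfer conn)
          (isTree? (spanningSubgraph fin S closed) V↔Fin
            (Product.≡-dec _≟ₑ_ (λ p q → yes ([]=-irrelevant p q)))
            (search-Σ (search-↔ E↔Fin) (λ e → Inverse.to E↔Fin e ∈? S) []=-irrelevant))
    where
    -- Being a tree does not depend on the proof that S is closed under inv.
    transfer : ∀ {c c′ : InvClosed fin S} →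
      IsTree (spanningSubgraph fin S c) → IsTree (spanningSubgraph fin S c′)
    transfer {c} {c′} (v , conn , acyc) =
      v , (λ u w → go (conn u w)) ,
      λ (n , es , p , q , r) →
        acyc (n , es , p , (λ i eq → q i (trans eq (cong (_ ,_) ([]=-irrelevant _ _)))) , r)
      where
      go : ∀ {u w} → Path (spanningSubgraph fin S c) u w → Path (spanningSubgraph fin S c′) u w
      go []      = []
      go (e ∷ p) = e ∷ go p

-- Every subset of Fin n, exactly once.
subsets : ∀ n → List (Subset n)
subsets zero    = [] ∷ []
subsets (suc n) = List.map (outside ∷_) (subsets n) ++ List.map (inside ∷_) (subsets n)

κ : (X : Graph) → Finite X → ℕ
κ X fin = length (filter (isSpanningTree? fin) (subsets (Finite.#E fin)))

-- A group whose equality is propositional, so that its elements can be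
-- used as components of vertices and edges.
record DiscreteGroup : Set₁ where
  infixl 7 _∙_
  field
    Carrier : Set
    _∙_     : Carrier → Carrier → Carrier
    ε       : Carrier
    _⁻¹     : Carrier → Carrier
    isGroup : IsGroup _≡_ _∙_ ε _⁻¹
  open IsGroup isGroup public using (assoc; identityʳ; inverseʳ)

record Voltage (X : Graph) (G : DiscreteGroup) : Set where
  open Graph X
  open DiscreteGroup G
  field
    α     : E → Carrier
    α-inv : ∀ e → α (inv e) ≡ α e ⁻¹

derivedGraph : (X : Graph) (G : DiscreteGroup) → Voltage X G → Graph
derivedGraph X G vol = record
  { V       = V × Carrier
  ; E       = E × Carrier
  ; o       = λ (e , σ) → o e , σ
  ; t       = λ (e , σ) → t e , σ ∙ α e
  ; inv     = λ (e , σ) → inv e , σ ∙ α e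
  ; o-inv   = λ (e , σ) → cong (_, σ ∙ α e) (o-inv e)
  ; t-inv   = λ (e , σ) → cong₂ _,_ (t-inv e) (cancel e σ)
  ; inv-inv = λ (e , σ) → cong₂ _,_ (inv-inv e) (cancel e σ)
  ; inv-≢   = λ (e , σ) eq → inv-≢ e (cong proj₁ eq)
  }
  where
  open Graph X
  open DiscreteGroup G
  open Voltage vol
  cancel : ∀ e σ → σ ∙ α e ∙ α (inv e) ≡ σ
  cancel e σ = begin
    σ ∙ α e ∙ α (inv e)  ≡⟨ cong (σ ∙ α e ∙_) (α-inv e) ⟩
    σ ∙ α e ∙ (α e ⁻¹)   ≡⟨ assoc σ (α e) (α e ⁻¹) ⟩
    σ ∙ (α e ∙ (α e ⁻¹)) ≡⟨ cong (σ ∙_) (inverseʳ (α e)) ⟩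
    σ ∙ ε                ≡⟨ identityʳ σ ⟩
    σ                    ∎
    where open ≡-Reasoning

derivedFinite : ∀ {X G n} → Finite X → DiscreteGroup.Carrier G ↔ Fin n →
                (vol : Voltage X G) → Finite (derivedGraph X G vol)
derivedFinite {n = n} fin G↔ vol = record
  { #V    = #V ℕ.* n
  ; #E    = #E ℕ.* n
  ; V↔Fin = Comp.inverse (V↔Fin ×-↔ G↔) (Sym.inverse *↔×)
  ; E↔Fin = Comp.inverse (E↔Fin ×-↔ G↔) (Sym.inverse *↔×)
  }
  where open Finite fin

ℤ-group : DiscreteGroup
ℤ-group = record { isGroup = ℤ.+-0-isGroup }

module _ (n : ℕ) .{{_ : NonZero n}} where

  π : ℤ → Fin n
  π x = fromℕ< (n%ℕd<d x n)

  _+ₙ_ : Fin n → Fin n → Fin n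
  i +ₙ j = π (+ toℕ i ℤ.+ + toℕ j)

  -ₙ_ : Fin n → Fin n
  -ₙ i = π (ℤ.- (+ toℕ i))

  infix 4 _~_ _by_
  record _~_ (x y : ℤ) : Set where
    constructor _by_
    field
      quotient : ℤ
      equation : x ≡ y ℤ.+ quotient ℤ.* + n

  rep : ∀ x → + toℕ (π x) ~ x
  rep x = (ℤ.- (x /ℕ n)) by (begin
    + toℕ (π x)                           ≡⟨ cong +_ (toℕ-fromℕ< _) ⟩
    + (x %ℕ n)                            ≡⟨ lem (+ (x %ℕ n)) (x /ℕ n) (+ n) ⟩
    + (x %ℕ n) ℤ.+ x /ℕ n ℤ.* + n ℤ.+ ℤ.- (x /ℕ n) ℤ.* + n
                                          ≡⟨ cong (ℤ._+ ℤ.- (x /ℕ n) ℤ.* + n) (a≡a%ℕn+[a/ℕn]*n x n) ⟨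
    x ℤ.+ ℤ.- (x /ℕ n) ℤ.* + n            ∎)
    where
    open ≡-Reasoning
    lem : ∀ r q m → r ≡ r ℤ.+ q ℤ.* m ℤ.+ ℤ.- q ℤ.* m
    lem = solve-∀

  small : ∀ k r r′ → r ℕ.< n → + r ≡ + r′ ℤ.+ k ℤ.* + n → + r′ ≡ + r ℤ.+ ℤ.- k ℤ.* + n →
          r ℕ.≤ r′
  small (+ zero)    r r′ r<n eq _ = ℕ.≤-reflexive (ℤ.+-injective (trans eq (ℤ.+-identityʳ (+ r′))))
  small ℤ.+[1+ k ]  r r′ r<n eq _ = ⊥-elim (ℕ.<⇒≱ r<n
    (subst (n ℕ.≤_) (sym (ℤ.+-injective (trans eq
       (trans (cong (ℤ._+_ (+ r′)) (sym (ℤ.pos-* (suc k) n))) (sym (ℤ.pos-+ r′ (suc k ℕ.* n)))))))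
       (ℕ.≤-trans (ℕ.m≤m+n n (k ℕ.* n)) (ℕ.m≤n+m _ r′))))
  small ℤ.-[1+ k ]  r r′ r<n _ eq =
    subst (r ℕ.≤_) (sym (ℤ.+-injective (trans eq
       (trans (cong (ℤ._+_ (+ r)) (sym (ℤ.pos-* (suc k) n))) (sym (ℤ.pos-+ r (suc k ℕ.* n)))))))
       (ℕ.m≤m+n r _)

  ~-flip : ∀ {x y} (p : x ~ y) → y ≡ x ℤ.+ ℤ.- (_~_.quotient p) ℤ.* + n
  ~-flip {y = y} (k by refl) = lem y k (+ n)
    where
    lem : ∀ y k m → y ≡ y ℤ.+ k ℤ.* m ℤ.+ ℤ.- k ℤ.* m
    lem = solve-∀

  ~-trans : ∀ {x y z} → x ~ y → y ~ z → x ~ z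
  ~-trans {z = z} (k by refl) (l by refl) = (l ℤ.+ k) by lem z k l (+ n)
    where
    lem : ∀ z k l m → z ℤ.+ l ℤ.* m ℤ.+ k ℤ.* m ≡ z ℤ.+ (l ℤ.+ k) ℤ.* m
    lem = solve-∀

  ~-sym : ∀ {x y} → x ~ y → y ~ x
  ~-sym p@(k by _) = (ℤ.- k) by ~-flip p

  +-~ : ∀ {x x′ y y′} → x ~ x′ → y ~ y′ → (x ℤ.+ y) ~ (x′ ℤ.+ y′)
  +-~ {x′ = x} {y′ = y} (k by refl) (l by refl) = (k ℤ.+ l) by lem x y k l (+ n)
    where
    lem : ∀ x y k l m → x ℤ.+ k ℤ.* m ℤ.+ (y ℤ.+ l ℤ.* m) ≡ x ℤ.+ y ℤ.+ (k ℤ.+ l) ℤ.* m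
    lem = solve-∀

  ~-refl : ∀ {x} → x ~ x
  ~-refl {x} = 0ℤ by sym (ℤ.+-identityʳ x)

  ~-toℕ : ∀ {i j : Fin n} → + toℕ i ~ + toℕ j → i ≡ j
  ~-toℕ {i} {j} p@(k by eq) = Fin.toℕ-injective (ℕ.≤-antisym
    (small k _ _ (toℕ<n i) eq (~-flip p))
    (small (ℤ.- k) _ _ (toℕ<n j) (~-flip p)
      (subst (λ l → + toℕ i ≡ + toℕ j ℤ.+ l ℤ.* + n) (sym (ℤ.neg-involutive k)) eq)))

  π-cong : ∀ {x y} → x ~ y → π x ≡ π y
  π-cong {x} {y} p = ~-toℕ (~-trans (rep x) (~-trans p (~-sym (rep y))))

  π-toℕ : ∀ i → π (+ toℕ i) ≡ i
  π-toℕ i = ~-toℕ (rep (+ toℕ i))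

  neg-~ : ∀ {x y} → x ~ y → (ℤ.- x) ~ (ℤ.- y)
  neg-~ {y = y} (k by refl) = (ℤ.- k) by lem y k (+ n)
    where
    lem : ∀ y k m → ℤ.- (y ℤ.+ k ℤ.* m) ≡ ℤ.- y ℤ.+ ℤ.- k ℤ.* m
    lem = solve-∀

  +ₙ-isGroup : IsGroup _≡_ _+ₙ_ (π 0ℤ) -ₙ_
  +ₙ-isGroup = record
    { isMonoid = record
      { isSemigroup = record
        { isMagma = record { isEquivalence = isEquivalence ; ∙-cong = cong₂ _+ₙ_ }
        ; assoc   = λ i j k → let x = + toℕ i; y = + toℕ j; z = + toℕ k in
            π-cong (~-trans (+-~ (rep (x ℤ.+ y)) (~-refl {z}))
              (subst (_~ (x ℤ.+ + toℕ (j +ₙ k))) (sym (ℤ.+-assoc x y z))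
                (+-~ (~-refl {x}) (~-sym (rep (y ℤ.+ z))))))
        }
      ; identity =
          (λ i → let x = + toℕ i in
             trans (π-cong (+-~ (rep 0ℤ) (~-refl {x})))
                   (trans (cong π (ℤ.+-identityˡ x)) (π-toℕ i)))
        , (λ i → let x = + toℕ i in
             trans (π-cong (+-~ (~-refl {x}) (rep 0ℤ)))
                   (trans (cong π (ℤ.+-identityʳ x)) (π-toℕ i)))
      }
    ; inverse =
        (λ i → let x = + toℕ i in
           trans (π-cong (+-~ (rep (ℤ.- x)) (~-refl {x}))) (cong π (ℤ.+-inverseˡ x)))
      , (λ i → let x = + toℕ i in
           trans (π-cong (+-~ (~-refl {x}) (rep (ℤ.- x)))) (cong π (ℤ.+-inverseʳ x)))
    ; ⁻¹-cong = cong -ₙ_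
    }

  ℤ/_ℤ : DiscreteGroup
  ℤ/_ℤ = record { isGroup = +ₙ-isGroup }

  reduce : ∀ {X} → Voltage X ℤ-group → Voltage X ℤ/_ℤ
  reduce vol = record
    { α     = π ∘ α
    ; α-inv = λ e → trans (cong π (α-inv e)) (π-cong (neg-~ (~-sym (rep (α e)))))
    }
    where open Voltage vol

-- A formal sum of monomials (k , c) = c tᵏ, with repetitions of
-- exponents and zero coefficients allowed.
Laurent : Set
Laurent = List (ℤ × ℤ)

coeff : Laurent → ℤ → ℤ
coeff []            k = 0ℤ
coeff ((l , c) ∷ f) k with l ℤ.≟ k
... | yes _ = c ℤ.+ coeff f k
... | no  _ = coeff f k

evalAt1 : Laurent → ℤ
evalAt1 []            = 0ℤ
evalAt1 ((_ , c) ∷ f) = c ℤ.+ evalAt1 f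

infix 9 t^_
t^_ : ℤ → Laurent
t^ k = (k , 1ℤ) ∷ []

const : ℤ → Laurent
const c = (0ℤ , c) ∷ []

ℤ[t^±1] : RawRing 0ℓ 0ℓ
ℤ[t^±1] = record
  { Carrier = Laurent
  ; _≈_     = λ f g → ∀ k → coeff f k ≡ coeff g k
  ; _+_     = _++_
  ; _*_     = List.cartesianProductWith (λ (k , c) (l , d) → k ℤ.+ l , c ℤ.* d)
  ; -_      = List.map (λ (k , c) → k , ℤ.- c)
  ; 0#      = []
  ; 1#      = const 1ℤ
  }

module _ (R : RawRing 0ℓ 0ℓ) where
  open RawRing R
  open import Algebra.Definitions.RawSemiring rawSemiring using (sum; _^_)

  Matrix : ℕ → Set
  Matrix n = Fin n → Fin n → Carrier

  -- Laplace expansion along the first row.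
  det : ∀ {n} → Matrix n → Carrier
  det {zero}  M = 1#
  det {suc n} M = sum λ j →
    (- 1#) ^ toℕ j * (M zero j * det (λ i k → M (suc i) (punchIn j k)))

module _ {X : Graph} (fin : Finite X) (vol : Voltage X ℤ-group) where
  open Graph X
  open Finite fin
  open Voltage vol
  open RawRing ℤ[t^±1] using (_+_; -_)

  degreeMatrix : Matrix ℤ[t^±1] #V
  degreeMatrix i j with i Fin.≟ j
  ... | yes _ = const (+ length (filter (λ e → o e ≟ᵥ vertex i) edges))
  ... | no  _ = const 0ℤ

  voltageMatrix : Matrix ℤ[t^±1] #V
  voltageMatrix i j = List.map (λ e → α e , 1ℤ)
    (filter (λ e → (o e ≟ᵥ vertex i) ×-dec (t e ≟ᵥ vertex j)) edges)

  iharaPolynomial : Laurent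
  iharaPolynomial = det ℤ[t^±1] (λ i j → degreeMatrix i j + (- voltageMatrix i j))

open RawRing ℤ[t^±1] public using () renaming (_≈_ to _≈ᴸ_; _*_ to _*ᴸ_)
open import Algebra.Definitions.RawSemiring (RawRing.rawSemiring ℤ[t^±1]) public
  using () renaming (_^_ to _^ᴸ_)

t-1 : Laurent
t-1 = (1ℤ , 1ℤ) ∷ (0ℤ , -1ℤ) ∷ []

-- Neither OrdAt0 nor OrdAt1 holds of any k when f is zero; otherwise each
-- holds of exactly one k.
OrdAt0 : Laurent → ℤ → Set
OrdAt0 f k = coeff f k ≢ 0ℤ × (∀ j → j ℤ.< k → coeff f j ≡ 0ℤ)

OrdAt1 : Laurent → ℕ → Set
OrdAt1 f k = Σ[ h ∈ Laurent ] f ≈ᴸ (t-1 ^ᴸ k) *ᴸ h × evalAt1 h ≢ 0ℤ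

-- A nonzero polynomial in ℤ[t]; coefficients in order of increasing degree.
record Polynomial : Set where
  field
    degree : ℕ
    coeffs : Vec ℤ (suc degree)
    lead≢0 : Vec.last coeffs ≢ 0ℤ

toLaurent : Polynomial → Laurent
toLaurent f = List.tabulate (λ i → + toℕ i , lookup coeffs i)
  where open Polynomial f

-- For f of degree d and g of degree n, the rows are the coefficients, in
-- order of decreasing degree, of tⁿ⁻¹f, …, f, tᵈ⁻¹g, …, g.
-- An entry of a row tᵏf in the column of tˡ is the coefficient of tˡ⁻ᵏ in f.
sylvester : (d n : ℕ) → Laurent → Laurent → Matrix ℤ.+-*-rawRing (n ℕ.+ d)
sylvester d n f g i j =
  [ (λ i → coeff f (+ (d ℕ.+ toℕ i) ℤ.- + toℕ j))
  , (λ i → coeff g (+ (n ℕ.+ toℕ i) ℤ.- + toℕ j))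
  ]′ (splitAt n i)

Res : (d n : ℕ) → Laurent → Laurent → ℤ
Res d n f g = det ℤ.+-*-rawRing (sylvester d n f g)

tⁿ-1 : ℕ → Laurent
tⁿ-1 n = (+ n , 1ℤ) ∷ (0ℤ , -1ℤ) ∷ []

-- For f = a ∏ᵢ (t - αᵢ) over the algebraic numbers, this resultant is
-- aⁿ ∏ᵢ (αᵢⁿ - 1).
Δ : (n : ℕ) .{{_ : NonZero n}} → Polynomial → ℤ
Δ n f = Res (Polynomial.degree f) n (toLaurent f) (tⁿ-1 n)

fromℤ : ℤ → ℚ
fromℤ z = z ℚ./ 1

module _ {X : Graph} (vol : Voltage X ℤ-group) where

  X∞ : Graph
  X∞ = derivedGraph X ℤ-group vol

  Xₙ : (n : ℕ) .{{_ : NonZero n}} → Graph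
  Xₙ n = derivedGraph X (ℤ/ n ℤ) (reduce n vol)

  Xₙ-finite : Finite X → (n : ℕ) .{{_ : NonZero n}} → Finite (Xₙ n)
  Xₙ-finite fin n = derivedFinite fin (Function.mk↔ₛ′ (λ i → i) (λ i → i) (λ _ → refl) (λ _ → refl))
                                  (reduce n vol)

{-# OPTIONS --safe #-}

-- Over a ring with ε² = 0 the matrix-tree theorem reads det (L + ε) = ε |V| κ for the Laplacian L of
-- a finite graph: splitting each row into a root ε and the outgoing edges of its vertex, only the
-- choices that form a spanning tree directed towards its single root contribute.
--
-- Adjoin to ℤ the roots x of tⁿ - 1. In the Newton basis of R[t]/(tⁿ - 1) the cyclic shift becomes
-- triangular with the x on the diagonal, and so does the block circulant Laplacian of Xₙ. Hence
-- det (Lₙ + ε) is the product of det (D - A(x) + ε) over all x. The factor at x = 1 is ε |V| κ(X), the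
-- others are I(x) up to ε, and therefore n κ(Xₙ) = κ(X) ∏ I(x) over x ≠ 1.
--
-- The same triangularisation gives Δₙ(J) = ± ∏ J(x). What remains is the product of x⁻ᵇ (x - 1)ᵉ over
-- x ≠ 1, which is ± nᵉ. The symmetry I(t) = I(t⁻¹) forces deg J + e = 2b, so that the signs combine to
-- (-1)ᵇ⁽ⁿ⁻¹⁾. Finally I ≠ 0, because the connected graph X₂ has a spanning tree.
module Submission where

open import Defs
open import Algebra.Bundles using (CommutativeRing; RawRing)
import Algebra.Solver.Ring as RingSolver
import Algebra.Solver.Ring.AlmostCommutativeRing as ACR
open import Data.Bool using (if_then_else_; true)
import Data.Bool.Properties as Bool
open import Data.Fin as Fin using (Fin; zero; suc; toℕ; fromℕ; fromℕ<; inject₁; inject≤; combine; remQuot; splitAt; punchIn; punchOut; _↑ˡ_; _↑ʳ_)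
import Data.Fin.Permutation as Perm
import Data.Fin.Properties as Fin
open import Data.Fin.Relation.Unary.Top using (view; ‵fromℕ; ‵inject₁)
open import Data.Fin.Subset using (Subset; _∈_; inside; outside)
open import Data.Fin.Subset.Properties using (_∈?_; ⊆-antisym)
open import Data.Integer as ℤ using (ℤ; +_; -[1+_]; 0ℤ; 1ℤ; -1ℤ; ∣_∣)
open import Data.Integer.DivMod using (n%ℕd<d)
import Data.Integer.Properties as ℤ
open import Data.Integer.Tactic.RingSolver using (solve-∀)
open import Data.List as List using (List; []; _∷_; _++_; filter; length; allFin; cartesianProductWith)
open import Data.List.Membership.Propositional using () renaming (_∈_ to _∈ₗ_)
open import Data.List.Membership.Propositional.Properties using (∈-cartesianProductWith⁺; ∈-allFin; ∈-++⁺ˡ; ∈-++⁺ʳ; ∈-map⁺; ∈-map⁻; ∈-filter⁺)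
import Data.List.Properties as List
open import Data.List.Relation.Unary.All as All using (All; []; _∷_)
open import Data.List.Relation.Unary.AllPairs using ([]; _∷_)
open import Data.List.Relation.Unary.Any using (here; there)
open import Data.List.Relation.Unary.Unique.Propositional using (Unique)
import Data.List.Relation.Unary.Unique.Propositional.Properties as Unique
open import Data.Maybe using (Maybe; just; nothing)
open import Data.Nat as ℕ using (ℕ; zero; suc; NonZero)
open import Data.Nat.DivMod using (_mod_; _%_; _/_; m<n⇒m%n≡m; n%n≡0; m≡m%n+[m/n]*n)
import Data.Nat.Properties as ℕ
open import Data.Product using (Σ-syntax; ∃; _×_; _,_; proj₁; proj₂)
open import Data.Product.Algebra using (×-comm)
open import Data.Rational as ℚ using (ℚ; 0ℚ)
import Data.Rational.Properties as ℚ
open import Data.Rational.Unnormalised as ℚᵘ using (mkℚᵘ; *≡*)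
import Data.Rational.Unnormalised.Properties as ℚᵘ
open import Data.Sum using (_⊎_; inj₁; inj₂; [_,_]′)
open import Data.Vec as Vec using (Vec; []; _∷_; lookup)
open import Data.Vec.Functional as Vector using (updateAt)
open import Data.Vec.Functional.Properties using (updateAt-updates; updateAt-minimal)
import Data.Vec.Properties as Vec
open import Data.Vec.Properties using ([]=⇒lookup; lookup⇒[]=; lookup∘tabulate)
open import Data.Vec.Properties.WithK using ([]=-irrelevant)
open import Function using (_∘_; _↔_; Inverse; Injection; mk↔ₛ′)
import Function.Construct.Composition as Comp
import Function.Construct.Symmetry as Sym
open import Function.Properties.Inverse using (↔⇒↣)
open import Level using (0ℓ)
open import Relation.Binary.Definitions using (DecidableEquality; tri<; tri≈; tri>)
open import Relation.Binary.PropositionalEquality as ≡ using (_≡_; _≢_; module ≡-Reasoning)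
open import Relation.Nullary using (¬_; Dec; yes; no; does; contradiction; ¬?; _×-dec_; _⊎-dec_; _→-dec_)
open import Relation.Nullary.Decidable using (decidable-stable; dec-true)
open import Relation.Unary using (Decidable)

-- Determinants over a commutative ring

-- The roots of tⁿ - 1 live in a tower of formally adjoined roots that is not known to be an
-- integral domain; what is available is the injectivity of the map from ℤ. Differences of roots can
-- thus be neither inverted nor cancelled, which rules out diagonalising the shift by a Vandermonde
-- matrix. The change to the Newton basis has determinant 1 and needs no division, and all
-- identities stay cross-multiplied until they are back in ℤ.
--
-- The ε replaces the deletion of a row in the usual matrix-tree theorem: a reduced Laplacian of Xₙ
-- is no longer block circulant, while L + ε is. As the factor at x = 1 is a multiple of ε, the
-- other factors enter only through their values at ε = 0.
--
-- The root 1 is kept apart: the roots of Φ = 1 + t + ... + tⁿ⁻¹ are adjoined and 1 is appended. Up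
-- to sign, the products of x and of x - 1 over x ≠ 1 are Φ(0) = 1 and Φ(1) = n.

missed⇒collision : ∀ {n} (f : Fin n → Fin n) i → (∀ k → f k ≢ i) → ∃ λ a → ∃ λ b → a ≢ b × f a ≡ f b
missed⇒collision {suc n} f i miss =
  let a , b , a<b , eq = Fin.pigeonhole (ℕ.n<1+n n) (λ k → punchOut (miss k ∘ ≡.sym))
  in a , b , (λ a≡b → ℕ.<⇒≢ a<b (≡.cong toℕ a≡b)) , Fin.punchOut-injective (miss a ∘ ≡.sym) (miss b ∘ ≡.sym) eq

module RingTheory (R : CommutativeRing 0ℓ 0ℓ) where
  open CommutativeRing R hiding (zero)
  open import Algebra.Properties.Ring ring using (-‿distribˡ-*; -‿distribʳ-*; -‿involutive; -‿+-comm; -0#≈0#; -1*x≈-x)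
  open import Algebra.Properties.Semiring.Mult semiring using (×-homo-+; ×1-homo-*) renaming (_×_ to _×ᴿ_)
  open import Algebra.Properties.Semiring.Exp semiring using (_^_)
  open import Algebra.Properties.Semiring.Sum semiring
  open import Relation.Binary.Reasoning.Setoid setoid

  ι : ℤ → Carrier
  ι (+ n)    = n ×ᴿ 1#
  ι -[1+ n ] = - (suc n ×ᴿ 1#)

  ι-⊖ : ∀ m n → ι (m ℤ.⊖ n) ≈ m ×ᴿ 1# + - (n ×ᴿ 1#)
  ι-⊖ m       zero    = trans (reflexive (≡.cong ι (ℤ.⊖-≥ {m} {0} ℕ.z≤n)))
                          (sym (trans (+-congˡ -0#≈0#) (+-identityʳ _)))
  ι-⊖ zero    (suc n) = sym (+-identityˡ _)
  ι-⊖ (suc m) (suc n) = begin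
    ι (suc m ℤ.⊖ suc n)                ≡⟨ ≡.cong ι (ℤ.[1+m]⊖[1+n]≡m⊖n m n) ⟩
    ι (m ℤ.⊖ n)                        ≈⟨ ι-⊖ m n ⟩
    m ×ᴿ 1# + - (n ×ᴿ 1#)              ≈⟨ +-congʳ (+-identityʳ _) ⟨
    m ×ᴿ 1# + 0# + - (n ×ᴿ 1#)         ≈⟨ +-congʳ (+-congˡ (-‿inverseʳ 1#)) ⟨
    m ×ᴿ 1# + (1# + - 1#) + - (n ×ᴿ 1#) ≈⟨ +-congʳ (+-assoc _ _ _) ⟨
    m ×ᴿ 1# + 1# + - 1# + - (n ×ᴿ 1#)  ≈⟨ +-congʳ (+-congʳ (+-comm _ _)) ⟩
    suc m ×ᴿ 1# + - 1# + - (n ×ᴿ 1#)   ≈⟨ +-assoc _ _ _ ⟩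
    suc m ×ᴿ 1# + (- 1# + - (n ×ᴿ 1#)) ≈⟨ +-congˡ (-‿+-comm _ _) ⟩
    suc m ×ᴿ 1# + - (suc n ×ᴿ 1#)      ∎

  ι-+ : ∀ x y → ι (x ℤ.+ y) ≈ ι x + ι y
  ι-+ (+ m)    (+ n)    = ×-homo-+ 1# m n
  ι-+ (+ m)    -[1+ n ] = ι-⊖ m (suc n)
  ι-+ -[1+ m ] (+ n)    = trans (ι-⊖ n (suc m)) (+-comm _ _)
  ι-+ -[1+ m ] -[1+ n ] = begin
    - (suc (suc (m ℕ.+ n)) ×ᴿ 1#)           ≡⟨ ≡.cong (λ k → - (suc k ×ᴿ 1#)) (≡.sym (ℕ.+-suc m n)) ⟩
    - ((suc m ℕ.+ suc n) ×ᴿ 1#)             ≈⟨ -‿cong (×-homo-+ 1# (suc m) (suc n)) ⟩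
    - (suc m ×ᴿ 1# + suc n ×ᴿ 1#)           ≈⟨ -‿+-comm _ _ ⟨
    - (suc m ×ᴿ 1#) + - (suc n ×ᴿ 1#)       ∎

  ι-neg : ∀ x → ι (ℤ.- x) ≈ - ι x
  ι-neg (+ zero)   = sym -0#≈0#
  ι-neg ℤ.+[1+ n ] = refl
  ι-neg -[1+ n ]   = sym (-‿involutive _)

  ι-pos-* : ∀ m n → ι (+ m ℤ.* + n) ≈ ι (+ m) * ι (+ n)
  ι-pos-* m n = trans (reflexive (≡.cong ι (≡.sym (ℤ.pos-* m n)))) (×1-homo-* m n)

  ι-* : ∀ x y → ι (x ℤ.* y) ≈ ι x * ι y
  ι-* (+ m)    (+ n)    = ι-pos-* m n
  ι-* (+ m)    -[1+ n ] = begin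
    ι (+ m ℤ.* -[1+ n ])          ≡⟨ ≡.cong ι (≡.sym (ℤ.neg-distribʳ-* (+ m) (+ suc n))) ⟩
    ι (ℤ.- (+ m ℤ.* + suc n))     ≈⟨ ι-neg (+ m ℤ.* + suc n) ⟩
    - ι (+ m ℤ.* + suc n)         ≈⟨ -‿cong (ι-pos-* m (suc n)) ⟩
    - (ι (+ m) * ι (+ suc n))     ≈⟨ -‿distribʳ-* _ _ ⟩
    ι (+ m) * ι -[1+ n ]          ∎
  ι-* -[1+ m ] (+ n)    = begin
    ι (-[1+ m ] ℤ.* + n)          ≡⟨ ≡.cong ι (≡.sym (ℤ.neg-distribˡ-* (+ suc m) (+ n))) ⟩
    ι (ℤ.- (+ suc m ℤ.* + n))     ≈⟨ ι-neg (+ suc m ℤ.* + n) ⟩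
    - ι (+ suc m ℤ.* + n)         ≈⟨ -‿cong (ι-pos-* (suc m) n) ⟩
    - (ι (+ suc m) * ι (+ n))     ≈⟨ -‿distribˡ-* _ _ ⟩
    ι -[1+ m ] * ι (+ n)          ∎
  ι-* -[1+ m ] -[1+ n ] = begin
    ι (+ suc m ℤ.* + suc n)             ≈⟨ ι-pos-* (suc m) (suc n) ⟩
    ι (+ suc m) * ι (+ suc n)           ≈⟨ -‿involutive _ ⟨
    - - (ι (+ suc m) * ι (+ suc n))     ≈⟨ -‿cong (-‿distribˡ-* _ _) ⟩
    - (- ι (+ suc m) * ι (+ suc n))     ≈⟨ -‿distribʳ-* _ _ ⟩
    ι -[1+ m ] * ι -[1+ n ]             ∎

  ι-1 : ι (+ 1) ≈ 1#
  ι-1 = +-identityʳ 1#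

  private
    ι-decide : ∀ x y → Maybe (ι x ≈ ι y)
    ι-decide x y with x ℤ.≟ y
    ... | yes x≡y = just (reflexive (≡.cong ι x≡y))
    ... | no  _   = nothing

    ι-morphism : CommutativeRing.rawRing ℤ.+-*-commutativeRing
                   ACR.-Raw-AlmostCommutative⟶ ACR.fromCommutativeRing R
    ι-morphism = record
      { ⟦_⟧ = ι ; +-homo = ι-+ ; *-homo = ι-* ; -‿homo = ι-neg ; 0-homo = refl ; 1-homo = ι-1 }

  -- Integer coefficients let the solver recognise cancellation. The constant `con (+ 1)` denotes
  -- `ι (+ 1)`, which is `1# + 0#`; identities involving `1#` therefore pass through `ι-1` or treat
  -- `1#` as a variable.
  module Solver = RingSolver (CommutativeRing.rawRing ℤ.+-*-commutativeRing)
                    (ACR.fromCommutativeRing R) ι-morphism ι-decide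
  open Solver using (solve; _:=_; _:+_; _:*_; :-_; con)

  𝟙 : ∀ {P : Set} → Dec P → Carrier
  𝟙 d = if does d then 1# else 0#

  𝟙-yes : ∀ {P} (d : Dec P) → P → 𝟙 d ≡ 1#
  𝟙-yes (yes _) p = ≡.refl
  𝟙-yes (no ¬p) p = contradiction p ¬p

  𝟙-no : ∀ {P} (d : Dec P) → ¬ P → 𝟙 d ≡ 0#
  𝟙-no (yes p) ¬p = contradiction p ¬p
  𝟙-no (no _)  ¬p = ≡.refl

  𝟙-cong : ∀ {P Q} (d : Dec P) (d′ : Dec Q) → (P → Q) → (Q → P) → 𝟙 d ≡ 𝟙 d′
  𝟙-cong (yes p) d′ f g = ≡.sym (𝟙-yes d′ (f p))
  𝟙-cong (no ¬p) d′ f g = ≡.sym (𝟙-no d′ (¬p ∘ g))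

  sum-zero : ∀ {n} {f : Fin n → Carrier} → (∀ i → f i ≈ 0#) → sum f ≈ 0#
  sum-zero {n} h = trans (sum-cong-≋ h) (sum-replicate-zero n)

  sum-single : ∀ {n} (i : Fin n) {f : Fin n → Carrier} → (∀ j → j ≢ i → f j ≈ 0#) → sum f ≈ f i
  sum-single zero    h = trans (+-congˡ (sum-zero (λ j → h (suc j) λ ()))) (+-identityʳ _)
  sum-single (suc i) h = trans (+-cong (h zero λ ()) (sum-single i (λ j j≢i → h (suc j) (j≢i ∘ Fin.suc-injective))))
                               (+-identityˡ _)

  sum-δ : ∀ {n} (i : Fin n) (f : Fin n → Carrier) → sum (λ k → 𝟙 (i Fin.≟ k) * f k) ≈ f i
  sum-δ i f = trans
    (sum-single i (λ j j≢i → trans (*-congʳ (reflexive (𝟙-no (i Fin.≟ j) (j≢i ∘ ≡.sym)))) (zeroˡ _)))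
    (trans (*-congʳ (reflexive (𝟙-yes (i Fin.≟ i) ≡.refl))) (*-identityˡ _))

  sum-δʳ : ∀ {n} (i : Fin n) (f : Fin n → Carrier) → sum (λ k → f k * 𝟙 (k Fin.≟ i)) ≈ f i
  sum-δʳ i f = trans
    (sum-single i (λ j j≢i → trans (*-congˡ (reflexive (𝟙-no (j Fin.≟ i) j≢i))) (zeroʳ _)))
    (trans (*-congˡ (reflexive (𝟙-yes (i Fin.≟ i) ≡.refl))) (*-identityʳ _))

  sum-linear : ∀ {n} a (f g : Fin n → Carrier) → sum (λ i → a * f i + g i) ≈ a * sum f + sum g
  sum-linear a f g = trans (∑-distrib-+ (λ i → a * f i) g) (+-congʳ (sym (*-distribˡ-sum a f)))

  sum-+ : ∀ m {n} (f : Fin (m ℕ.+ n) → Carrier) → sum f ≈ sum (λ i → f (i ↑ˡ n)) + sum (λ j → f (m ↑ʳ j))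
  sum-+ zero    f = sym (+-identityˡ _)
  sum-+ (suc m) f = trans (+-congˡ (sum-+ m (f ∘ suc))) (sym (+-assoc _ _ _))

  sum-combine : ∀ m n (f : Fin (m ℕ.* n) → Carrier) →
                sum f ≈ sum (λ i → sum (λ j → f (Fin.combine {m} {n} i j)))
  sum-combine zero    n f = refl
  sum-combine (suc m) n f = trans (sum-+ n f) (+-congˡ (sum-combine m n _))

  Rows : ℕ → ℕ → Set
  Rows n p = Fin n → Fin p → Carrier

  Mat : ℕ → Set
  Mat n = Rows n n

  infix 4 _≋_
  _≋_ : ∀ {n p} → Rows n p → Rows n p → Set
  M ≋ M′ = ∀ i j → M i j ≈ M′ i j

  infixl 8 _[_]≔_
  _[_]≔_ : ∀ {n p} → Rows n p → Fin n → (Fin p → Carrier) → Rows n p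
  M [ i ]≔ v = updateAt M i (λ _ → v)

  []≔-same : ∀ {n p} (M : Rows n p) i v j → (M [ i ]≔ v) i j ≡ v j
  []≔-same M i v j = ≡.cong (λ r → r j) (updateAt-updates i M)

  []≔-other : ∀ {n p} (M : Rows n p) i v k → k ≢ i → ∀ j → (M [ i ]≔ v) k j ≡ M k j
  []≔-other M i v k k≢i j = ≡.cong (λ r → r j) (updateAt-minimal k i M k≢i)

  -- The three matrices in `linear` are tied by equations off row `i` and on row `i` instead of
  -- being built by row replacement, so that the axiom applies to matrices of any shape.
  record IsMultilinear {n p} (H : Rows n p → Carrier) : Set where
    field
      H-cong : ∀ {M M′} → M ≋ M′ → H M ≈ H M′
      linear : ∀ i {M M₁ M₂} a → (∀ k → k ≢ i → ∀ j → M k j ≈ M₁ k j) → (∀ k → k ≢ i → ∀ j → M k j ≈ M₂ k j) →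
               (∀ j → M i j ≈ a * M₁ i j + M₂ i j) → H M ≈ a * H M₁ + H M₂

    -- A zero row is `- 1#` times itself plus itself, so the value is `- H M + H M`.
    zero-row : ∀ i {M} → (∀ j → M i j ≈ 0#) → H M ≈ 0#
    zero-row i {M} h = trans
      (linear i {M} {M} {M} (- 1#) (λ _ _ _ → refl) (λ _ _ _ → refl)
        (λ j → trans (h j) (sym (trans (+-cong (trans (*-congˡ (h j)) (zeroʳ _)) (h j)) (+-identityˡ 0#)))))
      (trans (+-congʳ (-1*x≈-x _)) (-‿inverseˡ _))

    sum-row : ∀ i {m} (a : Fin m → Carrier) (N : Fin m → Rows n p) M →
              (∀ c k → k ≢ i → ∀ j → M k j ≈ N c k j) → (∀ j → M i j ≈ sum (λ c → a c * N c i j)) →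
              H M ≈ sum (λ c → a c * H (N c))
    sum-row i {zero}  a N M off on = zero-row i on
    sum-row i {suc m} a N M off on = trans
      (linear i (a zero) (off zero) (λ k k≢i j → sym (reflexive ([]≔-other M i _ k k≢i j)))
        (λ j → trans (on j) (+-congˡ (reflexive (≡.sym ([]≔-same M i _ j))))))
      (+-congˡ (sum-row i (a ∘ suc) (N ∘ suc) (M [ i ]≔ λ j → sum (λ c → a (suc c) * N (suc c) i j))
        (λ c k k≢i j → trans (reflexive ([]≔-other M i _ k k≢i j)) (off (suc c) k k≢i j))
        (λ j → reflexive ([]≔-same M i _ j))))

    AlternatingAt : Fin n → Fin n → Set
    AlternatingAt i k = ∀ M → (∀ j → M i j ≈ M k j) → H M ≈ 0#

    -- Polarisation: with the sum of both rows in places `i` and `k` the value is zero, and so are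
    -- the two pure terms of its expansion. The two mixed terms must cancel.
    swap : ∀ {i k} → i ≢ k → AlternatingAt i k → ∀ {M M′} → (∀ j → M′ i j ≈ M k j) → (∀ j → M′ k j ≈ M i j) →
           (∀ l → l ≢ i → l ≢ k → ∀ j → M′ l j ≈ M l j) → H M′ ≈ - H M
    swap {i} {k} i≢k alt {M} {M′} eqi eqk eql = begin
      H M′                         ≈⟨ H-cong M′≋ ⟩
      H (N b a)                    ≈⟨ solve 2 (λ x y → y := (x :+ y) :+ :- x) refl _ _ ⟩
      (H (N a b) + H (N b a)) + - H (N a b) ≈⟨ +-cong cancel (-‿cong (H-cong M≋)) ⟩
      0# + - H M                   ≈⟨ +-identityˡ _ ⟩
      - H M                        ∎
      where
      a = M i
      b = M k
      a+b : Fin p → Carrier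
      a+b j = 1# * a j + b j
      N : (Fin p → Carrier) → (Fin p → Carrier) → Rows n p
      N x y = M [ i ]≔ x [ k ]≔ y
      N-i : ∀ x y j → N x y i j ≈ x j
      N-i x y j = reflexive (≡.trans ([]≔-other (M [ i ]≔ x) k y i i≢k j) ([]≔-same M i x j))
      N-k : ∀ x y j → N x y k j ≈ y j
      N-k x y j = reflexive ([]≔-same (M [ i ]≔ x) k y j)
      N-l : ∀ x y l → l ≢ i → l ≢ k → ∀ j → N x y l j ≈ M l j
      N-l x y l l≢i l≢k j = reflexive (≡.trans ([]≔-other (M [ i ]≔ x) k y l l≢k j) ([]≔-other M i x l l≢i j))
      M≋ : N a b ≋ M
      M≋ l j with l Fin.≟ i | l Fin.≟ k
      ... | yes ≡.refl | _          = N-i a b j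
      ... | no _       | yes ≡.refl = N-k a b j
      ... | no l≢i     | no l≢k     = N-l a b l l≢i l≢k j
      M′≋ : M′ ≋ N b a
      M′≋ l j with l Fin.≟ i | l Fin.≟ k
      ... | yes ≡.refl | _          = trans (eqi j) (sym (N-i b a j))
      ... | no _       | yes ≡.refl = trans (eqk j) (sym (N-k b a j))
      ... | no l≢i     | no l≢k     = trans (eql l l≢i l≢k j) (sym (N-l b a l l≢i l≢k j))
      first : ∀ y → H (N a+b y) ≈ 1# * H (N a y) + H (N b y)
      first y = linear i 1# (off a) (off b) (λ j → trans (N-i _ y j) (+-cong (*-congˡ (sym (N-i a y j))) (sym (N-i b y j))))
        where
        off : ∀ x l → l ≢ i → ∀ j → N a+b y l j ≈ N x y l j
        off x l l≢i j with l Fin.≟ k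
        ... | yes ≡.refl = trans (N-k _ y j) (sym (N-k x y j))
        ... | no l≢k     = trans (N-l _ y l l≢i l≢k j) (sym (N-l x y l l≢i l≢k j))
      second : ∀ x → H (N x a+b) ≈ 1# * H (N x a) + H (N x b)
      second x = linear k 1# (off a) (off b) (λ j → trans (N-k x _ j) (+-cong (*-congˡ (sym (N-k x a j))) (sym (N-k x b j))))
        where
        off : ∀ y l → l ≢ k → ∀ j → N x a+b l j ≈ N x y l j
        off y l l≢k j with l Fin.≟ i
        ... | yes ≡.refl = trans (N-i x _ j) (sym (N-i x y j))
        ... | no l≢i     = trans (N-l x _ l l≢i l≢k j) (sym (N-l x y l l≢i l≢k j))
      diagonal : ∀ x → H (N x x) ≈ 0#
      diagonal x = alt (N x x) (λ j → trans (N-i x x j) (sym (N-k x x j)))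
      cancel : H (N a b) + H (N b a) ≈ 0#
      cancel = begin
        H (N a b) + H (N b a)
          ≈⟨ +-cong (+-identityˡ _) (+-identityʳ _) ⟨
        (0# + H (N a b)) + (H (N b a) + 0#)
          ≈⟨ +-cong (+-congʳ (diagonal a)) (+-congˡ (diagonal b)) ⟨
        (H (N a a) + H (N a b)) + (H (N b a) + H (N b b))
          ≈⟨ solve 4 (λ x y z w → (x :+ y) :+ (z :+ w) := con (+ 1) :* (con (+ 1) :* x :+ y) :+ (con (+ 1) :* z :+ w)) refl _ _ _ _ ⟩
        ι (+ 1) * (ι (+ 1) * H (N a a) + H (N a b)) + (ι (+ 1) * H (N b a) + H (N b b))
          ≈⟨ +-cong (*-cong ι-1 (+-congʳ (*-congʳ ι-1))) (+-congʳ (*-congʳ ι-1)) ⟩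
        1# * (1# * H (N a a) + H (N a b)) + (1# * H (N b a) + H (N b b))
          ≈⟨ +-cong (*-congˡ (second a)) (second b) ⟨
        1# * H (N a a+b) + H (N b a+b)
          ≈⟨ first a+b ⟨
        H (N a+b a+b)
          ≈⟨ diagonal a+b ⟩
        0# ∎

    IsAlternating : Set
    IsAlternating = ∀ {i k} → i ≢ k → AlternatingAt i k

  open IsMultilinear

  I : ∀ {n} → Mat n
  I i j = 𝟙 (i Fin.≟ j)

  module _ {n} {H : Mat n → Carrier} (ml : IsMultilinear H) (alt : IsAlternating ml) (H-I : H I ≈ 0#) where

    basis : (Fin n → Fin n) → Mat n
    basis f i = I (f i)

    -- Sorting of `f` by transpositions, with the first `m` positions already fixed. If `f` misses
    -- the index `m`, two rows agree; otherwise a swap brings that value to its place at the cost of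
    -- a sign. A fully sorted `f` gives the identity matrix.
    vanish-basis : ∀ d m → d ℕ.+ m ≡ n → (f : Fin n → Fin n) → (∀ i → toℕ i ℕ.< m → f i ≡ i) → H (basis f) ≈ 0#
    vanish-basis zero    m ≡.refl f fixed =
      trans (H-cong ml (λ i j → reflexive (≡.cong (λ k → I k j) (fixed i (Fin.toℕ<n i))))) H-I
    vanish-basis (suc d) m d+m≡n f fixed with Fin.any? (λ k → f k Fin.≟ i)
      where
      i : Fin n
      i = fromℕ< {m} (≡.subst (m ℕ.<_) d+m≡n (ℕ.s≤s (ℕ.m≤n+m m d)))
    ... | no ¬hit with missed⇒collision f _ (λ k eq → ¬hit (k , eq))
    ...   | a , b , a≢b , eq = alt a≢b (basis f) (λ j → reflexive (≡.cong (λ k → I k j) eq))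
    vanish-basis (suc d) m d+m≡n f fixed | yes (k , fk≡i) with k Fin.≟ fromℕ< {m} (≡.subst (m ℕ.<_) d+m≡n (ℕ.s≤s (ℕ.m≤n+m m d)))
    ... | yes ≡.refl = vanish-basis d (suc m) (≡.trans (ℕ.+-suc d m) d+m≡n) f extend
      where
      extend : ∀ j → toℕ j ℕ.< suc m → f j ≡ j
      extend j j<1+m with ℕ.m≤n⇒m<n∨m≡n (ℕ.s≤s⁻¹ j<1+m)
      ... | inj₁ j<m = fixed j j<m
      ... | inj₂ j≡m = ≡.subst (λ l → f l ≡ l) (Fin.toℕ-injective (≡.trans (Fin.toℕ-fromℕ< _) (≡.sym j≡m))) fk≡i
    ... | no k≢i = trans
        (trans (sym (-‿involutive _)) (-‿cong (sym (swap ml (k≢i ∘ ≡.sym) (alt (k≢i ∘ ≡.sym))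
           (λ j → entry (≡.trans f′i (≡.sym fk≡i)) j) (λ j → entry f′k j) (λ l l≢i l≢k j → entry (f′l l l≢i l≢k) j)))))
        (trans (-‿cong (vanish-basis d (suc m) (≡.trans (ℕ.+-suc d m) d+m≡n) f′ extend)) -0#≈0#)
      where
      i : Fin n
      i = fromℕ< {m} (≡.subst (m ℕ.<_) d+m≡n (ℕ.s≤s (ℕ.m≤n+m m d)))
      f′ : Fin n → Fin n
      f′ = updateAt (updateAt f i (λ _ → i)) k (λ _ → f i)
      f′k : f′ k ≡ f i
      f′k = updateAt-updates k _
      f′i : f′ i ≡ i
      f′i = ≡.trans (updateAt-minimal i k _ (k≢i ∘ ≡.sym)) (updateAt-updates i f)
      f′l : ∀ l → l ≢ i → l ≢ k → f′ l ≡ f l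
      f′l l l≢i l≢k = ≡.trans (updateAt-minimal l k _ l≢k) (updateAt-minimal l i f l≢i)
      entry : ∀ {x y} → x ≡ y → ∀ j → I x j ≈ I y j
      entry eq j = reflexive (≡.cong (λ z → I z j) eq)
      extend : ∀ j → toℕ j ℕ.< suc m → f′ j ≡ j
      extend j j<1+m with j Fin.≟ i
      ... | yes ≡.refl = f′i
      ... | no j≢i = ≡.trans (f′l j j≢i j≢k) (fixed j j<m)
        where
        j<m : toℕ j ℕ.< m
        j<m = ℕ.≤∧≢⇒< (ℕ.s≤s⁻¹ j<1+m) (λ j≡m → j≢i (Fin.toℕ-injective (≡.trans j≡m (≡.sym (Fin.toℕ-fromℕ< _)))))
        j≢k : j ≢ k
        j≢k ≡.refl = k≢i (≡.trans (≡.sym (fixed j j<m)) fk≡i)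

    -- The rows from index `m` on are already unit rows, and row `m - 1` is expanded in the standard
    -- basis. The hypothesis is void for `m` equal to `n`, and at 0 only a choice function of unit
    -- rows is left.
    vanish-from : ∀ m → m ℕ.≤ n → (M : Mat n) → (∀ i → m ℕ.≤ toℕ i → ∃ λ c → ∀ j → M i j ≈ I c j) → H M ≈ 0#
    vanish-from zero    m≤n M bas =
      trans (H-cong ml (λ i j → proj₂ (bas i ℕ.z≤n) j)) (vanish-basis n 0 (ℕ.+-identityʳ n) (λ i → proj₁ (bas i ℕ.z≤n)) λ _ ())
    vanish-from (suc m) m<n M bas = trans
      (sum-row ml i (M i) (λ c → M [ i ]≔ I c) M
        (λ c k k≢i j → sym (reflexive ([]≔-other M i _ k k≢i j)))
        (λ j → sym (trans (sum-cong-≋ (λ c → *-congˡ (reflexive ([]≔-same M i (I c) j)))) (sum-δʳ j (M i)))))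
      (sum-zero (λ c → trans (*-congˡ (vanish-from m (ℕ.<⇒≤ m<n) (M [ i ]≔ I c) (bas′ c))) (zeroʳ _)))
      where
      i : Fin n
      i = fromℕ< m<n
      bas′ : ∀ c k → m ℕ.≤ toℕ k → ∃ λ c′ → ∀ j → (M [ i ]≔ I c) k j ≈ I c′ j
      bas′ c k m≤k with k Fin.≟ i
      ... | yes ≡.refl = c , λ j → reflexive ([]≔-same M i (I c) j)
      ... | no k≢i with bas k (ℕ.≤∧≢⇒< m≤k (λ m≡k → k≢i (Fin.toℕ-injective (≡.trans (≡.sym m≡k) (≡.sym (Fin.toℕ-fromℕ< m<n))))))
      ...   | c′ , eq = c′ , λ j → trans (reflexive ([]≔-other M i (I c) k k≢i j)) (eq j)

    vanish : ∀ M → H M ≈ 0#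
    vanish M = vanish-from n ℕ.≤-refl M (λ i n≤i → contradiction (Fin.toℕ<n i) (ℕ.≤⇒≯ n≤i))

  Det : ∀ {n} → Mat n → Carrier
  Det = det rawRing

  sgn : ∀ {n} → Fin n → Carrier
  sgn j = (- 1#) ^ toℕ j

  minor : ∀ {n} → Fin (suc n) → Mat (suc n) → Mat n
  minor j M i k = M (suc i) (punchIn j k)

  laplace : ∀ {n} → Mat (suc n) → Fin (suc n) → Carrier
  laplace M j = sgn j * (M zero j * Det (minor j M))

  Det-cong : ∀ {n} {M M′ : Mat n} → M ≋ M′ → Det M ≈ Det M′
  Det-cong {zero}  h = refl
  Det-cong {suc n} {M} {M′} h = sum-cong-≋ (λ j → *-congˡ {sgn j} (*-cong (h zero j) (Det-cong {M = minor j M} {minor j M′} (λ i k → h (suc i) (punchIn j k)))))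

  Det-linear : ∀ {n} (i : Fin n) {M M₁ M₂ : Mat n} a →
    (∀ k → k ≢ i → ∀ j → M k j ≈ M₁ k j) → (∀ k → k ≢ i → ∀ j → M k j ≈ M₂ k j) →
    (∀ j → M i j ≈ a * M₁ i j + M₂ i j) → Det M ≈ a * Det M₁ + Det M₂
  Det-linear {suc n} zero {M} {M₁} {M₂} a off₁ off₂ on = trans
    (sum-cong-≋ (λ j → trans (*-congˡ (*-congʳ (on j)))
      (trans (solve 5 (λ s a x y d → s :* ((a :* x :+ y) :* d) := a :* (s :* (x :* d)) :+ s :* (y :* d)) refl
                (sgn j) a (M₁ zero j) (M₂ zero j) (Det (minor j M)))
        (+-cong (*-congˡ (*-congˡ (*-congˡ (Det-cong (λ i k → off₁ (suc i) (λ ()) _)))))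
                (*-congˡ (*-congˡ (Det-cong (λ i k → off₂ (suc i) (λ ()) _))))))))
    (sum-linear a (laplace M₁) (laplace M₂))
  Det-linear {suc n} (suc i) {M} {M₁} {M₂} a off₁ off₂ on = trans
    (sum-cong-≋ (λ j → trans
      (*-congˡ (*-congˡ (Det-linear i {minor j M} {minor j M₁} {minor j M₂} a
         (λ k k≢i l → off₁ (suc k) (k≢i ∘ Fin.suc-injective) _)
         (λ k k≢i l → off₂ (suc k) (k≢i ∘ Fin.suc-injective) _)
         (λ l → on _))))
      (trans (solve 5 (λ s x a d₁ d₂ → s :* (x :* (a :* d₁ :+ d₂)) := a :* (s :* (x :* d₁)) :+ s :* (x :* d₂)) refl
                (sgn j) (M zero j) a _ _)
        (+-cong (*-congˡ (*-congˡ (*-congʳ (off₁ zero (λ ()) j)))) (*-congˡ (*-congʳ (off₂ zero (λ ()) j)))))))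
    (sum-linear a (laplace M₁) (laplace M₂))

  Det-multilinear : ∀ {n} → IsMultilinear (Det {n})
  Det-multilinear = record { H-cong = Det-cong ; linear = Det-linear }

  -- The terms for (j , punchIn j k) and for the transposed pair carry opposite signs.
  antisymmetric-sum : ∀ n (F : Fin (suc n) → Fin (suc n) → Carrier) → (∀ j k → F j k ≈ F k j) →
    sum (λ j → sum (λ k → sgn j * (sgn k * F j (punchIn j k)))) ≈ 0#
  antisymmetric-sum zero    F F-sym = +-identityʳ _
  antisymmetric-sum (suc n) F F-sym = begin
    sum top + sum (λ j → left j + sum (lower j))               ≈⟨ +-congˡ (∑-distrib-+ left (sum ∘ lower)) ⟩
    sum top + (sum left + sum (λ j → sum (lower j)))           ≈⟨ +-assoc _ _ _ ⟨
    sum top + sum left + sum (λ j → sum (lower j))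
      ≈⟨ +-cong (trans (sym (∑-distrib-+ top left)) (sum-zero cancel))
                (trans (sum-cong-≋ (λ j → sum-cong-≋ (signs j)))
                       (antisymmetric-sum n (λ j k → F (suc j) (suc k)) (λ j k → F-sym (suc j) (suc k)))) ⟩
    0# + 0#                                                    ≈⟨ +-identityˡ _ ⟩
    0#                                                         ∎
    where
    top left : Fin (suc n) → Carrier
    top k  = 1# * (sgn k * F zero (suc k))
    left j = sgn (suc j) * (1# * F (suc j) zero)
    lower : Fin (suc n) → Fin n → Carrier
    lower j k = sgn (suc j) * (sgn (suc k) * F (suc j) (suc (punchIn j k)))
    cancel : ∀ k → top k + left k ≈ 0#
    cancel k = trans (+-cong (*-identityˡ _) (*-cong (-1*x≈-x _) (trans (*-identityˡ _) (F-sym _ _))))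
      (solve 2 (λ s f → s :* f :+ (:- s) :* f := con (+ 0)) refl _ _)
    signs : ∀ j k → lower j k ≈ sgn j * (sgn k * F (suc j) (suc (punchIn j k)))
    signs j k = trans (*-cong (-1*x≈-x _) (*-congʳ (-1*x≈-x _)))
      (solve 3 (λ s s′ f → (:- s) :* ((:- s′) :* f) := s :* (s′ :* f)) refl _ _ _)

  punchIn-comm : ∀ {n} (j k : Fin (suc (suc n))) (p : j ≢ k) (q : k ≢ j) l →
                 punchIn j (punchIn (punchOut p) l) ≡ punchIn k (punchIn (punchOut q) l)
  punchIn-comm zero    zero    p q l       = contradiction ≡.refl p
  punchIn-comm zero    (suc k) p q l       = ≡.refl
  punchIn-comm (suc j) zero    p q l       = ≡.refl
  punchIn-comm (suc j) (suc k) p q zero    = ≡.refl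
  punchIn-comm (suc j) (suc k) p q (suc l) = ≡.cong suc (punchIn-comm j k (p ∘ ≡.cong suc) (q ∘ ≡.cong suc) l)

  -- Expanding the top two rows gives a signed sum over ordered pairs of distinct columns. When the
  -- rows agree, the unsigned summand is symmetric in the pair, and `antisymmetric-sum` applies.
  Det-alt₀₁ : ∀ {n} {M : Mat (suc (suc n))} → (∀ j → M zero j ≈ M (suc zero) j) → Det M ≈ 0#
  Det-alt₀₁ {n} {M} eq = trans
    (sum-cong-≋ (λ j → trans (*-congˡ (*-distribˡ-sum (M zero j) (inner j))) (trans (*-distribˡ-sum (sgn j) (λ k → M zero j * inner j k))
      (sum-cong-≋ (λ k → rearrange j k)))))
    (antisymmetric-sum (suc n) F F-sym)
    where
    inner : Fin (suc (suc n)) → Fin (suc n) → Carrier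
    inner j k = sgn k * (M (suc zero) (punchIn j k) * Det (minor k (minor j M)))
    cofactor : ∀ j k → Dec (j ≡ k) → Carrier
    -- A default value that makes `F` total: the sum only visits `punchIn j k`, which differs from
    -- `j`.
    cofactor j k (yes _)  = 0#
    cofactor j k (no j≢k) = Det (λ i l → M (suc (suc i)) (punchIn j (punchIn (punchOut j≢k) l)))
    F : Fin (suc (suc n)) → Fin (suc (suc n)) → Carrier
    F j k = M zero j * M zero k * cofactor j k (j Fin.≟ k)
    cofactor-sym : ∀ j k d d′ → cofactor j k d ≈ cofactor k j d′
    cofactor-sym j k (yes _)  (yes _)  = refl
    cofactor-sym j k (yes eq) (no neq) = contradiction (≡.sym eq) neq
    cofactor-sym j k (no neq) (yes eq) = contradiction (≡.sym eq) neq
    cofactor-sym j k (no p)   (no q)   = Det-cong (λ i l → reflexive (≡.cong (M (suc (suc i))) (punchIn-comm j k p q l)))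
    F-sym : ∀ j k → F j k ≈ F k j
    F-sym j k = *-cong (*-comm _ _) (cofactor-sym j k (j Fin.≟ k) (k Fin.≟ j))
    cofactor-punchIn : ∀ j k d → cofactor j (punchIn j k) d ≈ Det (minor k (minor j M))
    cofactor-punchIn j k (yes eq) = contradiction (≡.sym eq) (Fin.punchInᵢ≢i j k)
    cofactor-punchIn j k (no neq) = Det-cong (λ i l → reflexive (≡.cong (λ c → M (suc (suc i)) (punchIn j (punchIn c l)))
      (≡.trans (Fin.punchOut-cong j ≡.refl) (Fin.punchOut-punchIn j))))
    rearrange : ∀ j k → sgn j * (M zero j * (sgn k * (M (suc zero) (punchIn j k) * Det (minor k (minor j M)))))
                      ≈ sgn j * (sgn k * F j (punchIn j k))
    rearrange j k = *-congˡ (trans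
      (solve 4 (λ a s b d → a :* (s :* (b :* d)) := s :* (a :* b :* d)) refl _ _ _ _)
      (*-congˡ (*-cong (*-congˡ (sym (eq _))) (sym (cofactor-punchIn j k (j Fin.≟ punchIn j k))))))

  Det-minors-zero : ∀ {n} (M : Mat (suc n)) → (∀ j → Det (minor j M) ≈ 0#) → Det M ≈ 0#
  Det-minors-zero M h = sum-zero {f = laplace M}
    (λ j → trans (*-congˡ (trans (*-congˡ (h j)) (zeroʳ _))) (zeroʳ _))

  -- A swap among the lower rows, whose alternation is already known from the minors, brings the row
  -- in question next to the top row.
  Det-alt-first : ∀ {n} → (∀ {i k : Fin n} → i ≢ k → AlternatingAt Det-multilinear (suc i) (suc k)) →
                  ∀ k → AlternatingAt (Det-multilinear {suc n}) zero (suc k)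
  Det-alt-first {suc n} lower zero M eq = Det-alt₀₁ {M = M} eq
  Det-alt-first {suc n} lower (suc k) M eq = begin
    Det M       ≈⟨ -‿involutive _ ⟨
    - - Det M   ≈⟨ -‿cong (swap Det-multilinear {suc zero} {suc (suc k)} (λ ()) (lower (λ ())) {M} {M′}
                     (λ j → refl)
                     (λ j → reflexive (≡.cong (λ r → r j) (updateAt-updates (suc (suc k)) (updateAt M (suc zero) (λ _ → M (suc (suc k)))))))
                     (λ l l≢1 l≢k j → reflexive (≡.cong (λ r → r j) (M′ₗ l l≢1 l≢k)))) ⟨
    - Det M′    ≈⟨ -‿cong (Det-alt₀₁ {M = M′} eq) ⟩
    - 0#        ≈⟨ -0#≈0# ⟩
    0#          ∎
    where
    M′ : Mat (suc (suc n))
    M′ = M [ suc zero ]≔ M (suc (suc k)) [ suc (suc k) ]≔ M (suc zero)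
    M′ₗ : ∀ l → l ≢ suc zero → l ≢ suc (suc k) → M′ l ≡ M l
    M′ₗ l l≢1 l≢k = ≡.trans (updateAt-minimal l (suc (suc k)) (updateAt M (suc zero) (λ _ → M (suc (suc k)))) l≢k)
                            (updateAt-minimal l (suc zero) M l≢1)

  Det-alt-extend : ∀ {n} → IsAlternating (Det-multilinear {n}) → IsAlternating (Det-multilinear {suc n})
  Det-alt-extend {n} ih {i} {k} = go i k
    where
    lower : ∀ {i k} → i ≢ k → AlternatingAt (Det-multilinear {suc n}) (suc i) (suc k)
    lower i≢k M eq = Det-minors-zero M (λ j → ih i≢k (minor j M) (λ l → eq (punchIn j l)))
    go : ∀ i k → i ≢ k → AlternatingAt (Det-multilinear {suc n}) i k
    go zero    zero    i≢k M eq = contradiction ≡.refl i≢k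
    go zero    (suc k) i≢k      = Det-alt-first lower k
    go (suc i) zero    i≢k M eq = Det-alt-first lower i M (λ j → sym (eq j))
    go (suc i) (suc k) i≢k      = lower (i≢k ∘ ≡.cong suc)

  Det-alt : ∀ {n} → IsAlternating (Det-multilinear {n})
  Det-alt {zero} {()}
  Det-alt {suc n} = Det-alt-extend (Det-alt {n})

  I-minor : ∀ {m} → minor zero (I {suc m}) ≋ I
  I-minor i j = reflexive (𝟙-cong (suc i Fin.≟ suc j) (i Fin.≟ j) Fin.suc-injective (≡.cong suc))

  I-off : ∀ {n} {i j : Fin n} → i ≢ j → I i j ≈ 0#
  I-off {i = i} {j} i≢j = reflexive (𝟙-no (i Fin.≟ j) i≢j)

  Det-I : ∀ {m} → Det (I {m}) ≈ 1#
  Det-I {zero}  = refl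
  Det-I {suc m} = begin
    Det (I {suc m})                      ≈⟨ sum-single zero {laplace (I {suc m})}
                                              (λ j j≢0 → trans (*-congˡ (trans (*-congʳ (I-off (j≢0 ∘ ≡.sym))) (zeroˡ _))) (zeroʳ _)) ⟩
    1# * (1# * Det (minor zero (I {suc m}))) ≈⟨ trans (*-identityˡ _) (*-identityˡ _) ⟩
    Det (minor zero (I {suc m}))         ≈⟨ Det-cong {m} {minor zero I} {I} I-minor ⟩
    Det (I {m})                          ≈⟨ Det-I {m} ⟩
    1#                                   ∎

  -- The difference of the two sides is again multilinear and alternating and vanishes at `I`, so
  -- `vanish` applies. Multiplicativity, transposition and simultaneous permutation are obtained
  -- from this principle by exhibiting a suitable `F`.
  Det-unique : ∀ {n} {F : Mat n → Carrier} (ml : IsMultilinear F) → IsAlternating ml → ∀ M → F M ≈ Det M * F I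
  Det-unique {n} {F} ml alt M = begin
    F M                                            ≈⟨ solve 2 (λ x y → x := (x :+ :- y) :+ y) refl _ _ ⟩
    (F M + - (Det M * F I)) + Det M * F I          ≈⟨ +-congʳ (vanish H-ml H-alt H-I M) ⟩
    0# + Det M * F I                               ≈⟨ +-identityˡ _ ⟩
    Det M * F I                                    ∎
    where
    H : Mat n → Carrier
    H M = F M + - (Det M * F I)
    H-ml : IsMultilinear H
    H-ml = record
      { H-cong = λ h → +-cong (H-cong ml h) (-‿cong (*-congʳ (Det-cong h)))
      ; linear = λ i a off₁ off₂ on → trans
          (+-cong (linear ml i a off₁ off₂ on) (-‿cong (*-congʳ (Det-linear i a off₁ off₂ on))))
          (solve 6 (λ a f₁ f₂ d₁ d₂ c → (a :* f₁ :+ f₂) :+ :- ((a :* d₁ :+ d₂) :* c)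
                     := a :* (f₁ :+ :- (d₁ :* c)) :+ (f₂ :+ :- (d₂ :* c))) refl _ _ _ _ _ _)
      }
    H-alt : IsAlternating H-ml
    H-alt i≢k M eq = trans (+-cong (alt i≢k M eq) (-‿cong (trans (*-congʳ (Det-alt i≢k M eq)) (zeroˡ _))))
                         (-‿inverseʳ 0#)
    H-I : H I ≈ 0#
    H-I = trans (+-congˡ (-‿cong (trans (*-congʳ (Det-I {n})) (*-identityˡ _)))) (-‿inverseʳ _)

-- Multiplicativity, transposition, block matrices and reindexing

module Determinants (R : CommutativeRing 0ℓ 0ℓ) where
  open CommutativeRing R hiding (zero)
  open RingTheory R
  open IsMultilinear
  open Solver using (solve; _:=_; _:+_; _:*_)
  open import Algebra.Properties.Semiring.Sum semiring
  open import Relation.Binary.Reasoning.Setoid setoid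

  infixl 7 _∙_
  _∙_ : ∀ {m n p} → Rows m n → Rows n p → Rows m p
  (A ∙ B) i j = sum (λ k → A i k * B k j)

  ∙-cong : ∀ {m n p} {A A′ : Rows m n} {B B′ : Rows n p} → A ≋ A′ → B ≋ B′ → A ∙ B ≋ A′ ∙ B′
  ∙-cong h g i j = sum-cong-≋ (λ k → *-cong (h i k) (g k j))

  ∙-assoc : ∀ {m n p q} (A : Rows m n) (B : Rows n p) (C : Rows p q) → A ∙ B ∙ C ≋ A ∙ (B ∙ C)
  ∙-assoc A B C i j = begin
    sum (λ l → sum (λ k → A i k * B k l) * C l j)    ≈⟨ sum-cong-≋ (λ l → *-distribʳ-sum (C l j) (λ k → A i k * B k l)) ⟩
    sum (λ l → sum (λ k → A i k * B k l * C l j))    ≈⟨ ∑-comm (λ l k → A i k * B k l * C l j) ⟩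
    sum (λ k → sum (λ l → A i k * B k l * C l j))    ≈⟨ sum-cong-≋ (λ k → sum-cong-≋ (λ l → *-assoc (A i k) (B k l) (C l j))) ⟩
    sum (λ k → sum (λ l → A i k * (B k l * C l j)))  ≈⟨ sum-cong-≋ (λ k → *-distribˡ-sum (A i k) (λ l → B k l * C l j)) ⟨
    sum (λ k → A i k * sum (λ l → B k l * C l j))    ∎

  I-∙ : ∀ {m n} (A : Rows m n) → I ∙ A ≋ A
  I-∙ A i j = sum-δ i (λ k → A k j)

  ∙-I : ∀ {m n} (A : Rows m n) → A ∙ I ≋ A
  ∙-I A i j = sum-δʳ j (A i)

  -- For fixed `B` the left side is multilinear and alternating in the rows of `A`, with value
  -- `Det B` at the identity.
  Det-∙ : ∀ {n} (A B : Mat n) → Det (A ∙ B) ≈ Det A * Det B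
  Det-∙ {n} A B = trans (Det-unique ml alt A) (*-congˡ (Det-cong {M = I ∙ B} (I-∙ B)))
    where
    ml : IsMultilinear (λ M → Det (M ∙ B))
    ml = record
      { H-cong = λ {M} {M′} h → Det-cong {M = M ∙ B} {M′ = M′ ∙ B} (∙-cong {B = B} h (λ _ _ → refl))
      ; linear = λ i {M} {M₁} {M₂} a off₁ off₂ on → Det-linear i {M ∙ B} {M₁ ∙ B} {M₂ ∙ B} a
          (λ k k≢i j → sum-cong-≋ (λ l → *-congʳ (off₁ k k≢i l)))
          (λ k k≢i j → sum-cong-≋ (λ l → *-congʳ (off₂ k k≢i l)))
          (λ j → trans (sum-cong-≋ (λ l → trans (*-congʳ (on l)) (trans (distribʳ _ _ _) (+-congʳ (*-assoc _ _ _)))))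
                       (sum-linear a (λ l → M₁ i l * B l j) (λ l → M₂ i l * B l j)))
      }
    alt : IsAlternating ml
    alt i≢k M eq = Det-alt i≢k (M ∙ B) (λ j → sum-cong-≋ (λ l → *-congʳ (eq l)))

  infix 10 _ᵀ
  _ᵀ : ∀ {m n} → Rows m n → Rows n m
  (M ᵀ) i j = M j i

  Det-linear-column : ∀ {n} (c : Fin n) {M M₁ M₂ : Mat n} a →
    (∀ k → k ≢ c → ∀ i → M i k ≈ M₁ i k) → (∀ k → k ≢ c → ∀ i → M i k ≈ M₂ i k) →
    (∀ i → M i c ≈ a * M₁ i c + M₂ i c) → Det M ≈ a * Det M₁ + Det M₂
  Det-linear-column {suc n} c {M} {M₁} {M₂} a off₁ off₂ on =
    trans (sum-cong-≋ term) (sum-linear a (laplace M₁) (laplace M₂))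
    where
    term : ∀ j → laplace M j ≈ a * laplace M₁ j + laplace M₂ j
    term j with j Fin.≟ c
    ... | yes ≡.refl = trans (*-congˡ (*-congʳ (on zero)))
      (trans (solve 5 (λ s a x y d → s :* ((a :* x :+ y) :* d) := a :* (s :* (x :* d)) :+ s :* (y :* d)) refl
                (sgn j) a (M₁ zero j) (M₂ zero j) (Det (minor j M)))
        (+-cong (*-congˡ (*-congˡ (*-congˡ (Det-cong (λ i k → off₁ _ (Fin.punchInᵢ≢i j k) (suc i))))))
                (*-congˡ (*-congˡ (Det-cong (λ i k → off₂ _ (Fin.punchInᵢ≢i j k) (suc i)))))))
    ... | no j≢c = trans
      (*-congˡ (*-congˡ (Det-linear-column (punchOut j≢c) {minor j M} {minor j M₁} {minor j M₂} a
        (λ k k≢ i → off₁ _ (moved k k≢) (suc i)) (λ k k≢ i → off₂ _ (moved k k≢) (suc i))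
        (λ i → ≡.subst (λ l → M (suc i) l ≈ a * M₁ (suc i) l + M₂ (suc i) l) (≡.sym (Fin.punchIn-punchOut j≢c)) (on (suc i))))))
      (trans (solve 5 (λ s x a d₁ d₂ → s :* (x :* (a :* d₁ :+ d₂)) := a :* (s :* (x :* d₁)) :+ s :* (x :* d₂)) refl
                (sgn j) (M zero j) a _ _)
        (+-cong (*-congˡ (*-congˡ (*-congʳ (off₁ j j≢c zero)))) (*-congˡ (*-congʳ (off₂ j j≢c zero)))))
      where
      moved : ∀ k → k ≢ punchOut j≢c → punchIn j k ≢ c
      moved k k≢ eq = k≢ (Fin.punchIn-injective j k _ (≡.trans eq (≡.sym (Fin.punchIn-punchOut j≢c))))

  -- The matrix `B` overwrites column `d` by column `c` and therefore fixes `M`. No column index is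
  -- sent to `d`, so row `d` of `B` is zero.
  Det-alt-column : ∀ {n} {c d : Fin n} → c ≢ d → (M : Mat n) → (∀ i → M i c ≈ M i d) → Det M ≈ 0#
  Det-alt-column {n} {c} {d} c≢d M eq = begin
    Det M                ≈⟨ Det-cong {M = M ∙ B} {M′ = M} M∙B ⟨
    Det (M ∙ B)          ≈⟨ Det-∙ M B ⟩
    Det M * Det B        ≈⟨ *-congˡ (zero-row Det-multilinear d {B} (λ j → I-off (g≢d j ∘ ≡.sym))) ⟩
    Det M * 0#           ≈⟨ zeroʳ _ ⟩
    0#                   ∎
    where
    g : Fin n → Fin n
    g = updateAt (λ j → j) d (λ _ → c)
    B : Mat n
    B i j = I i (g j)
    g≢d : ∀ j → g j ≢ d
    g≢d j with j Fin.≟ d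
    ... | yes ≡.refl = λ gd≡d → c≢d (≡.trans (≡.sym (updateAt-updates d (λ j → j))) gd≡d)
    ... | no j≢d     = λ gj≡d → j≢d (≡.trans (≡.sym (updateAt-minimal j d (λ j → j) j≢d)) gj≡d)
    M∙B : M ∙ B ≋ M
    M∙B i j with j Fin.≟ d
    ... | yes ≡.refl = trans (sum-δʳ (g d) (M i)) (trans (reflexive (≡.cong (M i) (updateAt-updates d (λ j → j)))) (eq i))
    ... | no j≢d     = trans (sum-δʳ (g j) (M i)) (reflexive (≡.cong (M i) (updateAt-minimal j d (λ j → j) j≢d)))

  Det-ᵀ : ∀ {n} (M : Mat n) → Det (M ᵀ) ≈ Det M
  Det-ᵀ {n} M = trans (Det-unique ml alt M) (trans (*-congˡ (trans (Det-cong {n} {I ᵀ} {I} I-sym) (Det-I {n}))) (*-identityʳ _))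
    where
    I-sym : I ᵀ ≋ I
    I-sym i j = reflexive (𝟙-cong (j Fin.≟ i) (i Fin.≟ j) ≡.sym ≡.sym)
    ml : IsMultilinear (λ M → Det (M ᵀ))
    ml = record
      { H-cong = λ {A} {B} h → Det-cong {M = A ᵀ} {M′ = B ᵀ} (λ i j → h j i)
      ; linear = λ i {A} {B} {C} a off₁ off₂ on → Det-linear-column i {A ᵀ} {B ᵀ} {C ᵀ} a off₁ off₂ on
      }
    alt : IsAlternating ml
    alt i≢k M eq = Det-alt-column i≢k (M ᵀ) eq

  punchIn-↑ˡ : ∀ {a} d (j : Fin (suc a)) k → punchIn (j ↑ˡ d) (k ↑ˡ d) ≡ punchIn j k ↑ˡ d
  punchIn-↑ˡ d zero    k       = ≡.refl
  punchIn-↑ˡ d (suc j) zero    = ≡.refl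
  punchIn-↑ˡ d (suc j) (suc k) = ≡.cong suc (punchIn-↑ˡ d j k)

  punchIn-↑ʳ : ∀ {a} d (j : Fin (suc a)) (k : Fin d) → punchIn (j ↑ˡ d) (a ↑ʳ k) ≡ suc a ↑ʳ k
  punchIn-↑ʳ         d zero    k = ≡.refl
  punchIn-↑ʳ {suc a} d (suc j) k = ≡.cong suc (punchIn-↑ʳ d j k)

  Det-block-lower : ∀ {a d} (A : Mat a) (D : Mat d) (M : Mat (a ℕ.+ d)) →
    (∀ i j → M (i ↑ˡ d) (j ↑ˡ d) ≈ A i j) → (∀ i j → M (i ↑ˡ d) (a ↑ʳ j) ≈ 0#) →
    (∀ i j → M (a ↑ʳ i) (a ↑ʳ j) ≈ D i j) → Det M ≈ Det A * Det D
  Det-block-lower {zero}  {d} A D M hA h0 hD = trans (Det-cong {M = M} {M′ = D} hD) (sym (*-identityˡ _))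
  Det-block-lower {suc a} {d} A D M hA h0 hD = begin
    sum T                                                        ≈⟨ sum-+ (suc a) T ⟩
    sum (λ j → T (j ↑ˡ d)) + sum (λ j → T (suc a ↑ʳ j))          ≈⟨ +-cong (sum-cong-≋ left) (sum-zero right) ⟩
    sum (λ j → laplace A j * Det D) + 0# ≈⟨ +-identityʳ _ ⟩
    sum (λ j → laplace A j * Det D)     ≈⟨ *-distribʳ-sum (Det D) (laplace A) ⟨
    Det A * Det D                                                ∎
    where
    T = laplace M
    right : ∀ j → T (suc a ↑ʳ j) ≈ 0#
    right j = trans (*-congˡ (trans (*-congʳ (h0 zero j)) (zeroˡ _))) (zeroʳ _)
    left : ∀ j → T (j ↑ˡ d) ≈ laplace A j * Det D
    left j = trans
      (*-cong (reflexive (≡.cong (λ k → (- 1#) ^ k) (Fin.toℕ-↑ˡ j d)))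
        (*-cong (hA zero j) (Det-block-lower (minor j A) D (minor (j ↑ˡ d) M)
          (λ i k → trans (reflexive (≡.cong (M (suc (i ↑ˡ d))) (punchIn-↑ˡ d j k))) (hA (suc i) (punchIn j k)))
          (λ i k → trans (reflexive (≡.cong (M (suc (i ↑ˡ d))) (punchIn-↑ʳ d j k))) (h0 (suc i) k))
          (λ i k → trans (reflexive (≡.cong (M (suc (a ↑ʳ i))) (punchIn-↑ʳ d j k))) (hD i k)))))
      (solve 4 (λ s x p q → s :* (x :* (p :* q)) := s :* (x :* p) :* q) refl _ _ _ _)
      where open import Algebra.Properties.Semiring.Exp semiring using (_^_)

  Det-block-upper : ∀ {a d} (A : Mat a) (D : Mat d) (M : Mat (a ℕ.+ d)) →
    (∀ i j → M (i ↑ˡ d) (j ↑ˡ d) ≈ A i j) → (∀ i j → M (a ↑ʳ i) (j ↑ˡ d) ≈ 0#) →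
    (∀ i j → M (a ↑ʳ i) (a ↑ʳ j) ≈ D i j) → Det M ≈ Det A * Det D
  Det-block-upper A D M hA h0 hD = begin
    Det M                   ≈⟨ Det-ᵀ M ⟨
    Det (M ᵀ)               ≈⟨ Det-block-lower (A ᵀ) (D ᵀ) (M ᵀ) (λ i j → hA j i) (λ i j → h0 j i) (λ i j → hD j i) ⟩
    Det (A ᵀ) * Det (D ᵀ)   ≈⟨ *-cong (Det-ᵀ A) (Det-ᵀ D) ⟩
    Det A * Det D           ∎

  -- Permuting rows and columns alike fixes the identity matrix, so the constant in `Det-unique` is
  -- 1.
  Det-reindex : ∀ {a b} (φ : Fin a ↔ Fin b) (M : Mat b) →
                Det (λ i j → M (Inverse.to φ i) (Inverse.to φ j)) ≈ Det M
  Det-reindex φ M with Perm.↔⇒≡ φ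
  Det-reindex {n} φ M | ≡.refl = trans (Det-unique ml alt M)
    (trans (*-congˡ (trans (Det-cong {M = λ i j → I (to i) (to j)} {M′ = I} I-to) (Det-I {n}))) (*-identityʳ _))
    where
    open Inverse φ using (to; from; strictlyInverseˡ; strictlyInverseʳ)
    to-injective : ∀ {i j} → to i ≡ to j → i ≡ j
    to-injective = Injection.injective (↔⇒↣ φ)
    I-to : ∀ i j → I (to i) (to j) ≈ I i j
    I-to i j = reflexive (𝟙-cong (to i Fin.≟ to j) (i Fin.≟ j) to-injective (≡.cong to))
    pull : Mat n → Mat n
    pull M i j = M (to i) (to j)
    away : ∀ {k i} → k ≢ from i → to k ≢ i
    away k≢ eq = k≢ (≡.trans (≡.sym (strictlyInverseʳ _)) (≡.cong from eq))
    ml : IsMultilinear (λ M → Det (pull M))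
    ml = record
      { H-cong = λ {A} {B} h → Det-cong {M = pull A} {M′ = pull B} (λ i j → h _ _)
      ; linear = λ i {A} {B} {C} a off₁ off₂ on → Det-linear (from i) {pull A} {pull B} {pull C} a
          (λ k k≢ j → off₁ (to k) (away k≢) _) (λ k k≢ j → off₂ (to k) (away k≢) _)
          (λ j → ≡.subst (λ l → A l (to j) ≈ a * B l (to j) + C l (to j)) (≡.sym (strictlyInverseˡ i)) (on (to j)))
      }
    alt : IsAlternating ml
    alt {i} {k} i≢k M eq = Det-alt {i = from i} {k = from k}
      (λ e → i≢k (≡.trans (≡.sym (strictlyInverseˡ i)) (≡.trans (≡.cong to e) (strictlyInverseˡ k)))) (pull M)
      (λ j → ≡.subst₂ (λ x y → M x (to j) ≈ M y (to j)) (≡.sym (strictlyInverseˡ i)) (≡.sym (strictlyInverseˡ k)) (eq (to j)))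

-- Determinants of rooted functional graphs

iter : ∀ {A : Set} → (A → A) → ℕ → A → A
iter p zero    v = v
iter p (suc k) v = iter p k (p v)

iter-+ : ∀ {A : Set} (p : A → A) j k v → iter p (j ℕ.+ k) v ≡ iter p k (iter p j v)
iter-+ p zero    k v = ≡.refl
iter-+ p (suc j) k v = iter-+ p j k (p v)

iter-fixed : ∀ {A : Set} (p : A → A) {r} → p r ≡ r → ∀ k → iter p k r ≡ r
iter-fixed p fix zero    = ≡.refl
iter-fixed p fix (suc k) = ≡.trans (≡.cong (iter p k) fix) (iter-fixed p fix k)

module Height {N} (p : Fin N → Fin N) (r : Fin N) where

  -- The first argument is fuel. Once `iter p k v` is `r`, the count is the true number of steps to
  -- the first visit of `r`, and more fuel does not change it.
  steps : ℕ → Fin N → ℕ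
  steps zero    v = 0
  steps (suc k) v with v Fin.≟ r
  ... | yes _ = 0
  ... | no  _ = suc (steps k (p v))

  steps-stable : ∀ k v → iter p k v ≡ r → steps (suc k) v ≡ steps k v
  steps-stable zero v eq with v Fin.≟ r
  ... | yes _ = ≡.refl
  ... | no v≢r = contradiction eq v≢r
  steps-stable (suc k) v eq with v Fin.≟ r
  ... | yes _ = ≡.refl
  ... | no _  = ≡.cong suc (steps-stable k (p v) eq)

  height : Fin N → ℕ
  height = steps N

  height-step : (∀ v → iter p N v ≡ r) → ∀ v → v ≢ r → height v ≡ suc (height (p v))
  height-step reach v v≢r = go N (reach v) v≢r
    where
    go : ∀ k → iter p k v ≡ r → v ≢ r → steps k v ≡ suc (steps k (p v))
    go zero    eq v≢r = contradiction eq v≢r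
    go (suc k) eq v≢r with v Fin.≟ r
    ... | yes v≡r = contradiction v≡r v≢r
    ... | no  _   = ≡.cong suc (≡.sym (steps-stable k (p v) eq))

-- Choosing for every vertex v either an edge leaving v (suc a) or to be a root (zero).
module Choice {N m} (o t : Fin m → Fin N) where

  target : Fin N → Fin (suc m) → Fin N
  target v zero    = v
  target v (suc a) = t a

  parent : (Fin N → Fin (suc m)) → Fin N → Fin N
  parent f v = target v (f v)

  -- `parent` fixes the root, so reaching it after exactly `N` steps covers every smaller depth as
  -- well.
  Arborescence : Fin N → (Fin N → Fin (suc m)) → Set
  Arborescence r f = f r ≡ zero × (∀ v → v ≢ r → Σ[ a ∈ Fin m ] f v ≡ suc a × o a ≡ v) ×
                     (∀ v → iter (parent f) N v ≡ r)

  arborescence? : ∀ r f → Dec (Arborescence r f)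
  arborescence? r f = (f r Fin.≟ zero) ×-dec
    Fin.all? (λ v → ¬? (v Fin.≟ r) →-dec Fin.any? (λ a → (f v Fin.≟ suc a) ×-dec (o a Fin.≟ v))) ×-dec
    Fin.all? (λ v → iter (parent f) N v Fin.≟ r)

  root-unique : ∀ {r f v} → Arborescence r f → f v ≡ zero → v ≡ r
  root-unique {r} {f} {v} (_ , edge , _) fv≡0 = decidable-stable (v Fin.≟ r) λ v≢r →
    let _ , fv≡a , _ = edge v v≢r in Fin.0≢1+n (≡.trans (≡.sym fv≡0) fv≡a)

-- Enumerations and multilinear expansion

choices : ∀ C N → List (Vec (Fin C) N)
choices C zero    = [] ∷ []
choices C (suc N) = cartesianProductWith _∷_ (allFin C) (choices C N)

choices-unique : ∀ C N → Unique (choices C N)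
choices-unique C zero    = [] ∷ []
choices-unique C (suc N) = Unique.cartesianProductWith⁺ _∷_ Vec.∷-injective (Unique.allFin⁺ C) (choices-unique C N)

∈-choices : ∀ {C N} (f : Vec (Fin C) N) → f ∈ₗ choices C N
∈-choices []      = here ≡.refl
∈-choices (c ∷ f) = ∈-cartesianProductWith⁺ _∷_ (∈-allFin c) (∈-choices f)

subsets-unique : ∀ n → Unique (subsets n)
subsets-unique zero    = [] ∷ []
subsets-unique (suc n) = Unique.++⁺ (Unique.map⁺ Vec.∷-injectiveʳ (subsets-unique n)) (Unique.map⁺ Vec.∷-injectiveʳ (subsets-unique n))
  λ (p , q) → let _ , _ , eq = ∈-map⁻ _ p ; _ , _ , eq′ = ∈-map⁻ _ q in
    contradiction (Vec.∷-injectiveˡ (≡.trans (≡.sym eq) eq′)) λ ()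

∈-subsets : ∀ {n} (S : Subset n) → S ∈ₗ subsets n
∈-subsets []            = here ≡.refl
∈-subsets (outside ∷ S) = ∈-++⁺ˡ (∈-map⁺ _ (∈-subsets S))
∈-subsets {suc n} (inside ∷ S) = ∈-++⁺ʳ (List.map (outside ∷_) (subsets n)) (∈-map⁺ _ (∈-subsets S))

module Expansion (R : CommutativeRing 0ℓ 0ℓ) where
  open CommutativeRing R hiding (zero)
  open RingTheory R
  open IsMultilinear
  open Solver using (solve; _:=_; _:+_)
  open import Algebra.Properties.Semiring.Sum semiring
  open import Relation.Binary.Reasoning.Setoid setoid

  sumᴸ : ∀ {X : Set} → List X → (X → Carrier) → Carrier
  sumᴸ []       F = 0#
  sumᴸ (x ∷ xs) F = F x + sumᴸ xs F

  sumᴸ-cong : ∀ {X : Set} (xs : List X) {F G : X → Carrier} → (∀ x → F x ≈ G x) → sumᴸ xs F ≈ sumᴸ xs G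
  sumᴸ-cong []       h = refl
  sumᴸ-cong (x ∷ xs) h = +-cong (h x) (sumᴸ-cong xs h)

  sumᴸ-++ : ∀ {X : Set} (xs ys : List X) F → sumᴸ (xs ++ ys) F ≈ sumᴸ xs F + sumᴸ ys F
  sumᴸ-++ []       ys F = sym (+-identityˡ _)
  sumᴸ-++ (x ∷ xs) ys F = trans (+-congˡ (sumᴸ-++ xs ys F)) (sym (+-assoc _ _ _))

  sumᴸ-map : ∀ {X Y : Set} (g : X → Y) xs F → sumᴸ (List.map g xs) F ≈ sumᴸ xs (F ∘ g)
  sumᴸ-map g []       F = refl
  sumᴸ-map g (x ∷ xs) F = +-congˡ (sumᴸ-map g xs F)

  sumᴸ-product : ∀ {X Y Z : Set} {n} (g : X → Y → Z) (h : Fin n → X) ys F →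
                 sumᴸ (cartesianProductWith g (List.tabulate h) ys) F ≈ sum (λ i → sumᴸ ys (F ∘ g (h i)))
  sumᴸ-product {n = zero}  g h ys F = refl
  sumᴸ-product {n = suc n} g h ys F = trans (sumᴸ-++ (List.map (g (h zero)) ys) _ F)
    (+-cong (sumᴸ-map (g (h zero)) ys F) (sumᴸ-product g (h ∘ suc) ys F))

  sumᴸ-sum : ∀ {X : Set} {n} (xs : List X) (F : X → Fin n → Carrier) →
             sumᴸ xs (λ x → sum (F x)) ≈ sum (λ i → sumᴸ xs (λ x → F x i))
  sumᴸ-sum {n = n} []       F = sym (sum-replicate-zero n)
  sumᴸ-sum         (x ∷ xs) F = trans (+-congˡ (sumᴸ-sum xs F)) (sym (∑-distrib-+ (F x) (λ i → sumᴸ xs (λ x → F x i))))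

  sumᴸ-*ʳ : ∀ {X : Set} (xs : List X) F a → sumᴸ xs (λ x → F x * a) ≈ sumᴸ xs F * a
  sumᴸ-*ʳ []       F a = sym (zeroˡ a)
  sumᴸ-*ʳ (x ∷ xs) F a = trans (+-congˡ (sumᴸ-*ʳ xs F a)) (sym (distribʳ a (F x) (sumᴸ xs F)))

  sumᴸ-count : ∀ {X : Set} {P : X → Set} (P? : Decidable P) xs →
               sumᴸ xs (λ x → 𝟙 (P? x)) ≈ ι (+ length (filter P? xs))
  sumᴸ-count P? []       = refl
  sumᴸ-count P? (x ∷ xs) with P? x
  ... | yes _ = +-congˡ (sumᴸ-count P? xs)
  ... | no  _ = trans (+-identityˡ _) (sumᴸ-count P? xs)

  sumᴸ-comm : ∀ {X Y : Set} (xs : List X) (ys : List Y) (F : X → Y → Carrier) →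
              sumᴸ xs (λ x → sumᴸ ys (F x)) ≈ sumᴸ ys (λ y → sumᴸ xs (λ x → F x y))
  sumᴸ-comm []       ys F = sym (zeros ys)
    where
    zeros : ∀ {Y : Set} (ys : List Y) → sumᴸ ys (λ _ → 0#) ≈ 0#
    zeros []       = refl
    zeros (y ∷ ys) = trans (+-identityˡ _) (zeros ys)
  sumᴸ-comm (x ∷ xs) ys F = trans (+-congˡ (sumᴸ-comm xs ys F)) (sym (sumᴸ-+ ys (F x) (λ y → sumᴸ xs (λ x → F x y))))
    where
    sumᴸ-+ : ∀ {Y : Set} (ys : List Y) F G → sumᴸ ys (λ y → F y + G y) ≈ sumᴸ ys F + sumᴸ ys G
    sumᴸ-+ []       F G = sym (+-identityˡ 0#)
    sumᴸ-+ (y ∷ ys) F G = trans (+-congˡ (sumᴸ-+ ys F G))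
      (solve 4 (λ a b c d → (a :+ b) :+ (c :+ d) := (a :+ c) :+ (b :+ d)) refl (F y) (G y) (sumᴸ ys F) (sumᴸ ys G))

  sumᴸ-none : ∀ {X : Set} {P : X → Set} (P? : Decidable P) xs → All (¬_ ∘ P) xs → sumᴸ xs (λ x → 𝟙 (P? x)) ≈ 0#
  sumᴸ-none P? []       []         = refl
  sumᴸ-none P? (x ∷ xs) (¬p ∷ ¬ps) = trans (+-cong (reflexive (𝟙-no (P? x) ¬p)) (sumᴸ-none P? xs ¬ps)) (+-identityˡ 0#)

  sumᴸ-unique : ∀ {X : Set} {P : X → Set} (P? : Decidable P) {xs x} → Unique xs → x ∈ₗ xs → P x →
                (∀ y → P y → y ≡ x) → sumᴸ xs (λ x → 𝟙 (P? x)) ≈ 1#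
  sumᴸ-unique P? {x ∷ xs} (x∉ ∷ _) (here ≡.refl) p uniq = trans
    (+-cong (reflexive (𝟙-yes (P? x) p)) (sumᴸ-none P? xs (All.map (λ x≢y q → x≢y (≡.sym (uniq _ q))) x∉)))
    (+-identityʳ 1#)
  sumᴸ-unique P? {x′ ∷ xs} {x} (x′∉ ∷ u) (there x∈) p uniq = trans
    (+-cong (reflexive (𝟙-no (P? x′) λ q → All.lookup x′∉ x∈ (uniq x′ q))) (sumᴸ-unique P? u x∈ p uniq))
    (+-identityˡ 1#)

  -- Double counting of the pairs `(x , y)` with `P x` and `Φ x ≡ y`: each `x` in `P` lies in
  -- exactly one such pair, and so does each `y` in `Q`.
  sumᴸ-bijection : ∀ {X Y : Set} {P : X → Set} {Q : Y → Set} (P? : Decidable P) (Q? : Decidable Q)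
    (_≟ᵧ_ : DecidableEquality Y) {xs ys} → Unique xs → (∀ x → x ∈ₗ xs) → Unique ys → (∀ y → y ∈ₗ ys) →
    (Φ : X → Y) → (∀ x → P x → Q (Φ x)) → (∀ y → Q y → ∃ λ x → P x × Φ x ≡ y) →
    (∀ x x′ → P x → P x′ → Φ x ≡ Φ x′ → x ≡ x′) →
    sumᴸ xs (λ x → 𝟙 (P? x)) ≈ sumᴸ ys (λ y → 𝟙 (Q? y))
  sumᴸ-bijection {P = P} {Q} P? Q? _≟ᵧ_ {xs} {ys} uxs ∈xs uys ∈ys Φ fwd bwd inj = begin
    sumᴸ xs (λ x → 𝟙 (P? x))                                     ≈⟨ sumᴸ-cong xs (λ x → sym (row x)) ⟩
    sumᴸ xs (λ x → sumᴸ ys (λ y → 𝟙 (P? x ×-dec (Φ x ≟ᵧ y))))    ≈⟨ sumᴸ-comm xs ys (λ x y → 𝟙 (P? x ×-dec (Φ x ≟ᵧ y))) ⟩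
    sumᴸ ys (λ y → sumᴸ xs (λ x → 𝟙 (P? x ×-dec (Φ x ≟ᵧ y))))    ≈⟨ sumᴸ-cong ys column ⟩
    sumᴸ ys (λ y → 𝟙 (Q? y))                                     ∎
    where
    row : ∀ x → sumᴸ ys (λ y → 𝟙 (P? x ×-dec (Φ x ≟ᵧ y))) ≈ 𝟙 (P? x)
    row x with P? x
    ... | yes p = sumᴸ-unique (λ y → yes p ×-dec (Φ x ≟ᵧ y)) uys (∈ys (Φ x)) (p , ≡.refl) (λ y (_ , eq) → ≡.sym eq)
    ... | no ¬p = sumᴸ-none (λ y → no ¬p ×-dec (Φ x ≟ᵧ y)) ys (All.universal (λ y (p , _) → ¬p p) ys)
    column : ∀ y → sumᴸ xs (λ x → 𝟙 (P? x ×-dec (Φ x ≟ᵧ y))) ≈ 𝟙 (Q? y)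
    column y with Q? y
    ... | yes q = let x , p , eq = bwd y q in
      sumᴸ-unique (λ x → P? x ×-dec (Φ x ≟ᵧ y)) uxs (∈xs x) (p , eq) (λ x′ (p′ , eq′) → inj x′ x p′ p (≡.trans eq′ (≡.sym eq)))
    ... | no ¬q = sumᴸ-none (λ x → P? x ×-dec (Φ x ≟ᵧ y)) xs (All.universal (λ x (p , eq) → ¬q (≡.subst Q eq (fwd x p))) xs)

  sum-ι : ∀ n k → sum {n} (λ _ → ι (+ k)) ≈ ι (+ (n ℕ.* k))
  sum-ι zero    k = refl
  sum-ι (suc n) k = trans (+-congˡ (sum-ι n k)) (sym (trans (reflexive (≡.cong ι (ℤ.pos-+ k (n ℕ.* k)))) (ι-+ (+ k) (+ (n ℕ.* k)))))
    where import Data.Integer.Properties as ℤ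

  expand : ∀ {n p C} {H : Rows n p → Carrier} → IsMultilinear H → (r : Fin n → Fin C → Fin p → Carrier) →
           H (λ i j → sum (λ c → r i c j)) ≈ sumᴸ (choices C n) (λ f → H (λ i → r i (lookup f i)))
  expand {zero}          {H = H} ml r = trans (H-cong ml (λ ())) (sym (+-identityʳ _))
  expand {suc n} {p} {C} {H}     ml r = begin
    H (λ i j → sum (λ c → r i c j))
      ≈⟨ sum-row ml zero (λ _ → 1#) (λ c → r zero c Vector.∷ rest) _
           (λ { c zero 0≢0 j → contradiction ≡.refl 0≢0 ; c (suc k) _ j → refl })
           (λ j → sum-cong-≋ (λ c → sym (*-identityˡ (r zero c j)))) ⟩
    sum (λ c → 1# * H (r zero c Vector.∷ rest))
      ≈⟨ sum-cong-≋ (λ c → trans (*-identityˡ _) (expand (ml′ c) (r ∘ suc))) ⟩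
    sum (λ c → sumᴸ (choices C n) (λ f → H (r zero c Vector.∷ (λ i → r (suc i) (lookup f i)))))
      ≈⟨ sum-cong-≋ (λ c → sumᴸ-cong (choices C n) (same c)) ⟩
    sum (λ c → sumᴸ (choices C n) (G ∘ (c ∷_)))
      ≈⟨ sumᴸ-product _∷_ (λ c → c) (choices C n) G ⟨
    sumᴸ (choices C (suc n)) G ∎
    where
    G : Vec (Fin C) (suc n) → Carrier
    G f = H (λ i → r i (lookup f i))
    same : ∀ c f → H (r zero c Vector.∷ (λ i → r (suc i) (lookup f i))) ≈ G (c ∷ f)
    same c f = H-cong ml (λ { zero j → refl ; (suc i) j → refl })
    rest : Rows n p
    rest i j = sum (λ c → r (suc i) c j)
    ml′ : ∀ c → IsMultilinear (λ M → H (r zero c Vector.∷ M))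
    ml′ c = record
      { H-cong = λ h → H-cong ml (λ { zero j → refl ; (suc i) j → h i j })
      ; linear = λ i a off₁ off₂ on → linear ml (suc i) a
          (λ { zero _ j → refl ; (suc k) k≢i j → off₁ k (k≢i ∘ ≡.cong suc) j })
          (λ { zero _ j → refl ; (suc k) k≢i j → off₂ k (k≢i ∘ ≡.cong suc) j }) on
      }

-- Row operations along cycles and trees

module FunctionalGraph (R : CommutativeRing 0ℓ 0ℓ) where
  open CommutativeRing R hiding (zero)
  open RingTheory R
  open IsMultilinear
  open import Relation.Binary.Reasoning.Setoid setoid

  Det-scale-row : ∀ {n} (i : Fin n) (M M₁ : Mat n) a → (∀ k → k ≢ i → ∀ j → M k j ≈ M₁ k j) →
                  (∀ j → M i j ≈ a * M₁ i j) → Det M ≈ a * Det M₁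
  Det-scale-row i M M₁ a off on = trans
    (Det-linear i {M} {M₁} {M [ i ]≔ λ _ → 0#} a off
      (λ k k≢i j → reflexive (≡.sym ([]≔-other M i (λ _ → 0#) k k≢i j)))
      (λ j → trans (on j) (sym (trans (+-congˡ (reflexive ([]≔-same M i (λ _ → 0#) j))) (+-identityʳ _)))))
    (trans (+-congˡ (zero-row Det-multilinear i {M [ i ]≔ λ _ → 0#} (λ j → reflexive ([]≔-same M i (λ _ → 0#) j)))) (+-identityʳ _))

  repeated-row : ∀ {N} (M : Mat N) v w x → w ≢ v → (∀ j → x j ≈ M w j) → Det (M [ v ]≔ x) ≈ 0#
  repeated-row M v w x w≢v eq = Det-alt {i = v} {k = w} (w≢v ∘ ≡.sym) (M [ v ]≔ x)
    (λ j → trans (reflexive ([]≔-same M v x j)) (trans (eq j) (reflexive (≡.sym ([]≔-other M v x w w≢v j)))))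

  []≔-id : ∀ {N} (M : Mat N) v → M [ v ]≔ M v ≋ M
  []≔-id M v i j with i Fin.≟ v
  ... | yes ≡.refl = reflexive ([]≔-same M v (M v) j)
  ... | no i≢v     = reflexive ([]≔-other M v (M v) i i≢v j)

  module _ {N} (p : Fin N → Fin N) where

    -- An edge row is the unit row of `w` minus that of `p w`. The equation is solved for `I w`,
    -- which makes it an instance of linearity with coefficient `1#`.
    UnitRow EdgeRow : Mat N → Fin N → Set
    UnitRow M w = ∀ j → M w j ≈ I w j
    EdgeRow M w = ∀ j → I w j ≈ 1# * M w j + I (p w) j

    edge-split : ∀ {M w} v → EdgeRow M w →
      Det (M [ v ]≔ I w) ≈ 1# * Det (M [ v ]≔ M w) + Det (M [ v ]≔ I (p w))
    edge-split {M} {w} v edge = Det-linear v {M [ v ]≔ I w} {M [ v ]≔ M w} {M [ v ]≔ I (p w)} 1#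
      (λ k k≢v j → reflexive (≡.trans ([]≔-other M v _ k k≢v j) (≡.sym ([]≔-other M v _ k k≢v j))))
      (λ k k≢v j → reflexive (≡.trans ([]≔-other M v _ k k≢v j) (≡.sym ([]≔-other M v _ k k≢v j))))
      (λ j → trans (reflexive ([]≔-same M v _ j)) (trans (edge j)
        (+-cong (*-congˡ (reflexive (≡.sym ([]≔-same M v _ j)))) (reflexive (≡.sym ([]≔-same M v _ j))))))

    -- A row operation: row `w` is the difference of the two unit rows and is still present in the
    -- matrix, because `w` is not the replaced index.
    edge-step : ∀ {M w} v → w ≢ v → EdgeRow M w → Det (M [ v ]≔ I w) ≈ Det (M [ v ]≔ I (p w))
    edge-step {M} {w} v w≢v edge = trans (edge-split {M} {w} v edge)
      (trans (+-congʳ (trans (*-identityˡ _) (repeated-row M v w (M w) w≢v (λ _ → refl)))) (+-identityˡ _))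

    -- Splitting the unit row of `v` produces `Det M` plus a determinant with the unit row of `p v`
    -- in place `v`. Moving that unit row once around the cycle brings it back to `v`, and the two
    -- modified determinants cancel.
    Det-cycle : ∀ {M v} L → iter p (suc L) v ≡ v → (∀ k → k ℕ.≤ L → EdgeRow M (iter p k v)) → Det M ≈ 0#
    Det-cycle {M} {v} L closed edge = begin
      Det M                                         ≈⟨ solve 2 (λ x y → x := (con (+ 1) :* x :+ y) :+ :- y) refl (Det M) (Det (M [ v ]≔ I v)) ⟩
      (ι (+ 1) * Det M + Det (M [ v ]≔ I v)) + - Det (M [ v ]≔ I v) ≈⟨ +-congʳ split ⟩
      Det (M [ v ]≔ I v) + - Det (M [ v ]≔ I v)     ≈⟨ -‿inverseʳ _ ⟩
      0#                                            ∎
      where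
      open Solver using (solve; _:=_; _:+_; _:*_; :-_; con)
      around : ∀ d w → iter p d w ≡ v → (∀ k → k ℕ.< d → EdgeRow M (iter p k w)) → Det (M [ v ]≔ I w) ≈ Det (M [ v ]≔ I v)
      around zero    w ≡.refl edge = refl
      around (suc d) w eq     edge with w Fin.≟ v
      -- The orbit may return to `v` before `d` steps; row `v` then already has the wanted form.
      ... | yes ≡.refl = refl
      ... | no w≢v     = trans (edge-step {M} {w} v w≢v (edge 0 ℕ.z<s)) (around d (p w) eq (λ k k<d → edge (suc k) (ℕ.s<s k<d)))
      split : ι (+ 1) * Det M + Det (M [ v ]≔ I v) ≈ Det (M [ v ]≔ I v)
      split = sym (trans (edge-split {M} {v} v (edge 0 ℕ.z≤n))
        (+-cong (*-cong (sym ι-1) (Det-cong {M = M [ v ]≔ M v} {M′ = M} ([]≔-id M v)))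
                (around L (p v) closed (λ k k<L → edge (suc k) k<L))))

    module _ (r : Fin N) (height : Fin N → ℕ) (descends : ∀ v → v ≢ r → height (p v) ℕ.< height v) where

      -- The unit row of `u` is pushed along `p` until it meets a row that is itself a unit row, at
      -- the latest that of `r`, and two rows agree. Heights below that of `v` keep the walk away
      -- from the replaced row; `h` is the fuel.
      Det-ancestor : ∀ M v → (∀ w → UnitRow M w ⊎ EdgeRow M w) → UnitRow M r →
                     ∀ h u → height u ℕ.≤ h → h ℕ.< height v → Det (M [ v ]≔ I u) ≈ 0#
      Det-ancestor M v rows unit-r h u u≤h h<v with u Fin.≟ r
      ... | yes ≡.refl = repeated-row M v r (I r) (λ { ≡.refl → ℕ.<⇒≱ h<v u≤h }) (λ j → sym (unit-r j))
      ... | no u≢r with rows u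
      ...   | inj₁ unit = repeated-row M v u (I u) (λ { ≡.refl → ℕ.<⇒≱ h<v u≤h }) (λ j → sym (unit j))
      ...   | inj₂ edge = trans (edge-step {M} {u} v (λ { ≡.refl → ℕ.<⇒≱ h<v u≤h }) edge)
                            (next h (ℕ.≤-trans (descends u u≢r) u≤h) h<v)
        where
        next : ∀ h → height (p u) ℕ.< h → h ℕ.< height v → Det (M [ v ]≔ I (p u)) ≈ 0#
        next (suc h) pu<1+h 1+h<v = Det-ancestor M v rows unit-r h (p u) (ℕ.s≤s⁻¹ pu<1+h) (ℕ.<-trans (ℕ.n<1+n h) 1+h<v)

      -- The rows are turned into unit rows one at a time. The change for row `v` is a determinant
      -- with the unit row of `p v` in place `v`, which is zero by `Det-ancestor`.
      Det-tree-from : ∀ k → k ℕ.≤ N → ∀ M → (∀ w → UnitRow M w ⊎ EdgeRow M w) → UnitRow M r →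
                      (∀ w → k ℕ.≤ toℕ w → UnitRow M w) → Det M ≈ 1#
      Det-tree-from zero    _   M rows unit-r units =
        trans (Det-cong {M = M} {M′ = I} (λ i j → units i ℕ.z≤n j)) (Det-I {N})
      Det-tree-from (suc k) k<N M rows unit-r units = trans same
        (Det-tree-from k (ℕ.<⇒≤ k<N) M′ (λ w → [ (λ u → inj₁ (unit′ w u)) , (λ e → edge′ w e) ]′ (rows w)) (unit′ r unit-r) units′)
        where
        v : Fin N
        v = fromℕ< k<N
        M′ : Mat N
        M′ = M [ v ]≔ I v
        unit-v : UnitRow M′ v
        unit-v j = reflexive ([]≔-same M v (I v) j)
        unit′ : ∀ w → UnitRow M w → UnitRow M′ w
        unit′ w unit j with w Fin.≟ v
        ... | yes ≡.refl = unit-v j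
        ... | no w≢v     = trans (reflexive ([]≔-other M v (I v) w w≢v j)) (unit j)
        edge′ : ∀ w → EdgeRow M w → UnitRow M′ w ⊎ EdgeRow M′ w
        edge′ w edge with w Fin.≟ v
        ... | yes ≡.refl = inj₁ unit-v
        ... | no w≢v     = inj₂ (λ j → trans (edge j) (+-congʳ (*-congˡ (sym (reflexive ([]≔-other M v (I v) w w≢v j))))))
        units′ : ∀ w → k ℕ.≤ toℕ w → UnitRow M′ w
        units′ w k≤w with w Fin.≟ v
        ... | yes ≡.refl = unit-v
        ... | no w≢v     = unit′ w (units w (ℕ.≤∧≢⇒< k≤w
              (λ k≡w → w≢v (Fin.toℕ-injective (≡.trans (≡.sym k≡w) (≡.sym (Fin.toℕ-fromℕ< k<N)))))))
        same : Det M ≈ Det M′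
        same with v Fin.≟ r
        ... | yes v≡r = Det-cong {M = M} {M′ = M′} (λ i j → unchanged i j)
          where
          unchanged : M ≋ M′
          unchanged i j with i Fin.≟ v
          ... | yes ≡.refl = trans (≡.subst (UnitRow M) (≡.sym v≡r) unit-r j) (sym (unit-v j))
          ... | no i≢v     = reflexive (≡.sym ([]≔-other M v (I v) i i≢v j))
        ... | no v≢r with rows v
        ...   | inj₁ unit = sym (Det-cong {M = M′} {M′ = M} (λ i j → trans (Det-row i j) ([]≔-id M v i j)))
          where
          Det-row : M′ ≋ M [ v ]≔ M v
          Det-row i j with i Fin.≟ v
          ... | yes ≡.refl = trans (unit-v j) (trans (sym (unit j)) (reflexive (≡.sym ([]≔-same M v (M v) j))))
          ... | no i≢v     = reflexive (≡.trans ([]≔-other M v (I v) i i≢v j) (≡.sym ([]≔-other M v (M v) i i≢v j)))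
        ...   | inj₂ edge = sym (trans (edge-split {M} {v} v edge)
                (trans (+-cong (trans (*-identityˡ _) (Det-cong {M = M [ v ]≔ M v} {M′ = M} ([]≔-id M v)))
                               (Det-ancestor M v rows unit-r (height (p v)) (p v) ℕ.≤-refl (descends v v≢r)))
                       (+-identityʳ _)))

      Det-tree : ∀ M → (∀ w → w ≢ r → EdgeRow M w) → UnitRow M r → Det M ≈ 1#
      Det-tree M edges unit-r = Det-tree-from N ℕ.≤-refl M rows unit-r
        (λ w N≤w → contradiction (Fin.toℕ<n w) (ℕ.≤⇒≯ N≤w))
        where
        rows : ∀ w → UnitRow M w ⊎ EdgeRow M w
        rows w with w Fin.≟ r
        ... | yes ≡.refl = inj₁ unit-r
        ... | no w≢r     = inj₂ (edges w w≢r)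

module RootedForests (R : CommutativeRing 0ℓ 0ℓ) (ε : CommutativeRing.Carrier R)
                     (ε²≈0 : CommutativeRing._≈_ R (CommutativeRing._*_ R ε ε) (CommutativeRing.0# R))
                     {N m} (o t : Fin m → Fin N) where
  open CommutativeRing R hiding (zero)
  open RingTheory R
  open IsMultilinear
  open Expansion R
  open FunctionalGraph R
  open Choice o t
  open Solver using (solve; _:=_; _:+_; :-_)
  open import Algebra.Properties.Semiring.Sum semiring
  open import Relation.Binary.Reasoning.Setoid setoid

  -- An edge that does not start at `v` contributes a zero row, so all vertices can share one index
  -- set of choices. Summed over the choices this is the row of ε + D - A.
  choiceRow : Fin N → Fin (suc m) → Fin N → Carrier
  choiceRow v zero    j = ε * I v j
  choiceRow v (suc a) j = 𝟙 (o a Fin.≟ v) * (I v j + - I (t a) j)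

  laplacian : Mat N
  laplacian v j = sum (λ c → choiceRow v c j)

  module _ (f : Fin N → Fin (suc m)) where

    private
      M : Mat N
      M v = choiceRow v (f v)

      p : Fin N → Fin N
      p = parent f

    root-row : ∀ {v} → f v ≡ zero → ∀ j → M v j ≈ ε * I v j
    root-row {v} eq j rewrite eq = refl

    edge-row : ∀ {v a} → f v ≡ suc a → o a ≡ v → EdgeRow p M v
    edge-row {v} {a} eq ≡.refl j rewrite eq = sym (trans
      (+-congʳ (*-congˡ (*-congʳ (reflexive (𝟙-yes (o a Fin.≟ v) ≡.refl)))))
      (trans (+-congʳ (trans (*-identityˡ _) (*-identityˡ _)))
        (solve 2 (λ x y → x :+ :- y :+ y := x) refl _ _)))

    Valid : Fin N → Set
    Valid v = f v ≡ zero ⊎ ∃ λ a → f v ≡ suc a × o a ≡ v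

    classify : ∀ v → Valid v ⊎ ∃ λ a → f v ≡ suc a × o a ≢ v
    classify v = go (f v) ≡.refl
      where
      go : ∀ c → f v ≡ c → Valid v ⊎ ∃ λ a → f v ≡ suc a × o a ≢ v
      go zero    eq = inj₁ (inj₁ eq)
      go (suc a) eq with o a Fin.≟ v
      ... | yes oa≡v = inj₁ (inj₂ (a , eq , oa≡v))
      ... | no oa≢v  = inj₂ (a , eq , oa≢v)

    all-valid : ¬ (∃ λ v → ∃ λ a → f v ≡ suc a × o a ≢ v) → ∀ v → Valid v
    all-valid none v = [ (λ valid → valid) , (λ invalid → contradiction (v , invalid) none) ]′ (classify v)

    invalid-row : ∀ {v a} → f v ≡ suc a → o a ≢ v → Det M ≈ 0#
    invalid-row {v} {a} eq oa≢v = zero-row Det-multilinear v {M} zeros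
      where
      zeros : ∀ j → M v j ≈ 0#
      zeros j rewrite eq = trans (*-congʳ (reflexive (𝟙-no (o a Fin.≟ v) oa≢v))) (zeroˡ _)

    -- Among the `N + 1` iterates of `v` from 0 to `N` two agree, and the stretch between them is a
    -- cycle of edge rows.
    rootless-cycle : (∀ v → Valid v) → ∀ v → (∀ k → k ℕ.≤ N → f (iter p k v) ≢ zero) → Det M ≈ 0#
    rootless-cycle valid v nonroot with Fin.pigeonhole (ℕ.n<1+n N) (λ (k : Fin (suc N)) → iter p (toℕ k) v)
    ... | i , j , i<j , eq = Det-cycle p {M} {iter p (toℕ i) v} L closed edges
      where
      L : ℕ
      L = toℕ j ℕ.∸ suc (toℕ i)
      i+1+L≡j : toℕ i ℕ.+ suc L ≡ toℕ j
      i+1+L≡j = ≡.trans (ℕ.+-suc (toℕ i) L) (ℕ.m+[n∸m]≡n i<j)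
      closed : iter p (suc L) (iter p (toℕ i) v) ≡ iter p (toℕ i) v
      closed = ≡.trans (≡.sym (iter-+ p (toℕ i) (suc L) v)) (≡.trans (≡.cong (λ k → iter p k v) i+1+L≡j) (≡.sym eq))
      edges : ∀ k → k ℕ.≤ L → EdgeRow p M (iter p k (iter p (toℕ i) v))
      edges k k≤L with valid (iter p k (iter p (toℕ i) v))
      ... | inj₂ (a , eq , oa) = edge-row eq oa
      ... | inj₁ eq = contradiction (≡.trans (≡.cong f (iter-+ p (toℕ i) k v)) eq) (nonroot (toℕ i ℕ.+ k)
              (ℕ.≤-trans (ℕ.+-monoʳ-≤ (toℕ i) (ℕ.m≤n⇒m≤1+n k≤L)) (ℕ.≤-trans (ℕ.≤-reflexive i+1+L≡j) (ℕ.s≤s⁻¹ (Fin.toℕ<n j)))))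

    two-roots : ∀ {r s} → r ≢ s → f r ≡ zero → f s ≡ zero → Det M ≈ 0#
    two-roots {r} {s} r≢s fr fs = begin
      Det M                   ≈⟨ Det-scale-row r M M₁ ε (λ k k≢r j → reflexive (≡.sym ([]≔-other M r (I r) k k≢r j)))
                                   (λ j → trans (root-row fr j) (*-congˡ (reflexive (≡.sym ([]≔-same M r (I r) j))))) ⟩
      ε * Det M₁              ≈⟨ *-congˡ (Det-scale-row s M₁ M₂ ε (λ k k≢s j → reflexive (≡.sym ([]≔-other M₁ s (I s) k k≢s j)))
                                   (λ j → trans (reflexive ([]≔-other M r (I r) s (r≢s ∘ ≡.sym) j))
                                            (trans (root-row fs j) (*-congˡ (reflexive (≡.sym ([]≔-same M₁ s (I s) j))))))) ⟩
      ε * (ε * Det M₂)        ≈⟨ *-assoc _ _ _ ⟨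
      ε * ε * Det M₂          ≈⟨ *-congʳ ε²≈0 ⟩
      0# * Det M₂             ≈⟨ zeroˡ _ ⟩
      0#                      ∎
      where
      M₁ M₂ : Mat N
      M₁ = M [ r ]≔ I r
      M₂ = M₁ [ s ]≔ I s

    Det-arborescence : ∀ {r} → Arborescence r f → Det M ≈ ε
    Det-arborescence {r} (fr , edge , reach) = begin
      Det M        ≈⟨ Det-scale-row r M M₁ ε (λ k k≢r j → reflexive (≡.sym ([]≔-other M r (I r) k k≢r j)))
                        (λ j → trans (root-row fr j) (*-congˡ (reflexive (≡.sym ([]≔-same M r (I r) j))))) ⟩
      ε * Det M₁   ≈⟨ *-congˡ (Det-tree p r height (λ v v≢r → ℕ.≤-reflexive (≡.sym (height-step reach v v≢r))) M₁
                        (λ w w≢r j → let a , eq , oa = edge w w≢r in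
                           trans (edge-row eq oa j) (+-congʳ (*-congˡ (reflexive (≡.sym ([]≔-other M r (I r) w w≢r j))))))
                        (λ j → reflexive ([]≔-same M r (I r) j))) ⟩
      ε * 1#       ≈⟨ *-identityʳ ε ⟩
      ε            ∎
      where
      open Height p r
      M₁ : Mat N
      M₁ = M [ r ]≔ I r

    -- At most one summand is nonzero. Writing the contribution of `f` as a sum over candidate roots
    -- allows the exchange with the sum over all choices.
    rootCount : Carrier
    rootCount = sum (λ r → 𝟙 (arborescence? r f) * ε)

    no-arborescence : Det M ≈ 0# → (∀ r → ¬ Arborescence r f) → Det M ≈ rootCount
    no-arborescence det none = trans det (sym (sum-zero (λ r →
      trans (*-congʳ (reflexive (𝟙-no (arborescence? r f) (none r)))) (zeroˡ ε))))

    -- Each way of failing to be an arborescence kills the determinant: a wrong origin gives a zero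
    -- row, two roots give ε², and a missing root or a vertex that never reaches the root gives a
    -- cycle. The vertex `v₀` is where the walk starts when there is no root at all.
    Det-choice : Fin N → Det M ≈ rootCount
    Det-choice v₀ with Fin.any? (λ v → Fin.any? (λ a → (f v Fin.≟ suc a) ×-dec ¬? (o a Fin.≟ v)))
    ... | yes (v , a , fv , oa≢v) = no-arborescence (invalid-row fv oa≢v) λ r (fr , edge , _) → bad r fr edge
      where
      bad : ∀ r → f r ≡ zero → (∀ v → v ≢ r → Σ[ a ∈ Fin m ] f v ≡ suc a × o a ≡ v) → _
      bad r fr edge with v Fin.≟ r
      ... | yes ≡.refl = Fin.0≢1+n (≡.trans (≡.sym fr) fv)
      ... | no v≢r = let b , fv′ , ob = edge v v≢r in
              oa≢v (≡.trans (≡.cong o (Fin.suc-injective (≡.trans (≡.sym fv) fv′))) ob)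
    ... | no ¬invalid with Fin.any? (λ v → f v Fin.≟ zero)
    ...   | no ¬root = no-arborescence (rootless-cycle (all-valid ¬invalid) v₀ (λ k _ eq → ¬root (_ , eq))) λ r (fr , _) → ¬root (r , fr)
    ...   | yes (r , fr) with Fin.any? (λ s → ¬? (r Fin.≟ s) ×-dec (f s Fin.≟ zero))
    ...     | yes (s , r≢s , fs) = no-arborescence (two-roots r≢s fr fs) λ q arb →
                r≢s (≡.trans (root-unique arb fr) (≡.sym (root-unique arb fs)))
    ...     | no ¬other with Fin.all? (λ v → iter p N v Fin.≟ r)
    ...       | no ¬reach = no-arborescence (rootless-cycle (all-valid ¬invalid) (proj₁ stuck) nonroot) λ q arb@(_ , _ , reach) →
                  ¬reach (λ v → ≡.trans (reach v) (≡.sym (root-unique arb fr)))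
      where
      stuck : ∃ λ v → iter p N v ≢ r
      stuck = Fin.¬∀⟶∃¬ N _ (λ v → iter p N v Fin.≟ r) ¬reach
      pr≡r : p r ≡ r
      pr≡r = ≡.cong (target r) fr
      -- A root met on the way would be `r`, the only one; `p` fixes `r`, so the walk would still be
      -- there after `N` steps.
      nonroot : ∀ k → k ℕ.≤ N → f (iter p k (proj₁ stuck)) ≢ zero
      nonroot k k≤N eq = proj₂ stuck (≡.trans (≡.cong (λ l → iter p l (proj₁ stuck)) (≡.sym (ℕ.m+[n∸m]≡n k≤N)))
        (≡.trans (iter-+ p k (N ℕ.∸ k) (proj₁ stuck)) (≡.trans (≡.cong (iter p (N ℕ.∸ k)) (≡.sym r≡)) (iter-fixed p pr≡r (N ℕ.∸ k)))))
        where
        r≡ : r ≡ iter p k (proj₁ stuck)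
        r≡ = decidable-stable (r Fin.≟ _) (λ r≢ → ¬other (_ , r≢ , eq))
    ...       | yes reach = trans (Det-arborescence arb) (sym (trans
                  (sum-single r (λ s s≢r → trans (*-congʳ (reflexive (𝟙-no (arborescence? s f) λ (fs , _) →
                     s≢r (root-unique {r} {f} arb fs)))) (zeroˡ ε)))
                  (trans (*-congʳ (reflexive (𝟙-yes (arborescence? r f) arb))) (*-identityˡ ε))))
      where
      arb : Arborescence r f
      arb = fr , (λ v v≢r → [ (λ fv → contradiction (v , v≢r ∘ ≡.sym , fv) ¬other) , (λ x → x) ]′ (all-valid ¬invalid v)) , reach

  Det-laplacian : Fin N → ∀ κ → (∀ r → sumᴸ (choices (suc m) N) (λ f → 𝟙 (arborescence? r (lookup f))) ≈ ι (+ κ)) →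
                  Det laplacian ≈ ι (+ (N ℕ.* κ)) * ε
  Det-laplacian v₀ κ count = begin
    Det laplacian
      ≈⟨ expand Det-multilinear choiceRow ⟩
    sumᴸ fs (λ f → Det (λ v → choiceRow v (lookup f v)))
      ≈⟨ sumᴸ-cong fs (λ f → Det-choice (lookup f) v₀) ⟩
    sumᴸ fs (λ f → rootCount (lookup f))
      ≈⟨ sumᴸ-sum fs (λ f r → 𝟙 (arborescence? r (lookup f)) * ε) ⟩
    sum (λ r → sumᴸ fs (λ f → 𝟙 (arborescence? r (lookup f)) * ε))
      ≈⟨ sum-cong-≋ (λ r → trans (sumᴸ-*ʳ fs (λ f → 𝟙 (arborescence? r (lookup f))) ε)
           (*-congʳ (count r))) ⟩
    sum {N} (λ r → ι (+ κ) * ε)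
      ≈⟨ *-distribʳ-sum {N} ε (λ _ → ι (+ κ)) ⟨
    sum {N} (λ _ → ι (+ κ)) * ε
      ≈⟨ *-congʳ (sum-ι N κ) ⟩
    ι (+ (N ℕ.* κ)) * ε ∎
    where
    fs = choices (suc m) N

-- Spanning trees and arborescences

least : ∀ {P : ℕ → Set} → Decidable P → ∀ k → P k → ∃ λ d → P d × (∀ j → P j → d ℕ.≤ j)
least P? zero    p = 0 , p , λ _ _ → ℕ.z≤n
least {P} P? (suc k) p with P? 0
... | yes p₀ = 0 , p₀ , λ _ _ → ℕ.z≤n
... | no ¬p₀ = let d , pd , min = least (P? ∘ suc) k p in
  suc d , pd , λ { zero p₀ → contradiction p₀ ¬p₀ ; (suc j) pj → ℕ.s≤s (min j pj) }

argmax : ∀ {n} (H : Fin (suc n) → ℕ) → ∃ λ i → ∀ j → H j ℕ.≤ H i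
argmax {zero}  H = zero , λ { zero → ℕ.≤-refl }
argmax {suc n} H with argmax (H ∘ suc)
... | i , max with ℕ.≤-total (H zero) (H (suc i))
...   | inj₁ 0≤i = suc i , λ { zero → 0≤i ; (suc j) → max j }
...   | inj₂ i≤0 = zero , λ { zero → ℕ.≤-refl ; (suc j) → ℕ.≤-trans (max j) i≤0 }

-- The bound is `N` steps although `h` may take larger values: an orbit that avoids `r` for so long
-- repeats a vertex, at which `h` would be smaller than itself.
descent⇒reach : ∀ {N} (p : Fin N → Fin N) r (h : Fin N → ℕ) → p r ≡ r → (∀ v → v ≢ r → h (p v) ℕ.< h v) →
                ∀ v → iter p N v ≡ r
descent⇒reach {N} p r h pr≡r desc v = decidable-stable (iter p N v Fin.≟ r) λ stuck →
  let away : ∀ k → k ℕ.≤ N → iter p k v ≢ r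
      away k k≤N eq = stuck (≡.trans (≡.cong (λ l → iter p l v) (≡.sym (ℕ.m+[n∸m]≡n k≤N)))
        (≡.trans (iter-+ p k (N ℕ.∸ k) v) (≡.trans (≡.cong (iter p (N ℕ.∸ k)) eq) (iter-fixed p pr≡r (N ℕ.∸ k)))))
      i , j , i<j , eq = Fin.pigeonhole (ℕ.n<1+n N) (λ (k : Fin (suc N)) → iter p (toℕ k) v)
      i+d≡j = ≡.trans (ℕ.+-suc (toℕ i) (toℕ j ℕ.∸ suc (toℕ i))) (ℕ.m+[n∸m]≡n i<j)
      strict = falls (iter p (toℕ i) v) (toℕ j ℕ.∸ suc (toℕ i)) λ k k≤d eqr → away (toℕ i ℕ.+ k)
        (ℕ.≤-trans (ℕ.+-monoʳ-≤ (toℕ i) (ℕ.m≤n⇒m≤1+n k≤d)) (ℕ.≤-trans (ℕ.≤-reflexive i+d≡j) (ℕ.s≤s⁻¹ (Fin.toℕ<n j))))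
        (≡.trans (iter-+ p (toℕ i) k v) eqr)
  in ℕ.<-irrefl (≡.cong h (≡.trans (≡.sym (iter-+ p (toℕ i) _ v)) (≡.trans (≡.cong (λ l → iter p l v) i+d≡j) (≡.sym eq)))) strict
  where
  falls : ∀ w d → (∀ k → k ℕ.≤ d → iter p k w ≢ r) → h (iter p (suc d) w) ℕ.< h w
  falls w zero    away = desc w (away 0 ℕ.z≤n)
  falls w (suc d) away = ℕ.<-trans (falls (p w) d (λ k k≤d → away (suc k) (ℕ.s≤s k≤d))) (desc w (away 0 ℕ.z≤n))

module _ {n : ℕ} where

  toℕ-mod : ∀ k → toℕ (k mod suc n) ≡ k % suc n
  toℕ-mod k = Fin.toℕ-fromℕ< _

  mod-inject₁ : ∀ (i : Fin n) → suc (toℕ (inject₁ i)) mod suc n ≡ suc i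
  mod-inject₁ i = Fin.toℕ-injective (≡.trans (toℕ-mod (suc (toℕ (inject₁ i))))
    (≡.trans (≡.cong (λ k → suc k % suc n) (Fin.toℕ-inject₁ i)) (m<n⇒m%n≡m (ℕ.s<s (Fin.toℕ<n i)))))

  mod-fromℕ : suc (toℕ (fromℕ n)) mod suc n ≡ zero
  mod-fromℕ = Fin.toℕ-injective (≡.trans (toℕ-mod (suc (toℕ (fromℕ n))))
    (≡.trans (≡.cong (λ k → suc k % suc n) (Fin.toℕ-fromℕ n)) (n%n≡0 (suc n))))

module _ (Y : Graph) where
  open Graph Y

  infixr 5 _▷▷_
  _▷▷_ : ∀ {u v w} → Path Y u v → Path Y v w → Path Y u w
  []      ▷▷ q = q
  (e ∷ p) ▷▷ q = e ∷ (p ▷▷ q)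

  edgePath : ∀ {u v} e → o e ≡ u → t e ≡ v → Path Y u v
  edgePath e ≡.refl ≡.refl = e ∷ []

  reversePath : ∀ {u v} → Path Y u v → Path Y v u
  reversePath []      = []
  reversePath (e ∷ p) = reversePath p ▷▷ edgePath (inv e) (o-inv e) (t-inv e)

  cyclicSuc-surjective : ∀ {n} (j : Fin (suc n)) → ∃ λ i → cyclicSuc Y i ≡ j
  cyclicSuc-surjective {n} zero    = fromℕ n , mod-fromℕ
  cyclicSuc-surjective     (suc j) = inject₁ j , mod-inject₁ j

  -- The walk has the `m + 1` edges `c 0` to `c m`. Backtracking at the closing point is not
  -- excluded, because two geodesics ending at the root may share their last edges.
  record ClosedReduced (m : ℕ) (c : ℕ → E) : Set where
    field
      joined  : ∀ i → i ℕ.< m → t (c i) ≡ o (c (suc i))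
      reduced : ∀ i → i ℕ.< m → c (suc i) ≢ inv (c i)
      closed  : t (c m) ≡ o (c 0)

  module _ (_≟_ : DecidableEquality V) where

    -- A shortest closed reduced walk is a circuit: a repeated vertex, in particular a
    -- backtracking at the closing point, would cut off a shorter one.
    circuit : ∀ k m → m ℕ.≤ k → ∀ c → ClosedReduced m c → Circuit Y
    circuit k m m≤k c cr with Fin.any? (λ (i : Fin (suc m)) → Fin.any? (λ (j : Fin (suc m)) →
                                  (toℕ i ℕ.<? toℕ j) ×-dec (t (c (toℕ i)) ≟ t (c (toℕ j)))))
    ... | yes (i , j , i<j , eq) = shorter k m≤k
      where
      open ClosedReduced cr
      a d : ℕ
      a = suc (toℕ i)
      d = toℕ j ℕ.∸ a
      a+d≡j : a ℕ.+ d ≡ toℕ j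
      a+d≡j = ℕ.m+[n∸m]≡n i<j
      j≤m : toℕ j ℕ.≤ m
      j≤m = ℕ.s≤s⁻¹ (Fin.toℕ<n j)
      within : ∀ {l} → l ℕ.< d → a ℕ.+ l ℕ.< m
      within l<d = ℕ.<-≤-trans (ℕ.+-monoʳ-< a l<d) (ℕ.≤-trans (ℕ.≤-reflexive a+d≡j) j≤m)
      d<m : d ℕ.< m
      d<m = ℕ.≤-trans (ℕ.s≤s (ℕ.m≤n+m d (toℕ i))) (ℕ.≤-trans (ℕ.≤-reflexive a+d≡j) j≤m)
      sub : ClosedReduced d (λ l → c (a ℕ.+ l))
      sub = record
        { joined  = λ l l<d → ≡.trans (joined (a ℕ.+ l) (within l<d)) (≡.cong (o ∘ c) (≡.sym (ℕ.+-suc a l)))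
        ; reduced = λ l l<d eq → reduced (a ℕ.+ l) (within l<d) (≡.trans (≡.cong c (≡.sym (ℕ.+-suc a l))) eq)
        ; closed  = ≡.trans (≡.cong (t ∘ c) a+d≡j) (≡.trans (≡.sym eq) (≡.trans
            (joined (toℕ i) (ℕ.≤-trans i<j j≤m)) (≡.cong (o ∘ c) (≡.sym (ℕ.+-identityʳ a)))))
        }
      shorter : ∀ k → m ℕ.≤ k → Circuit Y
      shorter zero    m≤0 = contradiction (ℕ.≤-trans d<m m≤0) λ ()
      shorter (suc k) m≤k = circuit k d (ℕ.s≤s⁻¹ (ℕ.≤-trans d<m m≤k)) (λ l → c (a ℕ.+ l)) sub
    ... | no ¬repeat = m , Vec.tabulate (c ∘ toℕ) , joined′ , reduced′ , injective′
      where
      open ClosedReduced cr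
      at : ∀ i → lookup (Vec.tabulate (c ∘ toℕ)) i ≡ c (toℕ i)
      at = lookup∘tabulate (c ∘ toℕ)
      injective : ∀ (i j : Fin (suc m)) → t (c (toℕ i)) ≡ t (c (toℕ j)) → i ≡ j
      injective i j eq with ℕ.<-cmp (toℕ i) (toℕ j)
      ... | tri< i<j _ _ = contradiction (i , j , i<j , eq) ¬repeat
      ... | tri≈ _ i≡j _ = Fin.toℕ-injective i≡j
      ... | tri> _ _ j<i = contradiction (j , i , j<i , ≡.sym eq) ¬repeat
      -- For a single edge this is `inv-≢`; for two edges the backtracking also occurs inside the
      -- walk; for more edges the terminus of `c 0` is the origin of the last edge, hence the
      -- terminus of the one before it, a repeated vertex.
      no-closing : ∀ l → l ≡ m → c 0 ≢ inv (c l)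
      no-closing zero          ≡.refl eq = inv-≢ _ (≡.sym eq)
      no-closing (suc zero)    ≡.refl eq = reduced 0 ℕ.z<s (≡.trans (≡.sym (inv-inv _)) (≡.cong inv (≡.sym eq)))
      no-closing (suc (suc l)) ≡.refl eq = Fin.0≢1+n (injective zero (suc (inject₁ (fromℕ l)))
        (≡.trans (≡.cong t eq) (≡.trans (t-inv _) (≡.trans (≡.sym (joined (suc l) ℕ.≤-refl))
          (≡.cong (t ∘ c ∘ suc) (≡.sym (≡.trans (Fin.toℕ-inject₁ (fromℕ l)) (Fin.toℕ-fromℕ l))))))))
      next : ∀ i → (toℕ i ≡ m × toℕ (cyclicSuc Y {m} i) ≡ 0) ⊎ (toℕ i ℕ.< m × toℕ (cyclicSuc Y {m} i) ≡ suc (toℕ i))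
      next i with ℕ.m≤n⇒m<n∨m≡n (ℕ.s≤s⁻¹ (Fin.toℕ<n i))
      ... | inj₁ i<m = inj₂ (i<m , ≡.trans (toℕ-mod (suc (toℕ i))) (m<n⇒m%n≡m (ℕ.s<s i<m)))
      ... | inj₂ i≡m = inj₁ (i≡m , ≡.trans (toℕ-mod (suc (toℕ i))) (≡.trans (≡.cong (λ k → suc k % suc m) i≡m) (n%n≡0 (suc m))))
      joined′ : ∀ i → t (lookup (Vec.tabulate (c ∘ toℕ)) i) ≡ o (lookup (Vec.tabulate (c ∘ toℕ)) (cyclicSuc Y i))
      joined′ i rewrite at i | at (cyclicSuc Y i) with next i
      ... | inj₁ (i≡m , eq) rewrite eq | i≡m = closed
      ... | inj₂ (i<m , eq) rewrite eq       = joined (toℕ i) i<m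
      reduced′ : ∀ i → lookup (Vec.tabulate (c ∘ toℕ)) (cyclicSuc Y i) ≢ inv (lookup (Vec.tabulate (c ∘ toℕ)) i)
      reduced′ i rewrite at i | at (cyclicSuc Y i) with next i
      ... | inj₁ (i≡m , eq) rewrite eq = no-closing (toℕ i) i≡m
      ... | inj₂ (i<m , eq) rewrite eq = reduced (toℕ i) i<m
      injective′ : ∀ i j → t (lookup (Vec.tabulate (c ∘ toℕ)) i) ≡ t (lookup (Vec.tabulate (c ∘ toℕ)) j) → i ≡ j
      injective′ i j rewrite at i | at j = injective i j

  data ReducedWalk : E → E → Set where
    [_]       : ∀ e → ReducedWalk e e
    _∷⟨_,_⟩_ : ∀ d {a b} → t d ≡ o a → a ≢ inv d → ReducedWalk a b → ReducedWalk d b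

  walkLength : ∀ {a b} → ReducedWalk a b → ℕ
  walkLength [ e ]                = 0
  walkLength (d ∷⟨ _ , _ ⟩ w) = suc (walkLength w)

  walkAt : ∀ {a b} → ReducedWalk a b → ℕ → E
  walkAt [ e ]                _       = e
  walkAt (d ∷⟨ _ , _ ⟩ w) zero    = d
  walkAt (d ∷⟨ _ , _ ⟩ w) (suc i) = walkAt w i

  walkAt-first : ∀ {a b} (w : ReducedWalk a b) → walkAt w 0 ≡ a
  walkAt-first [ e ]            = ≡.refl
  walkAt-first (d ∷⟨ _ , _ ⟩ w) = ≡.refl

  walkAt-last : ∀ {a b} (w : ReducedWalk a b) → walkAt w (walkLength w) ≡ b
  walkAt-last [ e ]            = ≡.refl
  walkAt-last (d ∷⟨ _ , _ ⟩ w) = walkAt-last w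

  closedReduced : ∀ {a b} (w : ReducedWalk a b) → t b ≡ o a → ClosedReduced (walkLength w) (walkAt w)
  closedReduced w eq = record
    { joined  = joined w
    ; reduced = reduced w
    ; closed  = ≡.trans (≡.cong t (walkAt-last w)) (≡.trans eq (≡.cong o (≡.sym (walkAt-first w))))
    }
    where
    joined : ∀ {a b} (w : ReducedWalk a b) i → i ℕ.< walkLength w → t (walkAt w i) ≡ o (walkAt w (suc i))
    joined (d ∷⟨ p , _ ⟩ w) zero    _   = ≡.trans p (≡.cong o (≡.sym (walkAt-first w)))
    joined (d ∷⟨ _ , _ ⟩ w) (suc i) i<m = joined w i (ℕ.s<s⁻¹ i<m)
    reduced : ∀ {a b} (w : ReducedWalk a b) i → i ℕ.< walkLength w → walkAt w (suc i) ≢ inv (walkAt w i)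
    reduced (d ∷⟨ _ , q ⟩ w) zero    _   eq = q (≡.trans (≡.sym (walkAt-first w)) eq)
    reduced (d ∷⟨ _ , _ ⟩ w) (suc i) i<m eq = reduced w i (ℕ.s<s⁻¹ i<m) eq

module Geodesics (Y : Graph) (_≟_ : DecidableEquality (Graph.V Y)) (searchE : Searchable (Graph.E Y))
                 (root : Graph.V Y) (connected : Connected Y) where
  open Graph Y

  Reaches : ℕ → V → Set
  Reaches zero    v = v ≡ root
  Reaches (suc k) v = Σ[ e ∈ E ] o e ≡ v × Reaches k (t e)

  reaches? : ∀ k → Decidable (Reaches k)
  reaches? zero    v = v ≟ root
  reaches? (suc k) v = searchE (λ e → (o e ≟ v) ×-dec reaches? k (t e))

  path⇒reaches : ∀ {v} → Path Y v root → ∃ λ k → Reaches k v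
  path⇒reaches []      = 0 , ≡.refl
  path⇒reaches (e ∷ p) = let k , r = path⇒reaches p in suc k , e , ≡.refl , r

  shortest : ∀ v → ∃ λ d → Reaches d v × (∀ j → Reaches j v → d ℕ.≤ j)
  shortest v = let k , r = path⇒reaches (connected v root) in least (λ k → reaches? k v) k r

  dist : V → ℕ
  dist v = proj₁ (shortest v)

  up : ∀ v → v ≡ root ⊎ Σ[ e ∈ E ] o e ≡ v × dist (t e) ℕ.< dist v
  up v with shortest v
  ... | zero  , v≡root      , _ = inj₁ v≡root
  ... | suc d , (e , oe , r) , _ = inj₂ (e , oe , ℕ.s≤s (proj₂ (proj₂ (shortest (t e))) d r))

  -- The condition that keeps an extension along geodesics reduced. It quantifies over the edge that
  -- `up` has chosen at `v`, so it is void where `up` reports the root.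
  NotUp : V → E → Set
  NotUp v e = ∀ e′ x → up v ≡ inj₂ (e′ , x) → e′ ≢ e

  up-not-back : ∀ {e v} → o e ≡ v → dist (t e) ℕ.< dist v → NotUp (t e) (inv e)
  up-not-back {e} {v} oe dec e′ (_ , dec′) _ e′≡ = ℕ.<-asym dec
    (≡.subst (λ w → dist w ℕ.< dist (t e)) (≡.trans (≡.cong t e′≡) (≡.trans (t-inv e) oe)) dec′)

  extendRight : ∀ n d → dist (t d) ℕ.≤ n → NotUp (t d) (inv d) → ∃ λ b → ReducedWalk Y d b × t b ≡ root
  extendRight n d ≤n notUp = go n ≤n (up (t d)) ≡.refl
    where
    go : ∀ n → dist (t d) ℕ.≤ n → (u : _) → up (t d) ≡ u → ∃ λ b → ReducedWalk Y d b × t b ≡ root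
    go n       ≤n (inj₁ td≡root)       eq = d , [ d ] , td≡root
    go zero    ≤0 (inj₂ (e , oe , dec)) eq = contradiction (ℕ.<-≤-trans dec ≤0) λ ()
    go (suc n) ≤n (inj₂ (e , oe , dec)) eq =
      let b , w , tb = extendRight n e (ℕ.s≤s⁻¹ (ℕ.<-≤-trans dec ≤n)) (up-not-back oe dec)
      in b , (d ∷⟨ ≡.sym oe , notUp e _ eq ⟩ w) , tb

  extendLeft : ∀ n {a b} → ReducedWalk Y a b → dist (o a) ℕ.≤ n → NotUp (o a) a → ∃ λ a′ → ReducedWalk Y a′ b × o a′ ≡ root
  extendLeft n {a} {b} w ≤n notUp = go n ≤n (up (o a)) ≡.refl
    where
    go : ∀ n → dist (o a) ℕ.≤ n → (u : _) → up (o a) ≡ u → ∃ λ a′ → ReducedWalk Y a′ b × o a′ ≡ root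
    go n       ≤n (inj₁ oa≡root)       eq = a , w , oa≡root
    go zero    ≤0 (inj₂ (e , oe , dec)) eq = contradiction (ℕ.<-≤-trans dec ≤0) λ ()
    go (suc n) ≤n (inj₂ (e , oe , dec)) eq = extendLeft n
      (inv e ∷⟨ ≡.trans (t-inv e) oe , (λ a≡ → notUp e _ eq (≡.sym (≡.trans a≡ (inv-inv e)))) ⟩ w)
      (≡.subst (λ x → dist x ℕ.≤ n) (≡.sym (o-inv e)) (ℕ.s≤s⁻¹ (ℕ.<-≤-trans dec ≤n)))
      (≡.subst (λ x → NotUp x (inv e)) (≡.sym (o-inv e)) (up-not-back oe dec))

  -- The fundamental circuit of an edge outside the geodesic tree: geodesics from both ends to the
  -- root close it to a reduced walk. The two hypotheses say that the tree uses `e` in neither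
  -- direction.
  circuit-through : ∀ e → NotUp (t e) (inv e) → NotUp (o e) e → Circuit Y
  circuit-through e right left =
    let b , w , tb = extendRight (dist (t e)) e ℕ.≤-refl right
        a , w′ , oa = extendLeft (dist (o e)) w ℕ.≤-refl left
    in circuit Y _≟_ _ _ ℕ.≤-refl (walkAt Y w′) (closedReduced Y w′ (≡.trans tb (≡.sym oa)))

lookup-ext : ∀ {A : Set} {n} {xs ys : Vec A n} → (∀ i → lookup xs i ≡ lookup ys i) → xs ≡ ys
lookup-ext {xs = []}     {[]}     h = ≡.refl
lookup-ext {xs = x ∷ xs} {y ∷ ys} h = ≡.cong₂ _∷_ (h zero) (lookup-ext (h ∘ suc))

does⇒ : ∀ {P : Set} (d : Dec P) → does d ≡ Data.Bool.true → P
does⇒ (yes p) _ = p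

module SpanningTrees {X : Graph} (fin : Finite X) where
  open Graph X
  open Finite fin

  ix : V → Fin #V
  ix = Inverse.to V↔Fin

  eix : E → Fin #E
  eix = Inverse.to E↔Fin

  edge : Fin #E → E
  edge = Inverse.from E↔Fin

  vertex-ix : ∀ v → vertex (ix v) ≡ v
  vertex-ix = Inverse.strictlyInverseʳ V↔Fin

  ix-vertex : ∀ i → ix (vertex i) ≡ i
  ix-vertex = Inverse.strictlyInverseˡ V↔Fin

  edge-eix : ∀ e → edge (eix e) ≡ e
  edge-eix = Inverse.strictlyInverseʳ E↔Fin

  eix-edge : ∀ a → eix (edge a) ≡ a
  eix-edge = Inverse.strictlyInverseˡ E↔Fin

  eix-injective : ∀ {e e′} → eix e ≡ eix e′ → e ≡ e′
  eix-injective eq = ≡.trans (≡.sym (edge-eix _)) (≡.trans (≡.cong edge eq) (edge-eix _))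

  oᶠ tᶠ : Fin #E → Fin #V
  oᶠ a = ix (o (edge a))
  tᶠ a = ix (t (edge a))

  open Choice oᶠ tᶠ public

  module _ (f : Fin #V → Fin (suc #E)) where

    -- A choice selects each tree edge only in the direction of the root, whereas an edge set closed
    -- under `inv` contains both directions.
    Uses : E → Set
    Uses e = ∃ λ v → f v ≡ suc (eix e) ⊎ f v ≡ suc (eix (inv e))

    uses? : ∀ e → Dec (Uses e)
    uses? e = Fin.any? (λ v → (f v Fin.≟ suc (eix e)) ⊎-dec (f v Fin.≟ suc (eix (inv e))))

    treeOf : Subset #E
    treeOf = Vec.tabulate (λ a → does (uses? (edge a)))

    ∈-treeOf⁺ : ∀ e → Uses e → eix e ∈ treeOf
    ∈-treeOf⁺ e u = lookup⇒[]= (eix e) treeOf (≡.trans (lookup∘tabulate _ (eix e))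
      (dec-true (uses? (edge (eix e))) (≡.subst Uses (≡.sym (edge-eix e)) u)))

    ∈-treeOf⁻ : ∀ e → eix e ∈ treeOf → Uses e
    ∈-treeOf⁻ e e∈ = ≡.subst Uses (edge-eix e) (does⇒ (uses? (edge (eix e)))
      (≡.trans (≡.sym (lookup∘tabulate (λ a → does (uses? (edge a))) (eix e))) ([]=⇒lookup e∈)))

    treeOf-closed : InvClosed fin treeOf
    treeOf-closed e e∈ = ∈-treeOf⁺ (inv e) (flip (∈-treeOf⁻ e e∈))
      where
      flip : Uses e → Uses (inv e)
      flip (v , inj₁ eq) = v , inj₂ (≡.trans eq (≡.cong (suc ∘ eix) (≡.sym (inv-inv e))))
      flip (v , inj₂ eq) = v , inj₁ eq

  module _ {r : Fin #V} {f : Fin #V → Fin (suc #E)} (arb : Arborescence r f) where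
    open Height (parent f) r

    private
      fr : f r ≡ zero
      fr = proj₁ arb

      out : ∀ v → v ≢ r → Σ[ a ∈ Fin #E ] f v ≡ suc a × oᶠ a ≡ v
      out = proj₁ (proj₂ arb)

      reach : ∀ v → iter (parent f) #V v ≡ r
      reach = proj₂ (proj₂ arb)

      p : Fin #V → Fin #V
      p = parent f

    choice-origin : ∀ {v e} → f v ≡ suc (eix e) → ix (o e) ≡ v
    choice-origin {v} {e} eq with out v (λ { ≡.refl → Fin.0≢1+n (≡.trans (≡.sym fr) eq) })
    ... | a , fv , oa = ≡.trans (≡.cong (ix ∘ o) (≡.sym (≡.trans (≡.cong edge (Fin.suc-injective (≡.trans (≡.sym fv) eq))) (edge-eix e)))) oa

    choice-target : ∀ {v e} → f v ≡ suc (eix e) → p v ≡ ix (t e)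
    choice-target {v} {e} eq = ≡.trans (≡.cong (target v) eq) (≡.cong (ix ∘ t) (edge-eix e))

    choice-height : ∀ {v e} → f v ≡ suc (eix e) → height v ≡ suc (height (ix (t e)))
    choice-height {v} eq = ≡.trans (height-step reach v (λ { ≡.refl → Fin.0≢1+n (≡.trans (≡.sym fr) eq) }))
                                   (≡.cong (suc ∘ height) (choice-target eq))

    direction : ∀ {e} → Uses f e → f (ix (o e)) ≡ suc (eix e) ⊎ f (ix (t e)) ≡ suc (eix (inv e))
    direction (v , inj₁ eq) = inj₁ (≡.trans (≡.cong f (choice-origin eq)) eq)
    direction {e} (v , inj₂ eq) = inj₂ (≡.trans (≡.cong (f ∘ ix) (≡.sym (o-inv e))) (≡.trans (≡.cong f (choice-origin eq)) eq))

    private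
      Y : Graph
      Y = spanningSubgraph fin (treeOf f) (treeOf-closed f)

    pathToRoot : ∀ k v → iter p k v ≡ r → Path Y (vertex v) (vertex r)
    pathToRoot zero    v ≡.refl = []
    pathToRoot (suc k) v eq with v Fin.≟ r
    ... | yes ≡.refl = []
    ... | no v≢r   = let a , fv , oa = out v v≢r
                         fv′ = ≡.trans fv (≡.cong suc (≡.sym (eix-edge a))) in
      _▷▷_ Y (edgePath Y (edge a , ∈-treeOf⁺ f (edge a) (v , inj₁ fv′))
        (≡.trans (≡.sym (vertex-ix _)) (≡.cong vertex oa))
        (≡.trans (≡.sym (vertex-ix _)) (≡.cong vertex (≡.sym (choice-target fv′)))))
      (pathToRoot k (p v) eq)

    -- Around a highest vertex of a circuit both edges would be the edge towards the root.
    acyclic : ¬ Circuit Y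
    acyclic (n , c , joined , reduced , _) = absurd
      where
      e : Fin (suc n) → E
      e i = proj₁ (lookup c i)
      top : Fin (suc n)
      top = proj₁ (argmax (λ i → height (ix (t (e i)))))
      top-max : ∀ j → height (ix (t (e j))) ℕ.≤ height (ix (t (e top)))
      top-max = proj₂ (argmax (λ i → height (ix (t (e i)))))
      used : ∀ i → Uses f (e i)
      used i = ∈-treeOf⁻ f (e i) (proj₂ (lookup c i))
      next : Fin (suc n)
      next = cyclicSuc Y top
      leaves : f (ix (t (e top))) ≡ suc (eix (e next))
      leaves = [ (λ eq → ≡.trans (≡.cong (f ∘ ix) (joined top)) eq)
               , (λ eq → contradiction (top-max next) (ℕ.<⇒≱ (ℕ.≤-reflexive (≡.sym (≡.trans (choice-height eq)
                    (≡.cong (suc ∘ height ∘ ix) (≡.trans (t-inv (e next)) (≡.sym (joined top)))))))))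
               ]′ (direction (used next))
      arrives : f (ix (t (e top))) ≡ suc (eix (inv (e top)))
      arrives with cyclicSuc-surjective Y top
      ... | prev , prev⁺≡top = [ (λ eq → contradiction (top-max prev) (ℕ.<⇒≱ (ℕ.≤-reflexive (≡.sym
                (≡.trans (≡.cong (height ∘ ix) (≡.trans (joined prev) (≡.cong (o ∘ e) prev⁺≡top))) (choice-height eq))))))
              , (λ eq → eq) ]′ (direction (used top))
      absurd : _
      absurd = reduced top (Σ-ext (eix-injective (Fin.suc-injective (≡.trans (≡.sym leaves) arrives))))
        where
        Σ-ext : ∀ {e e′} {q : eix e ∈ treeOf f} {q′ : eix e′ ∈ treeOf f} → e ≡ e′ →
                _≡_ {A = Σ[ e ∈ E ] eix e ∈ treeOf f} (e , q) (e′ , q′)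
        Σ-ext {e} ≡.refl = ≡.cong (e ,_) ([]=-irrelevant _ _)

    arborescence⇒tree : IsSpanningTree fin (treeOf f)
    arborescence⇒tree = treeOf-closed f , vertex r , connected , acyclic
      where
      toRoot : ∀ v → Path Y v (vertex r)
      toRoot v = ≡.subst (λ w → Path Y w (vertex r)) (vertex-ix v) (pathToRoot #V (ix v) (reach (ix v)))
      connected : Connected Y
      connected u v = _▷▷_ Y (toRoot u) (reversePath Y (toRoot v))

  -- Induction on the height in `f`. The edge chosen by `f` at `v` is used by `f′`, either from `v`,
  -- as wanted, or backwards from the parent. In the second case the induction hypothesis makes `f`
  -- choose the reverse edge at the parent, and the height of `v` would exceed itself by 2.
  treeOf-injective : ∀ {r f f′} → Arborescence r f → Arborescence r f′ → treeOf f ≡ treeOf f′ → ∀ v → f v ≡ f′ v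
  treeOf-injective {r} {f} {f′} arb@(fr , out , reach) arb′@(f′r , _ , _) eq v = go (height v) v ℕ.≤-refl
    where
    open Height (parent f) r
    go : ∀ k v → height v ℕ.≤ k → f v ≡ f′ v
    go k v v≤k with v Fin.≟ r
    ... | yes ≡.refl = ≡.trans fr (≡.sym f′r)
    ... | no v≢r with out v v≢r
    ...   | a , fv , oa with direction arb′ (∈-treeOf⁻ f′ (edge a) (≡.subst (eix (edge a) ∈_) eq
                               (∈-treeOf⁺ f (edge a) (v , inj₁ (≡.trans fv (≡.cong suc (≡.sym (eix-edge a))))))))
    ...     | inj₁ f′o = ≡.trans fv (≡.trans (≡.cong suc (≡.sym (eix-edge a))) (≡.trans (≡.sym f′o) (≡.cong f′ oa)))
    ...     | inj₂ f′t = contradiction (≡.trans v-height (≡.cong suc (choice-height arb fu)))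
                                       (λ eq → ℕ.<⇒≢ (ℕ.m<n+m (height v) {2} ℕ.z<s)
                                         (≡.trans eq (≡.cong (λ w → 2 ℕ.+ height w) (≡.trans (≡.cong ix (t-inv (edge a))) oa))))
      where
      v-height : height v ≡ suc (height (tᶠ a))
      v-height = choice-height arb (≡.trans fv (≡.cong suc (≡.sym (eix-edge a))))
      smaller : ∀ k → height v ℕ.≤ k → f (tᶠ a) ≡ f′ (tᶠ a)
      smaller zero    v≤0 = contradiction (≡.subst (ℕ._≤ 0) v-height v≤0) λ ()
      smaller (suc k) v≤k = go k (tᶠ a) (ℕ.s≤s⁻¹ (≡.subst (ℕ._≤ suc k) v-height v≤k))
      fu : f (tᶠ a) ≡ suc (eix (inv (edge a)))
      fu = ≡.trans (smaller k v≤k) f′t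

  module _ (S : Subset #E) (closed : InvClosed fin S) (connected : Connected (spanningSubgraph fin S closed))
           (r : Fin #V) where

    private
      Y : Graph
      Y = spanningSubgraph fin S closed

    open Geodesics Y _≟ᵥ_ (search-Σ (search-↔ E↔Fin) (λ e → eix e ∈? S) []=-irrelevant) (vertex r) connected

    pick : ∀ {v} → v ≡ vertex r ⊎ Σ[ e ∈ Graph.E Y ] Graph.o Y e ≡ v × dist (Graph.t Y e) ℕ.< dist v → Fin (suc #E)
    pick (inj₁ _)       = zero
    pick (inj₂ (e , _)) = suc (eix (proj₁ e))

    geodesicChoice : Fin #V → Fin (suc #E)
    geodesicChoice i = pick (up (vertex i))

    geodesicChoice-arborescence : Arborescence r geodesicChoice
    geodesicChoice-arborescence = atRoot , out , descent⇒reach (parent geodesicChoice) r (dist ∘ vertex) fixed descends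
      where
      root-dist : ∀ {v} → v ≡ vertex r → dist v ℕ.≤ 0
      root-dist v≡ = proj₂ (proj₂ (shortest _)) 0 v≡
      atRoot : geodesicChoice r ≡ zero
      atRoot with up (vertex r)
      ... | inj₁ _ = ≡.refl
      ... | inj₂ (e , _ , dec) = contradiction (ℕ.<-≤-trans dec (root-dist ≡.refl)) λ ()
      fixed : parent geodesicChoice r ≡ r
      fixed = ≡.cong (target r) atRoot
      out : ∀ v → v ≢ r → Σ[ a ∈ Fin #E ] geodesicChoice v ≡ suc a × oᶠ a ≡ v
      out v v≢r with up (vertex v)
      ... | inj₁ eq = contradiction (≡.trans (≡.sym (ix-vertex v)) (≡.trans (≡.cong ix eq) (ix-vertex r))) v≢r
      ... | inj₂ (e , oe , _) = eix (proj₁ e) , ≡.refl ,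
              ≡.trans (≡.cong (ix ∘ o) (edge-eix (proj₁ e))) (≡.trans (≡.cong ix oe) (ix-vertex v))
      descends : ∀ v → v ≢ r → dist (vertex (parent geodesicChoice v)) ℕ.< dist (vertex v)
      descends v v≢r with up (vertex v)
      ... | inj₁ eq = contradiction (≡.trans (≡.sym (ix-vertex v)) (≡.trans (≡.cong ix eq) (ix-vertex r))) v≢r
      ... | inj₂ (e , _ , dec) = ≡.subst (λ w → dist w ℕ.< dist (vertex v))
              (≡.trans (≡.sym (vertex-ix _)) (≡.cong (vertex ∘ ix ∘ t) (≡.sym (edge-eix (proj₁ e))))) dec

    geodesicChoice-∈ : ∀ v e → geodesicChoice v ≡ suc (eix e) → eix e ∈ S
    geodesicChoice-∈ v e eq with up (vertex v)
    ... | inj₂ ((e′ , e′∈S) , _) = ≡.subst (_∈ S) (Fin.suc-injective eq) e′∈S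

    geodesicChoice-⊆ : ∀ e → Uses geodesicChoice e → eix e ∈ S
    geodesicChoice-⊆ e (v , inj₁ eq) = geodesicChoice-∈ v e eq
    geodesicChoice-⊆ e (v , inj₂ eq) = ≡.subst (λ x → eix x ∈ S) (inv-inv e) (closed (inv e) (geodesicChoice-∈ v (inv e) eq))

    -- An edge of an acyclic subgraph that the geodesic tree did not use would close a circuit by
    -- `circuit-through`.
    geodesicChoice-⊇ : ¬ Circuit Y → ∀ e → eix e ∈ S → Uses geodesicChoice e
    geodesicChoice-⊇ acyclic e e∈S = decidable-stable (uses? geodesicChoice e) λ unused →
      acyclic (circuit-through (e , e∈S)
        (λ e′ x eq e′≡ → unused (ix (t e) , inj₂ (≡.trans (picked (t e) eq) (≡.cong (suc ∘ eix ∘ proj₁) e′≡))))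
        (λ e′ x eq e′≡ → unused (ix (o e) , inj₁ (≡.trans (picked (o e) eq) (≡.cong (suc ∘ eix ∘ proj₁) e′≡)))))
      where
      picked : ∀ v {e′ x} → up v ≡ inj₂ (e′ , x) → geodesicChoice (ix v) ≡ suc (eix (proj₁ e′))
      picked v {e′} eq = go (≡.sym (vertex-ix v))
        where
        go : ∀ {w} → v ≡ w → pick (up w) ≡ suc (eix (proj₁ e′))
        go ≡.refl = ≡.cong pick eq

    treeOf-geodesicChoice : ¬ Circuit Y → treeOf geodesicChoice ≡ S
    treeOf-geodesicChoice acyclic = ⊆-antisym
      (λ {a} a∈ → ≡.subst (_∈ S) (eix-edge a) (geodesicChoice-⊆ (edge a) (∈-treeOf⁻ geodesicChoice (edge a)
         (≡.subst (_∈ treeOf geodesicChoice) (≡.sym (eix-edge a)) a∈))))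
      (λ {a} a∈ → ≡.subst (_∈ treeOf geodesicChoice) (eix-edge a) (∈-treeOf⁺ geodesicChoice (edge a)
         (geodesicChoice-⊇ acyclic (edge a) (≡.subst (_∈ S) (≡.sym (eix-edge a)) a∈))))

  tree⇒arborescence : ∀ r S → IsSpanningTree fin S → ∃ λ (f : Vec (Fin (suc #E)) #V) → Arborescence r (lookup f) × treeOf (lookup f) ≡ S
  tree⇒arborescence r S (closed , _ , connected , acyclic) =
    Vec.tabulate g , arborescence-ext (λ v → ≡.sym (lookup∘tabulate g v)) (geodesicChoice-arborescence S closed connected r) ,
    ≡.trans (treeOf-ext (lookup∘tabulate g)) (treeOf-geodesicChoice S closed connected r acyclic)
    where
    g : Fin #V → Fin (suc #E)
    g = geodesicChoice S closed connected r
    treeOf-ext : ∀ {f f′ : Fin #V → Fin (suc #E)} → (∀ v → f v ≡ f′ v) → treeOf f ≡ treeOf f′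
    treeOf-ext {f} {f′} h = ⊆-antisym (include f f′ h) (include f′ f (≡.sym ∘ h))
      where
      include : ∀ f f′ → (∀ v → f v ≡ f′ v) → ∀ {a} → a ∈ treeOf f → a ∈ treeOf f′
      include f f′ h {a} a∈ = ≡.subst (_∈ treeOf f′) (eix-edge a) (∈-treeOf⁺ f′ (edge a)
        (transfer (∈-treeOf⁻ f (edge a) (≡.subst (_∈ treeOf f) (≡.sym (eix-edge a)) a∈))))
        where
        transfer : ∀ {e} → Uses f e → Uses f′ e
        transfer (v , inj₁ eq) = v , inj₁ (≡.trans (≡.sym (h v)) eq)
        transfer (v , inj₂ eq) = v , inj₂ (≡.trans (≡.sym (h v)) eq)
    arborescence-ext : ∀ {f f′ : Fin #V → Fin (suc #E)} → (∀ v → f v ≡ f′ v) → Arborescence r f → Arborescence r f′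
    arborescence-ext {f} {f′} h (fr , out , reach) = ≡.trans (≡.sym (h r)) fr ,
      (λ v v≢r → let a , fv , oa = out v v≢r in a , ≡.trans (≡.sym (h v)) fv , oa) ,
      (λ v → ≡.trans (same #V v) (reach v))
      where
      same : ∀ k v → iter (parent f′) k v ≡ iter (parent f) k v
      same zero    v = ≡.refl
      same (suc k) v = ≡.trans (≡.cong (λ c → iter (parent f′) k (target v c)) (≡.sym (h v))) (same k (parent f v))

  -- The geodesic tree of the subgraph that contains every edge.
  spanning-tree-exists : Connected X → Fin #V → ∃ (IsSpanningTree fin)
  spanning-tree-exists connected r = _ , arborescence⇒tree (geodesicChoice-arborescence all (λ e _ → full (inv e)) connected′ r)
    where
    all : Subset #E
    all = Vec.replicate #E inside
    full : ∀ e → eix e ∈ all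
    full e = lookup⇒[]= (eix e) all (Vec.lookup-replicate (eix e) _)
    connected′ : Connected (spanningSubgraph fin all (λ e _ → full (inv e)))
    connected′ u v = lift (connected u v)
      where
      lift : ∀ {u v} → Path X u v → Path (spanningSubgraph fin all (λ e _ → full (inv e))) u v
      lift []      = []
      lift (e ∷ p) = (e , full e) ∷ lift p

rootedTrees : ∀ {X} → Finite X → ℕ
rootedTrees {X} fin = Finite.#V fin ℕ.* κ X fin

module MatrixTree (R : CommutativeRing 0ℓ 0ℓ) (ε : CommutativeRing.Carrier R)
                  (ε²≈0 : CommutativeRing._≈_ R (CommutativeRing._*_ R ε ε) (CommutativeRing.0# R))
                  {X : Graph} (fin : Finite X) where
  open CommutativeRing R hiding (zero)
  open RingTheory R
  open Expansion R
  open Finite fin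
  open SpanningTrees fin
  open RootedForests R ε ε²≈0 oᶠ tᶠ using (laplacian; Det-laplacian) public

  -- For each fixed root, forgetting the orientation is a bijection from arborescences to spanning
  -- trees, so every root contributes the same count κ.
  matrix-tree : Fin #V → Det laplacian ≈ ι (+ rootedTrees fin) * ε
  matrix-tree v₀ = Det-laplacian v₀ (κ X fin) λ r → trans
    (sumᴸ-bijection (λ f → arborescence? r (lookup f)) (isSpanningTree? fin) (Vec.≡-dec Bool._≟_)
      (choices-unique (suc #E) #V) ∈-choices (subsets-unique #E) ∈-subsets
      (treeOf ∘ lookup) (λ f arb → arborescence⇒tree arb) (tree⇒arborescence r)
      (λ f f′ arb arb′ eq → lookup-ext (treeOf-injective arb arb′ eq)))
    (sumᴸ-count (isSpanningTree? fin) (subsets #E))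

-- Adjoining the roots of a monic polynomial

record Embedding (K S : CommutativeRing 0ℓ 0ℓ) : Set where
  private
    module K = CommutativeRing K
    module S = CommutativeRing S
  field
    φ         : K.Carrier → S.Carrier
    cong      : ∀ {a b} → a K.≈ b → φ a S.≈ φ b
    injective : ∀ {a b} → φ a S.≈ φ b → a K.≈ b
    +-homo    : ∀ a b → φ (a K.+ b) S.≈ φ a S.+ φ b
    *-homo    : ∀ a b → φ (a K.* b) S.≈ φ a S.* φ b
    neg-homo  : ∀ a → φ (K.- a) S.≈ S.- φ a
    0-homo    : φ K.0# S.≈ S.0#
    1-homo    : φ K.1# S.≈ S.1#

  ι-homo⁺ : ∀ n → φ (RingTheory.ι K (+ n)) S.≈ RingTheory.ι S (+ n)
  ι-homo⁺ zero    = 0-homo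
  ι-homo⁺ (suc n) = S.trans (+-homo _ _) (S.+-cong 1-homo (ι-homo⁺ n))

  ι-homo : ∀ z → φ (RingTheory.ι K z) S.≈ RingTheory.ι S z
  ι-homo (+ n)    = ι-homo⁺ n
  ι-homo -[1+ n ] = S.trans (neg-homo _) (S.-‿cong (ι-homo⁺ (suc n)))

id-embedding : ∀ K → Embedding K K
id-embedding K = record
  { φ = λ a → a ; cong = λ eq → eq ; injective = λ eq → eq
  ; +-homo = λ _ _ → refl ; *-homo = λ _ _ → refl ; neg-homo = λ _ → refl ; 0-homo = refl ; 1-homo = refl }
  where open CommutativeRing K using (refl)

_∘-embedding_ : ∀ {K S T} → Embedding S T → Embedding K S → Embedding K T
_∘-embedding_ {K} {S} {T} G F = record
  { φ = G.φ ∘ F.φ ; cong = G.cong ∘ F.cong ; injective = F.injective ∘ G.injective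
  ; +-homo   = λ a b → trans (G.cong (F.+-homo a b)) (G.+-homo _ _)
  ; *-homo   = λ a b → trans (G.cong (F.*-homo a b)) (G.*-homo _ _)
  ; neg-homo = λ a → trans (G.cong (F.neg-homo a)) (G.neg-homo _)
  ; 0-homo   = trans (G.cong F.0-homo) G.0-homo
  ; 1-homo   = trans (G.cong F.1-homo) G.1-homo }
  where
  open CommutativeRing T using (trans)
  module F = Embedding F
  module G = Embedding G

-- A polynomial is given by its sequence of coefficients.
module PolynomialRoots (K : CommutativeRing 0ℓ 0ℓ) where
  open CommutativeRing K hiding (zero)
  open RingTheory K
  open Solver using (solve; _:=_; _:+_; _:*_; :-_; con)
  open import Relation.Binary.Reasoning.Setoid setoid

  record Monic (d : ℕ) (f : ℕ → Carrier) : Set where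
    field
      leading : f d ≈ 1#
      above   : ∀ j → d ℕ.< j → f j ≈ 0#

  -- On coefficient sequences this is multiplication by t, and `times-root x` is multiplication by t
  -- - x.
  shift : (ℕ → Carrier) → ℕ → Carrier
  shift g zero    = 0#
  shift g (suc j) = g j

  times-root : Carrier → (ℕ → Carrier) → ℕ → Carrier
  times-root x g j = shift g j + - (x * g j)

  -- newton x k = (t - x₀) ⋯ (t - xₖ₋₁)
  newton : (ℕ → Carrier) → ℕ → ℕ → Carrier
  newton x zero    zero    = 1#
  newton x zero    (suc j) = 0#
  newton x (suc k) = times-root (x k) (newton x k)

  shift-cong : ∀ {g g′} → (∀ j → g j ≈ g′ j) → ∀ j → shift g j ≈ shift g′ j
  shift-cong h zero    = refl
  shift-cong h (suc j) = h j

  times-root-cong : ∀ {x x′ g g′} → x ≈ x′ → (∀ j → g j ≈ g′ j) → ∀ j → times-root x g j ≈ times-root x′ g′ j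
  times-root-cong e h j = +-cong (shift-cong h j) (-‿cong (*-cong e (h j)))

  newton-cong : ∀ k {x x′} → (∀ i → i ℕ.< k → x i ≈ x′ i) → ∀ j → newton x k j ≈ newton x′ k j
  newton-cong zero    h zero    = refl
  newton-cong zero    h (suc j) = refl
  newton-cong (suc k) h j =
    times-root-cong (h k ℕ.≤-refl) (newton-cong k (λ i i<k → h i (ℕ.m≤n⇒m≤1+n i<k))) j

  newton-above : ∀ x k j → k ℕ.< j → newton x k j ≈ 0#
  newton-above x zero    (suc j) _   = refl
  newton-above x (suc k) (suc j) k<j = begin
    newton x k j + - (x k * newton x k (suc j)) ≈⟨ +-cong (newton-above x k j (ℕ.s<s⁻¹ k<j)) (-‿cong (*-congˡ (newton-above x k (suc j) (ℕ.m≤n⇒m≤1+n (ℕ.s<s⁻¹ k<j))))) ⟩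
    0# + - (x k * 0#)                           ≈⟨ solve 1 (λ y → con (+ 0) :+ :- (y :* con (+ 0)) := con (+ 0)) refl (x k) ⟩
    0#                                          ∎

  newton-leading : ∀ x k → newton x k k ≈ 1#
  newton-leading x zero    = refl
  newton-leading x (suc k) = begin
    newton x k k + - (x k * newton x k (suc k)) ≈⟨ +-cong (newton-leading x k) (-‿cong (*-congˡ (newton-above x k (suc k) ℕ.≤-refl))) ⟩
    1# + - (x k * 0#)                           ≈⟨ solve 2 (λ o y → o :+ :- (y :* con (+ 0)) := o) refl 1# (x k) ⟩
    1#                                          ∎

  module Division (f : ℕ → Carrier) (x : Carrier) (m : ℕ) (above : ∀ j → suc m ℕ.< j → f j ≈ 0#) where

    -- The coefficient of degree `j` in the quotient by t - x is f(j+1) + x f(j+2) + x² f(j+3) +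
    -- ..., truncated here after `n` terms.
    horner : ℕ → ℕ → Carrier
    horner zero    j = 0#
    horner (suc n) j = f (suc j) + x * horner n (suc j)

    quotient : ℕ → Carrier
    quotient = horner (suc m)

    horner-stable : ∀ n j → f (suc (j ℕ.+ n)) ≈ 0# → horner (suc n) j ≈ horner n j
    horner-stable zero    j eq = begin
      f (suc j) + x * 0#  ≈⟨ +-congʳ (trans (reflexive (≡.cong (f ∘ suc) (≡.sym (ℕ.+-identityʳ j)))) eq) ⟩
      0# + x * 0#         ≈⟨ solve 1 (λ x → con (+ 0) :+ x :* con (+ 0) := con (+ 0)) refl x ⟩
      0#                  ∎
    horner-stable (suc n) j eq = +-congˡ (*-congˡ (horner-stable n (suc j)
      (trans (reflexive (≡.cong (f ∘ suc) (≡.sym (ℕ.+-suc j n)))) eq)))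

    horner-above : ∀ n j → m ℕ.< j → horner n j ≈ 0#
    horner-above zero    j m<j = refl
    horner-above (suc n) j m<j = begin
      f (suc j) + x * horner n (suc j) ≈⟨ +-cong (above (suc j) (ℕ.s<s m<j)) (*-congˡ (horner-above n (suc j) (ℕ.m≤n⇒m≤1+n m<j))) ⟩
      0# + x * 0#                      ≈⟨ solve 1 (λ x → con (+ 0) :+ x :* con (+ 0) := con (+ 0)) refl x ⟩
      0#                               ∎

    quotient-above : ∀ j → m ℕ.< j → quotient j ≈ 0#
    quotient-above = horner-above (suc m)

    quotient-leading : quotient m ≈ f (suc m)
    quotient-leading = trans (+-congˡ (*-congˡ (horner-above m (suc m) ℕ.≤-refl)))
                             (solve 2 (λ o x → o :+ x :* con (+ 0) := o) refl (f (suc m)) x)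

    -- The hypothesis is f(x) = 0 in Horner form. It accounts for the constant coefficient; the
    -- other coefficients are the Horner recursion, up to a truncation that `horner-stable` removes.
    factor : f 0 + x * quotient 0 ≈ 0# → ∀ j → times-root x quotient j ≈ f j
    factor root zero    = begin
      0# + - (x * quotient 0)                    ≈⟨ +-congʳ root ⟨
      f 0 + x * quotient 0 + - (x * quotient 0)  ≈⟨ solve 2 (λ a b → a :+ b :+ :- b := a) refl (f 0) (x * quotient 0) ⟩
      f 0                                        ∎
    factor root (suc j) = begin
      f (suc j) + x * horner m (suc j) + - (x * quotient (suc j))
        ≈⟨ +-congˡ (-‿cong (*-congˡ (horner-stable m (suc j) (above _ (ℕ.s<s (ℕ.s≤s (ℕ.m≤n+m m j))))))) ⟩
      f (suc j) + x * horner m (suc j) + - (x * horner m (suc j))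
        ≈⟨ solve 2 (λ a b → a :+ b :+ :- b := a) refl (f (suc j)) (x * horner m (suc j)) ⟩
      f (suc j) ∎

module EmbeddedPolynomials {K S : CommutativeRing 0ℓ 0ℓ} (F : Embedding K S) where
  open CommutativeRing S hiding (zero)
  open Embedding F
  open PolynomialRoots S
  private
    module P = PolynomialRoots K

  φ-shift : ∀ g j → shift (φ ∘ g) j ≈ φ (P.shift g j)
  φ-shift g zero    = sym 0-homo
  φ-shift g (suc j) = refl

  φ-times-root : ∀ y g j → times-root (φ y) (φ ∘ g) j ≈ φ (P.times-root y g j)
  φ-times-root y g j = sym (trans (+-homo _ _) (+-cong (sym (φ-shift g j)) (trans (neg-homo _) (-‿cong (*-homo _ _)))))

  φ-newton : ∀ y k j → newton (φ ∘ y) k j ≈ φ (P.newton y k j)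
  φ-newton y zero    zero    = sym 1-homo
  φ-newton y zero    (suc j) = sym 0-homo
  φ-newton y (suc k) j       = trans (times-root-cong refl (φ-newton y k) j) (φ-times-root (y k) (P.newton y k) j)

-- K[x]/(f) for f monic of degree m + 1, realised by the action of polynomial expressions in the
-- shift operator x on the sequences satisfying the linear recurrence f.
module RootRing (K : CommutativeRing 0ℓ 0ℓ) (m : ℕ) (f : ℕ → CommutativeRing.Carrier K)
                (monic : PolynomialRoots.Monic K (suc m) f) where
  open CommutativeRing K hiding (zero)
  open RingTheory K
  open PolynomialRoots K using (module Monic)
  open Monic monic
  open Solver using (solve; _:=_; _:+_; _:*_)
  open import Algebra.Properties.Ring ring using (-‿distribʳ-*; -‿+-comm)
  open import Relation.Binary.Reasoning.Setoid setoid

  infixl 6 _⊕_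
  infixl 7 _⊗_
  infix  8 ⊖_
  data Expr : Set where
    scalar  : Carrier → Expr
    x       : Expr
    _⊕_ _⊗_ : Expr → Expr → Expr
    ⊖_      : Expr → Expr

  ⟦_⟧ : Expr → (ℕ → Carrier) → ℕ → Carrier
  ⟦ scalar c ⟧ s i = c * s i
  ⟦ x ⟧        s i = s (suc i)
  ⟦ p ⊕ q ⟧    s i = ⟦ p ⟧ s i + ⟦ q ⟧ s i
  ⟦ p ⊗ q ⟧    s   = ⟦ p ⟧ (⟦ q ⟧ s)
  ⟦ ⊖ p ⟧      s i = - ⟦ p ⟧ s i

  ⟦⟧-cong : ∀ p {s s′} → (∀ i → s i ≈ s′ i) → ∀ i → ⟦ p ⟧ s i ≈ ⟦ p ⟧ s′ i
  ⟦⟧-cong (scalar c) h i = *-congˡ (h i)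
  ⟦⟧-cong x          h i = h (suc i)
  ⟦⟧-cong (p ⊕ q)    h i = +-cong (⟦⟧-cong p h i) (⟦⟧-cong q h i)
  ⟦⟧-cong (p ⊗ q)    h i = ⟦⟧-cong p (⟦⟧-cong q h) i
  ⟦⟧-cong (⊖ p)      h i = -‿cong (⟦⟧-cong p h i)

  ⟦⟧-+ : ∀ p s s′ i → ⟦ p ⟧ (λ i → s i + s′ i) i ≈ ⟦ p ⟧ s i + ⟦ p ⟧ s′ i
  ⟦⟧-+ (scalar c) s s′ i = distribˡ c _ _
  ⟦⟧-+ x          s s′ i = refl
  ⟦⟧-+ (p ⊕ q)    s s′ i = trans (+-cong (⟦⟧-+ p s s′ i) (⟦⟧-+ q s s′ i))
    (solve 4 (λ a b c d → (a :+ b) :+ (c :+ d) := (a :+ c) :+ (b :+ d)) refl _ _ _ _)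
  ⟦⟧-+ (p ⊗ q)    s s′ i = trans (⟦⟧-cong p (⟦⟧-+ q s s′) i) (⟦⟧-+ p (⟦ q ⟧ s) (⟦ q ⟧ s′) i)
  ⟦⟧-+ (⊖ p)      s s′ i = trans (-‿cong (⟦⟧-+ p s s′ i)) (sym (-‿+-comm _ _))

  ⟦⟧-* : ∀ p c s i → ⟦ p ⟧ (λ i → c * s i) i ≈ c * ⟦ p ⟧ s i
  ⟦⟧-* (scalar d) c s i = solve 3 (λ c d s → d :* (c :* s) := c :* (d :* s)) refl c d (s i)
  ⟦⟧-* x          c s i = refl
  ⟦⟧-* (p ⊕ q)    c s i = trans (+-cong (⟦⟧-* p c s i) (⟦⟧-* q c s i)) (sym (distribˡ c _ _))
  ⟦⟧-* (p ⊗ q)    c s i = trans (⟦⟧-cong p (⟦⟧-* q c s) i) (⟦⟧-* p c (⟦ q ⟧ s) i)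
  ⟦⟧-* (⊖ p)      c s i = trans (-‿cong (⟦⟧-* p c s i)) (-‿distribʳ-* _ _)

  ⟦⟧-neg : ∀ p s i → ⟦ p ⟧ (λ i → - s i) i ≈ - ⟦ p ⟧ s i
  ⟦⟧-neg (scalar c) s i = sym (-‿distribʳ-* _ _)
  ⟦⟧-neg x          s i = refl
  ⟦⟧-neg (p ⊕ q)    s i = trans (+-cong (⟦⟧-neg p s i) (⟦⟧-neg q s i)) (-‿+-comm _ _)
  ⟦⟧-neg (p ⊗ q)    s i = trans (⟦⟧-cong p (⟦⟧-neg q s) i) (⟦⟧-neg p (⟦ q ⟧ s) i)
  ⟦⟧-neg (⊖ p)      s i = -‿cong (⟦⟧-neg p s i)

  ⟦⟧-shift : ∀ p s i → ⟦ p ⟧ (s ∘ suc) i ≈ ⟦ p ⟧ s (suc i)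
  ⟦⟧-shift (scalar c) s i = refl
  ⟦⟧-shift x          s i = refl
  ⟦⟧-shift (p ⊕ q)    s i = +-cong (⟦⟧-shift p s i) (⟦⟧-shift q s i)
  ⟦⟧-shift (p ⊗ q)    s i = trans (⟦⟧-cong p (⟦⟧-shift q s) i) (⟦⟧-shift p (⟦ q ⟧ s) i)
  ⟦⟧-shift (⊖ p)      s i = -‿cong (⟦⟧-shift p s i)

  ⟦⟧-comm : ∀ p q s i → ⟦ p ⟧ (⟦ q ⟧ s) i ≈ ⟦ q ⟧ (⟦ p ⟧ s) i
  ⟦⟧-comm (scalar c) q s i = sym (⟦⟧-* q c s i)
  ⟦⟧-comm x          q s i = sym (⟦⟧-shift q s i)
  ⟦⟧-comm (p ⊕ p′)   q s i = trans (+-cong (⟦⟧-comm p q s i) (⟦⟧-comm p′ q s i)) (sym (⟦⟧-+ q _ _ i))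
  ⟦⟧-comm (p ⊗ p′)   q s i = trans (⟦⟧-cong p (⟦⟧-comm p′ q s) i) (⟦⟧-comm p q (⟦ p′ ⟧ s) i)
  ⟦⟧-comm (⊖ p)      q s i = trans (-‿cong (⟦⟧-comm p q s i)) (sym (⟦⟧-neg q _ i))

  combination : ℕ → ℕ → (ℕ → Carrier) → ℕ → Carrier
  combination zero    j s i = 0#
  combination (suc n) j s i = f j * s i + combination n (suc j) s (suc i)

  combination-cong : ∀ n j {s s′ i i′} → (∀ k → k ℕ.< n → s (i ℕ.+ k) ≈ s′ (i′ ℕ.+ k)) →
                     combination n j s i ≈ combination n j s′ i′
  combination-cong zero    j h = refl
  combination-cong (suc n) j {s} {s′} {i} {i′} h = +-cong
    (*-congˡ (≡.subst₂ (λ a b → s a ≈ s′ b) (ℕ.+-identityʳ i) (ℕ.+-identityʳ i′) (h 0 ℕ.z<s)))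
    (combination-cong n (suc j) (λ k k<n → ≡.subst₂ (λ a b → s a ≈ s′ b) (ℕ.+-suc i k) (ℕ.+-suc i′ k) (h (suc k) (ℕ.s<s k<n))))

  combination-snoc : ∀ n j s i → combination (suc n) j s i ≈ combination n j s i + f (j ℕ.+ n) * s (i ℕ.+ n)
  combination-snoc zero    j s i = trans (+-comm _ _)
    (+-congˡ (reflexive (≡.cong₂ (λ a b → f a * s b) (≡.sym (ℕ.+-identityʳ j)) (≡.sym (ℕ.+-identityʳ i)))))
  combination-snoc (suc n) j s i = trans (+-congˡ (combination-snoc n (suc j) s (suc i)))
    (trans (sym (+-assoc _ _ _)) (+-congˡ (reflexive (≡.cong₂ (λ a b → f a * s b) (≡.sym (ℕ.+-suc j n)) (≡.sym (ℕ.+-suc i n))))))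

  combination-⟦⟧ : ∀ p n j s i → combination n j (⟦ p ⟧ s) i ≈ ⟦ p ⟧ (combination n j s) i
  combination-⟦⟧ p zero    j s i = sym (trans (⟦⟧-cong p (λ i → sym (zeroˡ 0#)) i)
    (trans (⟦⟧-* p 0# (λ _ → 0#) i) (zeroˡ _)))
  combination-⟦⟧ p (suc n) j s i = trans
    (+-cong (sym (⟦⟧-* p (f j) s i)) (trans (combination-⟦⟧ p n (suc j) s (suc i)) (sym (⟦⟧-shift p _ i))))
    (sym (⟦⟧-+ p (λ i → f j * s i) (λ i → combination n (suc j) s (suc i)) i))

  Recurrent : (ℕ → Carrier) → Set
  Recurrent s = ∀ i → combination (suc (suc m)) 0 s i ≈ 0#

  -- Equality of expressions is tested on recurrent sequences. Products respect it because the right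
  -- factor sends such a sequence to another one.
  ⟦⟧-recurrent : ∀ p {s} → Recurrent s → Recurrent (⟦ p ⟧ s)
  ⟦⟧-recurrent p {s} rec i = trans (combination-⟦⟧ p (suc (suc m)) 0 s i)
    (trans (⟦⟧-cong p (λ i → trans (rec i) (sym (zeroˡ 0#))) i) (trans (⟦⟧-* p 0# (λ _ → 0#) i) (zeroˡ _)))

  infix 4 _≈ᴱ_
  _≈ᴱ_ : Expr → Expr → Set
  p ≈ᴱ q = ∀ s → Recurrent s → ∀ i → ⟦ p ⟧ s i ≈ ⟦ q ⟧ s i

  rootRing : CommutativeRing 0ℓ 0ℓ
  rootRing = record
    { Carrier = Expr ; _≈_ = _≈ᴱ_ ; _+_ = _⊕_ ; _*_ = _⊗_ ; -_ = ⊖_ ; 0# = scalar 0# ; 1# = scalar 1#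
    ; isCommutativeRing = record
      { isRing = record
        { +-isAbelianGroup = record
          { isGroup = record
            { isMonoid = record
              { isSemigroup = record
                { isMagma = record
                  { isEquivalence = record
                    { refl  = λ s r i → refl
                    ; sym   = λ h s r i → sym (h s r i)
                    ; trans = λ h h′ s r i → trans (h s r i) (h′ s r i) }
                  ; ∙-cong = λ h h′ s r i → +-cong (h s r i) (h′ s r i) }
                ; assoc = λ p q u s r i → +-assoc _ _ _ }
              ; identity = (λ p s r i → trans (+-congʳ (zeroˡ _)) (+-identityˡ _))
                         , (λ p s r i → trans (+-congˡ (zeroˡ _)) (+-identityʳ _)) }
            ; inverse = (λ p s r i → trans (-‿inverseˡ _) (sym (zeroˡ _)))
                      , (λ p s r i → trans (-‿inverseʳ _) (sym (zeroˡ _)))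
            ; ⁻¹-cong = λ h s r i → -‿cong (h s r i) }
          ; comm = λ p q s r i → +-comm _ _ }
        ; *-cong = λ {p} {p′} {q} {q′} h h′ s r i →
            trans (⟦⟧-cong p (h′ s r) i) (h (⟦ q′ ⟧ s) (⟦⟧-recurrent q′ r) i)
        ; *-assoc = λ p q u s r i → refl
        ; *-identity = (λ p s r i → *-identityˡ _) , (λ p s r i → ⟦⟧-cong p (λ i → *-identityˡ _) i)
        ; distrib = (λ p q u s r i → ⟦⟧-+ p _ _ i) , (λ p q u s r i → refl) }
      ; *-comm = λ p q s r i → ⟦⟧-comm p q s i } }

  -- For `j ≤ m` this is the entry `i + j` of the solution of the recurrence with initial values 1,
  -- 0, ..., 0. Carrying `m + 1` consecutive entries makes the recursion structural.
  window : ℕ → ℕ → Carrier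
  window zero    zero    = 1#
  window zero    (suc j) = 0#
  window (suc i) j with j ℕ.<? m
  ... | yes _ = window i (suc j)
  ... | no  _ = - combination (suc m) 0 (window i) 0

  impulse : ℕ → Carrier
  impulse i = window i 0

  impulse-window : ∀ j i → j ℕ.≤ m → impulse (i ℕ.+ j) ≈ window i j
  impulse-window zero    i _   = reflexive (≡.cong impulse (ℕ.+-identityʳ i))
  impulse-window (suc j) i j<m = trans (reflexive (≡.cong impulse (ℕ.+-suc i j)))
    (trans (impulse-window j (suc i) (ℕ.<⇒≤ j<m)) slide)
    where
    slide : window (suc i) j ≈ window i (suc j)
    slide with j ℕ.<? m
    ... | yes _  = refl
    ... | no j≮m = contradiction j<m j≮m

  impulse-recurrent : Recurrent impulse
  impulse-recurrent i = begin
    combination (suc (suc m)) 0 impulse i                                   ≈⟨ combination-snoc (suc m) 0 impulse i ⟩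
    combination (suc m) 0 impulse i + f (suc m) * impulse (i ℕ.+ suc m)     ≈⟨ +-cong same (*-cong leading last) ⟩
    combination (suc m) 0 (window i) 0 + 1# * - combination (suc m) 0 (window i) 0 ≈⟨ +-congˡ (*-identityˡ _) ⟩
    combination (suc m) 0 (window i) 0 + - combination (suc m) 0 (window i) 0 ≈⟨ -‿inverseʳ _ ⟩
    0#                                                                      ∎
    where
    same : combination (suc m) 0 impulse i ≈ combination (suc m) 0 (window i) 0
    same = combination-cong (suc m) 0 (λ k k<1+m → impulse-window k i (ℕ.s≤s⁻¹ k<1+m))
    overflow : window (suc i) m ≈ - combination (suc m) 0 (window i) 0
    overflow with m ℕ.<? m
    ... | yes m<m = contradiction m<m (ℕ.<-irrefl ≡.refl)
    ... | no _    = refl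
    last : impulse (i ℕ.+ suc m) ≈ - combination (suc m) 0 (window i) 0
    last = trans (reflexive (≡.cong impulse (ℕ.+-suc i m))) (trans (impulse-window m (suc i) ℕ.≤-refl) overflow)

  scalar-embedding : Embedding K rootRing
  scalar-embedding = record
    { φ = scalar
    ; cong = λ eq s r i → *-congʳ eq
    -- Scalars are told apart by acting on `impulse`, whose entry at 0 is `1#`.
    ; injective = λ h → trans (sym (*-identityʳ _)) (trans (h impulse impulse-recurrent 0) (*-identityʳ _))
    ; +-homo = λ a b s r i → distribʳ _ _ _
    ; *-homo = λ a b s r i → *-assoc _ _ _
    ; neg-homo = λ a s r i → sym (-‿distribˡ-* _ _)
    ; 0-homo = λ s r i → refl
    ; 1-homo = λ s r i → refl }
    where open import Algebra.Properties.Ring ring using (-‿distribˡ-*)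

  private
    module S = PolynomialRoots rootRing

  open S.Division (scalar ∘ f) x m (λ j m<j s r i → *-congʳ (above j m<j)) public

  quotient-monic : S.Monic m quotient
  quotient-monic = record
    { leading = CommutativeRing.trans rootRing {quotient m} {scalar (f (suc m))} {scalar 1#}
                  quotient-leading (λ s r i → *-congʳ leading)
    ; above   = quotient-above }

  horner-combination : ∀ n j s i → ⟦ horner n j ⟧ s i ≈ combination n (suc j) s i
  horner-combination zero    j s i = zeroˡ _
  horner-combination (suc n) j s i = +-congˡ (horner-combination n (suc j) s (suc i))

  -- The value f(x), with x the shift, acts on a sequence as the recurrence itself, hence as zero on
  -- recurrent sequences.
  x-factor : ∀ j → S.times-root x quotient j ≈ᴱ scalar (f j)
  x-factor = factor (λ s r i → trans (+-congˡ (horner-combination (suc m) 0 s (suc i))) (trans (r i) (sym (zeroˡ _))))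

record Splitting (K : CommutativeRing 0ℓ 0ℓ) (d : ℕ) (f : ℕ → CommutativeRing.Carrier K) : Set₁ where
  field
    ring      : CommutativeRing 0ℓ 0ℓ
    embedding : Embedding K ring
    root      : ℕ → CommutativeRing.Carrier ring
    splits    : ∀ j → CommutativeRing._≈_ ring (PolynomialRoots.newton ring root d j) (Embedding.φ embedding (f j))

-- One root is adjoined and divided out, and the quotient is split over the larger ring. The root
-- adjoined at this stage gets the top index `m`, because `newton` multiplies by the factor of
-- highest index last.
splitting : ∀ d (K : CommutativeRing 0ℓ 0ℓ) f → PolynomialRoots.Monic K d f → Splitting K d f
splitting zero K f monic = record
  { ring = K ; embedding = id-embedding K ; root = λ _ → CommutativeRing.0# K
  ; splits = λ { zero → sym leading ; (suc j) → sym (above (suc j) ℕ.z<s) } }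
  where
  open CommutativeRing K using (sym)
  open PolynomialRoots.Monic monic
splitting (suc m) K f monic = record
  { ring = T ; embedding = rest.embedding ∘-embedding scalar-embedding ; root = root ; splits = splits }
  where
  open RootRing K m f monic
  module rest = Splitting (splitting m rootRing quotient quotient-monic)
  T : CommutativeRing 0ℓ 0ℓ
  T = rest.ring
  open CommutativeRing T hiding (zero; ring)
  open Embedding rest.embedding
  open PolynomialRoots T
  root : ℕ → Carrier
  root k with k ℕ.≟ m
  ... | yes _ = φ x
  ... | no  _ = rest.root k
  root-m : root m ≈ φ x
  root-m with m ℕ.≟ m
  ... | yes _  = refl
  ... | no m≢m = contradiction ≡.refl m≢m
  root-< : ∀ k → k ℕ.< m → root k ≈ rest.root k
  root-< k k<m with k ℕ.≟ m
  ... | yes ≡.refl = contradiction k<m (ℕ.<-irrefl ≡.refl)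
  ... | no _       = refl
  open EmbeddedPolynomials rest.embedding
  splits : ∀ j → newton root (suc m) j ≈ φ (scalar (f j))
  splits j = trans (times-root-cong root-m (λ j → trans (newton-cong m root-< j) (rest.splits j)) j)
    (trans (φ-times-root x quotient j) (cong (x-factor j)))

-- Block circulant determinants

module Cyclic (ν : ℕ) where

  cyc : Fin (suc ν) → Fin (suc ν)
  cyc σ = suc (toℕ σ) mod suc ν

  uncyc : Fin (suc ν) → Fin (suc ν)
  uncyc zero    = fromℕ ν
  uncyc (suc τ) = inject₁ τ

  cyc-uncyc : ∀ τ → cyc (uncyc τ) ≡ τ
  cyc-uncyc zero    = mod-fromℕ
  cyc-uncyc (suc τ) = mod-inject₁ τ

  uncyc-cyc : ∀ σ → uncyc (cyc σ) ≡ σ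
  uncyc-cyc σ with view σ
  ... | ‵fromℕ     = ≡.cong uncyc mod-fromℕ
  ... | ‵inject₁ τ = ≡.cong uncyc (mod-inject₁ τ)

  cyc≡π : ∀ σ → cyc σ ≡ π (suc ν) (+ suc (toℕ σ))
  cyc≡π σ = Fin.toℕ-injective (≡.trans (toℕ-mod (suc (toℕ σ))) (≡.sym (Fin.toℕ-fromℕ< _)))

  iter-cyc : ∀ r σ → iter cyc r σ ≡ π (suc ν) (+ toℕ σ ℤ.+ + r)
  iter-cyc zero    σ = ≡.sym (≡.trans (≡.cong (π (suc ν)) (ℤ.+-identityʳ (+ toℕ σ))) (π-toℕ (suc ν) σ))
  iter-cyc (suc r) σ = ≡.trans (iter-cyc r (cyc σ)) (≡.trans
    (π-cong (suc ν) (+-~ (suc ν) (≡.subst (λ τ → _~′_ (+ toℕ τ) (+ suc (toℕ σ))) (≡.sym (cyc≡π σ)) (rep (suc ν) (+ suc (toℕ σ)))) (~-refl (suc ν) {+ r})))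
    (≡.cong (π (suc ν)) (≡.cong +_ (≡.sym (ℕ.+-suc (toℕ σ) r)))))
    where
    open import Defs using () renaming (_~_ to ~-of)
    _~′_ : ℤ → ℤ → Set
    _~′_ = ~-of (suc ν)

  π-shift : ∀ a σ → π (suc ν) (+ toℕ σ ℤ.+ a) ≡ iter cyc (toℕ (π (suc ν) a)) σ
  π-shift a σ = ≡.trans (π-cong (suc ν) (+-~ (suc ν) (~-refl (suc ν) {+ toℕ σ}) (~-sym (suc ν) (rep (suc ν) a))))
                        (≡.sym (iter-cyc (toℕ (π (suc ν) a)) σ))

module BlockCirculant (R : CommutativeRing 0ℓ 0ℓ) where
  open CommutativeRing R hiding (zero)
  open RingTheory R
  open Determinants R
  open PolynomialRoots R
  open Solver using (solve; _:=_; _:+_; _:*_; :-_; con)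
  open import Algebra.Properties.Semiring.Exp semiring using (_^_)
  open import Algebra.Properties.Semiring.Sum semiring
  open import Relation.Binary.Reasoning.Setoid setoid

  prod : ∀ {n} → (Fin n → Carrier) → Carrier
  prod {zero}  f = 1#
  prod {suc n} f = f zero * prod (f ∘ suc)

  prod-cong : ∀ {n} {f g : Fin n → Carrier} → (∀ i → f i ≈ g i) → prod f ≈ prod g
  prod-cong {zero}  h = refl
  prod-cong {suc n} h = *-cong (h zero) (prod-cong (h ∘ suc))

  prod-one : ∀ {n} {f : Fin n → Carrier} → (∀ i → f i ≈ 1#) → prod f ≈ 1#
  prod-one {zero}  h = refl
  prod-one {suc n} h = trans (*-cong (h zero) (prod-one (h ∘ suc))) (*-identityˡ 1#)

  prod-* : ∀ {n} (f g : Fin n → Carrier) → prod (λ i → f i * g i) ≈ prod f * prod g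
  prod-* {zero}  f g = sym (*-identityˡ 1#)
  prod-* {suc n} f g = trans (*-congˡ (prod-* (f ∘ suc) (g ∘ suc)))
    (solve 4 (λ a b c d → (a :* b) :* (c :* d) := (a :* c) :* (b :* d)) refl (f zero) (g zero) (prod (f ∘ suc)) (prod (g ∘ suc)))

  Det-block-triangular : ∀ n {g} (M : Mat (n ℕ.* g)) →
    (∀ (k : Fin n) (v : Fin g) (l : Fin n) (w : Fin g) → toℕ l ℕ.< toℕ k → M (combine k v) (combine l w) ≈ 0#) →
    Det M ≈ prod {n} (λ k → Det {g} (λ v w → M (combine k v) (combine k w)))
  Det-block-triangular zero        M low = refl
  Det-block-triangular (suc n) {g} M low = trans
    (Det-block-upper A D M (λ _ _ → refl)
      (λ i w → let k , v , eq = Fin.combine-surjective {n} {g} i in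
         ≡.subst (λ i → M (g ↑ʳ i) (w ↑ˡ (n ℕ.* g)) ≈ 0#) eq (low (suc k) v zero w ℕ.z<s))
      (λ _ _ → refl))
    (*-congˡ (Det-block-triangular n D (λ k v l w l<k → low (suc k) v (suc l) w (ℕ.s<s l<k))))
    where
    A : Mat g
    A v w = M (v ↑ˡ (n ℕ.* g)) (w ↑ˡ (n ℕ.* g))
    D : Mat (n ℕ.* g)
    D i j = M (g ↑ʳ i) (g ↑ʳ j)

  lift : ∀ {n g} → (Fin n → Fin g → Fin n → Fin g → Carrier) → Mat (n ℕ.* g)
  lift {n} {g} B i j = B (proj₁ (remQuot {n} g i)) (proj₂ (remQuot {n} g i)) (proj₁ (remQuot {n} g j)) (proj₂ (remQuot {n} g j))

  lift-combine : ∀ {n g} (B : Fin n → Fin g → Fin n → Fin g → Carrier) k v l w →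
                 lift B (combine k v) (combine l w) ≡ B k v l w
  lift-combine B k v l w = ≡.cong₂ (λ p q → B (proj₁ p) (proj₂ p) (proj₁ q) (proj₂ q))
    (Fin.remQuot-combine k v) (Fin.remQuot-combine l w)

  ≋-combine : ∀ {n g} {M M′ : Mat (n ℕ.* g)} →
    (∀ (k : Fin n) (v : Fin g) (l : Fin n) (w : Fin g) → M (combine k v) (combine l w) ≈ M′ (combine k v) (combine l w)) → M ≋ M′
  ≋-combine {n} {g} {M} {M′} h i j =
    let k , v , eq  = Fin.combine-surjective {n} {g} i
        l , w , eq′ = Fin.combine-surjective {n} {g} j
    in ≡.subst₂ (λ i j → M i j ≈ M′ i j) eq eq′ (h k v l w)

  lift-∙ : ∀ {n g} (B C : Fin n → Fin g → Fin n → Fin g → Carrier) k v l w →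
    (lift B ∙ lift C) (combine k v) (combine l w) ≈ sum (λ m → sum (λ u → B k v m u * C m u l w))
  lift-∙ {n} {g} B C k v l w = trans (sum-combine n g _)
    (sum-cong-≋ (λ m → sum-cong-≋ (λ u → *-cong (reflexive (lift-combine B k v m u)) (reflexive (lift-combine C m u l w)))))

  module _ (ν : ℕ) (x : ℕ → Carrier)
           (splits : ∀ j → newton x (suc ν) j ≈ 𝟙 (j ℕ.≟ suc ν) + - 𝟙 (j ℕ.≟ 0)) where
    open Cyclic ν

    private
      n : ℕ
      n = suc ν

    -- The cyclic shift P of the monomial basis of R[t]/(tⁿ - 1), the Newton basis U and
    -- multiplication by t in the Newton basis T.
    U T P : Mat n
    U k σ = newton x (toℕ k) (toℕ σ)
    T k l = x (toℕ k) * I k l + 𝟙 (toℕ l ℕ.≟ suc (toℕ k))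
    P σ τ = I (cyc σ) τ

    P-power T-power : ℕ → Mat n
    P-power r σ = I (iter cyc r σ)
    T-power zero    = I
    T-power (suc r) = T ∙ T-power r

    U-upper : ∀ k σ → toℕ k ℕ.< toℕ σ → U k σ ≈ 0#
    U-upper k σ = newton-above x (toℕ k) (toℕ σ)

    U∙P : ∀ k τ → (U ∙ P) k τ ≈ U k (uncyc τ)
    U∙P k τ = trans (sum-cong-≋ (λ σ → *-congˡ {U k σ} (reflexive (𝟙-cong (cyc σ Fin.≟ τ) (σ Fin.≟ uncyc τ)
      (λ eq → ≡.trans (≡.sym (uncyc-cyc σ)) (≡.cong uncyc eq)) (λ eq → ≡.trans (≡.cong cyc eq) (cyc-uncyc τ))))))
      (sum-δʳ (uncyc τ) (U k))

    T∙U : ∀ k τ → (T ∙ U) k τ ≈ x (toℕ k) * U k τ + sum (λ l → 𝟙 (toℕ l ℕ.≟ suc (toℕ k)) * U l τ)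
    T∙U k τ = trans (sum-cong-≋ (λ l → trans (distribʳ (U l τ) (x (toℕ k) * I k l) (𝟙 (toℕ l ℕ.≟ suc (toℕ k)))) (+-congʳ (*-assoc (x (toℕ k)) (I k l) (U l τ)))))
      (trans (sum-linear (x (toℕ k)) (λ l → I k l * U l τ) (λ l → 𝟙 (toℕ l ℕ.≟ suc (toℕ k)) * U l τ))
             (+-congʳ (*-congˡ (sum-δ k (λ l → U l τ)))))

    newton-step : ∀ k τ → shift (newton x k) τ ≈ x k * newton x k τ + newton x (suc k) τ
    newton-step k τ = solve 2 (λ s y → s := y :+ (s :+ :- y)) refl (shift (newton x k) τ) (x k * newton x k τ)

    -- With Nₖ the Newton polynomials this is t Nₖ = xₖ Nₖ + Nₖ₊₁, read modulo tⁿ - 1. In the last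
    -- row the term Nₙ is tⁿ - 1 itself and drops out.
    U∙P≋T∙U : U ∙ P ≋ T ∙ U
    U∙P≋T∙U k τ = trans (U∙P k τ) (trans (shifted k τ) (sym (T∙U k τ)))
      where
      inner : ∀ (k : Fin ν) τ → sum (λ l → 𝟙 (toℕ l ℕ.≟ suc (toℕ (inject₁ k))) * U l τ) ≈ newton x (suc (toℕ (inject₁ k))) (toℕ τ)
      inner k τ = trans (sum-cong-≋ (λ l → *-congʳ {U l τ} (reflexive (𝟙-cong (toℕ l ℕ.≟ suc (toℕ (inject₁ k))) (suc k Fin.≟ l)
          (λ eq → Fin.toℕ-injective (≡.sym (≡.trans eq (≡.cong suc (Fin.toℕ-inject₁ k)))))
          (λ { ≡.refl → ≡.cong suc (≡.sym (Fin.toℕ-inject₁ k)) })))))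
        (trans (sum-δ (suc k) (λ l → U l τ)) (reflexive (≡.cong (λ i → newton x (suc i) (toℕ τ)) (≡.sym (Fin.toℕ-inject₁ k)))))
      outer : ∀ τ → sum (λ l → 𝟙 (toℕ l ℕ.≟ suc (toℕ (fromℕ ν))) * U l τ) ≈ 0#
      outer τ = sum-zero (λ l → trans (*-congʳ {U l τ} (reflexive (𝟙-no (toℕ l ℕ.≟ suc (toℕ (fromℕ ν)))
        (λ eq → ℕ.<⇒≢ (Fin.toℕ<n l) (≡.trans eq (≡.cong suc (Fin.toℕ-fromℕ ν))))))) (zeroˡ _))
      top : ∀ τ → toℕ τ ≢ 0 → newton x (suc ν) (toℕ {n} τ) ≈ 0#
      top τ τ≢0 = trans (splits (toℕ τ)) (trans (+-cong (reflexive (𝟙-no (toℕ τ ℕ.≟ suc ν) (ℕ.<⇒≢ (Fin.toℕ<n τ))))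
        (-‿cong (reflexive (𝟙-no (toℕ τ ℕ.≟ 0) τ≢0)))) (-‿inverseʳ 0#))
      shifted : ∀ k τ → U k (uncyc τ) ≈ x (toℕ k) * U k τ + sum (λ l → 𝟙 (toℕ l ℕ.≟ suc (toℕ k)) * U l τ)
      shifted k τ with view k
      shifted _ zero | ‵inject₁ j = trans
        (trans (newton-above x (toℕ (inject₁ j)) (toℕ (fromℕ ν)) (≡.subst₂ ℕ._<_ (≡.sym (Fin.toℕ-inject₁ j)) (≡.sym (Fin.toℕ-fromℕ ν)) (Fin.toℕ<n j)))
               (newton-step (toℕ (inject₁ j)) 0))
        (+-congˡ (sym (inner j zero)))
      shifted _ (suc τ) | ‵inject₁ j = trans
        (trans (reflexive (≡.cong (newton x (toℕ (inject₁ j))) (Fin.toℕ-inject₁ τ))) (newton-step (toℕ (inject₁ j)) (suc (toℕ τ))))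
        (+-congˡ (sym (inner j (suc τ))))
      -- The leading 1 of degree `ν` wraps around to column 0. That it agrees with xᵥ times the
      -- constant coefficient of the last Newton polynomial, with v = `ν`, is `splits` at 0.
      shifted _ zero | ‵fromℕ = begin
        newton x (toℕ (fromℕ ν)) (toℕ (fromℕ ν))  ≈⟨ newton-leading x (toℕ (fromℕ ν)) ⟩
        1#                                        ≈⟨ solve 1 (λ o → o := :- (con (+ 0) :+ :- o)) refl 1# ⟩
        - (0# + - 1#)                             ≈⟨ -‿cong (splits 0) ⟨
        - newton x (suc ν) 0                      ≈⟨ solve 1 (λ y → :- (con (+ 0) :+ :- y) := y :+ con (+ 0)) refl (x ν * newton x ν 0) ⟩
        x ν * newton x ν 0 + 0#                   ≈⟨ +-cong (reflexive (≡.cong (λ i → x i * newton x i 0) (≡.sym (Fin.toℕ-fromℕ ν)))) (sym (outer zero)) ⟩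
        x (toℕ (fromℕ ν)) * U (fromℕ ν) zero + sum (λ l → 𝟙 (toℕ l ℕ.≟ suc (toℕ (fromℕ ν))) * U l zero) ∎
      shifted _ (suc τ) | ‵fromℕ = trans
        (trans (reflexive (≡.cong (newton x (toℕ (fromℕ ν))) (Fin.toℕ-inject₁ τ))) (newton-step (toℕ (fromℕ ν)) (suc (toℕ τ))))
        (+-congˡ (trans (reflexive (≡.cong (λ i → newton x (suc i) (suc (toℕ τ))) (Fin.toℕ-fromℕ ν)))
                        (trans (top (suc τ) (λ ())) (sym (outer (suc τ))))))

    intertwine : ∀ r → U ∙ P-power r ≋ T-power r ∙ U
    intertwine zero    k τ = trans (∙-I U k τ) (sym (I-∙ U k τ))
    intertwine (suc r) k τ = begin
      (U ∙ P-power (suc r)) k τ       ≈⟨ ∙-cong {A = U} (λ _ _ → refl) (λ σ τ → sym (sum-δ (cyc σ) (λ ρ → P-power r ρ τ))) k τ ⟩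
      (U ∙ (P ∙ P-power r)) k τ       ≈⟨ ∙-assoc U P (P-power r) k τ ⟨
      (U ∙ P ∙ P-power r) k τ         ≈⟨ ∙-cong {B = P-power r} U∙P≋T∙U (λ _ _ → refl) k τ ⟩
      (T ∙ U ∙ P-power r) k τ         ≈⟨ ∙-assoc T U (P-power r) k τ ⟩
      (T ∙ (U ∙ P-power r)) k τ       ≈⟨ ∙-cong {A = T} (λ _ _ → refl) (intertwine r) k τ ⟩
      (T ∙ (T-power r ∙ U)) k τ       ≈⟨ ∙-assoc T (T-power r) U k τ ⟨
      (T ∙ T-power r ∙ U) k τ         ∎

    T-lower : ∀ k l → toℕ l ℕ.< toℕ k → T k l ≈ 0#
    T-lower k l l<k = begin
      x (toℕ k) * I k l + 𝟙 (toℕ l ℕ.≟ suc (toℕ k))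
        ≈⟨ +-cong (*-congˡ (I-off (λ k≡l → ℕ.<⇒≢ l<k (≡.cong toℕ (≡.sym k≡l)))))
                  (reflexive (𝟙-no (toℕ l ℕ.≟ suc (toℕ k)) (ℕ.<⇒≢ (ℕ.m≤n⇒m≤1+n l<k)))) ⟩
      x (toℕ k) * 0# + 0#  ≈⟨ trans (+-identityʳ _) (zeroʳ _) ⟩
      0#                   ∎

    T-power-lower : ∀ r k l → toℕ l ℕ.< toℕ k → T-power r k l ≈ 0#
    T-power-lower zero    k l l<k = I-off (λ k≡l → ℕ.<⇒≢ l<k (≡.cong toℕ (≡.sym k≡l)))
    T-power-lower (suc r) k l l<k = sum-zero term
      where
      term : ∀ ρ → T k ρ * T-power r ρ l ≈ 0#
      term ρ with toℕ ρ ℕ.<? toℕ k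
      ... | yes ρ<k = trans (*-congʳ (T-lower k ρ ρ<k)) (zeroˡ _)
      ... | no ρ≮k  = trans (*-congˡ (T-power-lower r ρ l (ℕ.<-≤-trans l<k (ℕ.≮⇒≥ ρ≮k)))) (zeroʳ _)

    T-power-diagonal : ∀ r k → T-power r k k ≈ x (toℕ k) ^ r
    T-power-diagonal zero    k = reflexive (𝟙-yes (k Fin.≟ k) ≡.refl)
    T-power-diagonal (suc r) k = trans (sum-single k term) (*-cong diagonal (T-power-diagonal r k))
      where
      diagonal : T k k ≈ x (toℕ k)
      diagonal = begin
        x (toℕ k) * I k k + 𝟙 (toℕ k ℕ.≟ suc (toℕ k))
          ≈⟨ +-cong (*-congˡ (reflexive (𝟙-yes (k Fin.≟ k) ≡.refl))) (reflexive (𝟙-no (toℕ k ℕ.≟ suc (toℕ k)) (ℕ.<⇒≢ ℕ.≤-refl))) ⟩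
        x (toℕ k) * 1# + 0#  ≈⟨ trans (+-identityʳ _) (*-identityʳ _) ⟩
        x (toℕ k)            ∎
      term : ∀ ρ → ρ ≢ k → T k ρ * T-power r ρ k ≈ 0#
      term ρ ρ≢k with ℕ.<-cmp (toℕ ρ) (toℕ k)
      ... | tri< ρ<k _ _ = trans (*-congʳ (T-lower k ρ ρ<k)) (zeroˡ _)
      ... | tri≈ _ ρ≡k _ = contradiction (Fin.toℕ-injective ρ≡k) ρ≢k
      ... | tri> _ _ k<ρ = trans (*-congˡ (T-power-lower r ρ k k<ρ)) (zeroʳ _)

    module _ {g q} (c : Fin q → Mat g) (r : Fin q → ℕ) where

      bigEntry triangularEntry newtonEntry : Fin n → Fin g → Fin n → Fin g → Carrier
      bigEntry        σ v τ w = sum (λ s → c s v w * P-power (r s) σ τ)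
      triangularEntry k v l w = sum (λ s → c s v w * T-power (r s) k l)
      newtonEntry     k v σ w = U k σ * I v w

      private
        Big Triangular Newton : Mat (n ℕ.* g)
        Big        = lift bigEntry
        Triangular = lift triangularEntry
        Newton     = lift newtonEntry

        exchange : ∀ (a : Fin n → Carrier) (b : Fin q → Carrier) (X : Fin q → Fin n → Carrier) →
          sum (λ σ → a σ * sum (λ s → b s * X s σ)) ≈ sum (λ s → b s * sum (λ σ → a σ * X s σ))
        exchange a b X = begin
          sum (λ σ → a σ * sum (λ s → b s * X s σ))      ≈⟨ sum-cong-≋ (λ σ → *-distribˡ-sum (a σ) (λ s → b s * X s σ)) ⟩
          sum (λ σ → sum (λ s → a σ * (b s * X s σ)))    ≈⟨ ∑-comm (λ σ s → a σ * (b s * X s σ)) ⟩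
          sum (λ s → sum (λ σ → a σ * (b s * X s σ)))    ≈⟨ sum-cong-≋ (λ s → sum-cong-≋ (λ σ →
                                                             solve 3 (λ a b x → a :* (b :* x) := b :* (a :* x)) refl (a σ) (b s) (X s σ))) ⟩
          sum (λ s → sum (λ σ → b s * (a σ * X s σ)))    ≈⟨ sum-cong-≋ (λ s → *-distribˡ-sum (b s) (λ σ → a σ * X s σ)) ⟨
          sum (λ s → b s * sum (λ σ → a σ * X s σ))      ∎

        conjugate : Newton ∙ Big ≋ Triangular ∙ Newton
        conjugate = ≋-combine {n} {g} λ k v τ w → begin
          (Newton ∙ Big) (combine k v) (combine τ w)
            ≈⟨ lift-∙ newtonEntry bigEntry k v τ w ⟩
          sum (λ σ → sum (λ u → U k σ * I v u * bigEntry σ u τ w))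
            ≈⟨ sum-cong-≋ (λ σ → trans (sum-cong-≋ (λ u → trans (*-congʳ (*-comm (U k σ) (I v u))) (*-assoc (I v u) (U k σ) _)))
                                       (sum-δ v (λ u → U k σ * bigEntry σ u τ w))) ⟩
          sum (λ σ → U k σ * bigEntry σ v τ w)
            ≈⟨ exchange (U k) (λ s → c s v w) (λ s σ → P-power (r s) σ τ) ⟩
          sum (λ s → c s v w * (U ∙ P-power (r s)) k τ)
            ≈⟨ sum-cong-≋ (λ s → *-congˡ (intertwine (r s) k τ)) ⟩
          sum (λ s → c s v w * (T-power (r s) ∙ U) k τ)
            ≈⟨ sum-cong-≋ (λ s → *-congˡ (sum-cong-≋ (λ l → *-comm (T-power (r s) k l) (U l τ)))) ⟩
          sum (λ s → c s v w * sum (λ l → U l τ * T-power (r s) k l))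
            ≈⟨ exchange (λ l → U l τ) (λ s → c s v w) (λ s l → T-power (r s) k l) ⟨
          sum (λ l → U l τ * triangularEntry k v l w)
            ≈⟨ sum-cong-≋ (λ l → trans (sum-cong-≋ (λ u → solve 3 (λ a b c → a :* (b :* c) := (b :* a) :* c) refl (triangularEntry k v l u) (U l τ) (I u w)))
                                       (sum-δʳ w (λ u → U l τ * triangularEntry k v l u))) ⟨
          sum (λ l → sum (λ u → triangularEntry k v l u * (U l τ * I u w)))
            ≈⟨ lift-∙ triangularEntry newtonEntry k v τ w ⟨
          (Triangular ∙ Newton) (combine k v) (combine τ w) ∎

        Det-Newton : Det Newton ≈ 1#
        Det-Newton = begin
          Det Newton       ≈⟨ Det-ᵀ Newton ⟨
          Det (Newton ᵀ)   ≈⟨ Det-block-triangular n {g} (Newton ᵀ) (λ k v l w l<k →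
                                trans (reflexive (lift-combine newtonEntry l w k v)) (trans (*-congʳ (U-upper l k l<k)) (zeroˡ _))) ⟩
          prod {n} (λ k → Det {g} (λ v w → Newton (combine k w) (combine k v)))
            ≈⟨ prod-one (λ k → trans (Det-cong {M = λ v w → Newton (combine k w) (combine k v)} {M′ = I ᵀ}
                 (λ v w → trans (reflexive (lift-combine newtonEntry k w k v)) (trans (*-congʳ (newton-leading x (toℕ k))) (*-identityˡ _))))
                 (trans (Det-ᵀ {g} I) (Det-I {g}))) ⟩
          1#               ∎

      -- Both sides of `conjugate` carry the factor `Det Newton`, which equals 1 since the Newton
      -- polynomials are monic; no inverse of the matrix is formed.
      Det-big : Det Big ≈ prod {n} (λ k → Det (λ v w → sum (λ s → c s v w * x (toℕ k) ^ r s)))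
      Det-big = begin
        Det Big                       ≈⟨ *-identityˡ _ ⟨
        1# * Det Big                  ≈⟨ *-congʳ Det-Newton ⟨
        Det Newton * Det Big          ≈⟨ Det-∙ Newton Big ⟨
        Det (Newton ∙ Big)            ≈⟨ Det-cong {M = Newton ∙ Big} {M′ = Triangular ∙ Newton} conjugate ⟩
        Det (Triangular ∙ Newton)     ≈⟨ Det-∙ Triangular Newton ⟩
        Det Triangular * Det Newton   ≈⟨ *-congˡ Det-Newton ⟩
        Det Triangular * 1#           ≈⟨ *-identityʳ _ ⟩
        Det Triangular
          ≈⟨ Det-block-triangular n {g} Triangular (λ k v l w l<k → trans (reflexive (lift-combine triangularEntry k v l w))
               (sum-zero (λ s → trans (*-congˡ (T-power-lower (r s) k l l<k)) (zeroʳ (c s v w))))) ⟩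
        prod {n} (λ k → Det {g} (λ v w → Triangular (combine k v) (combine k w)))
          ≈⟨ prod-cong (λ k → Det-cong {g} {λ v w → Triangular (combine k v) (combine k w)} {λ v w → sum (λ s → c s v w * x (toℕ k) ^ r s)}
               (λ v w → trans (reflexive (lift-combine triangularEntry k v k w))
                              (sum-cong-≋ (λ s → *-congˡ (T-power-diagonal (r s) k))))) ⟩
        prod {n} (λ k → Det (λ v w → sum (λ s → c s v w * x (toℕ k) ^ r s))) ∎

      -- The derived graph numbers its vertices with the layer as inner index, while block
      -- triangularity needs the layer as outer index; `φ` exchanges the two.
      Det-block-circulant : (M : Mat (g ℕ.* n)) →
        (∀ v σ w τ → M (combine v σ) (combine w τ) ≈ sum (λ s → c s v w * I (iter cyc (r s) σ) τ)) →
        Det M ≈ prod {n} (λ k → Det (λ v w → sum (λ s → c s v w * x (toℕ k) ^ r s)))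
      Det-block-circulant M h = begin
        Det M                                                 ≈⟨ Det-cong {M = M} {M′ = λ i j → Big (to i) (to j)} (≋-combine {g} {n} entries) ⟩
        Det (λ i j → Big (to i) (to j))                       ≈⟨ Det-reindex φ Big ⟩
        Det Big                                               ≈⟨ Det-big ⟩
        prod {n} (λ k → Det (λ v w → sum (λ s → c s v w * x (toℕ k) ^ r s))) ∎
        where
        φ : Fin (g ℕ.* n) ↔ Fin (n ℕ.* g)
        φ = Comp.inverse (Fin.*↔× {g} {n}) (Comp.inverse (×-comm (Fin g) (Fin n)) (Sym.inverse (Fin.*↔× {n} {g})))
        to : Fin (g ℕ.* n) → Fin (n ℕ.* g)
        to = Inverse.to φ
        to-combine : ∀ v σ → to (combine v σ) ≡ combine σ v
        to-combine v σ = ≡.cong (λ p → combine (proj₂ p) (proj₁ p)) (Fin.remQuot-combine v σ)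
        entries : ∀ v σ w τ → M (combine v σ) (combine w τ) ≈ Big (to (combine v σ)) (to (combine w τ))
        entries v σ w τ = trans (h v σ w τ) (sym (reflexive
          (≡.trans (≡.cong₂ Big (to-combine v σ) (to-combine w τ)) (lift-combine bigEntry σ v τ w))))

-- Laurent polynomials

ℤ-ring : CommutativeRing 0ℓ 0ℓ
ℤ-ring = ℤ.+-*-commutativeRing

module ℤ-theory = RingTheory ℤ-ring

ι-ℤ : ∀ z → ℤ-theory.ι z ≡ z
ι-ℤ (+ n)    = go n
  where
  go : ∀ n → ℤ-theory.ι (+ n) ≡ + n
  go zero    = ≡.refl
  go (suc n) = ≡.cong (ℤ._+_ (1ℤ)) (go n)
ι-ℤ -[1+ n ] = ≡.cong ℤ.-_ (ι-ℤ (+ suc n))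

coeff-++ : ∀ f g k → coeff (f ++ g) k ≡ coeff f k ℤ.+ coeff g k
coeff-++ []            g k = ≡.sym (ℤ.+-identityˡ _)
coeff-++ ((l , c) ∷ f) g k with l ℤ.≟ k
... | yes _ = ≡.trans (≡.cong (ℤ._+_ (c)) (coeff-++ f g k)) (≡.sym (ℤ.+-assoc c (coeff f k) (coeff g k)))
... | no  _ = coeff-++ f g k

coeff-neg : ∀ f k → coeff (List.map (λ (l , c) → l , ℤ.- c) f) k ≡ ℤ.- coeff f k
coeff-neg []            k = ≡.refl
coeff-neg ((l , c) ∷ f) k with l ℤ.≟ k
... | yes _ = ≡.trans (≡.cong (ℤ._+_ ((ℤ.- c))) (coeff-neg f k)) (≡.sym (ℤ.neg-distrib-+ c (coeff f k)))
... | no  _ = coeff-neg f k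

-- The action of `f` on coefficient functions by convolution. It linearises products of formal sums:
-- `coeff-*` computes them, and associativity becomes the composition law `conv-*`.
conv : Laurent → (ℤ → ℤ) → ℤ → ℤ
conv []            φ k = 0ℤ
conv ((l , c) ∷ f) φ k = c ℤ.* φ (k ℤ.- l) ℤ.+ conv f φ k

conv-cong : ∀ f {φ ψ} → (∀ k → φ k ≡ ψ k) → ∀ k → conv f φ k ≡ conv f ψ k
conv-cong []            h k = ≡.refl
conv-cong ((l , c) ∷ f) h k = ≡.cong₂ (λ a b → c ℤ.* a ℤ.+ b) (h (k ℤ.- l)) (conv-cong f h k)

conv-++ : ∀ f g φ k → conv (f ++ g) φ k ≡ conv f φ k ℤ.+ conv g φ k
conv-++ []            g φ k = ≡.sym (ℤ.+-identityˡ _)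
conv-++ ((l , c) ∷ f) g φ k = ≡.trans (≡.cong (ℤ._+_ (c ℤ.* φ (k ℤ.- l))) (conv-++ f g φ k)) (≡.sym (ℤ.+-assoc (c ℤ.* φ (k ℤ.- l)) (conv f φ k) (conv g φ k)))

monomial-* : ℤ × ℤ → ℤ × ℤ → ℤ × ℤ
monomial-* (k , c) (l , d) = k ℤ.+ l , c ℤ.* d

conv-monomial : ∀ l c g φ k → conv (List.map (monomial-* (l , c)) g) φ k ≡ c ℤ.* conv g φ (k ℤ.- l)
conv-monomial l c []            φ k = ≡.sym (ℤ.*-zeroʳ c)
conv-monomial l c ((m , d) ∷ g) φ k = ≡.trans
  (≡.cong₂ ℤ._+_ (≡.cong (λ j → c ℤ.* d ℤ.* φ j) (exponent k l m)) (conv-monomial l c g φ k))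
  (factor c d (φ (k ℤ.- l ℤ.- m)) (conv g φ (k ℤ.- l)))
  where
  exponent : ∀ k l m → k ℤ.- (l ℤ.+ m) ≡ k ℤ.- l ℤ.- m
  exponent = solve-∀
  factor : ∀ c d x y → c ℤ.* d ℤ.* x ℤ.+ c ℤ.* y ≡ c ℤ.* (d ℤ.* x ℤ.+ y)
  factor = solve-∀

coeff-monomial : ∀ l c g k → coeff (List.map (monomial-* (l , c)) g) k ≡ c ℤ.* coeff g (k ℤ.- l)
coeff-monomial l c []            k = ≡.sym (ℤ.*-zeroʳ c)
coeff-monomial l c ((m , d) ∷ g) k with l ℤ.+ m ℤ.≟ k | m ℤ.≟ k ℤ.- l
... | yes _    | yes _    = ≡.trans (≡.cong (ℤ._+_ (c ℤ.* d)) (coeff-monomial l c g k)) (≡.sym (ℤ.*-distribˡ-+ c d (coeff g (k ℤ.- l))))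
... | no _     | no _     = coeff-monomial l c g k
... | yes l+m≡k | no m≢   = contradiction (≡.trans (lem m l) (≡.cong (ℤ._- l) l+m≡k)) m≢
  where
  lem : ∀ m l → m ≡ l ℤ.+ m ℤ.- l
  lem = solve-∀
... | no l+m≢k | yes m≡   = contradiction (≡.trans (≡.cong (ℤ._+_ (l)) m≡) (lem k l)) l+m≢k
  where
  lem : ∀ k l → l ℤ.+ (k ℤ.- l) ≡ k
  lem = solve-∀

coeff-* : ∀ f g k → coeff (f *ᴸ g) k ≡ conv f (coeff g) k
coeff-* []            g k = ≡.refl
coeff-* ((l , c) ∷ f) g k = ≡.trans (coeff-++ (List.map (monomial-* (l , c)) g) (f *ᴸ g) k)
  (≡.cong₂ ℤ._+_ (coeff-monomial l c g k) (coeff-* f g k))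

conv-* : ∀ f g φ k → conv (f *ᴸ g) φ k ≡ conv f (conv g φ) k
conv-* []            g φ k = ≡.refl
conv-* ((l , c) ∷ f) g φ k = ≡.trans (conv-++ (List.map (monomial-* (l , c)) g) (f *ᴸ g) φ k)
  (≡.cong₂ ℤ._+_ (conv-monomial l c g φ k) (conv-* f g φ k))

conv-zero : ∀ f k → conv f (λ _ → 0ℤ) k ≡ 0ℤ
conv-zero []            k = ≡.refl
conv-zero ((l , c) ∷ f) k = ≡.trans (≡.cong₂ ℤ._+_ (ℤ.*-zeroʳ c) (conv-zero f k)) ≡.refl

conv-+ : ∀ f φ ψ k → conv f (λ k → φ k ℤ.+ ψ k) k ≡ conv f φ k ℤ.+ conv f ψ k
conv-+ []            φ ψ k = ≡.refl
conv-+ ((l , c) ∷ f) φ ψ k = ≡.trans (≡.cong (ℤ._+_ (c ℤ.* (φ (k ℤ.- l) ℤ.+ ψ (k ℤ.- l)))) (conv-+ f φ ψ k))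
  (lem c (φ (k ℤ.- l)) (ψ (k ℤ.- l)) (conv f φ k) (conv f ψ k))
  where
  lem : ∀ c a b x y → c ℤ.* (a ℤ.+ b) ℤ.+ (x ℤ.+ y) ≡ c ℤ.* a ℤ.+ x ℤ.+ (c ℤ.* b ℤ.+ y)
  lem = solve-∀

conv-singleton : ∀ l c g k → conv g (coeff ((l , c) ∷ [])) k ≡ c ℤ.* coeff g (k ℤ.- l)
conv-singleton l c []            k = ≡.sym (ℤ.*-zeroʳ c)
conv-singleton l c ((m , d) ∷ g) k with l ℤ.≟ k ℤ.- m | m ℤ.≟ k ℤ.- l
... | yes _  | yes _  = ≡.trans (≡.cong (ℤ._+_ (d ℤ.* (c ℤ.+ 0ℤ))) (conv-singleton l c g k)) (lem c d (coeff g (k ℤ.- l)))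
  where
  lem : ∀ c d x → d ℤ.* (c ℤ.+ 0ℤ) ℤ.+ c ℤ.* x ≡ c ℤ.* (d ℤ.+ x)
  lem = solve-∀
... | no _   | no _   = ≡.trans (≡.cong₂ ℤ._+_ (ℤ.*-zeroʳ d) (conv-singleton l c g k)) (ℤ.+-identityˡ _)
... | yes l≡ | no m≢  = contradiction (≡.trans (lem k m) (≡.cong (ℤ._-_ k) (≡.sym l≡))) m≢
  where
  lem : ∀ k m → m ≡ k ℤ.- (k ℤ.- m)
  lem = solve-∀
... | no l≢  | yes m≡ = contradiction (≡.trans (lem k l) (≡.cong (ℤ._-_ k) (≡.sym m≡))) l≢
  where
  lem : ∀ k l → l ≡ k ℤ.- (k ℤ.- l)
  lem = solve-∀

*ᴸ-comm : ∀ f g → f *ᴸ g ≈ᴸ g *ᴸ f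
*ᴸ-comm f g k = ≡.trans (coeff-* f g k) (≡.trans (go f) (≡.sym (coeff-* g f k)))
  where
  go : ∀ f → conv f (coeff g) k ≡ conv g (coeff f) k
  go []            = ≡.sym (conv-zero g k)
  go ((l , c) ∷ f) = begin
    c ℤ.* coeff g (k ℤ.- l) ℤ.+ conv f (coeff g) k           ≡⟨ ≡.cong₂ ℤ._+_ (≡.sym (conv-singleton l c g k)) (go f) ⟩
    conv g (coeff ((l , c) ∷ [])) k ℤ.+ conv g (coeff f) k   ≡⟨ conv-+ g (coeff ((l , c) ∷ [])) (coeff f) k ⟨
    conv g (λ k → coeff ((l , c) ∷ []) k ℤ.+ coeff f k) k    ≡⟨ conv-cong g (λ j → coeff-++ ((l , c) ∷ []) f j) k ⟨
    conv g (coeff ((l , c) ∷ f)) k                           ∎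
    where open ≡-Reasoning

*ᴸ-congˡ : ∀ f {g g′} → g ≈ᴸ g′ → f *ᴸ g ≈ᴸ f *ᴸ g′
*ᴸ-congˡ f {g} {g′} h k = ≡.trans (coeff-* f g k) (≡.trans (conv-cong f h k) (≡.sym (coeff-* f g′ k)))

-- `conv f` is defined by recursion on the formal sum `f` but sees `g` only through its
-- coefficients, so the right argument is easy; commutativity carries this over to the left.
*ᴸ-cong : ∀ {f f′ g g′} → f ≈ᴸ f′ → g ≈ᴸ g′ → f *ᴸ g ≈ᴸ f′ *ᴸ g′
*ᴸ-cong {f} {f′} {g} {g′} h h′ k = ≡.trans (*ᴸ-congˡ f h′ k) (≡.trans (*ᴸ-comm f g′ k)
  (≡.trans (*ᴸ-congˡ g′ h k) (*ᴸ-comm g′ f′ k)))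

*ᴸ-assoc : ∀ f g h → (f *ᴸ g) *ᴸ h ≈ᴸ f *ᴸ (g *ᴸ h)
*ᴸ-assoc f g h k = begin
  coeff ((f *ᴸ g) *ᴸ h) k           ≡⟨ coeff-* (f *ᴸ g) h k ⟩
  conv (f *ᴸ g) (coeff h) k         ≡⟨ conv-* f g (coeff h) k ⟩
  conv f (conv g (coeff h)) k       ≡⟨ conv-cong f (coeff-* g h) k ⟨
  conv f (coeff (g *ᴸ h)) k         ≡⟨ coeff-* f (g *ᴸ h) k ⟨
  coeff (f *ᴸ (g *ᴸ h)) k           ∎
  where open ≡-Reasoning

t^-coeff : ∀ l f k → coeff (t^ l *ᴸ f) k ≡ coeff f (k ℤ.- l)
t^-coeff l f k = ≡.trans (coeff-* (t^ l) f k) (≡.trans (ℤ.+-identityʳ _) (ℤ.*-identityˡ _))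

*ᴸ-identityˡ : ∀ f → const 1ℤ *ᴸ f ≈ᴸ f
*ᴸ-identityˡ f k = ≡.trans (t^-coeff 0ℤ f k) (≡.cong (coeff f) (ℤ.+-identityʳ k))

*ᴸ-distribˡ : ∀ f g h → f *ᴸ (g ++ h) ≈ᴸ (f *ᴸ g) ++ (f *ᴸ h)
*ᴸ-distribˡ f g h k = begin
  coeff (f *ᴸ (g ++ h)) k                       ≡⟨ coeff-* f (g ++ h) k ⟩
  conv f (coeff (g ++ h)) k                     ≡⟨ conv-cong f (coeff-++ g h) k ⟩
  conv f (λ k → coeff g k ℤ.+ coeff h k) k      ≡⟨ conv-+ f (coeff g) (coeff h) k ⟩
  conv f (coeff g) k ℤ.+ conv f (coeff h) k     ≡⟨ ≡.cong₂ ℤ._+_ (coeff-* f g k) (coeff-* f h k) ⟨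
  coeff (f *ᴸ g) k ℤ.+ coeff (f *ᴸ h) k         ≡⟨ coeff-++ (f *ᴸ g) (f *ᴸ h) k ⟨
  coeff ((f *ᴸ g) ++ (f *ᴸ h)) k                ∎
  where open ≡-Reasoning

laurentRing : CommutativeRing 0ℓ 0ℓ
laurentRing = record
  { RawRing ℤ[t^±1]
  ; isCommutativeRing = record
    { isRing = record
      { +-isAbelianGroup = record
        { isGroup = record
          { isMonoid = record
            { isSemigroup = record
              { isMagma = record
                { isEquivalence = record
                  { refl  = λ k → ≡.refl
                  ; sym   = λ h k → ≡.sym (h k)
                  ; trans = λ h h′ k → ≡.trans (h k) (h′ k) }
                ; ∙-cong = λ {f} {f′} {g} {g′} h h′ k → ≡.trans (coeff-++ f g k)
                    (≡.trans (≡.cong₂ ℤ._+_ (h k) (h′ k)) (≡.sym (coeff-++ f′ g′ k))) }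
              ; assoc = λ f g h k → ≡.cong (λ l → coeff l k) (List.++-assoc f g h) }
            ; identity = (λ f k → ≡.refl) , (λ f k → ≡.cong (λ l → coeff l k) (List.++-identityʳ f)) }
          ; inverse = (λ f k → ≡.trans (coeff-++ (neg f) f k) (≡.trans (≡.cong (ℤ._+ coeff f k) (coeff-neg f k)) (ℤ.+-inverseˡ (coeff f k))))
                    , (λ f k → ≡.trans (coeff-++ f (neg f) k) (≡.trans (≡.cong (ℤ._+_ (coeff f k)) (coeff-neg f k)) (ℤ.+-inverseʳ (coeff f k))))
          ; ⁻¹-cong = λ {f} {g} h k → ≡.trans (coeff-neg f k) (≡.trans (≡.cong ℤ.-_ (h k)) (≡.sym (coeff-neg g k))) }
        ; comm = λ f g k → ≡.trans (coeff-++ f g k) (≡.trans (ℤ.+-comm (coeff f k) (coeff g k)) (≡.sym (coeff-++ g f k))) }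
      ; *-cong = λ {f} {f′} {g} {g′} → *ᴸ-cong {f} {f′} {g} {g′}
      ; *-assoc = *ᴸ-assoc
      ; *-identity = *ᴸ-identityˡ , λ f k → ≡.trans (*ᴸ-comm f (const 1ℤ) k) (*ᴸ-identityˡ f k)
      ; distrib = *ᴸ-distribˡ , λ f g h k → ≡.trans (*ᴸ-comm (g ++ h) f k) (≡.trans (*ᴸ-distribˡ f g h k)
          (≡.trans (coeff-++ (f *ᴸ g) (f *ᴸ h) k) (≡.trans (≡.cong₂ ℤ._+_ (*ᴸ-comm f g k) (*ᴸ-comm f h k)) (≡.sym (coeff-++ (g *ᴸ f) (h *ᴸ f) k))))) }
    ; *-comm = *ᴸ-comm } }
  where
  neg : Laurent → Laurent
  neg = List.map (λ (l , c) → l , ℤ.- c)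

module DetHomomorphism (S : RawRing 0ℓ 0ℓ) (R : CommutativeRing 0ℓ 0ℓ) where
  private module S = RawRing S
  open CommutativeRing R hiding (zero)
  open RingTheory R
  open import Algebra.Definitions.RawSemiring S.rawSemiring using () renaming (sum to sumˢ; _^_ to _^ˢ_)
  open import Algebra.Properties.Semiring.Exp semiring using (_^_; ^-congˡ)
  open import Algebra.Properties.Semiring.Sum semiring using (sum; sum-cong-≋)

  record IsRawHomomorphism (h : S.Carrier → Carrier) : Set where
    field
      +-homo   : ∀ a b → h (a S.+ b) ≈ h a + h b
      *-homo   : ∀ a b → h (a S.* b) ≈ h a * h b
      neg-homo : ∀ a → h (S.- a) ≈ - h a
      0-homo   : h S.0# ≈ 0#
      1-homo   : h S.1# ≈ 1#

    sum-homo : ∀ {n} (f : Fin n → S.Carrier) → h (sumˢ f) ≈ sum (h ∘ f)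
    sum-homo {zero}  f = 0-homo
    sum-homo {suc n} f = trans (+-homo _ _) (+-congˡ (sum-homo (f ∘ suc)))

    ^-homo : ∀ a n → h (a ^ˢ n) ≈ h a ^ n
    ^-homo a zero    = 1-homo
    ^-homo a (suc n) = trans (*-homo a (a ^ˢ n)) (*-congˡ (^-homo a n))

    det-homo : ∀ {n} (M : Matrix S n) → h (det S M) ≈ Det (λ i j → h (M i j))
    det-homo {zero}  M = 1-homo
    det-homo {suc n} M = trans (sum-homo (λ j → ((S.- S.1#) ^ˢ toℕ j) S.* (M zero j S.* det S (λ i k → M (suc i) (Fin.punchIn j k)))))
      (sum-cong-≋ (λ j → trans (*-homo _ _)
        (*-cong (trans (^-homo (S.- S.1#) (toℕ j)) (^-congˡ (toℕ j) (trans (neg-homo S.1#) (-‿cong 1-homo))))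
                (trans (*-homo _ _) (*-congˡ {h (M zero j)} (det-homo (λ i k → M (suc i) (Fin.punchIn j k))))))))

module Evaluation (R : CommutativeRing 0ℓ 0ℓ) (φ : ℤ → CommutativeRing.Carrier R) where
  open CommutativeRing R hiding (zero)
  open RingTheory R
  open Solver using (solve; _:=_; _:+_; _:*_; :-_; con)
  open import Relation.Binary.Reasoning.Setoid setoid

  -- `φ` is an arbitrary function of the exponent: powers of a root give evaluation at it, a
  -- Kronecker delta gives a coefficient, and the constant 1 gives the value at 1.
  ev : Laurent → Carrier
  ev []            = 0#
  ev ((k , c) ∷ f) = ι c * φ k + ev f

  ev-++ : ∀ f g → ev (f ++ g) ≈ ev f + ev g
  ev-++ []            g = sym (+-identityˡ _)
  ev-++ ((k , c) ∷ f) g = trans (+-congˡ (ev-++ f g)) (sym (+-assoc _ _ _))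

  ev-neg : ∀ f → ev (List.map (λ (l , c) → l , ℤ.- c) f) ≈ - ev f
  ev-neg []            = solve 0 (con 0ℤ := :- con 0ℤ) refl
  ev-neg ((k , c) ∷ f) = trans (+-cong (*-congʳ (ι-neg c)) (ev-neg f))
    (solve 3 (λ c x y → :- c :* x :+ :- y := :- (c :* x :+ y)) refl (ι c) (φ k) (ev f))

  without : ℤ → Laurent → Laurent
  without k = filter (λ (l , _) → ¬? (l ℤ.≟ k))

  ev-without : ∀ k f → ev f ≈ ι (coeff f k) * φ k + ev (without k f)
  ev-without k []            = sym (trans (+-congʳ (zeroˡ _)) (+-identityʳ _))
  ev-without k ((l , c) ∷ f) with l ℤ.≟ k
  ... | yes ≡.refl = trans (+-congˡ (ev-without k f)) (trans
          (solve 4 (λ c x d y → c :* x :+ (d :* x :+ y) := (c :+ d) :* x :+ y) refl (ι c) (φ k) (ι (coeff f k)) (ev (without k f)))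
          (+-congʳ (*-congʳ (sym (ι-+ c (coeff f k))))))
  ... | no _ = trans (+-congˡ (ev-without k f))
          (solve 3 (λ a b y → a :+ (b :+ y) := b :+ (a :+ y)) refl (ι c * φ l) (ι (coeff f k) * φ k) (ev (without k f)))

  coeff-without-same : ∀ k f → coeff (without k f) k ≡ 0ℤ
  coeff-without-same k []            = ≡.refl
  coeff-without-same k ((l , c) ∷ f) with l ℤ.≟ k
  ... | yes _  = coeff-without-same k f
  ... | no l≢k with l ℤ.≟ k
  ...   | yes l≡k = contradiction l≡k l≢k
  ...   | no _    = coeff-without-same k f

  coeff-without-other : ∀ k f j → j ≢ k → coeff (without k f) j ≡ coeff f j
  coeff-without-other k []            j j≢k = ≡.refl
  coeff-without-other k ((l , c) ∷ f) j j≢k with l ℤ.≟ k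
  ... | yes ≡.refl with l ℤ.≟ j
  ...   | yes l≡j = contradiction (≡.sym l≡j) j≢k
  ...   | no _    = coeff-without-other k f j j≢k
  coeff-without-other k ((l , c) ∷ f) j j≢k | no _ with l ℤ.≟ j
  ...   | yes _ = ≡.cong (ℤ._+_ (c)) (coeff-without-other k f j j≢k)
  ...   | no _  = coeff-without-other k f j j≢k

  coeff-without-zero : ∀ k f → (∀ j → j ≢ k → coeff f j ≡ 0ℤ) → without k f ≈ᴸ []
  coeff-without-zero k f h j with j ℤ.≟ k
  ... | yes ≡.refl = coeff-without-same k f
  ... | no j≢k     = ≡.trans (coeff-without-other k f j j≢k) (h j j≢k)

  -- A formal sum with zero coefficients may still contain terms that cancel each other. All terms
  -- with the exponent of the head are collected and removed at once; the list gets shorter and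
  -- still has zero coefficients.
  ev-zero : ∀ n f → length f ℕ.≤ n → f ≈ᴸ [] → ev f ≈ 0#
  ev-zero n       []              _  _ = refl
  ev-zero (suc n) ((k , c) ∷ f) (ℕ.s≤s f≤n) h = begin
    ι c * φ k + ev f                                        ≈⟨ +-congˡ (ev-without k f) ⟩
    ι c * φ k + (ι (coeff f k) * φ k + ev (without k f))
      ≈⟨ solve 4 (λ c x d y → c :* x :+ (d :* x :+ y) := (c :+ d) :* x :+ y) refl (ι c) (φ k) (ι (coeff f k)) (ev (without k f)) ⟩
    (ι c + ι (coeff f k)) * φ k + ev (without k f)
      ≈⟨ +-cong (*-congʳ (trans (sym (ι-+ c (coeff f k))) (reflexive (≡.cong ι (≡.trans (≡.sym head-coeff) (h k))))))
                (ev-zero n (without k f) (ℕ.≤-trans (List.length-filter _ f) f≤n)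
                  (coeff-without-zero k f (λ j j≢k → ≡.trans (≡.sym (tail-coeff j j≢k)) (h j)))) ⟩
    0# * φ k + 0#                                           ≈⟨ trans (+-identityʳ _) (zeroˡ _) ⟩
    0#                                                      ∎
    where
    head-coeff : coeff ((k , c) ∷ f) k ≡ c ℤ.+ coeff f k
    head-coeff with k ℤ.≟ k
    ... | yes _  = ≡.refl
    ... | no k≢k = contradiction ≡.refl k≢k
    tail-coeff : ∀ j → j ≢ k → coeff ((k , c) ∷ f) j ≡ coeff f j
    tail-coeff j j≢k with k ℤ.≟ j
    ... | yes k≡j = contradiction (≡.sym k≡j) j≢k
    ... | no _    = ≡.refl

  ev-cong : ∀ {f g} → f ≈ᴸ g → ev f ≈ ev g
  ev-cong {f} {g} h = begin
    ev f                          ≈⟨ solve 2 (λ x y → x := x :+ :- y :+ y) refl (ev f) (ev g) ⟩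
    ev f + - ev g + ev g          ≈⟨ +-congʳ (+-congˡ (ev-neg g)) ⟨
    ev f + ev (neg g) + ev g      ≈⟨ +-congʳ (ev-++ f (neg g)) ⟨
    ev (f ++ neg g) + ev g        ≈⟨ +-congʳ (ev-zero _ (f ++ neg g) ℕ.≤-refl difference) ⟩
    0# + ev g                     ≈⟨ +-identityˡ _ ⟩
    ev g                          ∎
    where
    neg : Laurent → Laurent
    neg = List.map (λ (l , c) → l , ℤ.- c)
    difference : f ++ neg g ≈ᴸ []
    difference k = ≡.trans (coeff-++ f (neg g) k) (≡.trans (≡.cong₂ ℤ._+_ (h k) (coeff-neg g k)) (ℤ.+-inverseʳ (coeff g k)))

  module Multiplicative (φ-0 : φ 0ℤ ≈ 1#) (φ-+ : ∀ k l → φ (k ℤ.+ l) ≈ φ k * φ l) where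
    open DetHomomorphism ℤ[t^±1] R public

    ev-* : ∀ f g → ev (f *ᴸ g) ≈ ev f * ev g
    ev-* []            g = sym (zeroˡ _)
    ev-* ((k , c) ∷ f) g = trans (ev-++ (List.map (monomial-* (k , c)) g) (f *ᴸ g))
      (trans (+-cong (monomial g) (ev-* f g)) (sym (distribʳ (ev g) _ _)))
      where
      monomial : ∀ g → ev (List.map (monomial-* (k , c)) g) ≈ ι c * φ k * ev g
      monomial []            = sym (zeroʳ _)
      monomial ((l , d) ∷ g) = trans (+-cong (*-cong (ι-* c d) (φ-+ k l)) (monomial g))
        (solve 5 (λ c d x y z → (c :* d) :* (x :* y) :+ c :* x :* z := c :* x :* (d :* y :+ z)) refl (ι c) (ι d) (φ k) (φ l) (ev g))

    ev-homomorphism : IsRawHomomorphism ev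
    ev-homomorphism = record
      { +-homo = ev-++ ; *-homo = ev-* ; neg-homo = ev-neg ; 0-homo = refl
      ; 1-homo = trans (+-identityʳ _) (trans (*-cong ι-1 φ-0) (*-identityˡ 1#)) }

    ev-t^ : ∀ k → ev (t^ k) ≈ φ k
    ev-t^ k = trans (+-identityʳ _) (trans (*-congʳ ι-1) (*-identityˡ _))

-- The Ihara polynomial

δ : ℤ → ℤ → ℤ
δ k l = ℤ-theory.𝟙 (l ℤ.≟ k)

-- With coefficients as an instance of `ev`, the entry formula `ev-iharaMatrix`, proved for every
-- `φ`, also describes the Ihara matrix coefficientwise.
coeff≡ev : ∀ f k → coeff f k ≡ Evaluation.ev ℤ-ring (δ k) f
coeff≡ev []            k = ≡.refl
coeff≡ev ((l , c) ∷ f) k with l ℤ.≟ k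
... | yes _ = ≡.cong₂ ℤ._+_ (≡.sym (≡.trans (ℤ.*-identityʳ _) (ι-ℤ c))) (coeff≡ev f k)
... | no _  = ≡.trans (coeff≡ev f k) (≡.sym (≡.trans (≡.cong (ℤ._+ Evaluation.ev ℤ-ring (δ k) f) (ℤ.*-zeroʳ (ℤ-theory.ι c))) (ℤ.+-identityˡ _)))

module IharaMatrix {X : Graph} (fin : Finite X) (vol : Voltage X ℤ-group) where
  open Graph X
  open Finite fin
  open Voltage vol
  open SpanningTrees fin

  iharaMatrix : Matrix ℤ[t^±1] #V
  iharaMatrix i j = degreeMatrix fin vol i j ++ List.map (λ (l , c) → l , ℤ.- c) (voltageMatrix fin vol i j)

  module _ (R : CommutativeRing 0ℓ 0ℓ) (φ : ℤ → CommutativeRing.Carrier R) where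
    open CommutativeRing R hiding (zero)
    open RingTheory R
    open Evaluation R φ
    open import Algebra.Properties.Semiring.Sum semiring
    open import Relation.Binary.Reasoning.Setoid setoid

    outDegree : Fin #V → Carrier
    outDegree v = sum (λ a → 𝟙 (oᶠ a Fin.≟ v))

    ev-monomials : ∀ {P : E → Set} (P? : Decidable P) {m} (h : Fin m → E) →
      ev (List.map (λ e → α e , 1ℤ) (filter P? (List.tabulate h))) ≈ sum (λ a → 𝟙 (P? (h a)) * φ (α (h a)))
    ev-monomials P? {zero}  h = refl
    ev-monomials P? {suc m} h with P? (h zero)
    ... | yes _ = +-cong (*-congʳ ι-1) (ev-monomials P? (h ∘ suc))
    ... | no _  = sym (trans (+-cong (zeroˡ _) (sym (ev-monomials P? (h ∘ suc)))) (+-identityˡ _))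

    ι-count : ∀ {P : E → Set} (P? : Decidable P) {m} (h : Fin m → E) →
      ι (+ length (filter P? (List.tabulate h))) ≈ sum (λ a → 𝟙 (P? (h a)))
    ι-count P? {zero}  h = refl
    ι-count P? {suc m} h with P? (h zero)
    ... | yes _ = +-congˡ (ι-count P? (h ∘ suc))
    ... | no _  = trans (ι-count P? (h ∘ suc)) (sym (+-identityˡ _))

    edges≡ : edges ≡ List.tabulate edge
    edges≡ = List.map-tabulate (λ a → a) edge

    o≟ : ∀ e v → 𝟙 (o e ≟ᵥ vertex v) ≡ 𝟙 (ix (o e) Fin.≟ v)
    o≟ e v = 𝟙-cong (o e ≟ᵥ vertex v) (ix (o e) Fin.≟ v)
      (λ eq → ≡.trans (≡.cong ix eq) (ix-vertex v)) (λ eq → ≡.trans (≡.sym (vertex-ix _)) (≡.cong vertex eq))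

    ev-degreeMatrix : ∀ i j → ev (degreeMatrix fin vol i j) ≈ I i j * outDegree i * φ 0ℤ
    ev-degreeMatrix i j with i Fin.≟ j
    ... | yes ≡.refl = trans (+-identityʳ _) (*-congʳ (trans degree (sym (*-identityˡ _))))
      where
      degree : ι (+ length (filter (λ e → o e ≟ᵥ vertex i) edges)) ≈ outDegree i
      degree rewrite edges≡ = trans (ι-count (λ e → o e ≟ᵥ vertex i) edge) (sum-cong-≋ (λ a → reflexive (o≟ (edge a) i)))
    ... | no i≢j = trans (trans (+-identityʳ _) (zeroˡ _)) (sym (trans (*-congʳ (zeroˡ _)) (zeroˡ _)))

    ev-voltageMatrix : ∀ i j → ev (voltageMatrix fin vol i j) ≈ sum (λ a → 𝟙 (oᶠ a Fin.≟ i) * I (tᶠ a) j * φ (α (edge a)))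
    ev-voltageMatrix i j rewrite edges≡ = trans
      (ev-monomials (λ e → (o e ≟ᵥ vertex i) ×-dec (t e ≟ᵥ vertex j)) edge)
      (sum-cong-≋ (λ a → *-congʳ (trans (𝟙-× (o (edge a) ≟ᵥ vertex i) (t (edge a) ≟ᵥ vertex j)) (*-cong (reflexive (o≟ (edge a) i)) (reflexive
        (𝟙-cong (t (edge a) ≟ᵥ vertex j) (tᶠ a Fin.≟ j)
          (λ eq → ≡.trans (≡.cong ix eq) (ix-vertex j)) (λ eq → ≡.trans (≡.sym (vertex-ix _)) (≡.cong vertex eq))))))))
      where
      𝟙-× : ∀ {P Q : Set} (p : Dec P) (q : Dec Q) → 𝟙 (p ×-dec q) ≈ 𝟙 p * 𝟙 q
      𝟙-× (yes _) (yes _) = sym (*-identityˡ 1#)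
      𝟙-× (yes _) (no _)  = sym (zeroʳ _)
      𝟙-× (no _)  q       = sym (zeroˡ _)

    ev-iharaMatrix : ∀ i j → ev (iharaMatrix i j) ≈
      I i j * outDegree i * φ 0ℤ + - sum (λ a → 𝟙 (oᶠ a Fin.≟ i) * I (tᶠ a) j * φ (α (edge a)))
    ev-iharaMatrix i j = trans (ev-++ (degreeMatrix fin vol i j) _)
      (+-cong (ev-degreeMatrix i j) (trans (ev-neg (voltageMatrix fin vol i j)) (-‿cong (ev-voltageMatrix i j))))

  private
    flip : Laurent → Laurent
    flip = List.map (λ (l , c) → ℤ.- l , c)

    coeff-flip : ∀ f k → coeff (flip f) k ≡ coeff f (ℤ.- k)
    coeff-flip []            k = ≡.refl
    coeff-flip ((l , c) ∷ f) k with ℤ.- l ℤ.≟ k | l ℤ.≟ ℤ.- k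
    ... | yes _   | yes _   = ≡.cong (ℤ._+_ c) (coeff-flip f k)
    ... | no _    | no _    = coeff-flip f k
    ... | yes eq  | no neq  = contradiction (≡.trans (≡.sym (ℤ.neg-involutive l)) (≡.cong ℤ.-_ eq)) neq
    ... | no neq  | yes eq  = contradiction (≡.trans (≡.cong ℤ.-_ eq) (ℤ.neg-involutive k)) neq

    flip-* : ∀ f g → flip (f *ᴸ g) ≡ flip f *ᴸ flip g
    flip-* []            g = ≡.refl
    flip-* ((l , c) ∷ f) g = ≡.trans (List.map-++ _ (List.map (monomial-* (l , c)) g) (f *ᴸ g))
      (≡.cong₂ _++_ (≡.trans (≡.sym (List.map-∘ g)) (≡.trans (List.map-cong (λ (m , d) → ≡.cong (_, c ℤ.* d) (ℤ.neg-distrib-+ l m)) g) (List.map-∘ g)))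
                    (flip-* f g))

    open DetHomomorphism ℤ[t^±1] laurentRing

    flip-homomorphism : IsRawHomomorphism flip
    flip-homomorphism = record
      { +-homo   = λ f g k → ≡.cong (λ l → coeff l k) (List.map-++ _ f g)
      ; *-homo   = λ f g k → ≡.cong (λ l → coeff l k) (flip-* f g)
      ; neg-homo = λ f k → ≡.cong (λ l → coeff l k) (≡.trans (≡.sym (List.map-∘ f)) (List.map-∘ f))
      ; 0-homo   = λ k → ≡.refl
      ; 1-homo   = λ k → ≡.refl }

    inverseEdge : Perm.Permutation #E #E
    inverseEdge = Perm.permutation bar bar bar-bar bar-bar
      where
      bar : Fin #E → Fin #E
      bar a = eix (inv (edge a))
      bar-bar : ∀ a → bar (bar a) ≡ a
      bar-bar a = ≡.trans (≡.cong (eix ∘ inv) (edge-eix _)) (≡.trans (≡.cong eix (inv-inv _)) (eix-edge a))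

    -- Summing over inverse edges exchanges origin and terminus and negates the voltage; the
    -- diagonal degree matrix is constant in t.
    flip-entry : ∀ i j k → coeff (flip (iharaMatrix i j)) k ≡ coeff (iharaMatrix j i) k
    flip-entry i j k = begin
      coeff (flip (iharaMatrix i j)) k                           ≡⟨ coeff-flip (iharaMatrix i j) k ⟩
      coeff (iharaMatrix i j) (ℤ.- k)                            ≡⟨ coeff≡ev (iharaMatrix i j) (ℤ.- k) ⟩
      Evaluation.ev ℤ-ring (δ (ℤ.- k)) (iharaMatrix i j)         ≡⟨ ev-iharaMatrix ℤ-ring (δ (ℤ.- k)) i j ⟩
      I i j ℤ.* deg i ℤ.* δ (ℤ.- k) 0ℤ ℤ.- sum (S (ℤ.- k) i j)   ≡⟨ ≡.cong₂ ℤ._-_ diagonal offDiagonal ⟩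
      I j i ℤ.* deg j ℤ.* δ k 0ℤ ℤ.- sum (S k j i)               ≡⟨ ev-iharaMatrix ℤ-ring (δ k) j i ⟨
      Evaluation.ev ℤ-ring (δ k) (iharaMatrix j i)               ≡⟨ coeff≡ev (iharaMatrix j i) k ⟨
      coeff (iharaMatrix j i) k                                  ∎
      where
      open ≡-Reasoning
      open ℤ-theory using (I; 𝟙; 𝟙-cong; I-off)
      open import Algebra.Properties.Semiring.Sum (CommutativeRing.semiring ℤ-ring) using (sum; sum-cong-≗; ∑-permute)
      deg : Fin #V → ℤ
      deg = outDegree ℤ-ring (δ k)
      S : ℤ → Fin #V → Fin #V → Fin #E → ℤ
      S k i j a = 𝟙 (oᶠ a Fin.≟ i) ℤ.* I (tᶠ a) j ℤ.* δ k (α (edge a))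
      diagonal : I i j ℤ.* deg i ℤ.* δ (ℤ.- k) 0ℤ ≡ I j i ℤ.* deg j ℤ.* δ k 0ℤ
      diagonal with i Fin.≟ j
      ... | yes ≡.refl = ≡.cong₂ ℤ._*_ (≡.cong (ℤ._* deg i) (≡.sym (ℤ-theory.𝟙-yes (i Fin.≟ i) ≡.refl)))
              (𝟙-cong (0ℤ ℤ.≟ ℤ.- k) (0ℤ ℤ.≟ k) (λ eq → ≡.trans (≡.cong ℤ.-_ eq) (ℤ.neg-involutive k)) (≡.cong (ℤ.-_)))
      ... | no i≢j = ≡.trans (≡.cong (ℤ._* δ (ℤ.- k) 0ℤ) (ℤ.*-zeroˡ (deg i)))
              (≡.sym (≡.trans (≡.cong (λ z → z ℤ.* deg j ℤ.* δ k 0ℤ) (I-off (i≢j ∘ ≡.sym))) (≡.cong (ℤ._* δ k 0ℤ) (ℤ.*-zeroˡ (deg j)))))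
      reversed : ∀ a → S (ℤ.- k) i j (inverseEdge Perm.⟨$⟩ʳ a) ≡ S k j i a
      reversed a = ≡.trans (≡.cong₂ ℤ._*_
        (≡.trans (≡.cong₂ ℤ._*_
          (≡.cong (λ v → 𝟙 (v Fin.≟ i)) (≡.trans (≡.cong (ix ∘ o) (edge-eix _)) (≡.cong ix (o-inv _))))
          (≡.cong (λ v → I v j) (≡.trans (≡.cong (ix ∘ t) (edge-eix _)) (≡.cong ix (t-inv _)))))
          (ℤ.*-comm (𝟙 (tᶠ a Fin.≟ i)) (I (oᶠ a) j)))
        (≡.trans (≡.cong (δ (ℤ.- k)) (≡.trans (≡.cong α (edge-eix _)) (α-inv (edge a))))
          (𝟙-cong (ℤ.- α (edge a) ℤ.≟ ℤ.- k) (α (edge a) ℤ.≟ k) ℤ.neg-injective (≡.cong (ℤ.-_))))) ≡.refl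
      offDiagonal : sum (S (ℤ.- k) i j) ≡ sum (S k j i)
      offDiagonal = ≡.trans (∑-permute (S (ℤ.- k) i j) inverseEdge) (sum-cong-≗ reversed)

  -- Substituting t⁻¹ is a ring homomorphism, hence compatible with `det`, and it transposes the
  -- Ihara matrix.
  ihara-symmetric : ∀ k → coeff (iharaPolynomial fin vol) (ℤ.- k) ≡ coeff (iharaPolynomial fin vol) k
  ihara-symmetric k = begin
    coeff (iharaPolynomial fin vol) (ℤ.- k)                         ≡⟨ coeff-flip (iharaPolynomial fin vol) k ⟨
    coeff (flip (iharaPolynomial fin vol)) k                        ≡⟨ IsRawHomomorphism.det-homo flip-homomorphism iharaMatrix k ⟩
    coeff (Det (λ i j → flip (iharaMatrix i j))) k                  ≡⟨ Det-cong {M = λ i j → flip (iharaMatrix i j)} {M′ = iharaMatrix ᵀ} flip-entry k ⟩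
    coeff (Det (iharaMatrix ᵀ)) k                                   ≡⟨ Det-ᵀ iharaMatrix k ⟩
    coeff (iharaPolynomial fin vol) k                               ∎
    where
    open ≡-Reasoning
    open RingTheory laurentRing
    open Determinants laurentRing

-- Splitting off the root 1 and centring symmetric Laurent polynomials

module ℤ-polynomials = PolynomialRoots ℤ-ring

laurentFrom : ℕ → ℕ → (ℕ → ℤ) → Laurent
laurentFrom zero    j c = []
laurentFrom (suc n) j c = (+ j , c j) ∷ laurentFrom n (suc j) c

coeff-laurentFrom-below : ∀ n j c i → i ℕ.< j → coeff (laurentFrom n j c) (+ i) ≡ 0ℤ
coeff-laurentFrom-below zero    j c i i<j = ≡.refl
coeff-laurentFrom-below (suc n) j c i i<j with + j ℤ.≟ + i
... | yes eq = contradiction (≡.sym (ℤ.+-injective eq)) (ℕ.<⇒≢ i<j)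
... | no _   = coeff-laurentFrom-below n (suc j) c i (ℕ.m≤n⇒m≤1+n i<j)

coeff-laurentFrom-at : ∀ n j c i → j ℕ.≤ i → i ℕ.< j ℕ.+ n → coeff (laurentFrom n j c) (+ i) ≡ c i
coeff-laurentFrom-at zero    j c i j≤i i<j = contradiction (ℕ.<-≤-trans i<j (ℕ.≤-trans (ℕ.≤-reflexive (ℕ.+-identityʳ j)) j≤i)) (ℕ.<-irrefl ≡.refl)
coeff-laurentFrom-at (suc n) j c i j≤i i<j with + j ℤ.≟ + i
... | yes ≡.refl = ≡.trans (≡.cong (ℤ._+_ (c j)) (coeff-laurentFrom-below n (suc j) c j ℕ.≤-refl)) (ℤ.+-identityʳ (c j))
... | no neq     = coeff-laurentFrom-at n (suc j) c i (ℕ.≤∧≢⇒< j≤i (neq ∘ ≡.cong +_)) (≡.subst (i ℕ.<_) (ℕ.+-suc j n) i<j)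

coeff-laurentFrom-beyond : ∀ n j c i → j ℕ.+ n ℕ.≤ i → coeff (laurentFrom n j c) (+ i) ≡ 0ℤ
coeff-laurentFrom-beyond zero    j c i j≤i = ≡.refl
coeff-laurentFrom-beyond (suc n) j c i j≤i with + j ℤ.≟ + i
... | yes ≡.refl = contradiction j≤i (ℕ.<⇒≱ (ℕ.m<m+n j ℕ.z<s))
... | no _       = coeff-laurentFrom-beyond n (suc j) c i (≡.subst (ℕ._≤ i) (ℕ.+-suc j n) j≤i)

coeff-laurentFrom-neg : ∀ n j c i → coeff (laurentFrom n j c) -[1+ i ] ≡ 0ℤ
coeff-laurentFrom-neg zero    j c i = ≡.refl
coeff-laurentFrom-neg (suc n) j c i with + j ℤ.≟ -[1+ i ]
... | no _ = coeff-laurentFrom-neg n (suc j) c i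

module _ (d : ℕ) (c : ℕ → ℤ) where

  laurent : Laurent
  laurent = laurentFrom (suc d) 0 c

  coeff-laurent : (∀ j → d ℕ.< j → c j ≡ 0ℤ) → ∀ i → coeff laurent (+ i) ≡ c i
  coeff-laurent above i with i ℕ.≤? d
  ... | yes i≤d = coeff-laurentFrom-at (suc d) 0 c i ℕ.z≤n (ℕ.s≤s i≤d)
  ... | no i≰d  = ≡.trans (coeff-laurentFrom-beyond (suc d) 0 c i (ℕ.≰⇒> i≰d)) (≡.sym (above i (ℕ.≰⇒> i≰d)))

t-1-* : ∀ d c → (∀ j → d ℕ.< j → c j ≡ 0ℤ) → ∀ c′ → (∀ j → suc d ℕ.< j → c′ j ≡ 0ℤ) →
        (∀ j → ℤ-polynomials.times-root 1ℤ c j ≡ c′ j) → t-1 *ᴸ laurent d c ≈ᴸ laurent (suc d) c′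
t-1-* d c above c′ above′ factor k = ≡.trans (coeff-* t-1 (laurent d c) k) (go k)
  where
  lem : ∀ x y → 1ℤ ℤ.* x ℤ.+ (-1ℤ ℤ.* y ℤ.+ 0ℤ) ≡ x ℤ.- 1ℤ ℤ.* y
  lem = solve-∀
  go : ∀ k → conv t-1 (coeff (laurent d c)) k ≡ coeff (laurent (suc d) c′) k
  go k = ≡.trans (lem (coeff (laurent d c) (k ℤ.- 1ℤ)) (coeff (laurent d c) (k ℤ.- 0ℤ)))
    (≡.trans (≡.cong (λ j → coeff (laurent d c) (k ℤ.- 1ℤ) ℤ.- 1ℤ ℤ.* coeff (laurent d c) j) (ℤ.+-identityʳ k)) (cases k))
    where
    cases : ∀ k → coeff (laurent d c) (k ℤ.- 1ℤ) ℤ.- 1ℤ ℤ.* coeff (laurent d c) k ≡ coeff (laurent (suc d) c′) k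
    cases (+ zero)   = ≡.trans (≡.cong₂ (λ x y → x ℤ.- 1ℤ ℤ.* y) (coeff-laurentFrom-neg (suc d) 0 c 0) (coeff-laurent d c above 0))
                               (≡.trans (factor 0) (≡.sym (coeff-laurent (suc d) c′ above′ 0)))
    cases ℤ.+[1+ i ] = ≡.trans (≡.cong₂ (λ x y → x ℤ.- 1ℤ ℤ.* y) (coeff-laurent d c above i) (coeff-laurent d c above (suc i)))
                               (≡.trans (factor (suc i)) (≡.sym (coeff-laurent (suc d) c′ above′ (suc i))))
    cases -[1+ i ]   = ≡.trans (≡.cong₂ (λ x y → x ℤ.- 1ℤ ℤ.* y) (coeff-laurentFrom-neg (suc d) 0 c (suc (i ℕ.+ 0))) (coeff-laurentFrom-neg (suc d) 0 c i))
                               (≡.sym (coeff-laurentFrom-neg (suc (suc d)) 0 c′ i))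

total : ℕ → ℕ → (ℕ → ℤ) → ℤ
total zero    j c = c j
total (suc d) j c = c j ℤ.+ total d (suc j) c

evalAt1-laurentFrom : ∀ d j c → evalAt1 (laurentFrom (suc d) j c) ≡ total d j c
evalAt1-laurentFrom zero    j c = ℤ.+-identityʳ (c j)
evalAt1-laurentFrom (suc d) j c = ≡.cong (ℤ._+_ (c j)) (evalAt1-laurentFrom d (suc j) c)

record UnitRootFactorization (d : ℕ) (f : ℕ → ℤ) : Set where
  field
    order degree : ℕ
    cofactor     : ℕ → ℤ
    degree-sum   : order ℕ.+ degree ≡ d
    leading      : cofactor degree ≢ 0ℤ
    above        : ∀ j → degree ℕ.< j → cofactor j ≡ 0ℤ
    at1          : evalAt1 (laurent degree cofactor) ≢ 0ℤ
    factors      : laurent d f ≈ᴸ t-1 ^ᴸ order *ᴸ laurent degree cofactor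

no-unit-root : ∀ {d f} → f d ≢ 0ℤ → (∀ j → d ℕ.< j → f j ≡ 0ℤ) → evalAt1 (laurent d f) ≢ 0ℤ → UnitRootFactorization d f
no-unit-root {d} {f} lead above at1 = record
  { order = 0 ; degree = d ; cofactor = f ; degree-sum = ≡.refl ; leading = lead ; above = above ; at1 = at1
  ; factors = λ k → ≡.sym (*ᴸ-identityˡ (laurent d f) k) }

-- Division by t - 1 is repeated as long as the value at 1 is zero. Each division lowers the degree
-- and keeps the leading coefficient; a nonzero constant has no zero at 1, so the process ends.
factorUnitRoot : ∀ d f → f d ≢ 0ℤ → (∀ j → d ℕ.< j → f j ≡ 0ℤ) → UnitRootFactorization d f
factorUnitRoot zero    f lead above = no-unit-root lead above
  (λ eq → lead (≡.trans (≡.sym (ℤ.+-identityʳ (f 0))) eq))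
factorUnitRoot (suc m) f lead above with evalAt1 (laurent (suc m) f) ℤ.≟ 0ℤ
... | no at1   = no-unit-root lead above at1
... | yes root = record
  { order = suc rest.order ; degree = rest.degree ; cofactor = rest.cofactor
  ; degree-sum = ≡.cong suc rest.degree-sum ; leading = rest.leading ; above = rest.above ; at1 = rest.at1
  ; factors = λ k → begin
      coeff (laurent (suc m) f) k                                        ≡⟨ t-1-* m quotient quotient-above f above (factor horner-root) k ⟨
      coeff (t-1 *ᴸ laurent m quotient) k                                ≡⟨ *ᴸ-congˡ t-1 {laurent m quotient} {t-1 ^ᴸ rest.order *ᴸ laurent rest.degree rest.cofactor} rest.factors k ⟩
      coeff (t-1 *ᴸ (t-1 ^ᴸ rest.order *ᴸ laurent rest.degree rest.cofactor)) k
        ≡⟨ *ᴸ-assoc t-1 (t-1 ^ᴸ rest.order) (laurent rest.degree rest.cofactor) k ⟨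
      coeff (t-1 ^ᴸ suc rest.order *ᴸ laurent rest.degree rest.cofactor) k ∎
  }
  where
  open ≡-Reasoning
  open ℤ-polynomials.Division f 1ℤ m above
  module rest = UnitRootFactorization (factorUnitRoot m quotient (λ eq → lead (≡.trans (≡.sym quotient-leading) eq)) quotient-above)
  horner-total : ∀ n j → horner (suc n) j ≡ total n (suc j) f
  horner-total zero    j = ℤ.+-identityʳ (f (suc j))
  horner-total (suc n) j = ≡.cong (ℤ._+_ (f (suc j))) (≡.trans (ℤ.*-identityˡ _) (horner-total n (suc j)))
  horner-root : f 0 ℤ.+ 1ℤ ℤ.* quotient 0 ≡ 0ℤ
  horner-root = ≡.trans (≡.cong (ℤ._+_ (f 0)) (≡.trans (ℤ.*-identityˡ (quotient 0)) (horner-total m 0)))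
    (≡.trans (≡.sym (evalAt1-laurentFrom (suc m) 0 f)) root)

-- Any bound on the exponents serves as a starting point for `top-coefficient`; a sum of absolute
-- values avoids maxima.
supportBound : Laurent → ℕ
supportBound []            = 0
supportBound ((l , _) ∷ f) = ∣ l ∣ ℕ.+ supportBound f

coeff-beyond : ∀ f k → supportBound f ℕ.< ∣ k ∣ → coeff f k ≡ 0ℤ
coeff-beyond []            k _ = ≡.refl
coeff-beyond ((l , c) ∷ f) k B<k with l ℤ.≟ k
... | yes ≡.refl = contradiction B<k (ℕ.≤⇒≯ (ℕ.m≤m+n ∣ l ∣ (supportBound f)))
... | no _       = coeff-beyond f k (ℕ.≤-<-trans (ℕ.m≤n+m (supportBound f) ∣ l ∣) B<k)

module SymmetricLaurent (f : Laurent) (symmetric : ∀ k → coeff f (ℤ.- k) ≡ coeff f k) where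

  -- By symmetry the coefficient at `+ B` also decides the one at the opposite end, so the bound
  -- descends until it is attained or the polynomial is seen to be zero.
  top-coefficient : ∀ B → (∀ k → B ℕ.< ∣ k ∣ → coeff f k ≡ 0ℤ) →
    f ≈ᴸ [] ⊎ ∃ λ b → coeff f (+ b) ≢ 0ℤ × (∀ k → b ℕ.< ∣ k ∣ → coeff f k ≡ 0ℤ)
  top-coefficient B bound with coeff f (+ B) ℤ.≟ 0ℤ
  ... | no neq = inj₂ (B , neq , bound)
  ... | yes eq = descend B bound eq
    where
    at-abs : ∀ {B} → coeff f (+ B) ≡ 0ℤ → ∀ k → B ≡ ∣ k ∣ → coeff f k ≡ 0ℤ
    at-abs eq (+ n)    ≡.refl = eq
    at-abs eq -[1+ n ] ≡.refl = ≡.trans (symmetric (+ suc n)) eq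
    descend : ∀ B → (∀ k → B ℕ.< ∣ k ∣ → coeff f k ≡ 0ℤ) → coeff f (+ B) ≡ 0ℤ → _
    descend zero    bound eq = inj₁ λ k → [ (λ B<k → bound k B<k) , at-abs eq k ]′ (ℕ.m≤n⇒m<n∨m≡n ℕ.z≤n)
    descend (suc B) bound eq = top-coefficient B λ k B<k → [ (λ B<k → bound k B<k) , at-abs eq k ]′ (ℕ.m≤n⇒m<n∨m≡n B<k)

  -- The support lies between -b and b and attains both ends, so tᵇ f is a polynomial of degree
  -- exactly 2b. This is the source of the relation between `e`, the degree of `J` and `b` that
  -- settles the signs.
  record Centered : Set where
    field
      b         : ℕ
      shifted   : ℕ → ℤ
      leading   : shifted (b ℕ.+ b) ≢ 0ℤ
      above     : ∀ j → b ℕ.+ b ℕ.< j → shifted j ≡ 0ℤ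
      shift-eq  : t^ (+ b) *ᴸ f ≈ᴸ laurent (b ℕ.+ b) shifted
      order-at0 : OrdAt0 f (ℤ.- (+ b))

  centered : ¬ f ≈ᴸ [] → Centered
  centered nonzero with top-coefficient (supportBound f) (coeff-beyond f)
  ... | inj₁ f≈0 = contradiction f≈0 nonzero
  ... | inj₂ (b , top , bound) = record
    { b = b ; shifted = c ; leading = λ eq → top (≡.trans (≡.cong (coeff f) (≡.sym (middle b))) eq) ; above = above
    ; shift-eq = λ k → ≡.trans (t^-coeff (+ b) f k) (shift-eq k)
    ; order-at0 = (λ eq → top (≡.trans (≡.sym (symmetric (+ b))) eq)) , λ j j<-b → bound j (far j j<-b) }
    where
    c : ℕ → ℤ
    c i = coeff f (+ i ℤ.- + b)
    middle : ∀ b → + (b ℕ.+ b) ℤ.- + b ≡ + b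
    middle b = lem (+ b)
      where
      lem : ∀ x → x ℤ.+ x ℤ.- x ≡ x
      lem = solve-∀
    above : ∀ j → b ℕ.+ b ℕ.< j → c j ≡ 0ℤ
    above j 2b<j = bound (+ j ℤ.- + b) (≡.subst (b ℕ.<_) (≡.cong ∣_∣ (≡.sym (≡.trans (ℤ.m-n≡m⊖n j b) (ℤ.⊖-≥ b≤j)))) (ℕ.m+n≤o⇒m≤o∸n (suc b) 2b<j))
      where
      b≤j : b ℕ.≤ j
      b≤j = ℕ.≤-trans (ℕ.m≤m+n b b) (ℕ.<⇒≤ 2b<j)
    shift-eq : ∀ k → coeff f (k ℤ.- + b) ≡ coeff (laurent (b ℕ.+ b) c) k
    shift-eq (+ i)    = ≡.sym (coeff-laurent (b ℕ.+ b) c above i)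
    shift-eq -[1+ i ] = ≡.trans (bound (-[1+ i ] ℤ.- + b) (≡.subst (b ℕ.<_) (negative b) (ℕ.s≤s (ℕ.m≤n+m b i))))
                                (≡.sym (coeff-laurentFrom-neg (suc (b ℕ.+ b)) 0 c i))
      where
      negative : ∀ b → suc (i ℕ.+ b) ≡ ∣ -[1+ i ] ℤ.- + b ∣
      negative zero    = ≡.cong suc (ℕ.+-identityʳ i)
      negative (suc b) = ≡.cong suc (ℕ.+-suc i b)
    far : ∀ j → j ℤ.< ℤ.- (+ b) → b ℕ.< ∣ j ∣
    far j j<-b = ≡.subst (b ℕ.<_) (ℤ.∣-i∣≡∣i∣ j) (positive (ℤ.- j) (≡.subst (ℤ._< ℤ.- j) (ℤ.neg-involutive (+ b)) (ℤ.neg-mono-< j<-b)))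
      where
      positive : ∀ i → + b ℤ.< i → b ℕ.< ∣ i ∣
      positive (+ n) (ℤ.+<+ b<n) = b<n

-- Roots of unity and resultants

module PolynomialValues (R : CommutativeRing 0ℓ 0ℓ) where
  open CommutativeRing R hiding (zero)
  open RingTheory R
  open BlockCirculant R using (prod; prod-cong; prod-*)
  open PolynomialRoots R
  open Solver using (solve; _:=_; _:+_; _:*_; :-_; con)
  open import Algebra.Properties.Semiring.Exp semiring using (_^_)
  open import Relation.Binary.Reasoning.Setoid setoid

  value : ℕ → (ℕ → Carrier) → Carrier → Carrier
  value zero    c y = 0#
  value (suc n) c y = c 0 + y * value n (c ∘ suc) y

  value-cong : ∀ n {c c′} y → (∀ j → j ℕ.< n → c j ≈ c′ j) → value n c y ≈ value n c′ y
  value-cong zero    y h = refl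
  value-cong (suc n) y h = +-cong (h 0 ℕ.z<s) (*-congˡ (value-cong n y (λ j j<n → h (suc j) (ℕ.s<s j<n))))

  value-linear : ∀ n a b x y → value n (λ j → a j + - (x * b j)) y ≈ value n a y + - (x * value n b y)
  value-linear zero    a b x y = solve 1 (λ x → con 0ℤ := con 0ℤ :+ :- (x :* con 0ℤ)) refl x
  value-linear (suc n) a b x y = trans (+-congˡ (*-congˡ (value-linear n (a ∘ suc) (b ∘ suc) x y)))
    (solve 6 (λ a b x y u v → a :+ :- (x :* b) :+ y :* (u :+ :- (x :* v)) := a :+ y :* u :+ :- (x :* (b :+ y :* v))) refl
      (a 0) (b 0) x y (value n (a ∘ suc) y) (value n (b ∘ suc) y))

  value-stable : ∀ n c y → c n ≈ 0# → value (suc n) c y ≈ value n c y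
  value-stable zero    c y eq = trans (+-cong eq (zeroʳ y)) (+-identityˡ 0#)
  value-stable (suc n) c y eq = +-congˡ (*-congˡ (value-stable n (c ∘ suc) y eq))

  value-times-root : ∀ n x g y → g n ≈ 0# → value (suc n) (times-root x g) y ≈ (y + - x) * value n g y
  value-times-root n x g y eq = begin
    value (suc n) (times-root x g) y                    ≈⟨ value-linear (suc n) (shift g) g x y ⟩
    0# + y * value n g y + - (x * value (suc n) g y)    ≈⟨ +-cong (+-identityˡ _) (-‿cong (*-congˡ (value-stable n g y eq))) ⟩
    y * value n g y + - (x * value n g y)               ≈⟨ solve 3 (λ x y v → y :* v :+ :- (x :* v) := (y :+ :- x) :* v) refl x y (value n g y) ⟩
    (y + - x) * value n g y                             ∎

  prod-snoc : ∀ n (F : ℕ → Carrier) → prod {suc n} (F ∘ toℕ) ≈ prod {n} (F ∘ toℕ) * F n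
  prod-snoc zero    F = *-comm _ _
  prod-snoc (suc n) F = trans (*-congˡ (prod-snoc n (F ∘ suc))) (sym (*-assoc _ _ _))

  value-newton : ∀ x k y → value (suc k) (newton x k) y ≈ prod {k} (λ i → y + - x (toℕ i))
  value-newton x zero    y = trans (+-congˡ (zeroʳ y)) (+-identityʳ 1#)
  value-newton x (suc k) y = begin
    value (suc (suc k)) (newton x (suc k)) y                    ≈⟨ value-times-root (suc k) (x k) (newton x k) y (newton-above x k (suc k) ℕ.≤-refl) ⟩
    (y + - x k) * value (suc k) (newton x k) y                  ≈⟨ *-congˡ (value-newton x k y) ⟩
    (y + - x k) * prod {k} (λ i → y + - x (toℕ i))              ≈⟨ *-comm _ _ ⟩
    prod {k} (λ i → y + - x (toℕ i)) * (y + - x k)              ≈⟨ prod-snoc k (λ i → y + - x i) ⟨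
    prod {suc k} (λ i → y + - x (toℕ i))                        ∎

  prod-zero : ∀ {n} (f : Fin n → Carrier) i → f i ≈ 0# → prod f ≈ 0#
  prod-zero f zero    eq = trans (*-congʳ eq) (zeroˡ _)
  prod-zero f (suc i) eq = trans (*-congˡ (prod-zero (f ∘ suc) i eq)) (zeroʳ _)

  prod-const : ∀ n a → prod {n} (λ _ → a) ≈ a ^ n
  prod-const zero    a = refl
  prod-const (suc n) a = *-congˡ (prod-const n a)

  prod-neg : ∀ {n} (f : Fin n → Carrier) → prod (λ i → - f i) ≈ (- 1#) ^ n * prod f
  prod-neg {n} f = trans (prod-cong {n} (λ i → sym (-1*x≈-x (f i)))) (trans (prod-* {n} (λ _ → - 1#) f) (*-congʳ (prod-const n (- 1#))))
    where open import Algebra.Properties.Ring ring using (-1*x≈-x)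

  sign² : ∀ n → (- 1#) ^ n * (- 1#) ^ n ≈ 1#
  sign² zero    = *-identityˡ 1#
  sign² (suc n) = trans (solve 2 (λ o s → (:- o :* s) :* (:- o :* s) := o :* o :* (s :* s)) refl 1# ((- 1#) ^ n))
                        (trans (*-cong (*-identityˡ 1#) (sign² n)) (*-identityˡ 1#))

  value-ones : ∀ n y → (y + - 1#) * value n (λ _ → 1#) y ≈ y ^ n + - 1#
  value-ones zero    y = trans (zeroʳ _) (sym (-‿inverseʳ 1#))
  value-ones (suc n) y = begin
    (y + - 1#) * (1# + y * value n (λ _ → 1#) y)
      ≈⟨ solve 3 (λ o y v → (y :+ :- o) :* (o :+ y :* v) := y :* o :+ :- (o :* o) :+ y :* ((y :+ :- o) :* v)) refl 1# y (value n (λ _ → 1#) y) ⟩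
    y * 1# + - (1# * 1#) + y * ((y + - 1#) * value n (λ _ → 1#) y)
      ≈⟨ +-cong (+-congˡ (-‿cong (*-identityˡ 1#))) (*-congˡ (value-ones n y)) ⟩
    y * 1# + - 1# + y * (y ^ n + - 1#)
      ≈⟨ solve 3 (λ o y p → y :* o :+ :- o :+ y :* (p :+ :- o) := y :* p :+ :- o) refl 1# y (y ^ n) ⟩
    y * y ^ n + - 1# ∎

  value-ones-at-1 : ∀ n → value n (λ _ → 1#) 1# ≈ ι (+ n)
  value-ones-at-1 zero    = refl
  value-ones-at-1 (suc n) = +-congˡ (trans (*-identityˡ _) (value-ones-at-1 n))

  -- The root 1 has the last index `ν`, so a product over `Fin ν` runs over the remaining roots.
  -- `ι-injective` is the way back from identities in the ring to identities in ℤ.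
  record RootsOfUnity (ν : ℕ) : Set where
    field
      ι-injective : ∀ {a b} → ι a ≈ ι b → a ≡ b
      root        : ℕ → Carrier
      splits      : ∀ j → newton root (suc ν) j ≈ 𝟙 (j ℕ.≟ suc ν) + - 𝟙 (j ℕ.≟ 0)
      root-power  : ∀ (k : Fin (suc ν)) → root (toℕ k) ^ suc ν ≈ 1#
      last-root   : root ν ≈ 1#
      prod-root   : prod {ν} (root ∘ toℕ) ≈ (- 1#) ^ ν
      prod-root-1 : prod {ν} (λ k → root (toℕ k) + - 1#) ≈ (- 1#) ^ ν * ι (+ suc ν)

-- The polynomial that gets split is Φ = 1 + t + ... + t^ν, and 1 is appended at index `ν`. Products
-- over the adjoined roots then are values of Φ, and `splits` is the identity (t - 1) Φ = tⁿ - 1.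
rootsOfUnity : ∀ ν → Σ[ S ∈ CommutativeRing 0ℓ 0ℓ ] PolynomialValues.RootsOfUnity S ν
rootsOfUnity ν = S , record
  { ι-injective = ι-injective ; root = root ; splits = splits ; root-power = root-power
  ; last-root = root-ν ; prod-root = prod-root ; prod-root-1 = prod-root-1 }
  where
  Φ : ℕ → ℤ
  Φ j = ℤ-theory.𝟙 (j ℕ.≤? ν)
  Φ-monic : PolynomialRoots.Monic ℤ-ring ν Φ
  Φ-monic = record
    { leading = ℤ-theory.𝟙-yes (ν ℕ.≤? ν) ℕ.≤-refl
    ; above   = λ j ν<j → ℤ-theory.𝟙-no (j ℕ.≤? ν) (ℕ.<⇒≱ ν<j) }
  module split = Splitting (splitting ν ℤ-ring Φ Φ-monic)
  S : CommutativeRing 0ℓ 0ℓ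
  S = split.ring
  open CommutativeRing S hiding (ring; zero)
  open RingTheory S
  open BlockCirculant S using (prod; prod-cong)
  open PolynomialRoots S
  open PolynomialValues S
  open Embedding split.embedding
  open Solver using (solve; _:=_; _:+_; :-_)
  open import Algebra.Properties.Semiring.Exp semiring using (_^_; ^-congˡ)
  open import Relation.Binary.Reasoning.Setoid setoid

  φ≈ι : ∀ z → φ z ≈ ι z
  φ≈ι z = trans (cong (≡.sym (ι-ℤ z))) (ι-homo z)

  ι-injective : ∀ {a b} → ι a ≈ ι b → a ≡ b
  ι-injective eq = injective (trans (φ≈ι _) (trans eq (sym (φ≈ι _))))

  root : ℕ → Carrier
  root k with k ℕ.≟ ν
  ... | yes _ = 1#
  ... | no  _ = split.root k
  root-ν : root ν ≈ 1#
  root-ν with ν ℕ.≟ ν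
  ... | yes _  = refl
  ... | no ν≢ν = contradiction ≡.refl ν≢ν
  root-< : ∀ k → k ℕ.< ν → root k ≈ split.root k
  root-< k k<ν with k ℕ.≟ ν
  ... | yes ≡.refl = contradiction k<ν (ℕ.<-irrefl ≡.refl)
  ... | no _       = refl

  newton-Φ : ∀ j → newton root ν j ≈ 𝟙 (j ℕ.≤? ν)
  newton-Φ j = trans (newton-cong ν root-< j) (trans (split.splits j) (φ-𝟙 (j ℕ.≤? ν)))
    where
    φ-𝟙 : ∀ {P : Set} (d : Dec P) → φ (ℤ-theory.𝟙 d) ≈ 𝟙 d
    φ-𝟙 (yes _) = 1-homo
    φ-𝟙 (no _)  = 0-homo

  splits : ∀ j → newton root (suc ν) j ≈ 𝟙 (j ℕ.≟ suc ν) + - 𝟙 (j ℕ.≟ 0)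
  splits zero = begin
    0# + - (root ν * newton root ν 0)      ≈⟨ +-congˡ (-‿cong (*-cong root-ν (trans (newton-Φ 0) (reflexive (𝟙-yes (0 ℕ.≤? ν) ℕ.z≤n))))) ⟩
    0# + - (1# * 1#)                       ≈⟨ +-congˡ (-‿cong (*-identityˡ 1#)) ⟩
    0# + - 1#                              ∎
  splits (suc j) = begin
    newton root ν j + - (root ν * newton root ν (suc j)) ≈⟨ +-cong (newton-Φ j) (-‿cong (trans (*-cong root-ν (newton-Φ (suc j))) (*-identityˡ _))) ⟩
    𝟙 (j ℕ.≤? ν) + - 𝟙 (suc j ℕ.≤? ν)                    ≈⟨ boundary (j ℕ.≤? ν) (suc j ℕ.≤? ν) (suc j ℕ.≟ suc ν) ⟩
    𝟙 (suc j ℕ.≟ suc ν) + - 0#                           ∎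
    where
    boundary : (d : Dec (j ℕ.≤ ν)) (d′ : Dec (suc j ℕ.≤ ν)) (d″ : Dec (suc j ≡ suc ν)) → 𝟙 d + - 𝟙 d′ ≈ 𝟙 d″ + - 0#
    boundary (yes _)   (yes 1+j≤ν) (yes ≡.refl) = contradiction 1+j≤ν (ℕ.<-irrefl ≡.refl)
    boundary (yes _)   (yes _)     (no _)       = trans (-‿inverseʳ 1#) (sym (-‿inverseʳ 0#))
    boundary (yes _)   (no _)      (yes _)      = refl
    boundary (yes j≤ν) (no 1+j≰ν)  (no j≢ν)     = contradiction (ℕ.≤∧≢⇒< j≤ν (j≢ν ∘ ≡.cong suc)) 1+j≰ν
    boundary (no j≰ν)  (yes 1+j≤ν) d″           = contradiction (ℕ.<⇒≤ 1+j≤ν) j≰ν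
    boundary (no j≰ν)  (no _)      (yes ≡.refl) = contradiction ℕ.≤-refl j≰ν
    boundary (no _)    (no _)      (no _)       = refl

  product : ∀ y → value (suc ν) (λ _ → 1#) y ≈ prod {ν} (λ i → y + - root (toℕ i))
  product y = trans (value-cong (suc ν) y (λ j j<1+ν → sym (trans (newton-Φ j) (reflexive (𝟙-yes (j ℕ.≤? ν) (ℕ.s≤s⁻¹ j<1+ν))))))
                    (value-newton root ν y)

  -- From the geometric sum (y - 1) Φ(y) = yⁿ - 1 and Φ(y) = 0.
  root-power-< : ∀ (k : Fin ν) → root (toℕ k) ^ suc ν ≈ 1#
  root-power-< k = begin
    y ^ suc ν                                     ≈⟨ solve 2 (λ p o → p := p :+ :- o :+ o) refl (y ^ suc ν) 1# ⟩
    y ^ suc ν + - 1# + 1#                         ≈⟨ +-congʳ (value-ones (suc ν) y) ⟨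
    (y + - 1#) * value (suc ν) (λ _ → 1#) y + 1#  ≈⟨ +-congʳ (*-congˡ (trans (product y) (prod-zero (λ i → y + - root (toℕ i)) k (-‿inverseʳ y)))) ⟩
    (y + - 1#) * 0# + 1#                          ≈⟨ trans (+-congʳ (zeroʳ _)) (+-identityˡ 1#) ⟩
    1#                                            ∎
    where
    y : Carrier
    y = root (toℕ k)

  one-power : ∀ n → 1# ^ n ≈ 1#
  one-power zero    = refl
  one-power (suc n) = trans (*-identityˡ _) (one-power n)

  root-power : ∀ (k : Fin (suc ν)) → root (toℕ k) ^ suc ν ≈ 1#
  root-power k with ℕ.m≤n⇒m<n∨m≡n (ℕ.s≤s⁻¹ (Fin.toℕ<n k))
  ... | inj₁ k<ν = ≡.subst (λ i → root i ^ suc ν ≈ 1#) (Fin.toℕ-fromℕ< k<ν) (root-power-< (fromℕ< k<ν))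
  ... | inj₂ k≡ν = trans (^-congˡ (suc ν) (trans (reflexive (≡.cong root k≡ν)) root-ν)) (one-power (suc ν))

  unsign : ∀ {a b} → (- 1#) ^ ν * a ≈ b → a ≈ (- 1#) ^ ν * b
  unsign {a} {b} eq = begin
    a                                   ≈⟨ *-identityˡ a ⟨
    1# * a                              ≈⟨ *-congʳ (sign² ν) ⟨
    (- 1#) ^ ν * (- 1#) ^ ν * a         ≈⟨ *-assoc _ _ _ ⟩
    (- 1#) ^ ν * ((- 1#) ^ ν * a)       ≈⟨ *-congˡ eq ⟩
    (- 1#) ^ ν * b                      ∎

  -- The product of the -x is Φ(0), which is 1.
  prod-root : prod {ν} (root ∘ toℕ) ≈ (- 1#) ^ ν
  prod-root = trans (unsign (begin
    (- 1#) ^ ν * prod {ν} (root ∘ toℕ)        ≈⟨ prod-neg {ν} (root ∘ toℕ) ⟨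
    prod {ν} (λ i → - root (toℕ i))           ≈⟨ prod-cong {ν} (λ i → +-identityˡ (- root (toℕ i))) ⟨
    prod {ν} (λ i → 0# + - root (toℕ i))      ≈⟨ product 0# ⟨
    1# + 0# * value ν (λ _ → 1#) 0#           ≈⟨ trans (+-congˡ (zeroˡ _)) (+-identityʳ 1#) ⟩
    1#                                        ∎)) (*-identityʳ _)

  -- The product of the 1 - x is Φ(1), a sum of `suc ν` ones.
  prod-root-1 : prod {ν} (λ k → root (toℕ k) + - 1#) ≈ (- 1#) ^ ν * ι (+ suc ν)
  prod-root-1 = unsign (begin
    (- 1#) ^ ν * prod {ν} (λ k → root (toℕ k) + - 1#)   ≈⟨ prod-neg {ν} (λ k → root (toℕ k) + - 1#) ⟨
    prod {ν} (λ i → - (root (toℕ i) + - 1#))            ≈⟨ prod-cong {ν} (λ i → solve 2 (λ o x → :- (x :+ :- o) := o :+ :- x) refl 1# (root (toℕ i))) ⟩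
    prod {ν} (λ i → 1# + - root (toℕ i))                ≈⟨ product 1# ⟨
    value (suc ν) (λ _ → 1#) 1#                         ≈⟨ value-ones-at-1 (suc ν) ⟩
    ι (+ suc ν)                                         ∎)

-- The resultant with tⁿ - 1 as a product over the roots of unity

module Triangular (R : CommutativeRing 0ℓ 0ℓ) where
  open CommutativeRing R hiding (zero)
  open RingTheory R
  open BlockCirculant R using (prod; prod-*)
  open import Algebra.Properties.Semiring.Exp semiring using (_^_)

  Det-lower-triangular : ∀ {n} (M : Mat n) → (∀ i j → toℕ i ℕ.< toℕ j → M i j ≈ 0#) → Det M ≈ prod (λ i → M i i)
  Det-lower-triangular {zero}  M low = refl
  Det-lower-triangular {suc n} M low = trans
    (sum-single zero {laplace M} (λ { zero 0≢0 → contradiction ≡.refl 0≢0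
                                    ; (suc j) _ → trans (*-congˡ (trans (*-congʳ (low zero (suc j) ℕ.z<s)) (zeroˡ _))) (zeroʳ _) }))
    (trans (*-identityˡ _) (*-congˡ (Det-lower-triangular (minor zero M) (λ i j i<j → low (suc i) (suc j) (ℕ.s<s i<j)))))

  Det-singleton : ∀ (M : Mat 1) → Det M ≈ M zero zero
  Det-singleton M = trans (+-identityʳ _) (trans (*-identityˡ _) (*-identityʳ _))

  prod-^ : ∀ {n} (f : Fin n → Carrier) d → prod (λ i → f i ^ d) ≈ prod f ^ d
  prod-^ {n} f zero    = ones n
    where
    ones : ∀ n → prod {n} (λ _ → 1#) ≈ 1#
    ones zero    = refl
    ones (suc n) = trans (*-identityˡ _) (ones n)
  prod-^ {n} f (suc d) = trans (prod-* f (λ i → f i ^ d)) (*-congˡ (prod-^ f d))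

module SylvesterReduction (ν : ℕ) (J : Polynomial) where
  open Polynomial J renaming (degree to d)
  open RingTheory ℤ-ring
  open Determinants ℤ-ring
  open Triangular ℤ-ring
  open BlockCirculant ℤ-ring using (prod; prod-cong)
  open CommutativeRing ℤ-ring using (semiring)
  open import Algebra.Properties.Semiring.Sum semiring using (sum; sum-cong-≗; ∑-comm; *-distribˡ-sum; *-distribʳ-sum)
  open ≡.≡-Reasoning

  private
    n : ℕ
    n = suc ν

    a : Fin (suc d) → ℤ
    a = lookup coeffs

  coeff-toLaurent : ∀ k → coeff (toLaurent J) k ≡ sum (λ m → a m ℤ.* δ k (+ toℕ m))
  coeff-toLaurent k = ≡.trans (coeff≡ev (toLaurent J) k) (go (λ m → + toℕ m) a)
    where
    go : ∀ {q} (x : Fin q → ℤ) (a : Fin q → ℤ) →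
         Evaluation.ev ℤ-ring (δ k) (List.tabulate (λ i → x i , a i)) ≡ sum (λ m → a m ℤ.* δ k (x m))
    go {zero}  x a = ≡.refl
    go {suc q} x a = ≡.cong₂ ℤ._+_ (≡.cong (ℤ._* δ k (x zero)) (ι-ℤ (a zero))) (go (x ∘ suc) (a ∘ suc))

  coeff-tⁿ-1 : ∀ k → coeff (tⁿ-1 n) k ≡ δ k (+ n) ℤ.- δ k 0ℤ
  coeff-tⁿ-1 k = ≡.trans (coeff≡ev (tⁿ-1 n) k) (lem (δ k (+ n)) (δ k 0ℤ))
    where
    lem : ∀ x y → 1ℤ ℤ.* x ℤ.+ (-1ℤ ℤ.* y ℤ.+ 0ℤ) ≡ x ℤ.- y
    lem = solve-∀

  sum-select : ∀ {N} x y (ρ : Fin N) → y ≡ x ℕ.+ toℕ ρ → (F : Fin N → ℤ) →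
               sum (λ k → δ (+ y ℤ.- + toℕ k) (+ x) ℤ.* F k) ≡ F ρ
  sum-select x y ρ ≡.refl F = ≡.trans
    (sum-cong-≗ (λ k → ≡.cong (ℤ._* F k) (𝟙-cong (+ x ℤ.≟ + (x ℕ.+ toℕ ρ) ℤ.- + toℕ k) (ρ Fin.≟ k) (to k) λ { ≡.refl → lem (+ x) (+ toℕ ρ) })))
    (sum-δ ρ F)
    where
    lem : ∀ x z → x ≡ x ℤ.+ z ℤ.- z
    lem = solve-∀
    to : ∀ k → + x ≡ + (x ℕ.+ toℕ ρ) ℤ.- + toℕ k → ρ ≡ k
    to k eq = Fin.toℕ-injective (ℕ.+-cancelˡ-≡ x _ _ (ℤ.+-injective (≡.trans (lem′ (+ (x ℕ.+ toℕ ρ)) (+ toℕ k)) (≡.cong (ℤ._+ + toℕ k) (≡.sym eq)))))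
      where
      lem′ : ∀ y k → y ≡ y ℤ.- k ℤ.+ k
      lem′ = solve-∀

  -- Columns of degree d, …, n + d - 1 collect the coefficients by residue of the degree modulo n.
  reduction : Mat (n ℕ.+ d)
  reduction k j = [ (λ j → 𝟙 (π n (+ toℕ k) Fin.≟ j)) , (λ j → I k (n ↑ʳ j)) ]′ (splitAt n j)

  reduction-left : ∀ k j → reduction k (j ↑ˡ d) ≡ 𝟙 (π n (+ toℕ k) Fin.≟ j)
  reduction-left k j rewrite Fin.splitAt-↑ˡ n j d = ≡.refl

  reduction-right : ∀ k j → reduction k (n ↑ʳ j) ≡ I k (n ↑ʳ j)
  reduction-right k j rewrite Fin.splitAt-↑ʳ n d j = ≡.refl

  ↑ˡ≢↑ʳ : ∀ (i : Fin n) (j : Fin d) → i ↑ˡ d ≢ n ↑ʳ j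
  ↑ˡ≢↑ʳ i j eq = ℕ.<⇒≱ (Fin.toℕ<n i) (≡.subst (n ℕ.≤_) (≡.trans (≡.sym (≡.trans (≡.cong toℕ eq) (Fin.toℕ-↑ʳ n j))) (Fin.toℕ-↑ˡ i d)) (ℕ.m≤m+n n (toℕ j)))

  Det-reduction : Det reduction ≡ 1ℤ
  Det-reduction = ≡.trans (Det-block-lower {n} {d} I I reduction
    (λ i j → ≡.trans (reduction-left (i ↑ˡ d) j) (≡.cong (λ σ → 𝟙 (σ Fin.≟ j)) (≡.trans (≡.cong (π n ∘ +_) (Fin.toℕ-↑ˡ i d)) (π-toℕ n i))))
    (λ i j → ≡.trans (reduction-right (i ↑ˡ d) j) (I-off (↑ˡ≢↑ʳ i j)))
    (λ i j → ≡.trans (reduction-right (n ↑ʳ i) j) (𝟙-cong (n ↑ʳ i Fin.≟ n ↑ʳ j) (i Fin.≟ j) (Fin.↑ʳ-injective n i j) (≡.cong (n ↑ʳ_)))))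
    (≡.cong₂ ℤ._*_ (Det-I {n}) (Det-I {d}))

  private
    Syl : Mat (n ℕ.+ d)
    Syl = sylvester d n (toLaurent J) (tⁿ-1 n)

  low : Fin d → Fin (n ℕ.+ d)
  low i = inject≤ i (ℕ.m≤n+m d n)

  lower-row : ∀ i (F : Fin (n ℕ.+ d) → ℤ) → sum (λ k → Syl (n ↑ʳ i) k ℤ.* F k) ≡ F (low i) ℤ.- F (n ↑ʳ i)
  lower-row i F = begin
    sum (λ k → Syl (n ↑ʳ i) k ℤ.* F k)
      ≡⟨ sum-cong-≗ (λ k → ≡.cong (ℤ._* F k) (≡.trans (entry k) (coeff-tⁿ-1 (e k)))) ⟩
    sum (λ k → (δ (e k) (+ n) ℤ.- δ (e k) 0ℤ) ℤ.* F k)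
      ≡⟨ sum-cong-≗ (λ k → lem (δ (e k) (+ n)) (δ (e k) 0ℤ) (F k)) ⟩
    sum (λ k → -1ℤ ℤ.* (δ (e k) 0ℤ ℤ.* F k) ℤ.+ δ (e k) (+ n) ℤ.* F k)
      ≡⟨ sum-linear -1ℤ (λ k → δ (e k) 0ℤ ℤ.* F k) (λ k → δ (e k) (+ n) ℤ.* F k) ⟩
    -1ℤ ℤ.* sum (λ k → δ (e k) 0ℤ ℤ.* F k) ℤ.+ sum (λ k → δ (e k) (+ n) ℤ.* F k)
      ≡⟨ ≡.cong₂ (λ x y → -1ℤ ℤ.* x ℤ.+ y)
           (sum-select 0 (n ℕ.+ toℕ i) (n ↑ʳ i) (≡.sym (Fin.toℕ-↑ʳ n i)) F)
           (sum-select n (n ℕ.+ toℕ i) (low i) (≡.cong (n ℕ.+_) (≡.sym (Fin.toℕ-inject≤ i (ℕ.m≤n+m d n)))) F) ⟩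
    -1ℤ ℤ.* F (n ↑ʳ i) ℤ.+ F (low i)
      ≡⟨ lem′ (F (n ↑ʳ i)) (F (low i)) ⟩
    F (low i) ℤ.- F (n ↑ʳ i) ∎
    where
    e : Fin (n ℕ.+ d) → ℤ
    e k = + (n ℕ.+ toℕ i) ℤ.- + toℕ k
    entry : ∀ k → Syl (n ↑ʳ i) k ≡ coeff (tⁿ-1 n) (e k)
    entry k rewrite Fin.splitAt-↑ʳ n d i = ≡.refl
    lem : ∀ x y f → (x ℤ.- y) ℤ.* f ≡ -1ℤ ℤ.* (y ℤ.* f) ℤ.+ x ℤ.* f
    lem = solve-∀
    lem′ : ∀ x y → -1ℤ ℤ.* x ℤ.+ y ≡ y ℤ.- x
    lem′ = solve-∀

  -- Columns are ordered by decreasing degree, hence the minus sign: in row `i` the coefficient of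
  -- degree `m` sits in column d + i - m.
  column : Fin n → Fin (suc d) → Fin (n ℕ.+ d)
  column i m = fromℕ< {d ℕ.+ toℕ i ℕ.∸ toℕ m} (ℕ.≤-<-trans (ℕ.m∸n≤m (d ℕ.+ toℕ i) (toℕ m))
    (≡.subst (d ℕ.+ toℕ i ℕ.<_) (ℕ.+-comm d n) (ℕ.+-monoʳ-< d (Fin.toℕ<n i))))

  upper-row : ∀ i (F : Fin (n ℕ.+ d) → ℤ) → sum (λ k → Syl (i ↑ˡ d) k ℤ.* F k) ≡ sum (λ m → a m ℤ.* F (column i m))
  upper-row i F = begin
    sum (λ k → Syl (i ↑ˡ d) k ℤ.* F k)
      ≡⟨ sum-cong-≗ (λ k → ≡.cong (ℤ._* F k) (≡.trans (entry k) (coeff-toLaurent (e k)))) ⟩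
    sum (λ k → sum (λ m → a m ℤ.* δ (e k) (+ toℕ m)) ℤ.* F k)
      ≡⟨ sum-cong-≗ (λ k → ≡.trans (*-distribʳ-sum (F k) (λ m → a m ℤ.* δ (e k) (+ toℕ m)))
                                   (sum-cong-≗ (λ m → ℤ.*-assoc (a m) (δ (e k) (+ toℕ m)) (F k)))) ⟩
    sum (λ k → sum (λ m → a m ℤ.* (δ (e k) (+ toℕ m) ℤ.* F k)))
      ≡⟨ ∑-comm (λ k m → a m ℤ.* (δ (e k) (+ toℕ m) ℤ.* F k)) ⟩
    sum (λ m → sum (λ k → a m ℤ.* (δ (e k) (+ toℕ m) ℤ.* F k)))
      ≡⟨ sum-cong-≗ (λ m → ≡.trans (≡.sym (*-distribˡ-sum (a m) (λ k → δ (e k) (+ toℕ m) ℤ.* F k)))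
           (≡.cong (ℤ._*_ (a m)) (sum-select (toℕ m) (d ℕ.+ toℕ i) (column i m) (position m) F))) ⟩
    sum (λ m → a m ℤ.* F (column i m)) ∎
    where
    e : Fin (n ℕ.+ d) → ℤ
    e k = + (d ℕ.+ toℕ i) ℤ.- + toℕ k
    entry : ∀ k → Syl (i ↑ˡ d) k ≡ coeff (toLaurent J) (e k)
    entry k rewrite Fin.splitAt-↑ˡ n i d = ≡.refl
    position : ∀ m → d ℕ.+ toℕ i ≡ toℕ m ℕ.+ toℕ (column i m)
    position m = ≡.trans (≡.sym (ℕ.m+[n∸m]≡n (ℕ.≤-trans (ℕ.s≤s⁻¹ (Fin.toℕ<n m)) (ℕ.m≤m+n d (toℕ i)))))
                         (≡.cong (toℕ m ℕ.+_) (≡.sym (Fin.toℕ-fromℕ< _)))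

  circulant : Mat n
  circulant i j = sum (λ m → a m ℤ.* 𝟙 (π n (+ toℕ (column i m)) Fin.≟ j))

  private
    -- For `d` larger than `n` the entry 1 of a lower row may itself fall into the last `d` columns,
    -- strictly below the diagonal of the block. `G` is thus lower triangular with -1 on the
    -- diagonal, though not always -1 times the identity.
    G : Mat d
    G i j = I (low i) (n ↑ʳ j) ℤ.- I (n ↑ʳ i) (n ↑ʳ j)

    low-≢ : ∀ i j → toℕ i ℕ.≤ toℕ j → low i ≢ n ↑ʳ j
    low-≢ i j i≤j eq = ℕ.<⇒≢ (ℕ.≤-<-trans i≤j (ℕ.m<n+m (toℕ j) {n} ℕ.z<s))
      (≡.trans (≡.sym (Fin.toℕ-inject≤ i (ℕ.m≤n+m d n))) (≡.trans (≡.cong toℕ eq) (Fin.toℕ-↑ʳ n j)))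

    Det-G : Det G ≡ prod {d} (λ _ → -1ℤ)
    Det-G = ≡.trans (Det-lower-triangular G
        (λ i j i<j → ≡.cong₂ ℤ._-_ (I-off (low-≢ i j (ℕ.<⇒≤ i<j))) (I-off (λ eq → ℕ.<⇒≢ i<j (≡.cong toℕ (Fin.↑ʳ-injective n i j eq))))))
      (prod-cong (λ i → ≡.cong₂ ℤ._-_ (I-off (low-≢ i i ℕ.≤-refl)) (𝟙-yes (n ↑ʳ i Fin.≟ n ↑ʳ i) ≡.refl)))

  -- Right multiplication by the unimodular `reduction` works modulo tⁿ - 1. The rows of multiples
  -- of tⁿ - 1 lose their left block, and the rows of multiples of `J` turn into a circulant.
  Δ-circulant : Δ n J ≡ Det circulant ℤ.* prod {d} (λ _ → -1ℤ)
  Δ-circulant = begin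
    Det Syl                          ≡⟨ ℤ.*-identityʳ (Det Syl) ⟨
    Det Syl ℤ.* 1ℤ                   ≡⟨ ≡.cong (ℤ._*_ (Det Syl)) Det-reduction ⟨
    Det Syl ℤ.* Det reduction        ≡⟨ Det-∙ Syl reduction ⟨
    Det (Syl ∙ reduction)            ≡⟨ Det-block-upper {n} {d} circulant G (Syl ∙ reduction)
      (λ i j → ≡.trans (sum-cong-≗ (λ k → ≡.cong (ℤ._*_ (Syl (i ↑ˡ d) k)) (reduction-left k j)))
                       (upper-row i (λ k → 𝟙 (π n (+ toℕ k) Fin.≟ j))))
      (λ i j → ≡.trans (sum-cong-≗ (λ k → ≡.cong (ℤ._*_ (Syl (n ↑ʳ i) k)) (reduction-left k j)))
        (≡.trans (lower-row i (λ k → 𝟙 (π n (+ toℕ k) Fin.≟ j)))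
          (≡.trans (≡.cong (λ σ → 𝟙 (π n (+ toℕ (low i)) Fin.≟ j) ℤ.- 𝟙 (σ Fin.≟ j)) (same-residue i)) (ℤ.+-inverseʳ (𝟙 (π n (+ toℕ (low i)) Fin.≟ j))))))
      (λ i j → ≡.trans (sum-cong-≗ (λ k → ≡.cong (ℤ._*_ (Syl (n ↑ʳ i) k)) (reduction-right k j)))
                       (lower-row i (λ k → I k (n ↑ʳ j)))) ⟩
    Det circulant ℤ.* Det G          ≡⟨ ≡.cong (ℤ._*_ (Det circulant)) Det-G ⟩
    Det circulant ℤ.* prod {d} (λ _ → -1ℤ) ∎
    where
    same-residue : ∀ i → π n (+ toℕ (n ↑ʳ i)) ≡ π n (+ toℕ (low i))
    same-residue i = π-cong n {+ toℕ (n ↑ʳ i)} {+ toℕ (low i)} (1ℤ by ≡.trans (≡.cong +_ (≡.trans (Fin.toℕ-↑ʳ n i) (ℕ.+-comm n (toℕ i))))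
      (≡.cong₂ ℤ._+_ (≡.cong +_ (≡.sym (Fin.toℕ-inject≤ i (ℕ.m≤n+m d n)))) (≡.sym (ℤ.*-identityˡ (+ n)))))

module RootEvaluation (R : CommutativeRing 0ℓ 0ℓ) (ν : ℕ) where
  open CommutativeRing R hiding (zero)
  open RingTheory R
  open import Algebra.Properties.Semiring.Exp semiring using (_^_; ^-homo-*; ^-congˡ; ^-assocʳ)
  open import Relation.Binary.Reasoning.Setoid setoid

  -- Reducing the exponent modulo `n` gives negative powers of an `n`-th root of unity without
  -- inverses.
  power : Carrier → ℤ → Carrier
  power y k = y ^ toℕ (π (suc ν) k)

  one-^ : ∀ n → 1# ^ n ≈ 1#
  one-^ zero    = refl
  one-^ (suc n) = trans (*-identityˡ _) (one-^ n)

  module _ {y : Carrier} (yⁿ≈1 : y ^ suc ν ≈ 1#) where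

    power-+ℕ : ∀ p → power y (+ p) ≈ y ^ p
    power-+ℕ p = sym (begin
      y ^ p                                          ≈⟨ reflexive (≡.cong (y ^_) (m≡m%n+[m/n]*n p (suc ν))) ⟩
      y ^ (p % suc ν ℕ.+ p / suc ν ℕ.* suc ν)        ≈⟨ ^-homo-* y (p % suc ν) (p / suc ν ℕ.* suc ν) ⟩
      y ^ (p % suc ν) * y ^ (p / suc ν ℕ.* suc ν)    ≈⟨ *-congˡ (trans (reflexive (≡.cong (y ^_) (ℕ.*-comm (p / suc ν) (suc ν)))) (sym (^-assocʳ y (suc ν) (p / suc ν)))) ⟩
      y ^ (p % suc ν) * (y ^ suc ν) ^ (p / suc ν)    ≈⟨ *-congˡ (trans (^-congˡ (p / suc ν) yⁿ≈1) (one-^ (p / suc ν))) ⟩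
      y ^ (p % suc ν) * 1#                           ≈⟨ *-identityʳ _ ⟩
      y ^ (p % suc ν)                                ≈⟨ reflexive (≡.cong (y ^_) (≡.sym (Fin.toℕ-fromℕ< (n%ℕd<d (+ p) (suc ν))))) ⟩
      power y (+ p)                                  ∎)

    power-0 : power y 0ℤ ≈ 1#
    power-0 = power-+ℕ 0

    power-+ : ∀ k l → power y (k ℤ.+ l) ≈ power y k * power y l
    power-+ k l = begin
      power y (k ℤ.+ l)                                                  ≈⟨ reflexive (≡.cong (λ σ → y ^ toℕ σ)
           (π-cong (suc ν) (+-~ (suc ν) (~-sym (suc ν) (rep (suc ν) k)) (~-sym (suc ν) (rep (suc ν) l))))) ⟩
      power y (+ (toℕ (π (suc ν) k) ℕ.+ toℕ (π (suc ν) l)))              ≈⟨ power-+ℕ (toℕ (π (suc ν) k) ℕ.+ toℕ (π (suc ν) l)) ⟩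
      y ^ (toℕ (π (suc ν) k) ℕ.+ toℕ (π (suc ν) l))                      ≈⟨ ^-homo-* y (toℕ (π (suc ν) k)) (toℕ (π (suc ν) l)) ⟩
      power y k * power y l                                              ∎

module ResultantProduct (S : CommutativeRing 0ℓ 0ℓ) (ν : ℕ) (roots : PolynomialValues.RootsOfUnity S ν) (J : Polynomial) where
  open CommutativeRing S hiding (zero)
  open RingTheory S
  open Determinants S
  open Triangular S
  open BlockCirculant S using (prod; prod-*; prod-one; prod-cong; Det-block-circulant)
  open PolynomialValues S
  open RootsOfUnity roots
  open RootEvaluation S ν
  open Cyclic ν
  open Polynomial J renaming (degree to d)
  open SylvesterReduction using (column; circulant; Δ-circulant)
  open import Algebra.Properties.Semiring.Exp semiring using (_^_; ^-congˡ)
  open import Algebra.Properties.Semiring.Sum semiring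
  open import Relation.Binary.Reasoning.Setoid setoid

  private
    n : ℕ
    n = suc ν

    x : Fin n → Carrier
    x k = root (toℕ k)

    a : Fin (suc d) → ℤ
    a = lookup coeffs

  open DetHomomorphism ℤ.+-*-rawRing S

  ι-homomorphism : IsRawHomomorphism ι
  ι-homomorphism = record { +-homo = ι-+ ; *-homo = ι-* ; neg-homo = ι-neg ; 0-homo = refl ; 1-homo = ι-1 }

  open IsRawHomomorphism ι-homomorphism using (det-homo; sum-homo)

  ι-𝟙 : ∀ {P : Set} (p : Dec P) → ι (ℤ-theory.𝟙 p) ≈ 𝟙 p
  ι-𝟙 (yes _) = ι-1
  ι-𝟙 (no _)  = refl

  ev-tabulate : ∀ φ {q} (e : Fin q → ℤ) (a : Fin q → ℤ) →
                Evaluation.ev S φ (List.tabulate (λ i → e i , a i)) ≈ sum (λ i → ι (a i) * φ (e i))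
  ev-tabulate φ {zero}  e a = refl
  ev-tabulate φ {suc q} e a = +-congˡ (ev-tabulate φ (e ∘ suc) (a ∘ suc))

  evᴶ : Fin n → Carrier
  evᴶ k = Evaluation.ev S (power (x k)) (toLaurent J)

  rowIndex : Fin (1 ℕ.* n) ↔ Fin n
  rowIndex = mk↔ₛ′ (λ i → proj₂ (remQuot {1} n i)) (combine {1} zero) (λ σ → ≡.cong proj₂ (Fin.remQuot-combine {1} zero σ))
    (λ i → ≡.trans (≡.cong (λ z → combine {1} z (proj₂ (remQuot {1} n i))) (only (proj₁ (remQuot {1} n i)))) (Fin.combine-remQuot {1} n i))
    where
    only : ∀ (z : Fin 1) → zero ≡ z
    only zero = ≡.refl

  -- Modulo `n`, column d + τ - m equals σ when a shift of σ by m - d leads to τ.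
  residue-swap : ∀ m (σ τ : Fin n) → π n (+ toℕ (column ν J τ m)) ≡ σ → iter cyc (toℕ (π n (+ toℕ m ℤ.- + d))) σ ≡ τ
  residue-swap m σ τ ≡.refl = ≡.trans (≡.sym (π-shift (+ toℕ m ℤ.- + d) σ))
    (≡.trans (π-cong n (+-~ n (rep n (+ toℕ (column ν J τ m))) (~-refl n {+ toℕ m ℤ.- + d})))
      (≡.trans (≡.cong (π n) (≡.trans (≡.cong (ℤ._+ (+ toℕ m ℤ.- + d)) (position m τ)) (lem (+ toℕ τ) (+ d) (+ toℕ m)))) (π-toℕ n τ)))
    where
    lem : ∀ t d m → t ℤ.+ (d ℤ.- m) ℤ.+ (m ℤ.- d) ≡ t
    lem = solve-∀
    position : ∀ m τ → + toℕ (column ν J τ m) ≡ + toℕ τ ℤ.+ (+ d ℤ.- + toℕ m)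
    position m τ = ≡.trans (≡.cong +_ (Fin.toℕ-fromℕ< _)) (≡.trans (≡.sym (ℤ.⊖-≥ m≤)) (≡.trans (≡.sym (ℤ.m-n≡m⊖n (d ℕ.+ toℕ τ) (toℕ m))) (lem′ (+ d) (+ toℕ τ) (+ toℕ m))))
      where
      m≤ : toℕ m ℕ.≤ d ℕ.+ toℕ τ
      m≤ = ℕ.≤-trans (ℕ.s≤s⁻¹ (Fin.toℕ<n m)) (ℕ.m≤m+n d (toℕ τ))
      lem′ : ∀ d t m → d ℤ.+ t ℤ.- m ≡ t ℤ.+ (d ℤ.- m)
      lem′ = solve-∀

  -- The transpose of `circulant` is J(P) P⁻ᵈ for the cyclic shift P; the power of P reflects the
  -- decreasing order of degrees in the Sylvester matrix.
  circulant-entry : ∀ σ τ → ι (circulant ν J τ σ) ≈ sum (λ m → ι (a m) * I (iter cyc (toℕ (π n (+ toℕ m ℤ.- + d))) σ) τ)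
  circulant-entry σ τ = trans (sum-homo (λ m → a m ℤ.* ℤ-theory.𝟙 (π n (+ toℕ (column ν J τ m)) Fin.≟ σ)))
    (sum-cong-≋ (λ m → trans (ι-* (a m) (ℤ-theory.𝟙 (π n (+ toℕ (column ν J τ m)) Fin.≟ σ))) (*-congˡ (trans (ι-𝟙 (π n (+ toℕ (column ν J τ m)) Fin.≟ σ))
      (reflexive (𝟙-cong (π n (+ toℕ (column ν J τ m)) Fin.≟ σ) (iter cyc (toℕ (π n (+ toℕ m ℤ.- + d))) σ Fin.≟ τ)
        (residue-swap m σ τ)
        (λ eq → iter-cyc-injective (toℕ (π n (+ toℕ m ℤ.- + d))) (≡.trans (residue-swap m _ τ ≡.refl) (≡.sym eq)))))))))
    where
    iter-cyc-injective : ∀ r {σ τ} → iter cyc r σ ≡ iter cyc r τ → σ ≡ τ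
    iter-cyc-injective zero    eq = eq
    iter-cyc-injective (suc r) eq = ≡.trans (≡.sym (uncyc-cyc _)) (≡.trans (≡.cong uncyc (iter-cyc-injective r eq)) (uncyc-cyc _))

  -- The product of the `d`-th powers of all roots is a sign, and a sign is its own inverse.
  prod-power-neg : prod (λ k → power (x k) (ℤ.- (+ d))) ≈ ((- 1#) ^ ν) ^ d
  prod-power-neg = begin
    P                                             ≈⟨ *-identityʳ P ⟨
    P * 1#                                        ≈⟨ *-congˡ (square d) ⟨
    P * (((- 1#) ^ ν) ^ d * ((- 1#) ^ ν) ^ d)     ≈⟨ *-assoc _ _ _ ⟨
    P * ((- 1#) ^ ν) ^ d * ((- 1#) ^ ν) ^ d       ≈⟨ *-congʳ (trans (*-congˡ (sym positive)) (sym (prod-* (λ k → power (x k) (ℤ.- (+ d))) (λ k → power (x k) (+ d))))) ⟩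
    prod (λ k → power (x k) (ℤ.- (+ d)) * power (x k) (+ d)) * ((- 1#) ^ ν) ^ d
                                                  ≈⟨ *-congʳ (prod-one (λ k → trans (sym (power-+ (root-power k) (ℤ.- (+ d)) (+ d)))
                                                       (trans (reflexive (≡.cong (power (x k)) (ℤ.+-inverseˡ (+ d)))) (power-0 (root-power k))))) ⟩
    1# * ((- 1#) ^ ν) ^ d                         ≈⟨ *-identityˡ _ ⟩
    ((- 1#) ^ ν) ^ d                              ∎
    where
    P : Carrier
    P = prod (λ k → power (x k) (ℤ.- (+ d)))
    square : ∀ d → ((- 1#) ^ ν) ^ d * ((- 1#) ^ ν) ^ d ≈ 1#
    square d = trans (sym (^-distrib-* ((- 1#) ^ ν) ((- 1#) ^ ν) d)) (trans (^-congˡ d (sign² ν)) (one-^ d))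
      where open import Algebra.Properties.CommutativeSemiring.Exp commutativeSemiring using (^-distrib-*)
    all-roots : prod x ≈ (- 1#) ^ ν
    all-roots = trans (prod-snoc ν root) (trans (*-cong prod-root last-root) (*-identityʳ _))
    positive : prod (λ k → power (x k) (+ d)) ≈ ((- 1#) ^ ν) ^ d
    positive = trans (prod-cong (λ k → power-+ℕ (root-power k) d)) (trans (prod-^ x d) (^-congˡ d all-roots))

  -- The factor (-1)ᵈ comes from the block `G` and the factor (-1)^(ν d) from the powers x⁻ᵈ.
  -- Together they are (-1)ⁿᵈ, the usual sign for exchanging the arguments of a resultant.
  ι-Δ : ι (Δ n J) ≈ (- 1#) ^ d * ((- 1#) ^ ν) ^ d * prod evᴶ
  ι-Δ = begin
    ι (Δ n J)
      ≈⟨ reflexive (≡.cong ι (Δ-circulant ν J)) ⟩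
    ι (ℤ-theory.Det (circulant ν J) ℤ.* BlockCirculant.prod ℤ-ring {d} (λ _ → -1ℤ))
      ≈⟨ ι-* (ℤ-theory.Det (circulant ν J)) (BlockCirculant.prod ℤ-ring {d} (λ _ → -1ℤ)) ⟩
    ι (ℤ-theory.Det (circulant ν J)) * ι (BlockCirculant.prod ℤ-ring {d} (λ _ → -1ℤ))
      ≈⟨ *-cong circulant-product (ι-sign d) ⟩
    prod (λ k → evᴶ k * power (x k) (ℤ.- (+ d))) * (- 1#) ^ d
      ≈⟨ *-congʳ (trans (prod-* evᴶ (λ k → power (x k) (ℤ.- (+ d)))) (*-congˡ prod-power-neg)) ⟩
    prod evᴶ * ((- 1#) ^ ν) ^ d * (- 1#) ^ d
      ≈⟨ trans (*-comm _ _) (trans (*-congˡ (*-comm _ _)) (sym (*-assoc _ _ _))) ⟩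
    (- 1#) ^ d * ((- 1#) ^ ν) ^ d * prod evᴶ ∎
    where
    ι-sign : ∀ d → ι (BlockCirculant.prod ℤ-ring {d} (λ _ → -1ℤ)) ≈ (- 1#) ^ d
    ι-sign zero    = ι-1
    ι-sign (suc d) = trans (ι-* -1ℤ (BlockCirculant.prod ℤ-ring {d} (λ _ → -1ℤ))) (*-cong (-‿cong (+-identityʳ 1#)) (ι-sign d))
    M : Mat (1 ℕ.* n)
    M i j = ι (circulant ν J (proj₂ (remQuot {1} n j)) (proj₂ (remQuot {1} n i)))
    factor : ∀ k → sum (λ m → ι (a m) * x k ^ toℕ (π n (+ toℕ m ℤ.- + d))) ≈ evᴶ k * power (x k) (ℤ.- (+ d))
    factor k = begin
      sum (λ m → ι (a m) * power (x k) (+ toℕ m ℤ.- + d))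
        ≈⟨ sum-cong-≋ (λ m → trans (*-congˡ {ι (a m)} (power-+ (root-power k) (+ toℕ m) (ℤ.- (+ d)))) (sym (*-assoc (ι (a m)) (power (x k) (+ toℕ m)) (power (x k) (ℤ.- (+ d)))))) ⟩
      sum (λ m → ι (a m) * power (x k) (+ toℕ m) * power (x k) (ℤ.- (+ d)))
        ≈⟨ *-distribʳ-sum (power (x k) (ℤ.- (+ d))) (λ m → ι (a m) * power (x k) (+ toℕ m)) ⟨
      sum (λ m → ι (a m) * power (x k) (+ toℕ m)) * power (x k) (ℤ.- (+ d))
        ≈⟨ *-congʳ (ev-tabulate (power (x k)) (λ m → + toℕ m) a) ⟨
      evᴶ k * power (x k) (ℤ.- (+ d)) ∎
    circulant-product : ι (ℤ-theory.Det (circulant ν J)) ≈ prod (λ k → evᴶ k * power (x k) (ℤ.- (+ d)))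
    circulant-product = begin
      ι (ℤ-theory.Det (circulant ν J))
        ≈⟨ det-homo (circulant ν J) ⟩
      Det (λ i j → ι (circulant ν J i j))
        ≈⟨ Det-ᵀ (λ i j → ι (circulant ν J i j)) ⟨
      Det (λ i j → ι (circulant ν J j i))
        ≈⟨ Det-reindex rowIndex (λ i j → ι (circulant ν J j i)) ⟨
      Det M
        ≈⟨ Det-block-circulant ν root splits {1} {suc d} (λ m _ _ → ι (a m)) (λ m → toℕ (π n (+ toℕ m ℤ.- + d))) M
             (λ v σ w τ → trans (reflexive (≡.cong₂ (λ i j → ι (circulant ν J j i)) (≡.cong proj₂ (Fin.remQuot-combine {1} v σ)) (≡.cong proj₂ (Fin.remQuot-combine {1} w τ))))
                                (circulant-entry σ τ)) ⟩
      prod {n} (λ k → Det {1} (λ v w → sum (λ m → ι (a m) * x k ^ toℕ (π n (+ toℕ m ℤ.- + d)))))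
        ≈⟨ prod-cong (λ k → trans (Det-singleton (λ v w → sum (λ m → ι (a m) * x k ^ toℕ (π n (+ toℕ m ℤ.- + d))))) (factor k)) ⟩
      prod (λ k → evᴶ k * power (x k) (ℤ.- (+ d))) ∎

-- The Laplacian of a cyclic cover

-- ε is a zero divisor, so ordinary cancellation fails; `infinitesimal-part` states what survives of
-- it, with `p` replaced by its value at ε = 0.
record Infinitesimals (S : CommutativeRing 0ℓ 0ℓ) : Set₁ where
  field
    ring : CommutativeRing 0ℓ 0ℓ
  private
    module S = CommutativeRing S
    module D = CommutativeRing ring
  field
    ε                     : D.Carrier
    ε²≈0                  : ε D.* ε D.≈ D.0#
    constant              : Embedding S ring
    standard              : D.Carrier → S.Carrier
    standard-cong         : ∀ {a b} → a D.≈ b → standard a S.≈ standard b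
    standard-homomorphism : DetHomomorphism.IsRawHomomorphism D.rawRing S standard
    standard-ε            : standard ε S.≈ S.0#
    standard-constant     : ∀ a → standard (Embedding.φ constant a) S.≈ a
    infinitesimal-part    : ∀ {p a b} → Embedding.φ constant a D.* ε D.≈ p D.* (Embedding.φ constant b D.* ε) →
                            a S.≈ standard p S.* b

module DualNumbers (S : CommutativeRing 0ℓ 0ℓ) where
  open CommutativeRing S hiding (zero)
  open RingTheory S using (module Solver)
  open Solver using (solve; _:=_; _:+_; _:*_; :-_; con)

  private
    _+ᴰ_ _*ᴰ_ : Carrier × Carrier → Carrier × Carrier → Carrier × Carrier
    (a , b) +ᴰ (c , d) = a + c , b + d
    (a , b) *ᴰ (c , d) = a * c , a * d + b * c

  dualRing : CommutativeRing 0ℓ 0ℓ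
  dualRing = record
    { Carrier = Carrier × Carrier ; _≈_ = λ (a , b) (c , d) → a ≈ c × b ≈ d
    ; _+_ = _+ᴰ_ ; _*_ = _*ᴰ_ ; -_ = λ (a , b) → - a , - b ; 0# = 0# , 0# ; 1# = 1# , 0#
    ; isCommutativeRing = record
      { isRing = record
        { +-isAbelianGroup = record
          { isGroup = record
            { isMonoid = record
              { isSemigroup = record
                { isMagma = record
                  { isEquivalence = record
                    { refl  = refl , refl
                    ; sym   = λ (h , k) → sym h , sym k
                    ; trans = λ (h , k) (h′ , k′) → trans h h′ , trans k k′ }
                  ; ∙-cong = λ (h , k) (h′ , k′) → +-cong h h′ , +-cong k k′ }
                ; assoc = λ p q r → +-assoc _ _ _ , +-assoc _ _ _ }
              ; identity = (λ p → +-identityˡ _ , +-identityˡ _) , (λ p → +-identityʳ _ , +-identityʳ _) }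
            ; inverse = (λ p → -‿inverseˡ _ , -‿inverseˡ _) , (λ p → -‿inverseʳ _ , -‿inverseʳ _)
            ; ⁻¹-cong = λ (h , k) → -‿cong h , -‿cong k }
          ; comm = λ p q → +-comm _ _ , +-comm _ _ }
        ; *-cong = λ (h , k) (h′ , k′) → *-cong h h′ , +-cong (*-cong h k′) (*-cong k h′)
        ; *-assoc = λ (a , b) (c , d) (e , f) → *-assoc a c e ,
            solve 6 (λ a b c d e f → (a :* c) :* f :+ (a :* d :+ b :* c) :* e := a :* (c :* f :+ d :* e) :+ b :* (c :* e)) refl a b c d e f
        ; *-identity = (λ (a , b) → *-identityˡ a , trans (+-cong (*-identityˡ b) (zeroˡ a)) (+-identityʳ b))
                     , (λ (a , b) → *-identityʳ a , trans (+-cong (zeroʳ a) (*-identityʳ b)) (+-identityˡ b))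
        ; distrib = (λ (a , b) (c , d) (e , f) → distribˡ a c e ,
                       solve 6 (λ a b c d e f → a :* (d :+ f) :+ b :* (c :+ e) := (a :* d :+ b :* c) :+ (a :* f :+ b :* e)) refl a b c d e f)
                  , (λ (a , b) (c , d) (e , f) → distribʳ a c e ,
                       solve 6 (λ a b c d e f → (c :+ e) :* b :+ (d :+ f) :* a := (c :* b :+ d :* a) :+ (e :* b :+ f :* a)) refl a b c d e f) }
      ; *-comm = λ (a , b) (c , d) → *-comm a c , solve 4 (λ a b c d → a :* d :+ b :* c := c :* b :+ d :* a) refl a b c d } }

  private module D = CommutativeRing dualRing

  ε : D.Carrier
  ε = 0# , 1#

  ε²≈0 : ε D.* ε D.≈ D.0#
  ε²≈0 = zeroˡ 0# , trans (+-cong (zeroˡ 1#) (zeroʳ 1#)) (+-identityˡ 0#)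

  constant : Embedding S dualRing
  constant = record
    { φ = _, 0# ; cong = _, refl ; injective = proj₁
    ; +-homo = λ a b → refl , sym (+-identityˡ 0#)
    ; *-homo = λ a b → refl , sym (trans (+-cong (zeroʳ a) (zeroˡ b)) (+-identityˡ 0#))
    ; neg-homo = λ a → refl , solve 0 (con 0ℤ := :- con 0ℤ) refl
    ; 0-homo = refl , refl ; 1-homo = refl , refl }

  open DetHomomorphism D.rawRing S

  standardPart : IsRawHomomorphism proj₁
  standardPart = record
    { +-homo = λ _ _ → refl ; *-homo = λ _ _ → refl ; neg-homo = λ _ → refl ; 0-homo = refl ; 1-homo = refl }

  -- The infinitesimal part of `p` is multiplied by another ε on the right side and disappears, so
  -- comparing the second components suffices.
  infinitesimal-part : ∀ {p a b} → Embedding.φ constant a D.* ε D.≈ p D.* (Embedding.φ constant b D.* ε) → a ≈ proj₁ p * b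
  infinitesimal-part {p , q} {a} {b} (_ , eq) = trans
    (solve 2 (λ a o → a := a :+ con 0ℤ :* con 0ℤ) refl a 1#)
    (trans (+-congʳ (sym (*-identityʳ a))) (trans eq
      (trans (+-cong (*-congˡ (trans (+-cong (*-identityʳ b) (zeroˡ 0#)) (+-identityʳ b))) (*-congˡ (zeroʳ b)))
             (trans (+-congˡ (zeroʳ q)) (+-identityʳ _)))))

  dualNumbers : Infinitesimals S
  dualNumbers = record
    { ring = dualRing ; ε = ε ; ε²≈0 = ε²≈0 ; constant = constant ; standard = proj₁
    ; standard-cong = proj₁ ; standard-homomorphism = standardPart ; standard-ε = refl ; standard-constant = λ _ → refl
    ; infinitesimal-part = infinitesimal-part }

module CoverLaplacian (R : CommutativeRing 0ℓ 0ℓ) (ε : CommutativeRing.Carrier R)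
                      (ε²≈0 : CommutativeRing._≈_ R (CommutativeRing._*_ R ε ε) (CommutativeRing.0# R))
                      {X : Graph} (fin : Finite X) (vol : Voltage X ℤ-group) (v₀ : Fin (Finite.#V fin)) (ν : ℕ) where
  open Graph X
  open Finite fin
  open Voltage vol
  open SpanningTrees fin
  open Cyclic ν
  open CommutativeRing R hiding (zero)
  open RingTheory R
  open BlockCirculant R using (prod; Det-block-circulant)
  open PolynomialRoots R using (newton)
  open PolynomialValues R using (prod-snoc)
  open Solver using (solve; _:=_; _:+_; _:*_; :-_)
  open import Algebra.Properties.Semiring.Exp semiring using (_^_; ^-congˡ)
  open import Algebra.Properties.Semiring.Sum semiring
  open import Relation.Binary.Reasoning.Setoid setoid

  private
    n : ℕ
    n = suc ν

    module T = SpanningTrees (Xₙ-finite vol fin (suc ν))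
    module base  = MatrixTree R ε ε²≈0 fin
    module cover = MatrixTree R ε ε²≈0 (Xₙ-finite vol fin (suc ν))

  shiftOf : Fin #E → ℕ
  shiftOf a = toℕ (π n (α (edge a)))

  outDegreeᴰ : Fin #V → Carrier
  outDegreeᴰ v = sum (λ a → 𝟙 (oᶠ a Fin.≟ v))

  -- With `exponent` this writes ε + D - A(t) as a matrix polynomial, one diagonal constant term and
  -- one monomial per edge. The same data describes the Laplacian of the cover, with the cyclic
  -- shift for t, and its symbol at each root.
  coefficient : Fin (suc #E) → Mat #V
  coefficient zero    v w = (ε + outDegreeᴰ v) * I v w
  coefficient (suc a) v w = - (𝟙 (oᶠ a Fin.≟ v) * I (tᶠ a) w)

  exponent : Fin (suc #E) → ℕ
  exponent zero    = 0
  exponent (suc a) = shiftOf a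

  oₙ : ∀ a ρ → T.oᶠ (combine a ρ) ≡ combine (oᶠ a) ρ
  oₙ a ρ = ≡.cong (λ p → combine (ix (o (edge (proj₁ p)))) (proj₂ p)) (Fin.remQuot-combine {#E} {n} a ρ)

  tₙ : ∀ a ρ → T.tᶠ (combine a ρ) ≡ combine (tᶠ a) (iter cyc (shiftOf a) ρ)
  tₙ a ρ = ≡.trans (≡.cong (λ p → combine (ix (t (edge (proj₁ p)))) (_+ₙ_ n (proj₂ p) (π n (α (edge (proj₁ p)))))) (Fin.remQuot-combine {#E} {n} a ρ))
    (≡.cong (combine (tᶠ a)) (≡.sym (iter-cyc (shiftOf a) ρ)))

  I-combine : ∀ (v : Fin #V) (σ : Fin n) w τ → I (combine v σ) (combine w τ) ≈ I v w * I σ τ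
  I-combine v σ w τ = go (combine v σ Fin.≟ combine w τ) (v Fin.≟ w) (σ Fin.≟ τ)
    where
    go : (d : Dec (combine v σ ≡ combine w τ)) (d₁ : Dec (v ≡ w)) (d₂ : Dec (σ ≡ τ)) → 𝟙 d ≈ 𝟙 d₁ * 𝟙 d₂
    go (yes eq) (no v≢w) d₂         = contradiction (Fin.combine-injectiveˡ v σ w τ eq) v≢w
    go (yes eq) (yes _)  (no σ≢τ)   = contradiction (Fin.combine-injectiveʳ v σ w τ eq) σ≢τ
    go (yes _)  (yes _)  (yes _)    = sym (*-identityˡ 1#)
    go (no neq) (yes ≡.refl) (yes ≡.refl) = contradiction ≡.refl neq
    go (no _)   (yes _)  (no _)     = sym (zeroʳ 1#)
    go (no _)   (no _)   d₂         = sym (zeroˡ (𝟙 d₂))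

  edge-sum : ∀ v σ w τ →
    sum (λ b → 𝟙 (T.oᶠ b Fin.≟ combine v σ) * (I (combine v σ) (combine w τ) + - I (T.tᶠ b) (combine w τ))) ≈
    sum (λ a → 𝟙 (oᶠ a Fin.≟ v) * (I v w * I σ τ + - (I (tᶠ a) w * I (iter cyc (shiftOf a) σ) τ)))
  edge-sum v σ w τ = trans (sum-combine #E n _) (sum-cong-≋ (λ a → trans (sum-cong-≋ (λ ρ → collapse a ρ)) (sum-δ σ (term a))))
    where
    term : Fin #E → Fin n → Carrier
    term a ρ = 𝟙 (oᶠ a Fin.≟ v) * (I v w * I σ τ + - (I (tᶠ a) w * I (iter cyc (shiftOf a) ρ) τ))
    collapse : ∀ a ρ → 𝟙 (T.oᶠ (combine a ρ) Fin.≟ combine v σ) * (I (combine v σ) (combine w τ) + - I (T.tᶠ (combine a ρ)) (combine w τ)) ≈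
                       I σ ρ * term a ρ
    collapse a ρ = trans
      (*-cong (trans (reflexive (≡.cong (λ i → I i (combine v σ)) (oₙ a ρ))) (trans (I-combine (oᶠ a) ρ v σ) (*-congˡ (reflexive (𝟙-cong (ρ Fin.≟ σ) (σ Fin.≟ ρ) ≡.sym ≡.sym)))))
              (+-cong (I-combine v σ w τ) (-‿cong (trans (reflexive (≡.cong (λ i → I i (combine w τ)) (tₙ a ρ))) (I-combine (tᶠ a) (iter cyc (shiftOf a) ρ) w τ)))))
      (trans (*-congʳ (*-comm _ _)) (*-assoc _ _ _))

  laplacian-entry : ∀ v σ w τ → cover.laplacian (combine v σ) (combine w τ) ≈
                    sum (λ s → coefficient s v w * I (iter cyc (exponent s) σ) τ)
  laplacian-entry v σ w τ = begin
    ε * I (combine v σ) (combine w τ) +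
      sum (λ b → 𝟙 (T.oᶠ b Fin.≟ combine v σ) * (I (combine v σ) (combine w τ) + - I (T.tᶠ b) (combine w τ)))
      ≈⟨ +-cong (*-congˡ (I-combine v σ w τ)) (edge-sum v σ w τ) ⟩
    ε * (I v w * I σ τ) + sum (λ a → 𝟙 (oᶠ a Fin.≟ v) * (I v w * I σ τ + - (I (tᶠ a) w * I (iter cyc (shiftOf a) σ) τ)))
      ≈⟨ +-congˡ (trans (sum-cong-≋ (λ a → solve 4 (λ o c t i → o :* (c :+ :- (t :* i)) := c :* o :+ (:- (o :* t)) :* i) refl
            (𝟙 (oᶠ a Fin.≟ v)) (I v w * I σ τ) (I (tᶠ a) w) (I (iter cyc (shiftOf a) σ) τ)))
          (sum-linear (I v w * I σ τ) (λ a → 𝟙 (oᶠ a Fin.≟ v)) (λ a → coefficient (suc a) v w * I (iter cyc (shiftOf a) σ) τ))) ⟩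
    ε * (I v w * I σ τ) + (I v w * I σ τ * outDegreeᴰ v + sum (λ a → coefficient (suc a) v w * I (iter cyc (shiftOf a) σ) τ))
      ≈⟨ solve 5 (λ e i j d r → e :* (i :* j) :+ (i :* j :* d :+ r) := (e :+ d) :* i :* j :+ r) refl
           ε (I v w) (I σ τ) (outDegreeᴰ v) (sum (λ a → coefficient (suc a) v w * I (iter cyc (shiftOf a) σ) τ)) ⟩
    (ε + outDegreeᴰ v) * I v w * I σ τ + sum (λ a → coefficient (suc a) v w * I (iter cyc (shiftOf a) σ) τ) ∎

  module _ (x : ℕ → Carrier) (splits : ∀ j → newton x (suc ν) j ≈ 𝟙 (j ℕ.≟ suc ν) + - 𝟙 (j ℕ.≟ 0)) (x-last : x ν ≈ 1#) where

    symbol : ℕ → Carrier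
    symbol k = Det (λ v w → sum (λ s → coefficient s v w * x k ^ exponent s))

    one-^ : ∀ r → 1# ^ r ≈ 1#
    one-^ zero    = refl
    one-^ (suc r) = trans (*-identityˡ _) (one-^ r)

    symbol-last : symbol ν ≈ ι (+ rootedTrees fin) * ε
    symbol-last = trans (Det-cong {M = λ v w → sum (λ s → coefficient s v w * x ν ^ exponent s)} {M′ = base.laplacian} entry) (base.matrix-tree v₀)
      where
      entry : ∀ v w → sum (λ s → coefficient s v w * x ν ^ exponent s) ≈ base.laplacian v w
      entry v w = begin
        (ε + outDegreeᴰ v) * I v w * 1# + sum (λ a → coefficient (suc a) v w * x ν ^ shiftOf a)
          ≈⟨ +-cong (*-identityʳ _) (sum-cong-≋ (λ a → trans (*-congˡ (trans (^-congˡ (shiftOf a) (x-last)) (one-^ (shiftOf a)))) (*-identityʳ _))) ⟩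
        (ε + outDegreeᴰ v) * I v w + sum (λ a → coefficient (suc a) v w)
          ≈⟨ solve 4 (λ e d i r → (e :+ d) :* i :+ r := e :* i :+ (i :* d :+ r)) refl ε (outDegreeᴰ v) (I v w) (sum (λ a → coefficient (suc a) v w)) ⟩
        ε * I v w + (I v w * outDegreeᴰ v + sum (λ a → coefficient (suc a) v w))
          ≈⟨ +-congˡ (sum-linear (I v w) (λ a → 𝟙 (oᶠ a Fin.≟ v)) (λ a → coefficient (suc a) v w)) ⟨
        ε * I v w + sum (λ a → I v w * 𝟙 (oᶠ a Fin.≟ v) + coefficient (suc a) v w)
          ≈⟨ +-congˡ (sum-cong-≋ (λ a → solve 3 (λ o i t → i :* o :+ :- (o :* t) := o :* (i :+ :- t)) refl (𝟙 (oᶠ a Fin.≟ v)) (I v w) (I (tᶠ a) w))) ⟩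
        base.laplacian v w ∎

    trees-of-cover : ι (+ rootedTrees (Xₙ-finite vol fin (suc ν))) * ε ≈ prod {ν} (symbol ∘ toℕ) * (ι (+ rootedTrees fin) * ε)
    trees-of-cover = begin
      ι (+ rootedTrees (Xₙ-finite vol fin (suc ν))) * ε     ≈⟨ cover.matrix-tree (combine v₀ zero) ⟨
      Det cover.laplacian                            ≈⟨ Det-block-circulant ν x splits coefficient exponent cover.laplacian laplacian-entry ⟩
      prod {n} (symbol ∘ toℕ)                        ≈⟨ prod-snoc ν symbol ⟩
      prod {ν} (symbol ∘ toℕ) * symbol ν             ≈⟨ *-congˡ symbol-last ⟩
      prod {ν} (symbol ∘ toℕ) * (ι (+ rootedTrees fin) * ε) ∎

module Cover {X : Graph} (fin : Finite X) (vol : Voltage X ℤ-group) (v₀ : Fin (Finite.#V fin)) (ν : ℕ)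
             (S : CommutativeRing 0ℓ 0ℓ) (roots : PolynomialValues.RootsOfUnity S ν) (inf : Infinitesimals S) where
  open Graph X
  open Finite fin
  open Voltage vol
  open Infinitesimals inf
  open SpanningTrees fin
  open IharaMatrix fin vol
  private
    n : ℕ
    n = suc ν

    module S where
      open CommutativeRing S hiding (zero) public
      open RingTheory S public
      open RootEvaluation S ν public
      open BlockCirculant S public using (prod; prod-cong)
      open import Algebra.Properties.Semiring.Sum semiring public using (sum; sum-cong-≋; *-distribˡ-sum)
      open import Algebra.Properties.Semiring.Exp semiring public using (_^_)
      open import Algebra.Properties.Ring (CommutativeRing.ring S) public using (-1*x≈-x; -‿distribˡ-*)
    module roots = PolynomialValues.RootsOfUnity roots
    module L = CoverLaplacian ring ε ε²≈0 fin vol v₀ ν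

  open CommutativeRing ring hiding (zero; ring)
  open RingTheory ring
  open BlockCirculant ring using (prod)
  open PolynomialRoots ring using (newton)
  open DetHomomorphism rawRing S
  open IsRawHomomorphism standard-homomorphism
  open import Algebra.Properties.Semiring.Exp semiring using (_^_)
  open import Algebra.Properties.Semiring.Sum semiring using (sum)
  open Embedding constant using (φ; ι-homo)

  x : ℕ → Carrier
  x k = φ (roots.root k)

  φ-𝟙 : ∀ {P : Set} (d : Dec P) → φ (S.𝟙 d) ≈ 𝟙 d
  φ-𝟙 (yes _) = Embedding.1-homo constant
  φ-𝟙 (no _)  = Embedding.0-homo constant

  splits : ∀ j → newton x (suc ν) j ≈ 𝟙 (j ℕ.≟ suc ν) + - 𝟙 (j ℕ.≟ 0)
  splits j = trans (EmbeddedPolynomials.φ-newton constant roots.root (suc ν) j) (trans (Embedding.cong constant (roots.splits j))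
    (trans (Embedding.+-homo constant (S.𝟙 (j ℕ.≟ suc ν)) (S.- S.𝟙 (j ℕ.≟ 0)))
      (+-cong (φ-𝟙 (j ℕ.≟ suc ν)) (trans (Embedding.neg-homo constant (S.𝟙 (j ℕ.≟ 0))) (-‿cong (φ-𝟙 (j ℕ.≟ 0)))))))

  x-last : x ν ≈ 1#
  x-last = trans (Embedding.cong constant roots.last-root) (Embedding.1-homo constant)

  symbol : ℕ → Carrier
  symbol = L.symbol x splits x-last

  evᴵ : ℕ → S.Carrier
  evᴵ k = Evaluation.ev S (S.power (roots.root k)) (iharaPolynomial fin vol)

  standard-𝟙 : ∀ {P : Set} (d : Dec P) → standard (𝟙 d) S.≈ S.𝟙 d
  standard-𝟙 (yes _) = 1-homo
  standard-𝟙 (no _)  = 0-homo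

  standard-power : ∀ k r → standard (x k ^ r) S.≈ roots.root k S.^ r
  standard-power k zero    = 1-homo
  standard-power k (suc r) = S.trans (*-homo _ _) (S.*-cong (standard-constant (roots.root k)) (standard-power k r))

  -- Two ring homomorphisms meet at the entries of the matrix: setting ε to 0 passes through the
  -- determinant of the symbol, and evaluation passes through the Ihara determinant because the
  -- `n`-th power of the root is 1.
  standard-symbol : ∀ (k : Fin n) → standard (symbol (toℕ k)) S.≈ evᴵ (toℕ k)
  standard-symbol k = S.trans
    (det-homo M)
    (S.trans (S.Det-cong {M = λ v w → standard (M v w)} {M′ = λ v w → Evaluation.ev S φₖ (iharaMatrix v w)} entry)
             (S.sym (ev-hom.det-homo iharaMatrix)))
    where
    M : Mat #V
    M v w = sum (λ s → L.coefficient s v w * x (toℕ k) ^ L.exponent s)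
    φₖ : ℤ → S.Carrier
    φₖ = S.power (roots.root (toℕ k))
    module multiplicative = Evaluation.Multiplicative S φₖ (S.power-0 (roots.root-power k)) (S.power-+ (roots.root-power k))
    module ev-hom = multiplicative.IsRawHomomorphism multiplicative.ev-homomorphism
    degree : ∀ v → standard (ε + L.outDegreeᴰ v) S.≈ outDegree S φₖ v
    degree v = S.trans (+-homo _ _) (S.trans (S.+-cong standard-ε (S.trans (sum-homo (λ a → 𝟙 (oᶠ a Fin.≟ v))) (S.sum-cong-≋ (λ a → standard-𝟙 (oᶠ a Fin.≟ v)))))
                                             (S.+-identityˡ _))
    neg-sum : ∀ {q} (f : Fin q → S.Carrier) → S.sum (λ i → S.- f i) S.≈ S.- S.sum f
    neg-sum f = S.trans (S.sum-cong-≋ (λ i → S.sym (S.-1*x≈-x (f i))))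
      (S.trans (S.sym (S.*-distribˡ-sum (S.- S.1#) f)) (S.-1*x≈-x (S.sum f)))
    term : Fin #V → Fin #V → Fin #E → S.Carrier
    term v w a = S.𝟙 (oᶠ a Fin.≟ v) S.* S.I (tᶠ a) w S.* φₖ (α (edge a))
    diagonal : ∀ v w → standard (L.coefficient zero v w * 1#) S.≈ S.I v w S.* outDegree S φₖ v S.* φₖ 0ℤ
    diagonal v w = S.trans (*-homo _ _) (S.*-cong
      (S.trans (*-homo _ _) (S.trans (S.*-cong (degree v) (standard-𝟙 (v Fin.≟ w))) (S.*-comm _ _)))
      (S.trans 1-homo (S.sym (S.power-0 (roots.root-power k)))))
    offDiagonal : ∀ v w a → standard (L.coefficient (suc a) v w * x (toℕ k) ^ L.shiftOf a) S.≈ S.- term v w a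
    offDiagonal v w a = S.trans (*-homo _ _) (S.trans
      (S.*-cong (S.trans (neg-homo _) (S.-‿cong (S.trans (*-homo _ _) (S.*-cong (standard-𝟙 (oᶠ a Fin.≟ v)) (standard-𝟙 (tᶠ a Fin.≟ w))))))
                (standard-power (toℕ k) (L.shiftOf a)))
      (S.sym (S.-‿distribˡ-* _ _)))
    entry : ∀ v w → standard (M v w) S.≈ Evaluation.ev S φₖ (iharaMatrix v w)
    entry v w = S.trans (+-homo _ _) (S.trans
      (S.+-cong (diagonal v w)
        (S.trans (sum-homo (λ a → L.coefficient (suc a) v w * x (toℕ k) ^ L.shiftOf a))
                 (S.trans (S.sum-cong-≋ (offDiagonal v w)) (neg-sum (term v w)))))
      (S.sym (ev-iharaMatrix S φₖ v w)))

  prod-standard : ∀ {q} (F : Fin q → Carrier) → standard (prod F) S.≈ S.prod (standard ∘ F)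
  prod-standard {zero}  F = 1-homo
  prod-standard {suc q} F = S.trans (*-homo _ _) (S.*-congˡ (prod-standard (F ∘ suc)))

  standard-symbols : standard (prod {ν} (symbol ∘ toℕ)) S.≈ S.prod {ν} (evᴵ ∘ toℕ)
  standard-symbols = S.trans (prod-standard {ν} (symbol ∘ toℕ)) (S.prod-cong {ν} (λ k →
    ≡.subst (λ i → standard (symbol i) S.≈ evᴵ i) (Fin.toℕ-inject₁ k) (standard-symbol (Fin.inject₁ k))))

  compare : ∀ (p q : ℤ) P → ι p * ε ≈ P * (ι q * ε) → S.ι p S.≈ standard P S.* S.ι q
  compare p q P eq = infinitesimal-part
    (trans (*-congʳ (ι-homo p)) (trans eq (*-congˡ (*-congʳ (sym (ι-homo q))))))

  trees-of-cover : S.ι (+ rootedTrees (Xₙ-finite vol fin (suc ν))) S.≈ S.prod {ν} (evᴵ ∘ toℕ) S.* S.ι (+ rootedTrees fin)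
  trees-of-cover = S.trans
    (compare (+ rootedTrees (Xₙ-finite vol fin (suc ν))) (+ rootedTrees fin) (prod {ν} (symbol ∘ toℕ)) (L.trees-of-cover x splits x-last))
    (S.*-congʳ standard-symbols)

  -- By the matrix-tree theorem for the base graph, the symbol at 1 is a multiple of ε, and its
  -- value at ε = 0 is the value of the Ihara polynomial at 1.
  ev-last : evᴵ ν S.≈ S.0#
  ev-last = S.trans (S.sym (≡.subst (λ i → standard (symbol i) S.≈ evᴵ i) (Fin.toℕ-fromℕ ν) (standard-symbol (Fin.fromℕ ν))))
    (S.trans (standard-cong (L.symbol-last x splits x-last)) (S.trans (*-homo _ _) (S.trans (S.*-congˡ standard-ε) (S.zeroʳ _))))

-- From products over the roots to an identity of integers

module _ (R : CommutativeRing 0ℓ 0ℓ) (φ : ℤ → CommutativeRing.Carrier R)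
         (φ≈1 : ∀ k → CommutativeRing._≈_ R (φ k) (CommutativeRing.1# R)) where
  open CommutativeRing R hiding (zero)
  open RingTheory R

  ev≈evalAt1 : ∀ f → Evaluation.ev R φ f ≈ ι (evalAt1 f)
  ev≈evalAt1 []            = refl
  ev≈evalAt1 ((k , c) ∷ f) = trans (+-cong (trans (*-congˡ (φ≈1 k)) (*-identityʳ _)) (ev≈evalAt1 f)) (sym (ι-+ c (evalAt1 f)))

evalAt1-cong : ∀ {f g} → f ≈ᴸ g → evalAt1 f ≡ evalAt1 g
evalAt1-cong {f} {g} h = ≡.trans (≡.sym (via f)) (≡.trans (Evaluation.ev-cong ℤ-ring (λ _ → 1ℤ) {f} {g} h) (via g))
  where
  via : ∀ f → Evaluation.ev ℤ-ring (λ _ → 1ℤ) f ≡ evalAt1 f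
  via f = ≡.trans (ev≈evalAt1 ℤ-ring (λ _ → 1ℤ) (λ _ → ≡.refl) f) (ι-ℤ (evalAt1 f))

evalAt1-t^-* : ∀ k f → evalAt1 (t^ k *ᴸ f) ≡ evalAt1 f
evalAt1-t^-* k f = ≡.trans (≡.cong evalAt1 (List.++-identityʳ (List.map (monomial-* (k , 1ℤ)) f))) (go f)
  where
  go : ∀ f → evalAt1 (List.map (monomial-* (k , 1ℤ)) f) ≡ evalAt1 f
  go []            = ≡.refl
  go ((l , c) ∷ f) = ≡.cong₂ ℤ._+_ (ℤ.*-identityˡ c) (go f)

module RootProducts (S : CommutativeRing 0ℓ 0ℓ) (ν : ℕ) (roots : PolynomialValues.RootsOfUnity S ν) where
  open CommutativeRing S hiding (zero)
  open RingTheory S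
  open Triangular S using (prod-^)
  open BlockCirculant S using (prod; prod-cong; prod-*)
  open PolynomialValues S using (prod-snoc)
  open PolynomialValues.RootsOfUnity roots
  open RootEvaluation S ν
  open import Algebra.Properties.Semiring.Exp semiring using (_^_; ^-congˡ)
  open import Algebra.Properties.CommutativeSemiring.Exp commutativeSemiring using (^-distrib-*)
  open import Relation.Binary.Reasoning.Setoid setoid

  evAt : ℕ → Laurent → Carrier
  evAt k = Evaluation.ev S (power (root k))

  evAt-last : ∀ f → evAt ν f ≈ ι (evalAt1 f)
  evAt-last = ev≈evalAt1 S (power (root ν)) (λ k → trans (^-congˡ (toℕ (π (suc ν) k)) last-root) (one-^ (toℕ (π (suc ν) k))))

  CoverProduct : Laurent → ℤ → ℤ → Set
  CoverProduct f A B = ι A ≈ prod {ν} (λ k → evAt (toℕ k) f) * ι B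

  ι-^ : ∀ z k → ι (z ℤ.^ k) ≈ ι z ^ k
  ι-^ z zero    = ι-1
  ι-^ z (suc k) = trans (ι-* z (z ℤ.^ k)) (*-congˡ (ι-^ z k))

  sign : Carrier
  sign = (- 1#) ^ ν

  ι-sign : ι (-1ℤ ℤ.^ ν) ≈ sign
  ι-sign = trans (ι-^ -1ℤ ν) (^-congˡ ν (-‿cong ι-1))

  module _ (I J : Laurent) (b e : ℕ) (relation : t^ (+ b) *ᴸ I ≈ᴸ t-1 ^ᴸ e *ᴸ J) where

    evAt-relation : ∀ (k : Fin (suc ν)) → root (toℕ k) ^ b * evAt (toℕ k) I ≈ (root (toℕ k) + - 1#) ^ e * evAt (toℕ k) J
    evAt-relation k = begin
      y ^ b * ev I                     ≈⟨ *-congʳ (trans (ev-t^ (+ b)) (power-+ℕ y^n b)) ⟨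
      ev (t^ (+ b)) * ev I             ≈⟨ ev-* (t^ (+ b)) I ⟨
      ev (t^ (+ b) *ᴸ I)               ≈⟨ ev-cong {t^ (+ b) *ᴸ I} {t-1 ^ᴸ e *ᴸ J} relation ⟩
      ev (t-1 ^ᴸ e *ᴸ J)               ≈⟨ ev-* (t-1 ^ᴸ e) J ⟩
      ev (t-1 ^ᴸ e) * ev J             ≈⟨ *-congʳ (trans (IsRawHomomorphism.^-homo ev-homomorphism t-1 e) (^-congˡ e ev-t-1)) ⟩
      (y + - 1#) ^ e * ev J            ∎
      where
      y : Carrier
      y = root (toℕ k)
      y^n : y ^ suc ν ≈ 1#
      y^n = root-power k
      open Evaluation S (power y)
      open Multiplicative (power-0 y^n) (power-+ y^n)
      ev-t-1 : ev t-1 ≈ y + - 1#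
      ev-t-1 = begin
        ι 1ℤ * power y 1ℤ + (ι -1ℤ * power y 0ℤ + 0#)
          ≈⟨ +-cong (*-cong ι-1 (trans (power-+ℕ y^n 1) (*-identityʳ y))) (+-congʳ (*-cong (-‿cong ι-1) (power-0 y^n))) ⟩
        1# * y + (- 1# * 1# + 0#)
          ≈⟨ +-cong (*-identityˡ y) (trans (+-identityʳ _) (*-identityʳ _)) ⟩
        y + - 1# ∎

    evAt-relation-< : ∀ (k : Fin ν) → root (toℕ k) ^ b * evAt (toℕ k) I ≈ (root (toℕ k) + - 1#) ^ e * evAt (toℕ k) J
    evAt-relation-< k = ≡.subst (λ i → root i ^ b * evAt i I ≈ (root i + - 1#) ^ e * evAt i J) (Fin.toℕ-inject₁ k) (evAt-relation (Fin.inject₁ k))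

    -- The relation between `I` and `J` is evaluated at every root other than the last and
    -- multiplied up; `prod-root` and `prod-root-1` supply the products of x and of x - 1.
    product-relation : sign ^ b * prod {ν} (λ k → evAt (toℕ k) I) ≈ sign ^ e * ι (+ suc ν) ^ e * prod {ν} (λ k → evAt (toℕ k) J)
    product-relation = begin
      sign ^ b * prod {ν} (λ k → evAt (toℕ k) I)
        ≈⟨ *-congʳ (trans (prod-^ {ν} (λ k → root (toℕ k)) b) (^-congˡ b prod-root)) ⟨
      prod {ν} (λ k → root (toℕ k) ^ b) * prod {ν} (λ k → evAt (toℕ k) I)
        ≈⟨ prod-* {ν} (λ k → root (toℕ k) ^ b) (λ k → evAt (toℕ k) I) ⟨
      prod {ν} (λ k → root (toℕ k) ^ b * evAt (toℕ k) I)
        ≈⟨ prod-cong {ν} evAt-relation-< ⟩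
      prod {ν} (λ k → (root (toℕ k) + - 1#) ^ e * evAt (toℕ k) J)
        ≈⟨ prod-* {ν} (λ k → (root (toℕ k) + - 1#) ^ e) (λ k → evAt (toℕ k) J) ⟩
      prod {ν} (λ k → (root (toℕ k) + - 1#) ^ e) * prod {ν} (λ k → evAt (toℕ k) J)
        ≈⟨ *-congʳ (trans (prod-^ {ν} (λ k → root (toℕ k) + - 1#) e) (trans (^-congˡ e prod-root-1) (^-distrib-* sign (ι (+ suc ν)) e))) ⟩
      sign ^ e * ι (+ suc ν) ^ e * prod {ν} (λ k → evAt (toℕ k) J) ∎

  module _ (J : Polynomial) where
    open Polynomial J renaming (degree to d)

    Δ-evalAt1 : ι (Δ (suc ν) J) ≈ (- 1#) ^ d * sign ^ d * (prod {ν} (λ k → evAt (toℕ k) (toLaurent J)) * ι (evalAt1 (toLaurent J)))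
    Δ-evalAt1 = trans (ResultantProduct.ι-Δ S ν roots J)
      (*-congˡ (trans (prod-snoc ν (λ k → evAt k (toLaurent J))) (*-congˡ (evAt-last (toLaurent J)))))

-- The case n = 1 of `Δ-evalAt1`: the product over the other roots is empty and the sign of the
-- roots is trivial.
Δ₁-via : (S : CommutativeRing 0ℓ 0ℓ) → PolynomialValues.RootsOfUnity S 0 → ∀ J →
         Δ 1 J ≡ -1ℤ ℤ.^ Polynomial.degree J ℤ.* evalAt1 (toLaurent J)
Δ₁-via S roots J = ι-injective (begin
  ι (Δ 1 J)                                    ≈⟨ Δ-evalAt1 J ⟩
  (- 1#) ^ d * 1# ^ d * (1# * ι J₁)            ≈⟨ *-cong (trans (*-congˡ (one-^ d)) (*-identityʳ _)) (*-identityˡ _) ⟩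
  (- 1#) ^ d * ι J₁                            ≈⟨ *-congʳ (trans (ι-^ -1ℤ d) (^-congˡ d (-‿cong ι-1))) ⟨
  ι (-1ℤ ℤ.^ d) * ι J₁                         ≈⟨ ι-* (-1ℤ ℤ.^ d) J₁ ⟨
  ι (-1ℤ ℤ.^ d ℤ.* J₁)                         ∎)
  where
  d : ℕ
  d = Polynomial.degree J
  J₁ : ℤ
  J₁ = evalAt1 (toLaurent J)
  open CommutativeRing S
  open RingTheory S
  open PolynomialValues.RootsOfUnity roots using (ι-injective)
  open RootEvaluation S 0 using (one-^)
  open RootProducts S 0 roots
  open import Algebra.Properties.Semiring.Exp semiring using (_^_; ^-congˡ)
  open import Relation.Binary.Reasoning.Setoid setoid

Δ₁-evalAt1 : ∀ J → Δ 1 J ≡ -1ℤ ℤ.^ Polynomial.degree J ℤ.* evalAt1 (toLaurent J)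
Δ₁-evalAt1 = Δ₁-via (proj₁ (rootsOfUnity 0)) (proj₂ (rootsOfUnity 0))

sign-^-square : ∀ ν k → (-1ℤ ℤ.^ ν) ℤ.^ k ℤ.* (-1ℤ ℤ.^ ν) ℤ.^ k ≡ 1ℤ
sign-^-square ν k = ≡.trans (≡.cong₂ ℤ._*_ (ℤ.^-*-assoc -1ℤ ν k) (ℤ.^-*-assoc -1ℤ ν k)) (go (ν ℕ.* k))
  where
  lem : ∀ x → (-1ℤ ℤ.* x) ℤ.* (-1ℤ ℤ.* x) ≡ x ℤ.* x
  lem = solve-∀
  go : ∀ m → -1ℤ ℤ.^ m ℤ.* -1ℤ ℤ.^ m ≡ 1ℤ
  go zero    = ≡.refl
  go (suc m) = ≡.trans (lem (-1ℤ ℤ.^ m)) (go m)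

module _ (ν : ℕ) (f : Laurent) (J : Polynomial) (b e : ℕ) (relation : t^ (+ b) *ᴸ f ≈ᴸ t-1 ^ᴸ e *ᴸ toLaurent J)
         (degree-sum : e ℕ.+ Polynomial.degree J ≡ b ℕ.+ b) (A B : ℤ) where

  private
    d : ℕ
    d = Polynomial.degree J
    J₁ σ n : ℤ
    J₁ = evalAt1 (toLaurent J)
    σ  = -1ℤ ℤ.^ ν
    n  = + suc ν

  -- Cross-multiplied, so that it follows in `S` from the cover identity, `product-relation` and
  -- `Δ-evalAt1` by rearrangement alone. `ι-injective` brings it to ℤ, where the signs can be
  -- cleared.
  signed-identity : (S : CommutativeRing 0ℓ 0ℓ) (roots : PolynomialValues.RootsOfUnity S ν) →
    RootProducts.CoverProduct S ν roots f A B →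
    σ ℤ.^ d ℤ.* σ ℤ.^ b ℤ.* (-1ℤ ℤ.^ d ℤ.* J₁) ℤ.* A ≡ σ ℤ.^ e ℤ.* n ℤ.^ e ℤ.* Δ (suc ν) J ℤ.* B
  signed-identity S roots cover = ι-injective (begin
    ι (σ ℤ.^ d ℤ.* σ ℤ.^ b ℤ.* (-1ℤ ℤ.^ d ℤ.* J₁) ℤ.* A)
      ≈⟨ trans (ι-* (σ ℤ.^ d ℤ.* σ ℤ.^ b ℤ.* (-1ℤ ℤ.^ d ℤ.* J₁)) A) (*-cong (trans (ι-* (σ ℤ.^ d ℤ.* σ ℤ.^ b) (-1ℤ ℤ.^ d ℤ.* J₁))
           (*-cong (trans (ι-* (σ ℤ.^ d) (σ ℤ.^ b)) (*-cong (ι-σ^ d) (ι-σ^ b)))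
                   (trans (ι-* (-1ℤ ℤ.^ d) J₁) (*-congʳ (trans (ι-^ -1ℤ d) (^-congˡ d (-‿cong ι-1))))))) cover) ⟩
    sign ^ d * sign ^ b * ((- 1#) ^ d * ι J₁) * (Q * ι B)
      ≈⟨ solve 6 (λ s t m j q b → s :* t :* (m :* j) :* (q :* b) := (t :* q) :* (m :* s :* j :* b)) refl
           (sign ^ d) (sign ^ b) ((- 1#) ^ d) (ι J₁) Q (ι B) ⟩
    (sign ^ b * Q) * ((- 1#) ^ d * sign ^ d * ι J₁ * ι B)
      ≈⟨ *-congʳ (product-relation f (toLaurent J) b e relation) ⟩
    (sign ^ e * ι n ^ e * QJ) * ((- 1#) ^ d * sign ^ d * ι J₁ * ι B)
      ≈⟨ solve 6 (λ u q m s j b → (u :* q) :* (m :* s :* j :* b) := u :* (m :* s :* (q :* j)) :* b) refl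
           (sign ^ e * ι n ^ e) QJ ((- 1#) ^ d) (sign ^ d) (ι J₁) (ι B) ⟩
    sign ^ e * ι n ^ e * ((- 1#) ^ d * sign ^ d * (QJ * ι J₁)) * ι B
      ≈⟨ *-congʳ (*-cong (*-cong (ι-σ^ e) (ι-^ n e)) (Δ-evalAt1 J)) ⟨
    ι (σ ℤ.^ e) * ι (n ℤ.^ e) * ι (Δ (suc ν) J) * ι B
      ≈⟨ trans (ι-* (σ ℤ.^ e ℤ.* n ℤ.^ e ℤ.* Δ (suc ν) J) B) (*-congʳ (trans (ι-* (σ ℤ.^ e ℤ.* n ℤ.^ e) (Δ (suc ν) J))
           (*-congʳ (ι-* (σ ℤ.^ e) (n ℤ.^ e))))) ⟨
    ι (σ ℤ.^ e ℤ.* n ℤ.^ e ℤ.* Δ (suc ν) J ℤ.* B) ∎)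
    where
    open CommutativeRing S
    open RingTheory S
    open PolynomialValues.RootsOfUnity roots using (ι-injective)
    open RootProducts S ν roots
    open BlockCirculant S using (prod)
    open Solver using (solve; _:=_; _:*_)
    open import Algebra.Properties.Semiring.Exp semiring using (_^_; ^-congˡ)
    open import Relation.Binary.Reasoning.Setoid setoid
    Q QJ : Carrier
    Q  = prod {ν} (λ k → evAt (toℕ k) f)
    QJ = prod {ν} (λ k → evAt (toℕ k) (toLaurent J))
    ι-σ^ : ∀ k → ι (σ ℤ.^ k) ≈ sign ^ k
    ι-σ^ k = trans (ι-^ σ k) (^-congˡ k ι-sign)

  -- Multiplication by `s * t` clears the signs on the left, as both square to 1. On the right
  -- `u * s` is σ to the power e + d = 2b, which is 1 as well, and the sign `t` remains.
  unsigned-identity : ∀ {D D₁} → σ ℤ.^ d ℤ.* σ ℤ.^ b ℤ.* D₁ ℤ.* A ≡ σ ℤ.^ e ℤ.* n ℤ.^ e ℤ.* D ℤ.* B →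
    A ℤ.* D₁ ≡ σ ℤ.^ b ℤ.* B ℤ.* n ℤ.^ e ℤ.* D
  unsigned-identity {D} {D₁} eq = begin
    A ℤ.* D₁                                                       ≡⟨ lem₁ A D₁ ⟩
    1ℤ ℤ.* 1ℤ ℤ.* (A ℤ.* D₁)
      ≡⟨ ≡.cong₂ (λ x y → x ℤ.* y ℤ.* (A ℤ.* D₁)) (sign-^-square ν d) (sign-^-square ν b) ⟨
    (s ℤ.* s) ℤ.* (t ℤ.* t) ℤ.* (A ℤ.* D₁)                         ≡⟨ lem₂ s t A D₁ ⟩
    s ℤ.* t ℤ.* (s ℤ.* t ℤ.* D₁ ℤ.* A)                             ≡⟨ ≡.cong (ℤ._*_ (s ℤ.* t)) eq ⟩
    s ℤ.* t ℤ.* (u ℤ.* n ℤ.^ e ℤ.* D ℤ.* B)                        ≡⟨ lem₃ s t u (n ℤ.^ e) D B ⟩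
    (u ℤ.* s) ℤ.* (t ℤ.* B ℤ.* n ℤ.^ e ℤ.* D)                      ≡⟨ ≡.cong (ℤ._* (t ℤ.* B ℤ.* n ℤ.^ e ℤ.* D)) signs ⟩
    1ℤ ℤ.* (t ℤ.* B ℤ.* n ℤ.^ e ℤ.* D)                             ≡⟨ ℤ.*-identityˡ _ ⟩
    t ℤ.* B ℤ.* n ℤ.^ e ℤ.* D                                      ∎
    where
    open ≡-Reasoning
    s t u : ℤ
    s = σ ℤ.^ d
    t = σ ℤ.^ b
    u = σ ℤ.^ e
    lem₁ : ∀ a d → a ℤ.* d ≡ 1ℤ ℤ.* 1ℤ ℤ.* (a ℤ.* d)
    lem₁ = solve-∀
    lem₂ : ∀ s t a d → (s ℤ.* s) ℤ.* (t ℤ.* t) ℤ.* (a ℤ.* d) ≡ s ℤ.* t ℤ.* (s ℤ.* t ℤ.* d ℤ.* a)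
    lem₂ = solve-∀
    lem₃ : ∀ s t u n d b → s ℤ.* t ℤ.* (u ℤ.* n ℤ.* d ℤ.* b) ≡ (u ℤ.* s) ℤ.* (t ℤ.* b ℤ.* n ℤ.* d)
    lem₃ = solve-∀
    signs : u ℤ.* s ≡ 1ℤ
    signs = ≡.trans (≡.sym (ℤ.^-distribˡ-+-* σ e d)) (≡.trans (≡.cong (σ ℤ.^_) degree-sum)
      (≡.trans (ℤ.^-distribˡ-+-* σ b b) (sign-^-square ν b)))

module _ {X : Graph} (vol : Voltage X ℤ-group) (ν : ℕ) where
  open Graph X
  open Voltage vol

  -- Reducing the layer modulo `n` sends paths to paths, and every vertex has a lift.
  Xₙ-connected : Connected (X∞ vol) → Connected (Xₙ vol (suc ν))
  Xₙ-connected connected (u , σ) (v , τ) = ≡.subst₂ (λ ρ ρ′ → Path (Xₙ vol (suc ν)) (u , ρ) (v , ρ′)) (π-toℕ (suc ν) σ) (π-toℕ (suc ν) τ)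
    (project (connected (u , + toℕ σ) (v , + toℕ τ)))
    where
    project : ∀ {u v : V × ℤ} → Path (X∞ vol) u v →
              Path (Xₙ vol (suc ν)) (proj₁ u , π (suc ν) (proj₂ u)) (proj₁ v , π (suc ν) (proj₂ v))
    project []            = []
    project ((e , k) ∷ p) = _▷▷_ (Xₙ vol (suc ν))
      (edgePath (Xₙ vol (suc ν)) (e , π (suc ν) k) ≡.refl
        (≡.cong (t e ,_) (π-cong (suc ν) (+-~ (suc ν) (rep (suc ν) k) (rep (suc ν) (α e)))))) (project p)

length-nonempty : ∀ {A : Set} {x : A} {xs : List A} → x ∈ₗ xs → length xs ≢ 0
length-nonempty (here _)  ()
length-nonempty (there _) ()

κ-positive : ∀ {X} (fin : Finite X) → Connected X → Fin (Finite.#V fin) → κ X fin ≢ 0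
κ-positive fin connected r = length-nonempty (∈-filter⁺ (isSpanningTree? fin) (∈-subsets (proj₁ tree)) (proj₂ tree))
  where
  tree : ∃ (IsSpanningTree fin)
  tree = SpanningTrees.spanning-tree-exists fin connected r

laurentPolynomial : (d : ℕ) (c : ℕ → ℤ) → c d ≢ 0ℤ → Polynomial
laurentPolynomial d c lead = record
  { degree = d ; coeffs = Vec.tabulate (c ∘ toℕ) ; lead≢0 = λ eq → lead (≡.trans (≡.sym (last-tabulate d c)) eq) }
  where
  last-tabulate : ∀ d (c : ℕ → ℤ) → Vec.last (Vec.tabulate {n = suc d} (c ∘ toℕ)) ≡ c d
  last-tabulate zero    c = ≡.refl
  last-tabulate (suc d) c = last-tabulate d (c ∘ suc)

toLaurent-laurentPolynomial : ∀ d c lead → toLaurent (laurentPolynomial d c lead) ≡ laurent d c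
toLaurent-laurentPolynomial d c lead = ≡.trans
  (List.tabulate-cong (λ i → ≡.cong (+ toℕ i ,_) (lookup∘tabulate (c ∘ toℕ) i)))
  (go (suc d) 0)
  where
  go : ∀ n j → List.tabulate {n = n} (λ i → + (j ℕ.+ toℕ i) , c (j ℕ.+ toℕ i)) ≡ laurentFrom n j c
  go zero    j = ≡.refl
  go (suc n) j = ≡.cong₂ _∷_ (≡.cong (λ i → + i , c i) (ℕ.+-identityʳ j))
    (≡.trans (List.tabulate-cong {n = n} (λ i → ≡.cong (λ k → + k , c k) (ℕ.+-suc j (toℕ i)))) (go n (suc j)))

-- Quotients in ℚ and assembly of the formula

open import Data.Rational using (_*_; _÷_)

fromℤ-* : ∀ x y → fromℤ (x ℤ.* y) ≡ fromℤ x * fromℤ y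
fromℤ-* x y = ℚ.toℚᵘ-injective (begin
  ℚ.toℚᵘ (fromℤ (x ℤ.* y))                     ≈⟨ ℚ.toℚᵘ-fromℚᵘ (mkℚᵘ (x ℤ.* y) 0) ⟩
  mkℚᵘ x 0 ℚᵘ.* mkℚᵘ y 0                       ≈⟨ ℚᵘ.*-cong (ℚ.toℚᵘ-fromℚᵘ (mkℚᵘ x 0)) (ℚ.toℚᵘ-fromℚᵘ (mkℚᵘ y 0)) ⟨
  ℚ.toℚᵘ (fromℤ x) ℚᵘ.* ℚ.toℚᵘ (fromℤ y)       ≈⟨ ℚ.toℚᵘ-homo-* (fromℤ x) (fromℤ y) ⟨
  ℚ.toℚᵘ (fromℤ x * fromℤ y)                   ∎)
  where open ℚᵘ.≃-Reasoning

fromℤ-nonZero : ∀ {z} → z ≢ 0ℤ → ℚ.NonZero (fromℤ z)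
fromℤ-nonZero {z} z≢0 = ℚ.≢-nonZero (λ eq → z≢0 (numerator (ℚᵘ.≃-trans (ℚᵘ.≃-sym (ℚ.toℚᵘ-fromℚᵘ (mkℚᵘ z 0))) (ℚ.toℚᵘ-cong eq))))
  where
  numerator : mkℚᵘ z 0 ℚᵘ.≃ ℚ.toℚᵘ 0ℚ → z ≡ 0ℤ
  numerator (*≡* eq) = ≡.trans (≡.sym (ℤ.*-identityʳ z)) eq

quotient-formula : ∀ k s c m D D₁ (D₁≢0 : ℚ.NonZero (fromℤ D₁)) → k ℤ.* D₁ ≡ s ℤ.* c ℤ.* m ℤ.* D →
  fromℤ k ≡ fromℤ s * fromℤ c * fromℤ m * _÷_ (fromℤ D) (fromℤ D₁) {{D₁≢0}}
quotient-formula k s c m D D₁ D₁≢0 eq = begin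
  fromℤ k                                               ≡⟨ ℚ.*-identityʳ (fromℤ k) ⟨
  fromℤ k * ℚ.1ℚ                                        ≡⟨ ≡.cong (fromℤ k *_) (ℚ.*-inverseʳ (fromℤ D₁)) ⟨
  fromℤ k * (fromℤ D₁ * ℚ.1/ fromℤ D₁)                  ≡⟨ ℚ.*-assoc (fromℤ k) (fromℤ D₁) (ℚ.1/ fromℤ D₁) ⟨
  fromℤ k * fromℤ D₁ * ℚ.1/ fromℤ D₁                    ≡⟨ ≡.cong (_* ℚ.1/ fromℤ D₁) products ⟩
  fromℤ s * fromℤ c * fromℤ m * fromℤ D * ℚ.1/ fromℤ D₁ ≡⟨ ℚ.*-assoc (fromℤ s * fromℤ c * fromℤ m) (fromℤ D) (ℚ.1/ fromℤ D₁) ⟩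
  fromℤ s * fromℤ c * fromℤ m * (fromℤ D ÷ fromℤ D₁)    ∎
  where
  open ≡-Reasoning
  instance
    nonZero : ℚ.NonZero (fromℤ D₁)
    nonZero = D₁≢0
  products : fromℤ k * fromℤ D₁ ≡ fromℤ s * fromℤ c * fromℤ m * fromℤ D
  products = ≡.trans (≡.sym (fromℤ-* k D₁)) (≡.trans (≡.cong fromℤ eq)
    (≡.trans (fromℤ-* (s ℤ.* c ℤ.* m) D) (≡.cong (_* fromℤ D)
      (≡.trans (fromℤ-* (s ℤ.* c) m) (≡.cong (_* fromℤ m) (fromℤ-* s c))))))

-- Any edge has an origin, and with neither vertices nor edges the Euler characteristic would be 0.
vertexExists : ∀ v e → (Fin e → Fin v) → (+ v ℚ./ 1) ℚ.- (+ e ℚ./ 2) ≢ 0ℚ → Fin v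
vertexExists (suc v) e       f χ≢0 = zero
vertexExists zero    (suc e) f χ≢0 = f zero
vertexExists zero    zero    f χ≢0 = contradiction ≡.refl χ≢0

open import Data.Integer using (-_)
open import Data.Nat using (_∸_; _≤_)

-- Rooted trees of the cover carry its number of vertices `N * n`, those of the base only `N`.
-- Cancelling the extra `n` is what lowers the exponent from e to e - 1, here from `suc e` to `e`.
cancel-rootedTrees : ∀ N n k c e s D D₁ .{{_ : NonZero N}} .{{_ : NonZero n}} →
  + (N ℕ.* n ℕ.* k) ℤ.* D₁ ≡ s ℤ.* + (N ℕ.* c) ℤ.* (+ n) ℤ.^ suc e ℤ.* D →
  + k ℤ.* D₁ ≡ s ℤ.* + c ℤ.* + (n ℕ.^ e) ℤ.* D
cancel-rootedTrees N n k c e s D D₁ eq = ℤ.*-cancelˡ-≡ (+ (N ℕ.* n)) _ _ {{ℕ.m*n≢0 N n}} (begin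
  + (N ℕ.* n) ℤ.* (+ k ℤ.* D₁)                        ≡⟨ ℤ.*-assoc (+ (N ℕ.* n)) (+ k) D₁ ⟨
  + (N ℕ.* n) ℤ.* + k ℤ.* D₁                          ≡⟨ ≡.cong (ℤ._* D₁) (ℤ.pos-* (N ℕ.* n) k) ⟨
  + (N ℕ.* n ℕ.* k) ℤ.* D₁                            ≡⟨ eq ⟩
  s ℤ.* + (N ℕ.* c) ℤ.* (+ n) ℤ.^ suc e ℤ.* D         ≡⟨ ≡.cong₂ (λ x y → s ℤ.* x ℤ.* (+ n ℤ.* y) ℤ.* D) (ℤ.pos-* N c) (pos-^ e) ⟩
  s ℤ.* (+ N ℤ.* + c) ℤ.* (+ n ℤ.* + (n ℕ.^ e)) ℤ.* D ≡⟨ lem (+ N) (+ n) s (+ c) (+ (n ℕ.^ e)) D ⟩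
  + N ℤ.* + n ℤ.* (s ℤ.* + c ℤ.* + (n ℕ.^ e) ℤ.* D)   ≡⟨ ≡.cong (ℤ._* (s ℤ.* + c ℤ.* + (n ℕ.^ e) ℤ.* D)) (ℤ.pos-* N n) ⟨
  + (N ℕ.* n) ℤ.* (s ℤ.* + c ℤ.* + (n ℕ.^ e) ℤ.* D)   ∎)
  where
  open ≡-Reasoning
  lem : ∀ N n s c m D → s ℤ.* (N ℤ.* c) ℤ.* (n ℤ.* m) ℤ.* D ≡ N ℤ.* n ℤ.* (s ℤ.* c ℤ.* m ℤ.* D)
  lem = solve-∀
  pos-^ : ∀ e → (+ n) ℤ.^ e ≡ + (n ℕ.^ e)
  pos-^ zero    = ≡.refl
  pos-^ (suc e) = ≡.trans (≡.cong (ℤ._*_ (+ n)) (pos-^ e)) (≡.sym (ℤ.pos-* n (n ℕ.^ e)))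

nonZero-elim : (P : (n : ℕ) .{{_ : NonZero n}} → Set) → (∀ ν → P (suc ν)) → (n : ℕ) .{{_ : NonZero n}} → P n
nonZero-elim P step zero    = contradiction ≡.refl (ℕ.≢-nonZero⁻¹ 0)
nonZero-elim P step (suc ν) = step ν

rootedTrees-positive : ∀ {X} (fin : Finite X) → Connected X → Fin (Finite.#V fin) → rootedTrees fin ≢ 0
rootedTrees-positive fin connected r eq = [ (λ #V≡0 → nonempty r #V≡0) , κ-positive fin connected r ]′ (ℕ.m*n≡0⇒m≡0∨n≡0 (Finite.#V fin) eq)
  where
  nonempty : ∀ {n} → Fin n → n ≢ 0
  nonempty () ≡.refl

module _ {X : Graph} (fin : Finite X) (vol : Voltage X ℤ-group) (v₀ : Fin (Finite.#V fin)) where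
  open Finite fin

  private
    ihara : Laurent
    ihara = iharaPolynomial fin vol

  cover-product : ∀ ν (S : CommutativeRing 0ℓ 0ℓ) (roots : PolynomialValues.RootsOfUnity S ν) →
    RootProducts.CoverProduct S ν roots ihara (+ rootedTrees (Xₙ-finite vol fin (suc ν))) (+ rootedTrees fin)
  cover-product ν S roots = Cover.trees-of-cover fin vol v₀ ν S roots (DualNumbers.dualNumbers S)

  ihara-at-1 : evalAt1 ihara ≡ 0ℤ
  ihara-at-1 = go (proj₁ (rootsOfUnity 0)) (proj₂ (rootsOfUnity 0))
    where
    go : (S : CommutativeRing 0ℓ 0ℓ) → PolynomialValues.RootsOfUnity S 0 → evalAt1 ihara ≡ 0ℤ
    go S roots = ι-injective (trans (sym (RootProducts.evAt-last S 0 roots ihara))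
      (Cover.ev-last fin vol v₀ 0 S roots (DualNumbers.dualNumbers S)))
      where
      open CommutativeRing S using (trans; sym)
      open PolynomialValues.RootsOfUnity roots using (ι-injective)

  -- A cover of degree at least 2 is taken because the product over the roots other than the last is
  -- then nonempty; its factor at index 0 vanishes.
  ihara≈0⇒no-trees : ∀ ν → ihara ≈ᴸ [] → rootedTrees (Xₙ-finite vol fin (suc (suc ν))) ≡ 0
  ihara≈0⇒no-trees ν ihara≈0 = ℤ.+-injective (go (proj₁ (rootsOfUnity (suc ν))) (proj₂ (rootsOfUnity (suc ν))))
    where
    go : (S : CommutativeRing 0ℓ 0ℓ) → PolynomialValues.RootsOfUnity S (suc ν) → + rootedTrees (Xₙ-finite vol fin (suc (suc ν))) ≡ 0ℤ
    go S roots = ι-injective (trans (cover-product (suc ν) S roots)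
      (trans (*-congʳ (trans (*-congʳ (Evaluation.ev-cong S (RootEvaluation.power S (suc ν) (root 0)) {ihara} {[]} ihara≈0)) (zeroˡ _))) (zeroˡ _)))
      where
      open CommutativeRing S using (trans; *-congʳ; zeroˡ)
      open PolynomialValues.RootsOfUnity roots using (ι-injective; root)

  -- A vanishing Ihara polynomial would leave the connected double cover without spanning trees.
  ihara-nonzero : Connected (X∞ vol) → ¬ ihara ≈ᴸ []
  ihara-nonzero connected = go 0
    where
    go : ∀ ν → ¬ ihara ≈ᴸ []
    go ν ihara≈0 = rootedTrees-positive (Xₙ-finite vol fin (suc (suc ν))) (Xₙ-connected vol (suc ν) connected) (combine v₀ zero)
                     (ihara≈0⇒no-trees ν ihara≈0)

  module _ (b : ℕ) (J : Polynomial) (J₁≢0 : evalAt1 (toLaurent J) ≢ 0ℤ) where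

    private
      d : ℕ
      d = Polynomial.degree J

    Δ₁≢0 : Δ 1 J ≢ 0ℤ
    Δ₁≢0 eq = [ sign≢0 d , J₁≢0 ]′ (ℤ.i*j≡0⇒i≡0∨j≡0 (-1ℤ ℤ.^ d) (≡.trans (≡.sym (Δ₁-evalAt1 J)) eq))
      where
      sign≢0 : ∀ d → -1ℤ ℤ.^ d ≢ 0ℤ
      sign≢0 (suc d) eq = [ (λ ()) , sign≢0 d ]′ (ℤ.i*j≡0⇒i≡0∨j≡0 -1ℤ eq)

    trees-identity : ∀ ν e → t^ (+ b) *ᴸ ihara ≈ᴸ t-1 ^ᴸ suc e *ᴸ toLaurent J → suc e ℕ.+ d ≡ b ℕ.+ b →
      + κ (Xₙ vol (suc ν)) (Xₙ-finite vol fin (suc ν)) ℤ.* Δ 1 J ≡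
      -1ℤ ℤ.^ (b ℕ.* ν) ℤ.* + κ X fin ℤ.* + (suc ν ℕ.^ e) ℤ.* Δ (suc ν) J
    trees-identity ν e relation degree-sum = ≡.trans
      (cancel-rootedTrees #V (suc ν) (κ (Xₙ vol (suc ν)) (Xₙ-finite vol fin (suc ν))) (κ X fin) e ((-1ℤ ℤ.^ ν) ℤ.^ b) (Δ (suc ν) J) (Δ 1 J) {{Fin.nonZeroIndex v₀}} (begin
        + rootedTrees (Xₙ-finite vol fin (suc ν)) ℤ.* Δ 1 J
          ≡⟨ ≡.cong (ℤ._*_ (+ rootedTrees (Xₙ-finite vol fin (suc ν)))) (Δ₁-evalAt1 J) ⟩
        + rootedTrees (Xₙ-finite vol fin (suc ν)) ℤ.* (-1ℤ ℤ.^ d ℤ.* evalAt1 (toLaurent J))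
          ≡⟨ unsigned-identity ν ihara J b (suc e) relation degree-sum (+ rootedTrees (Xₙ-finite vol fin (suc ν))) (+ rootedTrees fin)
               {Δ (suc ν) J} { -1ℤ ℤ.^ d ℤ.* evalAt1 (toLaurent J)} identity ⟩
        (-1ℤ ℤ.^ ν) ℤ.^ b ℤ.* + rootedTrees fin ℤ.* (+ suc ν) ℤ.^ suc e ℤ.* Δ (suc ν) J ∎))
      (≡.cong (λ s → s ℤ.* + κ X fin ℤ.* + (suc ν ℕ.^ e) ℤ.* Δ (suc ν) J)
        (≡.trans (ℤ.^-*-assoc -1ℤ ν b) (≡.cong (-1ℤ ℤ.^_) (ℕ.*-comm ν b))))
      where
      open ≡-Reasoning
      identity = signed-identity ν ihara J b (suc e) relation degree-sum (+ rootedTrees (Xₙ-finite vol fin (suc ν))) (+ rootedTrees fin)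
        (proj₁ (rootsOfUnity ν)) (proj₂ (rootsOfUnity ν)) (cover-product ν (proj₁ (rootsOfUnity ν)) (proj₂ (rootsOfUnity ν)))

    trees-quotient : ∀ ν e p q → ν ≡ p → e ≡ q → t^ (+ b) *ᴸ ihara ≈ᴸ t-1 ^ᴸ suc e *ᴸ toLaurent J → suc e ℕ.+ d ≡ b ℕ.+ b →
      (Δ₁-nonZero : ℚ.NonZero (fromℤ (Δ 1 J))) →
      fromℤ (+ κ (Xₙ vol (suc ν)) (Xₙ-finite vol fin (suc ν))) ≡
        fromℤ (-1ℤ ℤ.^ (b ℕ.* p)) * fromℤ (+ κ X fin) * fromℤ (+ (suc ν ℕ.^ q))
          * _÷_ (fromℤ (Δ (suc ν) J)) (fromℤ (Δ 1 J)) {{Δ₁-nonZero}}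
    trees-quotient ν e _ _ ≡.refl ≡.refl relation degree-sum nz =
      quotient-formula (+ κ (Xₙ vol (suc ν)) (Xₙ-finite vol fin (suc ν))) (-1ℤ ℤ.^ (b ℕ.* ν)) (+ κ X fin) (+ (suc ν ℕ.^ e))
        (Δ (suc ν) J) (Δ 1 J) nz (trees-identity ν e relation degree-sum)

    trees-formula-suc : ∀ e → 1 ≤ e → t^ (+ b) *ᴸ ihara ≈ᴸ t-1 ^ᴸ e *ᴸ toLaurent J → e ℕ.+ d ≡ b ℕ.+ b →
      (Δ₁-nonZero : ℚ.NonZero (fromℤ (Δ 1 J))) → (ν : ℕ) →
      fromℤ (+ κ (Xₙ vol (suc ν)) (Xₙ-finite vol fin (suc ν))) ≡
        fromℤ (-1ℤ ℤ.^ (b ℕ.* (suc ν ∸ 1))) * fromℤ (+ κ X fin) * fromℤ (+ (suc ν ℕ.^ (e ∸ 1)))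
          * _÷_ (fromℤ (Δ (suc ν) J)) (fromℤ (Δ 1 J)) {{Δ₁-nonZero}}
    trees-formula-suc (suc e) _ relation degree-sum nz ν =
      trees-quotient ν e (suc ν ∸ 1) (suc e ∸ 1) ≡.refl ≡.refl relation degree-sum nz

    trees-formula : ∀ e → 1 ≤ e → t^ (+ b) *ᴸ ihara ≈ᴸ t-1 ^ᴸ e *ᴸ toLaurent J → e ℕ.+ d ≡ b ℕ.+ b →
      (Δ₁-nonZero : ℚ.NonZero (fromℤ (Δ 1 J))) → (n : ℕ) .{{_ : NonZero n}} →
      fromℤ (+ κ (Xₙ vol n) (Xₙ-finite vol fin n)) ≡
        fromℤ (-1ℤ ℤ.^ (b ℕ.* (n ∸ 1))) * fromℤ (+ κ X fin) * fromℤ (+ (n ℕ.^ (e ∸ 1)))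
          * _÷_ (fromℤ (Δ n J)) (fromℤ (Δ 1 J)) {{Δ₁-nonZero}}
    trees-formula e 1≤e relation degree-sum nz = nonZero-elim
      (λ n → fromℤ (+ κ (Xₙ vol n) (Xₙ-finite vol fin n)) ≡
        fromℤ (-1ℤ ℤ.^ (b ℕ.* (n ∸ 1))) * fromℤ (+ κ X fin) * fromℤ (+ (n ℕ.^ (e ∸ 1)))
          * _÷_ (fromℤ (Δ n J)) (fromℤ (Δ 1 J)) {{nz}})
      (trees-formula-suc e 1≤e relation degree-sum nz)

-- The cofactor is t⁻ᵇ g; multiplying by a power of t does not change the value at 1.
ordAt1 : ∀ f g b e → t^ (+ b) *ᴸ f ≈ᴸ t-1 ^ᴸ e *ᴸ g → evalAt1 g ≢ 0ℤ → OrdAt1 f e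
ordAt1 f g b e relation g₁≢0 = t^ (- (+ b)) *ᴸ g , factor , λ eq → g₁≢0 (≡.trans (≡.sym (evalAt1-t^-* (- (+ b)) g)) eq)
  where
  lem : ∀ k b → k ≡ k ℤ.- - b ℤ.- b
  lem = solve-∀
  factor : f ≈ᴸ t-1 ^ᴸ e *ᴸ (t^ (- (+ b)) *ᴸ g)
  factor k = begin
    coeff f k                                               ≡⟨ ≡.cong (coeff f) (lem k (+ b)) ⟩
    coeff f (k ℤ.- - (+ b) ℤ.- + b)                         ≡⟨ t^-coeff (+ b) f (k ℤ.- - (+ b)) ⟨
    coeff (t^ (+ b) *ᴸ f) (k ℤ.- - (+ b))                   ≡⟨ relation (k ℤ.- - (+ b)) ⟩
    coeff (t-1 ^ᴸ e *ᴸ g) (k ℤ.- - (+ b))                   ≡⟨ t^-coeff (- (+ b)) (t-1 ^ᴸ e *ᴸ g) k ⟨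
    coeff (t^ (- (+ b)) *ᴸ (t-1 ^ᴸ e *ᴸ g)) k               ≡⟨ *ᴸ-assoc (t^ (- (+ b))) (t-1 ^ᴸ e) g k ⟨
    coeff ((t^ (- (+ b)) *ᴸ t-1 ^ᴸ e) *ᴸ g) k               ≡⟨ *ᴸ-cong {t^ (- (+ b)) *ᴸ t-1 ^ᴸ e} {t-1 ^ᴸ e *ᴸ t^ (- (+ b))} {g} {g}
                                                                 (*ᴸ-comm (t^ (- (+ b))) (t-1 ^ᴸ e)) (λ _ → ≡.refl) k ⟩
    coeff ((t-1 ^ᴸ e *ᴸ t^ (- (+ b))) *ᴸ g) k               ≡⟨ *ᴸ-assoc (t-1 ^ᴸ e) (t^ (- (+ b))) g k ⟩
    coeff (t-1 ^ᴸ e *ᴸ (t^ (- (+ b)) *ᴸ g)) k               ∎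
    where open ≡-Reasoning

ordAt1-positive : ∀ f e → OrdAt1 f e → evalAt1 f ≡ 0ℤ → 1 ≤ e
ordAt1-positive f (suc e) _            _    = ℕ.s≤s ℕ.z≤n
ordAt1-positive f zero (h , f≈h , h₁≢0) f₁≡0 = contradiction
  (≡.trans (≡.sym (evalAt1-t^-* 0ℤ h)) (≡.trans (≡.sym (evalAt1-cong {f} {const 1ℤ *ᴸ h} f≈h)) f₁≡0)) h₁≢0

theorem3p6 : (X : Graph) (fin : Finite X) → Connected X → χ X fin ≢ 0ℚ →
    (α : Voltage X ℤ-group) → Connected (X∞ α) →
    Σ[ b ∈ ℕ ] Σ[ e ∈ ℕ ] Σ[ J ∈ Polynomial ]
    OrdAt0 (iharaPolynomial fin α) (- (+ b)) ×
    OrdAt1 (iharaPolynomial fin α) e × 1 ≤ e ×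
    t^ (+ b) *ᴸ iharaPolynomial fin α ≈ᴸ t-1 ^ᴸ e *ᴸ toLaurent J ×
    Σ[ Δ₁≢0 ∈ ℚ.NonZero (fromℤ (Δ 1 J)) ]
    ((n : ℕ) .{{_ : NonZero n}} →
    fromℤ (+ κ (Xₙ α n) (Xₙ-finite α fin n)) ≡
    fromℤ (-1ℤ ℤ.^ (b ℕ.* (n ∸ 1))) * fromℤ (+ κ X fin) * fromℤ (+ (n ℕ.^ (e ∸ 1)))
    * _÷_ (fromℤ (Δ n J)) (fromℤ (Δ 1 J)) {{Δ₁≢0}})
theorem3p6 X fin _ χ≢0 α connected =
  b , e , J , order-at0 , order-at1 , 1≤e , relation , Δ₁-nonZero , trees-formula fin α v₀ b J J₁≢0 e 1≤e relation degree-sum Δ₁-nonZero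
  where
  v₀ : Fin (Finite.#V fin)
  v₀ = vertexExists _ _ (SpanningTrees.oᶠ fin) χ≢0
  open SymmetricLaurent (iharaPolynomial fin α) (IharaMatrix.ihara-symmetric fin α)
  open Centered (centered (ihara-nonzero fin α v₀ connected))
  -- The factorisation is applied to tᵇ times the Ihara polynomial, of degree exactly 2b, so its
  -- `degree-sum` is the equation e + deg J = 2b that the sign computation needs.
  open UnitRootFactorization (factorUnitRoot (b ℕ.+ b) shifted leading above)
    renaming (order to e; leading to leadingᴶ; above to aboveᴶ)
  J : Polynomial
  J = laurentPolynomial degree cofactor leadingᴶ
  J-laurent : toLaurent J ≡ laurent degree cofactor
  J-laurent = toLaurent-laurentPolynomial degree cofactor leadingᴶ
  J₁≢0 : evalAt1 (toLaurent J) ≢ 0ℤ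
  J₁≢0 eq = at1 (≡.trans (≡.cong evalAt1 (≡.sym J-laurent)) eq)
  relation : t^ (+ b) *ᴸ iharaPolynomial fin α ≈ᴸ t-1 ^ᴸ e *ᴸ toLaurent J
  relation k = ≡.trans (shift-eq k) (≡.trans (factors k) (≡.cong (λ f → coeff (t-1 ^ᴸ e *ᴸ f) k) (≡.sym J-laurent)))
  order-at1 : OrdAt1 (iharaPolynomial fin α) e
  order-at1 = ordAt1 (iharaPolynomial fin α) (toLaurent J) b e relation J₁≢0
  1≤e : 1 ≤ e
  1≤e = ordAt1-positive (iharaPolynomial fin α) e order-at1 (ihara-at-1 fin α v₀)
  Δ₁-nonZero : ℚ.NonZero (fromℤ (Δ 1 J))
  Δ₁-nonZero = fromℤ-nonZero (Δ₁≢0 fin α v₀ b J J₁≢0)
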